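{- Let $r\geq 2$ be an integer and let $\mathbf{H}=(H_1,\ldots,H_r)$ be an $r$-tuple of (finite, simple) graphs, each with at least one vertex. Let $d\in(0,1)$ be fixed and let $k\geq 2$ be the unique integer with $\frac{k-2}{k-1}<d\leq\frac{k-1}{k}$. Then $$p(n;\mathbf{H},d)=n^{ -1/\beta(\mathbf{H};k)}.$$ That is: if $\beta(\mathbf{H};k)>0$, then the function $n\mapsto n^{ -1/\beta(\mathbf{H};k)}$ is a perturbed vertex-Ramsey threshold function for $H_1,\ldots,H_r$ at density $d$; and if $\beta(\mathbf{H};k)=0$ (where by convention $n^{ -1/0}:=0$), then every graph on sufficiently many vertices of density at least $d$ is $(H_1,\ldots,H_r)_v$-Ramsey.
   Context: Graphs are finite and simple; $v(G)$, $e(G)$ denote the numbers of vertices and edges of $G$; the density of $G$ is $d(G):=e(G)/\binom{v(G)}{2}$. A graph is called non-empty if it has at least one vertex (the empty graph $\emptyset$ has no vertices). $G(n,p)$ is the binomial random graph on $n$ vertices in which each edge is present independently with probability $p$; $G_n\cup G(n,p)$ is the union of edge sets on the same vertex set. **Vertex-Ramsey.** $G$ is $(H_1,\ldots,H_r)_v$-Ramsey, written $G\to(H_1,\ldots,H_r)_v$, if for every colouring of $V(G)$ with colours $[r]=\{1,\ldots,r\}$ there is $j\in[r]$ such that $G$ contains a (not necessarily induced) copy of $H_j$ all of whose vertices have colour $j$. **Threshold.** For $d\in[0,1]$, a function $p:\mathbb{N}\to[0,1]$ is a perturbed vertex-Ramsey threshold function for $H_1,\ldots,H_r$ at density $d$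 if: (i) there exist an infinite increasing sequence of positive integers $(n_m)_{m\in\mathbb{N}}$ and $n_m$-vertex graphs $G_{n_m}$, each of density at least $d$, such that whenever $q(n)=o(p(n))$ (with $q:\mathbb{N}\to[0,1]$), $\lim_{m\to\infty}\mathbb{P}[G_{n_m}\cup G(n_m,q(n_m))\to(H_1,\ldots,H_r)_v]=0$; and (ii) for every $q:\mathbb{N}\to[0,1]$ with $q(n)=\omega(p(n))$ and every sequence $(G_n)_{n\in\mathbb{N}}$ of $n$-vertex graphs each of density at least $d$, $\lim_{n\to\infty}\mathbb{P}[G_n\cup G(n,q(n))\to(H_1,\ldots,H_r)_v]=1$. The notation $p(n;H_1,\ldots,H_r,d)$ (or $p(n;\mathbf{H},d)$) stands for any such threshold function; if every graph on sufficiently many vertices of density at least $d$ is $(H_1,\ldots,H_r)_v$-Ramsey, one sets $p(n;\mathbf{H},d):=0$. **Densities.** For a graph $H$, $m_1(H):=\max\{e(J)/(v(J)-1): J\subseteq H,\ v(J)\geq 2\}$, with $m_1(H)=0$ if $v(H)\leq 1$. For graphs $A,B$ with $m_1(A)\geq m_1(B)$, $m_1(B,A):=\max\{(m_1(B)+e(J))/v(J): J\subseteq A,\ v(J)\geq 1\}$, with $m_1(B,A)=0$ if $v(A)=0$. For an $r$-tuple of graphs $(A_1,\ldots,A_r)$, let $\sigma$ be any permutation of $[r]$ with $m_1(A_{\sigma(1)})\geq m_1(A_{\sigma(2)})\geq\cdots\geq m_1(A_{\sigma(r)})$ and put $\beta(A_1,\ldots,A_r):=m_1(A_{\sigma(2)},A_{\sigma(1)})$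 (independent of the choice of $\sigma$). For an $r$-tuple of families of graphs, $\beta(\mathcal{A}_1,\ldots,\mathcal{A}_r):=\min\{\beta(A_1,\ldots,A_r): A_1\in\mathcal{A}_1,\ldots,A_r\in\mathcal{A}_r\}$. **Certificates.** For a graph $H$ and $k\geq 2$, $\mathrm{Part}(H,k)$ is the set of ordered $k$-tuples $(H_1',\ldots,H_k')$ of (possibly empty) graphs for which there is a partition $V(H)=V_1\sqcup\cdots\sqcup V_k$ (parts may be empty) with $H[V_i]=H_i'$ for all $i\in[k]$. A $k$-partite certificate of $H$-freeness is an ordered $k$-tuple $\mathcal{F}(H;k)=(\mathcal{F}_1,\ldots,\mathcal{F}_k)$ of collections of non-empty subgraphs of $H$ such that for every $(H_1',\ldots,H_k')\in\mathrm{Part}(H,k)$ there is some $i\in[k]$ with $H_i'\in\mathcal{F}_i$. Write $\mathcal{F}(H;k)_i:=\mathcal{F}_i$. (Each $\mathcal{F}_i$ then necessarily contains $H$ itself.) **Critical parameter.** For $\mathbf{H}=(H_1,\ldots,H_r)$ and $k\geq 2$, $$\beta(\mathbf{H};k):=\max_{\mathcal{F}(H_1;k),\ldots,\mathcal{F}(H_r;k)}\ \min_{i\in[k]}\ \beta\big(\mathcal{F}(H_1;k)_i,\ldots,\mathcal{F}(H_r;k)_i\big),$$ the maximum being over all $r$-tuples of $k$-partite certificates of $H_1$-, $\ldots$, $H_r$-freeness. -}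

module Defs where

open import Data.Bool.Base using (Bool; T; if_then_else_)
open import Data.Bool.Properties using (T?) renaming (_≟_ to _≟ᵇ_)
open import Data.Fin.Base using (Fin)
open import Data.Fin.Properties using (all?; any?) renaming (_≟_ to _≟ᶠ_; _<?_ to _<?ᶠ_)
open import Data.Fin.Subset using (Subset; inside; outside; _∈_; ∣_∣; _∩_; _∪_; ⊤)
open import Data.Fin.Subset.Properties
  using (_∈?_; _⊆?_; x∈p∩q⁺; x∈p∪q⁺)
open import Data.Integer.Base as ℤ using (+_; +≤+)
import Data.Integer.Properties as ℤₚ
open import Data.List.Base
  using (List; []; _∷_; _++_; map; filter; foldr; length; concatMap;
         cartesianProduct; cartesianProductWith; allFin)
open import Data.List.Membership.Propositional using () renaming (_∈_ to _∈ˡ_)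
open import Data.List.Relation.Unary.Any using (Any) renaming (any? to anyˡ?)
import Data.List.Sort
open import Data.Nat.Base as ℕ using (ℕ; zero; suc; _∸_; z≤n; s≤s)
open import Data.Nat.Combinatorics using (_C_)
import Data.Nat.Properties as ℕₚ
open import Data.Product using (Σ; ∃; _×_; _,_; proj₁; proj₂)
open import Data.Product.Properties using (≡-dec)
open import Data.Rational as ℚ using (ℚ; mkℚ; 0ℚ; 1ℚ; ½; _/_; toℚᵘ)
import Data.Rational.Properties as ℚₚ
import Data.Rational.Solver as ℚ-Solver
open import Data.Rational.Unnormalised.Base as ℚᵘ using (mkℚᵘ)
import Data.Rational.Unnormalised.Properties as ℚᵘₚ
open import Data.Sum using (_⊎_; inj₁; inj₂; swap) renaming (map to map⊎)
open import Data.Vec.Base as Vec using (Vec; []; _∷_; lookup; replicate; toList)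
import Data.Vec.Properties as Vecₚ
open import Relation.Binary using (DecTotalOrder)
import Relation.Binary.Construct.Flip.EqAndOrd as Flip
import Relation.Binary.Construct.On as On
open import Relation.Binary.PropositionalEquality
  using (_≡_; _≢_; refl; sym; trans; cong; subst; subst₂)
open import Relation.Nullary using (Dec; yes; no; ¬_; ¬?; contradiction)
open import Relation.Nullary.Decidable
  using (⌊_⌋; toWitness; fromWitness; _×-dec_; _⊎-dec_; _→-dec_; map′)
open import Relation.Unary using (Decidable)

------------------------------------------------------------------------
-- Rationals

infixl 7 _÷_

-- The value at denominator 0 is never used for a meaningful quotient.
_÷_ : ℕ → ℕ → ℚ
m ÷ zero  = 0ℚ
m ÷ suc n = + m / suc n

-- All quantities maximised below are nonnegative, so taking 0 as the base
-- value both leaves true maxima unchanged and yields the conventions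
-- m₁(H) = 0 for v(H) ≤ 1 and m₁(B,A) = 0 for v(A) = 0.
maximum : List ℚ → ℚ
maximum = foldr ℚ._⊔_ 0ℚ

-- Only applied to nonempty lists.
minimum : List ℚ → ℚ
minimum []       = 0ℚ
minimum (x ∷ xs) = foldr ℚ._⊓_ x xs

------------------------------------------------------------------------
-- Reals: Cauchy sequences of rationals, with the operations acting termwise

record ℝ : Set where
  field
    seq    : ℕ → ℚ
    cauchy : ∀ ε → 0ℚ ℚ.< ε → ∃ λ N → ∀ m n → N ℕ.≤ m → N ℕ.≤ n →
             ℚ.∣ seq m ℚ.- seq n ∣ ℚ.≤ ε

open ℝ public

fromℚ : ℚ → ℝ
fromℚ p = record
  { seq    = λ _ → p
  ; cauchy = λ ε 0<ε → 0 , λ _ _ _ _ →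
      subst (λ z → ℚ.∣ z ∣ ℚ.≤ ε) (sym (ℚₚ.+-inverseʳ p)) (ℚₚ.<⇒≤ 0<ε)
  }

infixl 6 _+ᴿ_
infixl 7 _*ᴿ_
infix  8 -ᴿ_
infixr 8 _^ᴿ_
infix  4 _≤ᴿ_ _<ᴿ_

private
  open ℚ-Solver.+-*-Solver

  +-minus : ∀ a b c d → (a ℚ.+ b) ℚ.- (c ℚ.+ d) ≡ (a ℚ.- c) ℚ.+ (b ℚ.- d)
  +-minus = solve 4 (λ a b c d → (a :+ b) :- (c :+ d) := (a :- c) :+ (b :- d)) refl

  neg-minus : ∀ a b → ℚ.- (a ℚ.- b) ≡ (ℚ.- a) ℚ.- (ℚ.- b)
  neg-minus = solve 2 (λ a b → :- (a :- b) := (:- a) :- (:- b)) refl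

  minus-plus : ∀ a b → a ≡ (a ℚ.- b) ℚ.+ b
  minus-plus = solve 2 (λ a b → a := (a :- b) :+ b) refl

  *-minus : ∀ a b c d → a ℚ.* b ℚ.- c ℚ.* d ≡ a ℚ.* (b ℚ.- d) ℚ.+ d ℚ.* (a ℚ.- c)
  *-minus = solve 4 (λ a b c d → a :* b :- c :* d := a :* (b :- d) :+ d :* (a :- c)) refl

  0≤+ : ∀ a b → 0ℚ ℚ.≤ a → 0ℚ ℚ.≤ b → 0ℚ ℚ.≤ a ℚ.+ b
  0≤+ a b 0≤a 0≤b = subst (ℚ._≤ a ℚ.+ b) (ℚₚ.+-identityˡ 0ℚ) (ℚₚ.+-mono-≤ 0≤a 0≤b)

  x≤a+x : ∀ a x → 0ℚ ℚ.≤ a → x ℚ.≤ a ℚ.+ x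
  x≤a+x a x 0≤a = subst (ℚ._≤ a ℚ.+ x) (ℚₚ.+-identityˡ x) (ℚₚ.+-monoˡ-≤ x 0≤a)

  0≤1 : 0ℚ ℚ.≤ 1ℚ
  0≤1 = ℚₚ.nonNegative⁻¹ 1ℚ

  0<1 : 0ℚ ℚ.< 1ℚ
  0<1 = ℚₚ.positive⁻¹ 1ℚ

  half-pos : ∀ ε → 0ℚ ℚ.< ε → 0ℚ ℚ.< ½ ℚ.* ε
  half-pos ε 0<ε = subst (ℚ._< ½ ℚ.* ε) (ℚₚ.*-zeroʳ ½) (ℚₚ.*-monoʳ-<-pos ½ 0<ε)

  halves : ∀ ε → ½ ℚ.* ε ℚ.+ ½ ℚ.* ε ≡ ε
  halves ε = trans (sym (ℚₚ.*-distribʳ-+ ε ½ ½)) (ℚₚ.*-identityˡ ε)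

  +-close : ∀ a b c d ε → ℚ.∣ a ℚ.- c ∣ ℚ.≤ ½ ℚ.* ε → ℚ.∣ b ℚ.- d ∣ ℚ.≤ ½ ℚ.* ε →
            ℚ.∣ (a ℚ.+ b) ℚ.- (c ℚ.+ d) ∣ ℚ.≤ ε
  +-close a b c d ε le₁ le₂ = begin
    ℚ.∣ (a ℚ.+ b) ℚ.- (c ℚ.+ d) ∣        ≡⟨ cong ℚ.∣_∣ (+-minus a b c d) ⟩
    ℚ.∣ (a ℚ.- c) ℚ.+ (b ℚ.- d) ∣        ≤⟨ ℚₚ.∣p+q∣≤∣p∣+∣q∣ (a ℚ.- c) (b ℚ.- d) ⟩
    ℚ.∣ a ℚ.- c ∣ ℚ.+ ℚ.∣ b ℚ.- d ∣      ≤⟨ ℚₚ.+-mono-≤ le₁ le₂ ⟩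
    ½ ℚ.* ε ℚ.+ ½ ℚ.* ε                  ≡⟨ halves ε ⟩
    ε ∎
    where
    open ℚₚ.≤-Reasoning

_+ᴿ_ : ℝ → ℝ → ℝ
seq (x +ᴿ y) n = seq x n ℚ.+ seq y n
cauchy (x +ᴿ y) ε 0<ε with cauchy x (½ ℚ.* ε) (half-pos ε 0<ε)
                         | cauchy y (½ ℚ.* ε) (half-pos ε 0<ε)
... | N₁ , c₁ | N₂ , c₂ = N₁ ℕ.⊔ N₂ , λ m n p q →
  +-close (seq x m) (seq y m) (seq x n) (seq y n) ε
    (c₁ m n (ℕₚ.≤-trans (ℕₚ.m≤m⊔n N₁ N₂) p) (ℕₚ.≤-trans (ℕₚ.m≤m⊔n N₁ N₂) q))
    (c₂ m n (ℕₚ.≤-trans (ℕₚ.m≤n⊔m N₁ N₂) p) (ℕₚ.≤-trans (ℕₚ.m≤n⊔m N₁ N₂) q))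

-ᴿ_ : ℝ → ℝ
seq (-ᴿ x) n = ℚ.- seq x n
cauchy (-ᴿ x) ε 0<ε with cauchy x ε 0<ε
... | N , c = N , λ m n p q →
  subst (ℚ._≤ ε)
    (trans (sym (ℚₚ.∣-p∣≡∣p∣ (seq x m ℚ.- seq x n)))
           (cong ℚ.∣_∣ (neg-minus (seq x m) (seq x n))))
    (c m n p q)

private
  near : ∀ a b c → ℚ.∣ a ℚ.- b ∣ ℚ.≤ c → ℚ.∣ a ∣ ℚ.≤ c ℚ.+ ℚ.∣ b ∣
  near a b c le = begin
    ℚ.∣ a ∣                        ≡⟨ cong ℚ.∣_∣ (minus-plus a b) ⟩
    ℚ.∣ (a ℚ.- b) ℚ.+ b ∣          ≤⟨ ℚₚ.∣p+q∣≤∣p∣+∣q∣ (a ℚ.- b) b ⟩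
    ℚ.∣ a ℚ.- b ∣ ℚ.+ ℚ.∣ b ∣      ≤⟨ ℚₚ.+-monoˡ-≤ ℚ.∣ b ∣ le ⟩
    c ℚ.+ ℚ.∣ b ∣ ∎
    where
    open ℚₚ.≤-Reasoning

  bounded : (x : ℝ) → ∃ λ B → ∃ λ N → 0ℚ ℚ.≤ B × (∀ n → N ℕ.≤ n → ℚ.∣ seq x n ∣ ℚ.≤ B)
  bounded x with cauchy x 1ℚ 0<1
  ... | N , c = 1ℚ ℚ.+ ℚ.∣ seq x N ∣ , N
              , 0≤+ 1ℚ ℚ.∣ seq x N ∣ 0≤1 (ℚₚ.0≤∣p∣ (seq x N))
              , λ n p → near (seq x n) (seq x N) 1ℚ (c n N p ℕₚ.≤-refl)

  *-mono-abs : ∀ {a b c d} → 0ℚ ℚ.≤ c → ℚ.∣ a ∣ ℚ.≤ c → ℚ.∣ b ∣ ℚ.≤ d →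
               ℚ.∣ a ℚ.* b ∣ ℚ.≤ c ℚ.* d
  *-mono-abs {a} {b} {c} {d} 0≤c a≤c b≤d = begin
    ℚ.∣ a ℚ.* b ∣          ≡⟨ ℚₚ.∣p*q∣≡∣p∣*∣q∣ a b ⟩
    ℚ.∣ a ∣ ℚ.* ℚ.∣ b ∣    ≤⟨ ℚₚ.*-monoʳ-≤-nonNeg ℚ.∣ b ∣ {{ℚ.nonNegative (ℚₚ.0≤∣p∣ b)}} a≤c ⟩
    c ℚ.* ℚ.∣ b ∣          ≤⟨ ℚₚ.*-monoˡ-≤-nonNeg c {{ℚ.nonNegative 0≤c}} b≤d ⟩
    c ℚ.* d ∎
    where
    open ℚₚ.≤-Reasoning

  scale : ∀ K → 0ℚ ℚ.< K → ∀ ε → 0ℚ ℚ.< ε → ∃ λ δ → 0ℚ ℚ.< δ × K ℚ.* δ ≡ ε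
  scale K 0<K ε 0<ε = ((ℚ.1/ K) ℚ.* ε)
    , subst (ℚ._< (ℚ.1/ K) ℚ.* ε) (ℚₚ.*-zeroʳ (ℚ.1/ K))
            (ℚₚ.*-monoʳ-<-pos (ℚ.1/ K) {{ℚₚ.1/pos⇒pos K}} 0<ε)
    , trans (sym (ℚₚ.*-assoc K (ℚ.1/ K) ε))
            (trans (cong (ℚ._* ε) (ℚₚ.*-inverseʳ K)) (ℚₚ.*-identityˡ ε))
    where
    instance
      K-pos : ℚ.Positive K
      K-pos = ℚ.positive 0<K
      K-nonZero : ℚ.NonZero K
      K-nonZero = ℚₚ.pos⇒nonZero K

  commonScale : ∀ u → 0ℚ ℚ.< u → ∀ B₁ B₂ → 0ℚ ℚ.≤ B₁ → 0ℚ ℚ.≤ B₂ → ∀ ε → 0ℚ ℚ.< ε →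
                ∃ λ δ → 0ℚ ℚ.< δ × B₁ ℚ.* δ ℚ.+ B₂ ℚ.* δ ℚ.≤ ε
  commonScale u 0<u B₁ B₂ 0≤B₁ 0≤B₂ ε 0<ε with scale (u ℚ.+ (B₁ ℚ.+ B₂))
    (ℚₚ.<-≤-trans 0<u (subst (u ℚ.≤_) (ℚₚ.+-comm (B₁ ℚ.+ B₂) u)
       (x≤a+x (B₁ ℚ.+ B₂) u (0≤+ B₁ B₂ 0≤B₁ 0≤B₂)))) ε 0<ε
  ... | δ , 0<δ , eq = δ , 0<δ , (begin
      B₁ ℚ.* δ ℚ.+ B₂ ℚ.* δ          ≡⟨ sym (ℚₚ.*-distribʳ-+ δ B₁ B₂) ⟩
      (B₁ ℚ.+ B₂) ℚ.* δ              ≤⟨ ℚₚ.*-monoʳ-≤-nonNeg δ {{ℚ.nonNegative (ℚₚ.<⇒≤ 0<δ)}}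
                                          (x≤a+x u (B₁ ℚ.+ B₂) (ℚₚ.<⇒≤ 0<u)) ⟩
      (u ℚ.+ (B₁ ℚ.+ B₂)) ℚ.* δ      ≡⟨ eq ⟩
      ε ∎)
    where
    open ℚₚ.≤-Reasoning

  *-close : ∀ a b c d {B₁ B₂ δ ε} → 0ℚ ℚ.≤ B₁ → 0ℚ ℚ.≤ B₂ →
            ℚ.∣ a ∣ ℚ.≤ B₁ → ℚ.∣ d ∣ ℚ.≤ B₂ →
            ℚ.∣ a ℚ.- c ∣ ℚ.≤ δ → ℚ.∣ b ℚ.- d ∣ ℚ.≤ δ →
            B₁ ℚ.* δ ℚ.+ B₂ ℚ.* δ ℚ.≤ ε →
            ℚ.∣ a ℚ.* b ℚ.- c ℚ.* d ∣ ℚ.≤ ε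
  *-close a b c d {B₁} {B₂} {δ} {ε} 0≤B₁ 0≤B₂ a≤ d≤ ac bd le = begin
    ℚ.∣ a ℚ.* b ℚ.- c ℚ.* d ∣
      ≡⟨ cong ℚ.∣_∣ (*-minus a b c d) ⟩
    ℚ.∣ a ℚ.* (b ℚ.- d) ℚ.+ d ℚ.* (a ℚ.- c) ∣
      ≤⟨ ℚₚ.∣p+q∣≤∣p∣+∣q∣ (a ℚ.* (b ℚ.- d)) (d ℚ.* (a ℚ.- c)) ⟩
    ℚ.∣ a ℚ.* (b ℚ.- d) ∣ ℚ.+ ℚ.∣ d ℚ.* (a ℚ.- c) ∣
      ≤⟨ ℚₚ.+-mono-≤ (*-mono-abs {a} {b ℚ.- d} 0≤B₁ a≤ bd) (*-mono-abs {d} {a ℚ.- c} 0≤B₂ d≤ ac) ⟩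
    B₁ ℚ.* δ ℚ.+ B₂ ℚ.* δ
      ≤⟨ le ⟩
    ε ∎
    where
    open ℚₚ.≤-Reasoning

  CauchyAt : (ℕ → ℚ) → ℚ → Set
  CauchyAt s ε = ∃ λ N → ∀ m n → N ℕ.≤ m → N ℕ.≤ n → ℚ.∣ s m ℚ.- s n ∣ ℚ.≤ ε

  BoundedBy : (ℕ → ℚ) → ℚ → Set
  BoundedBy s B = ∃ λ N → 0ℚ ℚ.≤ B × (∀ n → N ℕ.≤ n → ℚ.∣ s n ∣ ℚ.≤ B)

  *-cauchy : ∀ s t {B₁ B₂ δ ε} → BoundedBy s B₁ → BoundedBy t B₂ →
             CauchyAt s δ → CauchyAt t δ → B₁ ℚ.* δ ℚ.+ B₂ ℚ.* δ ℚ.≤ ε →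
             CauchyAt (λ n → s n ℚ.* t n) ε
  *-cauchy s t (M₁ , 0≤B₁ , b₁) (M₂ , 0≤B₂ , b₂) (N₁ , c₁) (N₂ , c₂) le =
    L ℕ.⊔ R , λ m n p q →
    *-close (s m) (t m) (s n) (t n) 0≤B₁ 0≤B₂
      (b₁ m (ℕₚ.≤-trans M₁≤ p)) (b₂ n (ℕₚ.≤-trans M₂≤ q))
      (c₁ m n (ℕₚ.≤-trans N₁≤ p) (ℕₚ.≤-trans N₁≤ q))
      (c₂ m n (ℕₚ.≤-trans N₂≤ p) (ℕₚ.≤-trans N₂≤ q)) le
    where
    L = N₁ ℕ.⊔ N₂
    R = M₁ ℕ.⊔ M₂
    N₁≤ = ℕₚ.≤-trans (ℕₚ.m≤m⊔n N₁ N₂) (ℕₚ.m≤m⊔n L R)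
    N₂≤ = ℕₚ.≤-trans (ℕₚ.m≤n⊔m N₁ N₂) (ℕₚ.m≤m⊔n L R)
    M₁≤ = ℕₚ.≤-trans (ℕₚ.m≤m⊔n M₁ M₂) (ℕₚ.m≤n⊔m L R)
    M₂≤ = ℕₚ.≤-trans (ℕₚ.m≤n⊔m M₁ M₂) (ℕₚ.m≤n⊔m L R)

  *-cauchy′ : ∀ s t {B₁ B₂} u → 0ℚ ℚ.< u → BoundedBy s B₁ → BoundedBy t B₂ →
              (∀ ε → 0ℚ ℚ.< ε → CauchyAt s ε) → (∀ ε → 0ℚ ℚ.< ε → CauchyAt t ε) →
              ∀ ε → 0ℚ ℚ.< ε → CauchyAt (λ n → s n ℚ.* t n) ε
  *-cauchy′ s t {B₁} {B₂} u 0<u bs bt cs ct ε 0<ε =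
    let δ , 0<δ , le = commonScale u 0<u B₁ B₂ (proj₁ (proj₂ bs)) (proj₁ (proj₂ bt)) ε 0<ε
    in *-cauchy s t bs bt (cs δ 0<δ) (ct δ 0<δ) le

_*ᴿ_ : ℝ → ℝ → ℝ
x *ᴿ y = record
  { seq    = λ n → seq x n ℚ.* seq y n
  ; cauchy = *-cauchy′ (seq x) (seq y) 1ℚ 0<1 (proj₂ (bounded x)) (proj₂ (bounded y))
                       (cauchy x) (cauchy y)
  }

_^ᴿ_ : ℝ → ℕ → ℝ
x ^ᴿ zero  = fromℚ 1ℚ
x ^ᴿ suc n = x *ᴿ (x ^ᴿ n)

sumᴿ : List ℝ → ℝ
sumᴿ = foldr _+ᴿ_ (fromℚ 0ℚ)

_≤ᴿ_ : ℝ → ℝ → Set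
x ≤ᴿ y = ∀ ε → 0ℚ ℚ.< ε → ∃ λ N → ∀ n → N ℕ.≤ n → seq x n ℚ.≤ seq y n ℚ.+ ε

_<ᴿ_ : ℝ → ℝ → Set
x <ᴿ y = ∃ λ ε → 0ℚ ℚ.< ε × ∃ λ N → ∀ n → N ℕ.≤ n → seq x n ℚ.+ ε ℚ.≤ seq y n

[0,1] : Set
[0,1] = Σ ℝ λ x → fromℚ 0ℚ ≤ᴿ x × x ≤ᴿ fromℚ 1ℚ

Tendsto : (ℕ → ℝ) → ℚ → Set
Tendsto x L = ∀ ε → 0ℚ ℚ.< ε → ∃ λ N → ∀ n → N ℕ.≤ n →
  fromℚ (L ℚ.- ε) ≤ᴿ x n × x n ≤ᴿ fromℚ (L ℚ.+ ε)

_=o_ : (ℕ → [0,1]) → (ℕ → [0,1]) → Set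
q =o p = ∀ ε → 0ℚ ℚ.< ε → ∃ λ N → ∀ n → N ℕ.≤ n →
  proj₁ (q n) ≤ᴿ fromℚ ε *ᴿ proj₁ (p n)

_=ω_ : (ℕ → [0,1]) → (ℕ → [0,1]) → Set
q =ω p = ∀ C → 0ℚ ℚ.< C → ∃ λ N → ∀ n → N ℕ.≤ n →
  fromℚ C *ᴿ proj₁ (p n) ≤ᴿ proj₁ (q n)

------------------------------------------------------------------------
-- The function n ↦ n^(-1/β)

-- The largest m ≤ b satisfying P, or 0 if there is none.
greatest : {P : ℕ → Set} → Decidable P → ℕ → ℕ
greatest P? zero    = zero
greatest P? (suc b) = if ⌊ P? (suc b) ⌋ then suc b else greatest P? b

greatest-≤ : ∀ {P : ℕ → Set} (P? : Decidable P) b → greatest P? b ℕ.≤ b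
greatest-≤ P? zero = z≤n
greatest-≤ P? (suc b) with P? (suc b)
... | yes _ = ℕₚ.≤-refl
... | no  _ = ℕₚ.m≤n⇒m≤1+n (greatest-≤ P? b)

greatest-holds : ∀ {P : ℕ → Set} (P? : Decidable P) b →
                 greatest P? b ≡ 0 ⊎ P (greatest P? b)
greatest-holds P? zero = inj₁ refl
greatest-holds P? (suc b) with P? (suc b)
... | yes p = inj₂ p
... | no  _ = greatest-holds P? b

greatest-fails : ∀ {P : ℕ → Set} (P? : Decidable P) b m →
                 greatest P? b ℕ.< m → m ℕ.≤ b → ¬ P m
greatest-fails P? zero m g<m m≤0 = contradiction (ℕₚ.<-≤-trans g<m m≤0) λ ()
greatest-fails P? (suc b) m g<m m≤1+b with P? (suc b)
... | yes _ = contradiction g<m (ℕₚ.≤⇒≯ m≤1+b)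
... | no ¬p with ℕₚ.m≤n⇒m<n∨m≡n m≤1+b
...   | inj₁ (s≤s m≤b) = greatest-fails P? b m g<m m≤b
...   | inj₂ refl      = ¬p

/-mono : ∀ m n p q → m ℕ.* suc q ℕ.≤ p ℕ.* suc n → m ÷ suc n ℚ.≤ p ÷ suc q
/-mono m n p q le = ℚₚ.toℚᵘ-cancel-≤
  (ℚᵘₚ.≤-respˡ-≃ (ℚᵘₚ.≃-sym (ℚₚ.toℚᵘ-fromℚᵘ (mkℚᵘ (+ m) n)))
    (ℚᵘₚ.≤-respʳ-≃ (ℚᵘₚ.≃-sym (ℚₚ.toℚᵘ-fromℚᵘ (mkℚᵘ (+ p) q)))
      (ℚᵘ.*≤* (subst₂ ℤ._≤_ (ℤₚ.pos-* m (suc q)) (ℤₚ.pos-* p (suc n)) (+≤+ le)))))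

archimedean : ∀ ε → 0ℚ ℚ.< ε → ∃ λ N → 1 ÷ suc N ℚ.≤ ε
archimedean (mkℚ (+ zero) d c) (ℚ.*<* lt) = contradiction lt λ { (ℤ.+<+ ()) }
archimedean (mkℚ ℤ.-[1+ a ] d c) (ℚ.*<* ())
archimedean (mkℚ (+ suc a) d c) _ = d , ℚₚ.toℚᵘ-cancel-≤
  (ℚᵘₚ.≤-respˡ-≃ (ℚᵘₚ.≃-sym (ℚₚ.toℚᵘ-fromℚᵘ (mkℚᵘ (+ 1) d)))
    (ℚᵘ.*≤* (subst₂ ℤ._≤_ (ℤₚ.pos-* 1 (suc d)) (ℤₚ.pos-* (suc a) (suc d))
      (+≤+ (ℕₚ.*-monoˡ-≤ (suc d) (s≤s (z≤n {a})))))))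

+-÷ : ∀ m p n → m ÷ suc n ℚ.+ p ÷ suc n ≡ (m ℕ.+ p) ÷ suc n
+-÷ m p n = ℚₚ.toℚᵘ-injective (begin
  toℚᵘ (m ÷ suc n ℚ.+ p ÷ suc n)               ≈⟨ ℚₚ.toℚᵘ-homo-+ (m ÷ suc n) (p ÷ suc n) ⟩
  toℚᵘ (m ÷ suc n) ℚᵘ.+ toℚᵘ (p ÷ suc n)       ≈⟨ ℚᵘₚ.+-cong (ℚₚ.toℚᵘ-fromℚᵘ (mkℚᵘ (+ m) n)) (ℚₚ.toℚᵘ-fromℚᵘ (mkℚᵘ (+ p) n)) ⟩
  mkℚᵘ (+ m) n ℚᵘ.+ mkℚᵘ (+ p) n               ≈⟨ ℚᵘ.*≡* eq ⟩
  mkℚᵘ (+ (m ℕ.+ p)) n                         ≈⟨ ℚᵘₚ.≃-sym (ℚₚ.toℚᵘ-fromℚᵘ (mkℚᵘ (+ (m ℕ.+ p)) n)) ⟩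
  toℚᵘ ((m ℕ.+ p) ÷ suc n) ∎)
  where
  open ℚᵘₚ.≃-Reasoning
  N = + suc n
  eq : (+ m ℤ.* N ℤ.+ + p ℤ.* N) ℤ.* N ≡ + (m ℕ.+ p) ℤ.* (N ℤ.* N)
  eq = trans (cong (ℤ._* N) (sym (ℤₚ.*-distribʳ-+ N (+ m) (+ p))))
             (ℤₚ.*-assoc (+ m ℤ.+ + p) N N)

private
  plus-minus : ∀ q ε → (q ℚ.+ ε) ℚ.- q ≡ ε
  plus-minus = solve 2 (λ q ε → (q :+ ε) :- q := ε) refl

  minus-swap : ∀ p q → q ℚ.- p ≡ ℚ.- (p ℚ.- q)
  minus-swap = solve 2 (λ p q → q :- p := :- (p :- q)) refl

  shift : ∀ p q ε → p ℚ.≤ q ℚ.+ ε → p ℚ.- q ℚ.≤ ε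
  shift p q ε le = subst (p ℚ.- q ℚ.≤_) (plus-minus q ε) (ℚₚ.+-monoˡ-≤ (ℚ.- q) le)

∣-∣≤ : ∀ p q ε → p ℚ.≤ q ℚ.+ ε → q ℚ.≤ p ℚ.+ ε → ℚ.∣ p ℚ.- q ∣ ℚ.≤ ε
∣-∣≤ p q ε p≤ q≤ with ℚₚ.∣p∣≡p∨∣p∣≡-p (p ℚ.- q)
... | inj₁ eq = subst (ℚ._≤ ε) (sym eq) (shift p q ε p≤)
... | inj₂ eq = subst (ℚ._≤ ε) (trans (minus-swap p q) (sym eq)) (shift q p ε q≤)

module _ (a b n : ℕ) where

  private
    P : ℕ → ℕ → Set
    P j m = m ℕ.^ a ℕ.* n ℕ.^ b ℕ.≤ suc j ℕ.^ a

    P? : ∀ j → Decidable (P j)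
    P? j m = m ℕ.^ a ℕ.* n ℕ.^ b ℕₚ.≤? suc j ℕ.^ a

  rootNumerator : ℕ → ℕ
  rootNumerator j = greatest (P? j) (suc j)

  private
    cross : ∀ i j → rootNumerator i ℕ.* suc j ℕ.≤ (rootNumerator j ℕ.+ 1) ℕ.* suc i
    cross i j with greatest-holds (P? i) (suc i)
    ... | inj₁ eq = subst (λ z → z ℕ.* suc j ℕ.≤ (rootNumerator j ℕ.+ 1) ℕ.* suc i) (sym eq) z≤n
    ... | inj₂ Pi with (rootNumerator j ℕ.+ 1) ℕₚ.≤? suc j
    ...   | no ¬le = ℕₚ.≤-trans (ℕₚ.*-mono-≤ (greatest-≤ (P? i) (suc i)) (ℕₚ.<⇒≤ (ℕₚ.≰⇒> ¬le)))
                                (ℕₚ.≤-reflexive (ℕₚ.*-comm (suc i) _))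
    ...   | yes le with rootNumerator i ℕ.* suc j ℕₚ.≤? (rootNumerator j ℕ.+ 1) ℕ.* suc i
    ...     | yes done = done
    ...     | no ¬done = contradiction chain (ℕₚ.<⇒≱ (ℕₚ.*-monoˡ-< (suc i ℕ.^ a) {{ℕₚ.m^n≢0 (suc i) a}} fail))
      where
      x = rootNumerator i
      y = rootNumerator j ℕ.+ 1
      c = n ℕ.^ b
      I = suc i ℕ.^ a
      J = suc j ℕ.^ a
      fail : J ℕ.< y ℕ.^ a ℕ.* c
      fail = ℕₚ.≰⇒> (greatest-fails (P? j) (suc j) y
               (subst (rootNumerator j ℕ.<_) (ℕₚ.+-comm 1 _) ℕₚ.≤-refl) le)
      ^-distrib-* : ∀ p q k → (p ℕ.* q) ℕ.^ k ≡ p ℕ.^ k ℕ.* q ℕ.^ k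
      ^-distrib-* p q zero    = refl
      ^-distrib-* p q (suc k) = trans (cong (p ℕ.* q ℕ.*_) (^-distrib-* p q k))
                                      (ℕₚ.[m*n]*[o*p]≡[m*o]*[n*p] p q (p ℕ.^ k) (q ℕ.^ k))
      open ℕₚ.≤-Reasoning
      swapʳ : ∀ p q r → p ℕ.* q ℕ.* r ≡ p ℕ.* r ℕ.* q
      swapʳ p q r = trans (ℕₚ.*-assoc p q r) (trans (cong (p ℕ.*_) (ℕₚ.*-comm q r)) (sym (ℕₚ.*-assoc p r q)))
      chain : y ℕ.^ a ℕ.* c ℕ.* I ℕ.≤ J ℕ.* I
      chain = begin
        y ℕ.^ a ℕ.* c ℕ.* I          ≡⟨ swapʳ (y ℕ.^ a) c I ⟩
        y ℕ.^ a ℕ.* I ℕ.* c          ≡⟨ cong (ℕ._* c) (sym (^-distrib-* y (suc i) a)) ⟩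
        (y ℕ.* suc i) ℕ.^ a ℕ.* c    ≤⟨ ℕₚ.*-monoˡ-≤ c (ℕₚ.^-monoˡ-≤ a (ℕₚ.<⇒≤ (ℕₚ.≰⇒> ¬done))) ⟩
        (x ℕ.* suc j) ℕ.^ a ℕ.* c    ≡⟨ cong (ℕ._* c) (^-distrib-* x (suc j) a) ⟩
        x ℕ.^ a ℕ.* J ℕ.* c          ≡⟨ swapʳ (x ℕ.^ a) J c ⟩
        x ℕ.^ a ℕ.* c ℕ.* J          ≤⟨ ℕₚ.*-monoˡ-≤ J Pi ⟩
        I ℕ.* J                      ≡⟨ ℕₚ.*-comm I J ⟩
        J ℕ.* I ∎

    close : ∀ N ε → 1 ÷ suc N ℚ.≤ ε → ∀ i j → N ℕ.≤ j →
            rootNumerator i ÷ suc i ℚ.≤ rootNumerator j ÷ suc j ℚ.+ ε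
    close N ε 1/N≤ε i j N≤j = begin
      rootNumerator i ÷ suc i                    ≤⟨ /-mono (rootNumerator i) i (rootNumerator j ℕ.+ 1) j (cross i j) ⟩
      (rootNumerator j ℕ.+ 1) ÷ suc j            ≡⟨ sym (+-÷ (rootNumerator j) 1 j) ⟩
      rootNumerator j ÷ suc j ℚ.+ 1 ÷ suc j      ≤⟨ ℚₚ.+-monoʳ-≤ (rootNumerator j ÷ suc j)
                                                      (ℚₚ.≤-trans (/-mono 1 j 1 N (ℕₚ.*-monoʳ-≤ 1 (s≤s N≤j))) 1/N≤ε) ⟩
      rootNumerator j ÷ suc j ℚ.+ ε ∎
      where
      open ℚₚ.≤-Reasoning

  rootNumerator-≤ : ∀ j → rootNumerator j ℕ.≤ suc j
  rootNumerator-≤ j = greatest-≤ (P? j) (suc j)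

  root : ℝ
  root = record
    { seq    = λ j → rootNumerator j ÷ suc j
    ; cauchy = λ ε 0<ε → let N , 1/N≤ε = archimedean ε 0<ε in
        N , λ i j N≤i N≤j → ∣-∣≤ _ _ ε (close N ε 1/N≤ε i j N≤j) (close N ε 1/N≤ε j i N≤i)
    }

-- With β = a/b in lowest terms, n^(-1/β) is the x ≥ 0 with x^a · n^b = 1; its
-- j-th approximant is the largest multiple m/(j+1) ≤ 1 with (m/(j+1))^a · n^b ≤ 1.
-- For n = 0 this gives 1. Intended for β > 0.
_^-1/_ : ℕ → ℚ → [0,1]
n ^-1/ β = root a b n , nonNeg , ≤1
  where
  a = ℤ.∣ ℚ.↥ β ∣
  b = ℚ.↧ₙ β
  nonNeg : fromℚ 0ℚ ≤ᴿ root a b n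
  nonNeg ε 0<ε = 0 , λ j _ → ℚₚ.≤-trans (/-mono 0 0 (rootNumerator a b n j) j z≤n)
    (subst (ℚ._≤ seq (root a b n) j ℚ.+ ε) (ℚₚ.+-identityʳ (seq (root a b n) j))
           (ℚₚ.+-monoʳ-≤ (seq (root a b n) j) (ℚₚ.<⇒≤ 0<ε)))
  ≤1 : root a b n ≤ᴿ fromℚ 1ℚ
  ≤1 ε 0<ε = 0 , λ j _ → ℚₚ.≤-trans
    (/-mono (rootNumerator a b n j) j 1 0
      (subst₂ ℕ._≤_ (sym (ℕₚ.*-identityʳ _)) (sym (ℕₚ.*-identityˡ _))
              (rootNumerator-≤ a b n j)))
    (subst (ℚ._≤ 1ℚ ℚ.+ ε) (ℚₚ.+-identityʳ 1ℚ) (ℚₚ.+-monoʳ-≤ 1ℚ (ℚₚ.<⇒≤ 0<ε)))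

------------------------------------------------------------------------
-- Finite enumerations

sublists : {A : Set} → List A → List (List A)
sublists []       = [] ∷ []
sublists (x ∷ xs) = sublists xs ++ map (x ∷_) (sublists xs)

choices : {A : Set} {n : ℕ} → Vec (List A) n → List (Vec A n)
choices []         = [] ∷ []
choices (xs ∷ xss) = cartesianProductWith _∷_ xs (choices xss)

subsets : ∀ n → List (Subset n)
subsets n = choices (replicate n (outside ∷ inside ∷ []))

allᵛ? : ∀ {k} n {P : Vec (Fin k) n → Set} → Decidable P → Dec (∀ c → P c)
allᵛ? zero    P? = map′ (λ { p [] → p }) (λ p → p []) (P? [])
allᵛ? (suc n) P? = map′ (λ { p (x ∷ c) → p x c }) (λ p x c → p (x ∷ c))
                        (all? λ x → allᵛ? n λ c → P? (x ∷ c))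

anyᵛ? : ∀ {k} n {P : Vec (Fin k) n → Set} → Decidable P → Dec (∃ P)
anyᵛ? zero    P? = map′ (λ p → [] , p) (λ { ([] , p) → p }) (P? [])
anyᵛ? (suc n) P? = map′ (λ { (x , c , p) → (x ∷ c) , p }) (λ { ((x ∷ c) , p) → x , c , p })
                        (any? λ x → anyᵛ? n λ c → P? (x ∷ c))

------------------------------------------------------------------------
-- Graphs

-- A finite simple graph whose vertex set is a subset of Fin n. Graphs are
-- compared by _≈_, since adj is a function.
record Graph (n : ℕ) : Set where
  field
    verts   : Subset n
    adj     : Fin n → Fin n → Bool
    sym-adj : ∀ {x y} → T (adj x y) → T (adj y x)
    irrefl  : ∀ {x} → ¬ T (adj x x)
    support : ∀ {x y} → T (adj x y) → x ∈ verts

open Graph public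

FinGraph : Set
FinGraph = ∃ Graph

_≈_ : ∀ {n} → Graph n → Graph n → Set
G ≈ H = verts G ≡ verts H × (∀ x y → adj G x y ≡ adj H x y)

_≈?_ : ∀ {n} (G H : Graph n) → Dec (G ≈ H)
G ≈? H = Vecₚ.≡-dec _≟ᵇ_ (verts G) (verts H)
         ×-dec all? λ x → all? λ y → adj G x y ≟ᵇ adj H x y

fromRelation : ∀ {n} (V : Subset n) {E : Fin n → Fin n → Set} →
               (∀ x y → Dec (E x y)) →
               (∀ {x y} → E x y → E y x) → (∀ {x} → ¬ E x x) →
               (∀ {x y} → E x y → x ∈ V) → Graph n
fromRelation V E? s i p = record
  { verts   = V
  ; adj     = λ x y → ⌊ E? x y ⌋
  ; sym-adj = λ {x} {y} e → fromWitness {a? = E? y x} (s (toWitness {a? = E? x y} e))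
  ; irrefl  = λ {x} e → i (toWitness {a? = E? x x} e)
  ; support = λ {x} {y} e → p (toWitness {a? = E? x y} e)
  }

pairs : ∀ n → List (Fin n × Fin n)
pairs n = filter (λ (x , y) → x <?ᶠ y) (cartesianProduct (allFin n) (allFin n))

edges : ∀ {n} → Graph n → List (Fin n × Fin n)
edges {n} G = filter (λ (x , y) → T? (adj G x y)) (pairs n)

v e : ∀ {n} → Graph n → ℕ
v G = ∣ verts G ∣
e G = length (edges G)

-- The convention that graphs on at most one vertex are complete, of density 1,
-- keeps "every G_n has density at least d" satisfiable at n = 0, 1.
density : ∀ {n} → Graph n → ℚ
density G with v G C 2
... | zero  = 1ℚ
... | suc m = e G ÷ suc m

_∈ˡ?_ : ∀ {n} (p : Fin n × Fin n) S → Dec (p ∈ˡ S)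
p ∈ˡ? S = anyˡ? (≡-dec _≟ᶠ_ _≟ᶠ_ p) S

-- Pairs outside V and loops are discarded.
fromEdges : ∀ {n} → Subset n → List (Fin n × Fin n) → Graph n
fromEdges V S = fromRelation V
  (λ x y → x ∈? V ×-dec y ∈? V ×-dec ¬? (x ≟ᶠ y)
           ×-dec ((x , y) ∈ˡ? S ⊎-dec (y , x) ∈ˡ? S))
  (λ (p , q , r , s) → q , p , (λ eq → r (sym eq)) , swap s)
  (λ (_ , _ , r , _) → r refl)
  proj₁

_[_] : ∀ {n} → Graph n → Subset n → Graph n
G [ W ] = fromRelation (verts G ∩ W)
  (λ x y → x ∈? W ×-dec y ∈? W ×-dec T? (adj G x y))
  (λ (p , q , r) → q , p , sym-adj G r)
  (λ (_ , _ , r) → irrefl G r)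
  (λ (p , _ , r) → x∈p∩q⁺ (support G r , p))

_∪ᴳ_ : ∀ {n} → Graph n → Graph n → Graph n
_∪ᴳ_ {n} G H = fromRelation (verts G ∪ verts H)
  (λ x y → T? (adj G x y) ⊎-dec T? (adj H x y))
  (map⊎ (sym-adj G) (sym-adj H))
  (λ { (inj₁ p) → irrefl G p ; (inj₂ p) → irrefl H p })
  (λ p → x∈p∪q⁺ (map⊎ (support G) (support H) p))

subgraphs : ∀ {n} → Graph n → List (Graph n)
subgraphs {n} G =
  concatMap (λ W → map (fromEdges W) (sublists (edges (G [ W ]))))
            (filter (_⊆? verts G) (subsets n))

-- The vertices in the i-th class of a k-colouring of Fin n.
class : ∀ {n k} → Vec (Fin k) n → Fin k → Subset n
class c i = Vec.map (λ j → ⌊ j ≟ᶠ i ⌋) c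

------------------------------------------------------------------------
-- Densities

m₁ : ∀ {n} → Graph n → ℚ
m₁ H = maximum (map (λ J → e J ÷ (v J ∸ 1))
                    (filter (λ J → 2 ℕₚ.≤? v J) (subgraphs H)))

m₁[_,_] : ∀ {n n′} → Graph n → Graph n′ → ℚ
m₁[ B , A ] = maximum (map (λ J → (m₁ B ℚ.+ e J ÷ 1) ℚ.* (1 ÷ v J))
                           (filter (λ J → 1 ℕₚ.≤? v J) (subgraphs A)))

m₁-decreasing : DecTotalOrder _ _ _
m₁-decreasing = On.decTotalOrder (Flip.decTotalOrder ℚₚ.≤-decTotalOrder)
                                 (λ ((_ , A) : FinGraph) → m₁ A)

open Data.List.Sort m₁-decreasing using (sort)

-- For a list sorted by decreasing m₁, of length at least 2.
βSorted : List FinGraph → ℚ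
βSorted ((_ , A₁) ∷ (_ , A₂) ∷ _) = m₁[ A₂ , A₁ ]
βSorted _                         = 0ℚ

βGraphs : ∀ {r} → Vec FinGraph r → ℚ
βGraphs As = βSorted (sort (toList As))

βFamilies : ∀ {r} → Vec (List FinGraph) r → ℚ
βFamilies 𝓐 = minimum (map βGraphs (choices 𝓐))

------------------------------------------------------------------------
-- Certificates

-- A partition of V(H) into k ordered parts is given by a k-colouring of the
-- ambient set Fin n, of which only the values on V(H) matter.
IsCertificate : ∀ {n} → Graph n → ∀ k → Vec (List (Graph n)) k → Set
IsCertificate {n} H k 𝓕 = (c : Vec (Fin k) n) →
  ∃ λ i → Any (H [ class c i ] ≈_) (lookup 𝓕 i)

isCertificate? : ∀ {n} (H : Graph n) k → Decidable (IsCertificate H k)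
isCertificate? {n} H k 𝓕 =
  allᵛ? n λ c → any? λ i → anyˡ? (H [ class c i ] ≈?_) (lookup 𝓕 i)

-- All collections of non-empty subgraphs of H.
families : ∀ {n} → Graph n → List (List (Graph n))
families H = sublists (filter (λ J → 1 ℕₚ.≤? v J) (subgraphs H))

certificates : FinGraph → ∀ k → List (Vec (List FinGraph) k)
certificates (n , H) k =
  map (Vec.map (map (n ,_)))
      (filter (isCertificate? H k) (choices (replicate k (families H))))

β : ∀ {r} → Vec FinGraph r → ℕ → ℚ
β 𝐇 k = maximum (map
  (λ 𝓕s → minimum (map (λ i → βFamilies (Vec.map (λ 𝓕 → lookup 𝓕 i) 𝓕s)) (allFin k)))
  (choices (Vec.map (λ H → certificates H k) 𝐇)))

------------------------------------------------------------------------
-- Vertex-Ramsey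

IsMonoCopy : ∀ {n r n′} → Graph n → Vec (Fin r) n → Fin r → Graph n′ → Vec (Fin n) n′ → Set
IsMonoCopy G c j H f =
    (∀ x → x ∈ verts H → lookup f x ∈ verts G × lookup c (lookup f x) ≡ j)
  × (∀ x y → x ∈ verts H → y ∈ verts H → lookup f x ≡ lookup f y → x ≡ y)
  × (∀ x y → T (adj H x y) → T (adj G (lookup f x) (lookup f y)))

-- Colourings and embeddings are vectors, i.e. functions on the ambient sets.
_⟶_ : ∀ {n r} → Graph n → Vec FinGraph r → Set
_⟶_ {n} {r} G 𝐇 = (c : Vec (Fin r) n) →
  ∃ λ j → ∃ λ f → IsMonoCopy G c j (proj₂ (lookup 𝐇 j)) f

_⟶?_ : ∀ {n r} (G : Graph n) (𝐇 : Vec FinGraph r) → Dec (G ⟶ 𝐇)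
_⟶?_ {n} G 𝐇 = allᵛ? n λ c → any? λ j → let n′ , H = lookup 𝐇 j in anyᵛ? n′ λ f →
        (all? λ x → x ∈? verts H →-dec (lookup f x ∈? verts G ×-dec lookup c (lookup f x) ≟ᶠ j))
  ×-dec (all? λ x → all? λ y → x ∈? verts H →-dec y ∈? verts H →-dec
           (lookup f x ≟ᶠ lookup f y →-dec x ≟ᶠ y))
  ×-dec (all? λ x → all? λ y → T? (adj H x y) →-dec T? (adj G (lookup f x) (lookup f y)))

------------------------------------------------------------------------
-- Random graphs

weight : ∀ n → [0,1] → Graph n → ℝ
weight n (p , _) R = p ^ᴿ e R *ᴿ (fromℚ 1ℚ +ᴿ -ᴿ p) ^ᴿ ((n C 2) ∸ e R)

-- The probability that G(n,p) has the property P.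
ℙ : ∀ n → [0,1] → {P : Graph n → Set} → Decidable P → ℝ
ℙ n p P? = sumᴿ (map (weight n p) (filter P? (map (fromEdges ⊤) (sublists (pairs n)))))

-- ℙ[ G ∪ G(n,p) → (H₁,…,H_r)_v ]
ramseyProbability : ∀ {n r} → Graph n → [0,1] → Vec FinGraph r → ℝ
ramseyProbability {n} G p 𝐇 = ℙ n p (λ R → (G ∪ᴳ R) ⟶? 𝐇)

------------------------------------------------------------------------
-- Thresholds

-- G is an n-vertex graph of density at least d.
IsDense : ℝ → ∀ {n} → Graph n → Set
IsDense d {n} G = v G ≡ n × d ≤ᴿ fromℚ (density G)

IsThreshold : ∀ {r} → Vec FinGraph r → ℝ → (ℕ → [0,1]) → Set
IsThreshold 𝐇 d p =
    (Σ (ℕ → ℕ) λ n → 1 ℕ.≤ n 0 × (∀ m → n m ℕ.< n (suc m)) ×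
     Σ (∀ m → Graph (n m)) λ G → (∀ m → IsDense d (G m)) ×
       (∀ q → q =o p → Tendsto (λ m → ramseyProbability (G m) (q (n m)) 𝐇) 0ℚ))
  × (∀ q → q =ω p → (G : ∀ n → Graph n) → (∀ n → IsDense d (G n)) →
       Tendsto (λ n → ramseyProbability (G n) (q n) 𝐇) 1ℚ)

-- The case in which the threshold is set to 0.
AllRamsey : ∀ {r} → Vec FinGraph r → ℝ → Set
AllRamsey 𝐇 d = ∃ λ N → ∀ n → N ℕ.≤ n → (G : Graph n) → IsDense d G → G ⟶ 𝐇

{-# OPTIONS --safe #-}
-- Below the threshold, G_n is a complete multipartite graph, and in every part an optimal certificate leaves families of graphs whose
-- copies in the random graph can be avoided by two colours: the exploration of overlapping copies started at a vertex stays small.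
-- Above it, dense graphs contain many cliques K_{k+1}; sprinkling the random edges in rounds finds, in the majority colour classes of
-- some part, copies of all graphs of a family that cannot be a certificate, and the clique structure glues them to a copy of some H_j.
module Submission where

import Data.Nat.Base as ℕ
import Data.Nat.Properties as ℕₚ
import Data.List.Relation.Unary.All as All
import Data.Fin.Base as Fin
import Data.List.Membership.Propositional as L
import Data.Vec.Base as Vec
import Data.List.Relation.Unary.Any as Any
import Data.List.Sort
import Data.Fin.Properties
import Data.List.Base as List
import Data.Integer.Base as ℤ
import Data.Fin.Subset
import Data.Rational as ℚ
import Data.Rational.Properties as ℚₚ
import Data.Rational
import Data.List.Properties
import Data.Fin.Subset.Properties
import Data.Vec.Properties
open import Data.Bool.Base using (T; _∧_; _∨_; false; if_then_else_; true) renaming (Bool to bH; not to ha)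
open import Data.Bool.Properties using (T?)
open import Data.Empty using () renaming (⊥-elim to aA)
open import Data.Fin.Base using (Fin; quotient) renaming (remQuot to Hw)
open import Data.Fin.Properties using () renaming (¬∀⟶∃¬ to zd; suc-injective to ze; all? to D5; 0≢1+n to Ei; any? to FI; combine-remQuot to F0)
open import Data.Fin.Properties using () renaming (<-cmp to <ᶠ-cmp; _<?_ to _<?ᶠ_; _≟_ to _≟ᶠ_)
open import Data.Fin.Subset using (_∉_; _∩_; _∪_; _⊆_; ⁅_⁆; ∁) renaming (Subset to av; outside to Bo)
open import Data.Fin.Subset using () renaming (_∈_ to _∈ₛ_; ⊤ to ⊤ₛ; ⊥ to tX)
open import Data.List.Base using (List; _++_; upTo) renaming (length to ah; allFin to ax; cartesianProduct to bD; concatMap to ce; filter to c9; map to fd; foldr to HB)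
open import Data.List.Membership.Propositional using (lose) renaming (find to GS)
open import Data.List.Membership.Propositional using () renaming (_∈_ to _∈ˡ_)
open import Data.List.Membership.Propositional.Properties using (∈-allFin; ∈-∃++) renaming (∈-++⁺ʳ to c8; ∈-cartesianProduct⁺ to dM; ∈-++⁺ˡ to dZ; ∈-filter⁻ to eO; ∈-filter⁺ to gV; ∈-++⁻ to kx; ∈-cartesianProduct⁻ to oG; ∈-cartesianProductWith⁺ to w1; ∈-cartesianProductWith⁻ to w2; ∈-concatMap⁻ to FH; ∈-upTo⁻ to HC; ∈-upTo⁺ to HD)
open import Data.List.Membership.Propositional.Properties using () renaming (∈-map⁺ to zb; ∈-map⁻ to zc)
open import Data.List.Properties using () renaming (length-tabulate to cR; length-map to fK; length-++ to i7; length-replicate to FL)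
open import Data.List.Relation.Binary.Permutation.Propositional using (_↭_; prep; swap) renaming (↭-sym to Eg; ↭-trans to FJ; ↭-refl to GT)
open import Data.List.Relation.Binary.Permutation.Propositional.Properties using (drop-∷) renaming (∈-resp-↭ to t9; ↭-length to D6)
open import Data.List.Relation.Unary.All using (All)
open import Data.List.Relation.Unary.AllPairs using (AllPairs)
open import Data.List.Relation.Unary.Any using (Any) renaming (index to xT)
open import Data.List.Relation.Unary.Any using () renaming (any? to pG)
open import Data.List.Relation.Unary.Any.Properties using () renaming (lookup-index to Bp)
open import Data.List.Relation.Unary.Linked.Properties using () renaming (Linked⇒AllPairs to Eh)
open import Data.List.Relation.Unary.Unique.Propositional using () renaming (Unique to eD)
open import Data.List.Relation.Unary.Unique.Propositional.Properties using (allFin⁺) renaming (cartesianProduct⁺ to lr; filter⁺ to FG)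
open import Data.Nat.Base using (_∸_) renaming (s≤s to bl; z≤n to bI)
open import Data.Nat.Combinatorics using () renaming (nCk+nC[k+1]≡[n+1]C[k+1] to m1; nC1≡n to Hu)
open import Data.Nat.DivMod using (m*n/n≡m; m/n≤m) renaming (m≡m%n+[m/n]*n to gS; m/n*n≤m to oF; m%n<n to Ck; /-monoˡ-≤ to Hv)
open import Data.Nat.DivMod using () renaming (_%_ to _%ₙ_; _/_ to _/ₙ_)
open import Data.Nat.Tactic.RingSolver using () renaming (solve-∀ to aU)
open import Data.Product using (_,_; proj₂; Σ) renaming (proj₁ to ai)
open import Data.Rational using (↥_; ↧ₙ_)
open import Data.Rational using () renaming (_<_ to _<ℚ_; _≤_ to _≤ℚ_)
open import Data.Sum.Base using ([_,_]′; _⊎_) renaming (inj₁ to aD; inj₂ to aG)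
open import Data.Sum.Base using () renaming (map to map⊎)
open import Data.Unit.Base using (tt)
open import Data.Vec.Base using (Vec; _[_]≔_; fromList) renaming (insertAt to d7; toList to e5; removeAt to t8)
open import Data.Vec.Membership.Propositional using () renaming (_∈_ to _∈ᵛ_)
open import Data.Vec.Membership.Propositional.Properties using () renaming (∈-lookup to mJ; ∈-fromList⁺ to FY)
open import Data.Vec.Properties using (lookup-replicate; map-id) renaming (lookup∘tabulate to a9; lookup-map to bv; lookup⇒[]= to fq; []=⇒lookup to gz; length-toList to n9; tabulate∘lookup to ua; lookup∘update′ to D7; insertAt-lookup to FW; lookup∘update to FZ)
open import Data.Vec.Properties using () renaming (lookup∘update′ to FX; lookup∘update to Ht)
open import Data.Vec.Relation.Unary.Any using () renaming (here to hereᵛ; there to thereᵛ)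
open import Function.Base using (_∘_)
open import Relation.Binary.Definitions using (tri<; tri>; tri≈)
open import Relation.Binary.PropositionalEquality using (_≡_)
open import Relation.Nullary using (no; yes; ¬?; ¬_) renaming (Dec to o8)
open import Relation.Nullary.Decidable using (_×-dec_; _→-dec_; _⊎-dec_; ⌊_⌋) renaming (fromWitness to bc; decidable-stable to vP; dec⇒maybe to HA)
open import Relation.Unary using () renaming (Decidable to FK)
open import Tactic.RingSolver using () renaming (solve-∀ to ap)
open import Tactic.RingSolver.Core.AlmostCommutativeRing using () renaming (AlmostCommutativeRing to Br; fromCommutativeRing to Dj)
open import Data.Nat.Base using () renaming (_≤_ to _<=_; _+_ to _+'_; _*_ to _*'_; _^_ to _^'_; _∸_ to _-'_; _<_ to _<'_)
open import Data.Nat.Properties using () renaming (≤-trans to aa; ≤-reflexive to ae; *-monoʳ-≤ to az; *-mono-≤ to aC; +-monoˡ-≤ to aK; *-monoˡ-≤ to aT; <-irrefl to aV; +-identityʳ to aW; m≤m+n to a3; m≤n⇒m≤1+n to a6; m≤n+m to bg; *-identityˡ to bp; m^n>0 to bz; n≤1+n to bB; +-monoʳ-≤ to bJ; ≤-refl to bT; <⇒≤ to bW; ^-monoʳ-≤ to bX; ^-monoˡ-≤ to b7; *-comm to ck; ^-*-assoc to cz; ≰⇒> to dY; +-comm to el; *-assoc to ew; ≤-pred to fw; *-zeroʳ to fx; +-mono-≤ to fI; *-identityʳ to f4; ≤⇒≤ᵇ to f5; ^-identityʳ to f6; <-≤-trans to gQ; ^-distribˡ-+-* to gR; *-cancelʳ-≤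 to g9; m+[n∸m]≡n to hQ; +-suc to ip; +-cancelʳ-≤ to kA; *-cancelˡ-≤ to kB; m≤m⊔n to kD; m≤n⊔m to kE; *-distribʳ-+ to lm; n≤0⇒n≡0 to ln; ≤ᵇ⇒≤ to lX; m∸n+n≡m to m0; <-asym to oE; +-cancelˡ-≤ to rq; ∸-monoˡ-≤ to rs; +-assoc to r4; <-cmp to vN; n∸n≡0 to wW; *-suc to Ci; +-∸-assoc to FE; ≤-antisym to FF; *-monoʳ-< to FV; ≮⇒≥ to GQ; 1+n≢0 to Hs)
open import Data.Rational.Properties using () renaming (≤-reflexive to ad; ≤-trans to af; *-identityʳ to aF; *-identityˡ to aH; +-identityˡ to bu; +-monoʳ-≤ to bA; +-monoˡ-≤ to bC; <⇒≤ to bO; ≤-refl to bR; *-zeroˡ to bY; +-mono-≤ to cQ; neg-antimono-≤ to c4; positive⁻¹ to da; +-identityʳ to dL; *-comm to e9; *-zeroʳ to fJ; <-≤-trans to gA; *-assoc to hp; 0≤p⇒∣p∣≡p to lY; ∣p+q∣≤∣p∣+∣q∣ to mI; 0≤∣p∣ to r5; *-distribˡ-+ to tZ; ≰⇒> to vO; nonNegative⁻¹ to wX; ∣p-q∣≤∣p∣+∣q∣ to yR; <-irrefl to za; *-distribʳ-+ to Bn; +-comm to Cj; +-inverseʳ to D2; ≤-<-trans to D3; ≤-antisym to D4; ≤-total to GR)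
open import Relation.Binary.PropositionalEquality using () renaming (trans to ag; cong to au; sym to aI; subst to aL; cong₂ to aS; subst₂ to lp)
open import Defs using () renaming (Graph to a1; edges to ba; FinGraph to bq; sublists to bG; βGraphs to b9; IsCertificate to cm; fromEdges to cs; ramseyProbability to ds; choices to em; subgraphs to e6; fromℚ to fL; m₁ to gT; families to hS; pairs to jo; class to jQ; isCertificate? to jR; density to jS; maximum to k4; certificates to qP; IsDense to sj; IsMonoCopy to zf; subsets to F1; minimum to F2; AllRamsey to GU; greatest-fails to Hx; greatest-holds to Hy)
open import Data.Rational using () renaming (0ℚ to 0'; 1ℚ to 1'; _≤_ to _=<_)
open import Relation.Binary.PropositionalEquality using () renaming (_≡_ to _==_)
open import Data.Nat.Base using () renaming (_≤ᵇ_ to _<=b_)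
import Data.Rational.Properties

-- Exponents are cleared of denominators: with `β = cN / b4` and `h` bounding all vertex numbers,
-- put `B = cN * h !` and `E = b4 * h !`. Then `E` times every `m₁` that occurs is a natural number,
-- and for an integer `z` of order n^(1/B) the threshold has order z^(-E), so counts become
-- inequalities between powers of `z`. Above the threshold the obstacle is that the colouring is
-- chosen after the random edges are seen, and the vertices already placed depend on it. Random
-- statements must therefore hold for all of the polynomially many states at once. Their failure
-- probability is exponentially small in `z`, except for one Markov event (too many overlapping
-- pairs of copies), which does not mention the state. Tuples with one sparse graph and otherwise
-- edgeless ones escape this scheme and are served by copies placed beforehand. Below the threshold
-- a missing colouring yields a critical family of copies, along which an exploration must
-- eventually run into itself; one such overlap pays for the choice of the start. Approximants of a
-- real in [0,1] may leave the interval, so probabilities are treated as polynomials.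

module RQ = Data.Rational.Properties.≤-Reasoning
import Data.Nat.Base as M0
import Data.Product as M1
import Data.Rational as M2
import Data.Rational.Properties as M3
import Relation.Binary.PropositionalEquality as M4
import Defs as M5
import Data.Fin.Base as M6
import Data.List.Base as M7
import Data.Vec.Base as M8
import Data.Fin.Subset as M9
import Data.List.Relation.Unary.All as M10
import Data.Fin.Subset.Properties as M11
import Data.List.Relation.Unary.AllPairs as M12
import Data.List.Relation.Unary.Any as M13
import Data.Vec.Relation.Unary.Any as M14
import Relation.Nullary.Decidable as M15
import Data.List.Membership.Propositional as M16
import Data.Fin.Properties as M17
import Data.List.Membership.Propositional.Properties as M18
import Data.Vec.Properties as M19
import Data.Nat.Combinatorics as M20
import Data.Unit.Base as M21
import Data.List.Relation.Unary.Unique.Propositional.Properties as M22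
import Relation.Binary.Definitions as M23
import Data.Empty as M24
import Data.List.Relation.Unary.All.Properties as M25

-- Rational arithmetic: powers, Bernoulli's inequality, exponential against polynomial growth.

module P1 where
 open M0 using (ℕ;zero;suc)
 open M1 using (∃;_×_)
 open M2 hiding (_÷_)
 open M3
 open M4
 open M5 using (_÷_;+-÷;/-mono)
 ar : Br _ _
 ar = Dj +-*-commutativeRing(\ x -> HA(0' ≟ x))
 infixr 8 _^_
 _^_ : ℚ -> ℕ -> ℚ
 x ^ zero = 1'
 x ^ suc n = x * x ^ n
 -- `ι` is abstract so that type checking never unfolds rational division; what is later said about
 -- it rests on the five facts of this block.
 abstract
  ι : ℕ -> ℚ
  ι n = n ÷ 1
  zk : ∀ n -> ι n == n ÷ 1
  zk n = refl
  iA : ι 0 == 0'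
  iA = refl
  jZ : ι 1 == 1'
  jZ = refl
  o9 : ∀ m n -> ι(m +' n)== ι m + ι n
  o9 m n = aI(+-÷ m n 0)
  bw : ∀{m n}-> m <= n -> ι m =< ι n
  bw{m}{n}Ej = /-mono m 0 n 0(aT 1 Ej)
 cV : ∀ n -> ι(suc n)== 1' + ι n
 cV n = ag(o9 1 n)(au(_+ ι n)jZ)
 cW : ∀ m n -> ι(m *' n)== ι m * ι n
 cW zero n = ag iA(aI(ag(au(_* ι n)iA)(bY(ι n))))
 cW(suc m)n = begin ι(n +' m *' n)≡⟨ o9 n(m *' n)⟩ ι n + ι(m *' n)≡⟨ au(ι n +_)(cW m n)⟩ ι n + ι m * ι n ≡⟨ a0(ι n)(ι m)⟩(1' + ι m)* ι n ≡⟨ au(_* ι n)(aI(cV m))⟩ ι(suc m)* ι n ∎ where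
  open ≡-Reasoning
  a0 : ∀ x y -> x + y * x ==(1' + y)* x
  a0 = ap ar
 mU : ∀ m n -> ι(m ^' n)== ι m ^ n
 mU m zero = jZ
 mU m(suc n)= ag(cW m(m ^' n))(au(ι m *_)(mU m n))
 aY : ∀ n -> 0' =< ι n
 aY n = aL(_=< ι n)iA(bw bI)
 gW : 0' < 1'
 gW = da 1'
 ca : 0' =< 1'
 ca = bO gW
 cO : ∀ n -> 0' < ι(suc n)
 cO n = gA gW(aL(_=< ι(suc n))jZ(bw(bl bI)))
 k5 : ∀{n}-> 1 <= n -> 0' < ι n
 k5{suc n}_ = cO n
 bS : ∀{m n}-> ι m =< ι n -> m <= n
 bS{m}{n}le with m ℕₚ.≤? n
 ... | yes p = p
 ... | no uQ = aA(za refl(gA lt le))where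
  lt : ι n < ι m
  lt = gA(aL(ι n <_)(aI(cV n))(aL(_< 1' + ι n)(bu(ι n))(+-monoˡ-<(ι n)gW)))(bw(dY uQ))
 bK : ∀{a b}d -> 0' =< d -> b == a + d -> a =< b
 bK{a}{b}d Ek eq = aL(a =<_)(aI eq)(aL(_=< a + d)(dL a)(bA a Ek))
 e7 : ∀{a b}-> a =< b -> 0' =< b - a
 e7{a}{b}le = aL(_=< b - a)(D2 a)(bC(- a)le)
 0≤+ : ∀{a b}-> 0' =< a -> 0' =< b -> 0' =< a + b
 0≤+{a}{b}p q = aL(_=< a + b)(bu 0')(cQ p q)
 aO : ∀{a b}c -> 0' =< c -> a =< b -> c * a =< c * b
 aO c iu = *-monoˡ-≤-nonNeg c{{nonNegative iu}}
 aX : ∀{a b}c -> 0' =< c -> a =< b -> a * c =< b * c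
 aX c iu = *-monoʳ-≤-nonNeg c{{nonNegative iu}}
 a7 : ∀{a b}-> 0' =< a -> 0' =< b -> 0' =< a * b
 a7{a}{b}p q = aL(_=< a * b)(fJ a)(aO a p q)
 r6 : ∀{a b}-> 0' < a -> 0' < b -> 0' < a * b
 r6{a}{b}p q = aL(_< a * b)(fJ a)(*-monoʳ-<-pos a{{positive p}}q)
 dS : ∀{a b c d}-> 0' =< a -> a =< b -> 0' =< c -> c =< d -> a * c =< b * d
 dS{a}{b}{c}{d}El Cl iu Em = af(aX c iu Cl)(aO b(af El Cl)Em)
 bZ : ∀{a b}c -> 0' < c -> c * a =< c * b -> a =< b
 bZ c En = *-cancelˡ-≤-pos c{{positive En}}
 jT : ∀ x -> 0' =< x * x
 jT x with GR 0' x
 ... | aD p = a7 p p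
 ... | aG p = aL(0' =<_)(a0 x)(a7(c4 p)(c4 p))where
  a0 : ∀ x ->(- x)*(- x)== x * x
  a0 = ap ar
 aQ : ∀{x}n -> 0' =< x -> 0' =< x ^ n
 aQ zero p = ca
 aQ(suc n)p = a7 p(aQ n p)
 rt : ∀{x}n -> 0' < x -> 0' < x ^ n
 rt zero p = gW
 rt(suc n)p = r6 p(rt n p)
 j0 : ∀{x y}n -> 0' =< x -> x =< y -> x ^ n =< y ^ n
 j0 zero p q = bR
 j0(suc n)p q = dS p q(aQ n p)(j0 n p q)
 1^ : ∀ n -> 1' ^ n == 1'
 1^ zero = refl
 1^(suc n)= ag(aH(1' ^ n))(1^ n)
 lZ : ∀{x}n -> 0' =< x -> x =< 1' -> x ^ n =< 1'
 lZ{x}n p q = aL(x ^ n =<_)(1^ n)(j0 n p q)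
 Cm : ∀{x}n -> 1' =< x -> 1' =< x ^ n
 Cm{x}n p = aL(_=< x ^ n)(1^ n)(j0 n ca p)
 zl : ∀ x m n -> x ^(m +' n)== x ^ m * x ^ n
 zl x zero n = aI(aH(x ^ n))
 zl x(suc m)n = ag(au(x *_)(zl x m n))(aI(hp x(x ^ m)(x ^ n)))
 b5 : ∀ x y n ->(x * y)^ n == x ^ n * y ^ n
 b5 x y zero = aI(aH 1')
 b5 x y(suc n)= ag(au(x * y *_)(b5 x y n))(a0 x y(x ^ n)(y ^ n))where
  a0 : ∀ a b c d -> a * b *(c * d)== a * c *(b * d)
  a0 = ap ar
 Cp : ∀ x m n -> x ^(m *' n)==(x ^ n)^ m
 Cp x zero n = refl
 Cp x(suc m)n = ag(zl x n(m *' n))(au(x ^ n *_)(Cp x m n))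
 f8 : ∀{x}{m n}-> 0' =< x -> x =< 1' -> m <= n -> x ^ n =< x ^ m
 f8{x}{n = n}p q bI = lZ n p q
 f8{x}p q(bl le)= aO x p(f8 p q le)
 m3 : ∀{x}{m n}-> 1' =< x -> m <= n -> x ^ m =< x ^ n
 m3{x}{n = n}q bI = Cm n q
 m3{x}q(bl le)= aO x(af ca q)(m3 q le)
 -- Bernoulli's inequality; the term thrown away in the induction step is `n * y²`.
 lu : ∀ y n -> 0' =< y -> 1' + ι n * y =<(1' + y)^ n
 lu y zero p = ad(ag(au(1' +_)(ag(au(_* y)iA)(bY y)))(dL 1'))
 lu y(suc n)p = af(bK(ι n *(y * y))(a7(aY n)(jT y))(ag(a0(ι n)y)(au(\ i -> 1' + i * y + ι n *(y * y))(aI(cV n)))))(aO(1' + y)(0≤+ ca p)(lu y n p))where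
  a0 : ∀ i y ->(1' + y)*(1' + i * y)== 1' +(1' + i)* y + i *(y * y)
  a0 = ap ar
 f9 : ∀ q -> 0' < q -> ∃ \ r -> 0' < r × q * r == 1'
 f9 q Eo =(1/ q), da(1/ q){{1/pos⇒pos q}}, *-inverseʳ q where
  instance
   Ep : Positive q
   Ep = positive Eo
   F3 : NonZero q
   F3 = pos⇒nonZero q
 vQ : ∀{y}n -> 0' =< y -> y =< 1' -> 1' =< ι n * y ->(1' - y)^ n =< ½
 vQ{y}n hT kF Dk = bZ(1' + 1')(da(1' + 1'))(begin(1' + 1')*(1' - y)^ n ≤⟨ aX _(aQ n(e7 kF))(af(bA 1' Dk)(lu y n hT))⟩(1' + y)^ n *(1' - y)^ n ≡⟨ aI(b5(1' + y)(1' - y)n)⟩((1' + y)*(1' - y))^ n ≤⟨ lZ n(a7(0≤+ ca hT)(e7 kF))(bK(y * y)(jT y)(a0 y))⟩ 1' ≡⟨⟩(1' + 1')* ½ ∎)where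
  open RQ
  a0 : ∀ y -> 1' ==(1' + y)*(1' - y)+ y * y
  a0 = ap ar
 -- The `n` factors are cut into `m` blocks of length `q = n / m`. From `n ≤ 2 m q` and `2 m ≤ n y`
 -- one gets `q y ≥ 1`, so each block contributes at most one half.
 qQ : ∀{y}n m -> 0' =< y -> y =< 1' -> ι(2 *' m)=< ι n * y ->(1' - y)^ n =< ½ ^ m
 qQ{y}n zero hT kF le = lZ n(e7 kF)(bK y hT(a0 y))where
  a0 : ∀ y -> 1' ==(1' - y)+ y
  a0 = ap ar
 qQ{y}n m@(suc G9)hT kF le = begin(1' - y)^ n ≤⟨ f8(e7 kF)(bK y hT(a0 y))zm ⟩(1' - y)^(m *' q)≡⟨ Cp(1' - y)m q ⟩((1' - y)^ q)^ m ≤⟨ j0 m(aQ q(e7 kF))(vQ q hT kF zn)⟩ ½ ^ m ∎ where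
  open RQ
  a0 : ∀ y -> 1' ==(1' - y)+ y
  a0 = ap ar
  q = n /ₙ m
  Bt : n == n %ₙ m +' q *' m
  Bt = gS n m
  zm : m *' q <= n
  zm = aa(ae(ck m q))(aa(bg(q *' m)(n %ₙ m))(ae(aI Bt)))
  zo : 2 *' m <= n
  zo = bS(af le(af(aO(ι n)(aY n)kF)(ad(aF(ι n)))))
  sk : 1 <= q
  sk with q | Bt
  ... | zero | eq = aA(aV refl(gQ(aL(_<' m)(aI(ag eq(aW _)))(Ck n m))(aa(a3 m(m +' 0))zo)))
  ... | suc _ | _ = bl bI
  xU : n <= 2 *' m *' q
  xU = aa(ae Bt)(aa(aK(q *' m)(aa(bW(Ck n m))(aL(_<= q *' m)(bp m)(aT m sk))))(ae(ag(aS _+'_(ck q m)(ck q m))(ag(au(m *' q +'_)(aI(aW _)))(aI(ew 2 m q))))))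
  zn : 1' =< ι q * y
  zn = bZ(ι(2 *' m))(cO _)(begin ι(2 *' m)* 1' ≡⟨ aF _ ⟩ ι(2 *' m)≤⟨ le ⟩ ι n * y ≤⟨ aX y hT(bw xU)⟩ ι(2 *' m *' q)* y ≡⟨ au(_* y)(cW(2 *' m)q)⟩ ι(2 *' m)* ι q * y ≡⟨ hp(ι(2 *' m))(ι q)y ⟩ ι(2 *' m)*(ι q * y)∎)
 iB : ∀ n -> suc n <= 2 ^' n
 iB zero = bl bI
 iB(suc n)= fI(aa(bl bI)(iB n))(aa(iB n)(a3 _ 0))
 b6 : ∀ m n o ->(m *' n)^' o == m ^' o *' n ^' o
 b6 m n zero = refl
 b6 m n(suc o)= ag(au(m *' n *'_)(b6 m n o))(ℕₚ.[m*n]*[o*p]≡[m*o]*[n*p] m n(m ^' o)(n ^' o))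
 -- With `u` the quotient of `z` by `c`, `z + 1 ≤ c (u + 1) ≤ c 2^u`; raising to the power `c` gives
 -- the constant `c ^ c`, because `u c ≤ z`.
 l0 : ∀ c -> ∃ \ K -> 1 <= K ×(∀ z -> suc z ^' c <= K *' 2 ^' z)
 l0 zero = 1 , bl bI , \ z -> aa(bz 2 z)(a3 _ 0)
 l0 c@(suc aN)= c ^' c , bz c c , \ z -> let u = z /ₙ c in begin suc z ^' c ≤⟨ b7 c(zp z)⟩(c *' 2 ^' u)^' c ≡⟨ b6 c(2 ^' u)c ⟩ c ^' c *'(2 ^' u)^' c ≡⟨ au(c ^' c *'_)(cz 2 u c)⟩ c ^' c *' 2 ^'(u *' c)≤⟨ az(c ^' c)(bX 2(aa(bg _(z %ₙ c))(ae(aI(gS z c)))))⟩ c ^' c *' 2 ^' z ∎ where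
  open ℕₚ.≤-Reasoning
  zp : ∀ z -> suc z <= c *' 2 ^'(z /ₙ c)
  zp z = begin suc z ≡⟨ au suc(gS z c)⟩ suc(z %ₙ c)+'(z /ₙ c)*' c ≤⟨ aK _(Ck z c)⟩ suc(z /ₙ c)*' c ≡⟨ ck(suc(z /ₙ c))c ⟩ c *' suc(z /ₙ c)≤⟨ az c(iB(z /ₙ c))⟩ c *' 2 ^'(z /ₙ c)∎
 j1 : ½ =< 1'
 j1 = bK ½(wX ½)refl
 eX : 0' =< ½
 eX = wX ½
 l1 : ι 2 == 1' + 1'
 l1 = ag(cV 1)(au(1' +_)jZ)
 ub : 1' - ½ == ½
 ub = refl
 vR :(1' + 1')* ½ == 1'
 vR = refl

-- Finite probability spaces, expectation, and sums over lists.

module P2 where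
 open M6 using (zero;suc)
 open M7 using ([];_∷_)
 open M0 using (ℕ;zero;suc)
 open M1 using (∃)
 open M2 hiding (_÷_;∣_∣)
 open M3
 open M8 using ([];_∷_)
 open M4
 open P1
 ao : bH -> ℚ
 ao true = 1'
 ao false = 0'
 a8 : ∀ b -> 0' =< ao b
 a8 true = ca
 a8 false = bR
 hU : ∀ b -> ao b =< 1'
 hU true = bR
 hU false = ca
 cX : ∀ a b -> ao(a ∧ b)== ao a * ao b
 cX true b = aI(aH(ao b))
 cX false b = aI(bY(ao b))
 dg : ∀{a b}->(T a -> T b)-> ao a =< ao b
 dg{true}{true}f = bR
 dg{true}{false}f = aA(f tt)
 dg{false}{b}f = a8 b
 pI : ∀{a}-> T a -> ao a == 1'
 pI{true}_ = refl
 -- A finite probability space as a tree of biased coins, so that every law of expectation is an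
 -- induction on the tree. The weight `p` belongs to the second subtree.
 data dx (A : Set) : Set where
  i8 : A -> dx A
  wY :(p : ℚ)-> 0' =< p -> p =< 1' -> dx A -> dx A -> dx A
 private variable
  A B : Set
 aB : dx A ->(A -> ℚ)-> ℚ
 aB(i8 a)f = f a
 aB(wY p _ _ d e)f =(1' - p)* aB d f + p * aB e f
 k6 :(A -> B)-> dx A -> dx B
 k6 h(i8 a)= i8(h a)
 k6 h(wY p l u d e)= wY p l u(k6 h d)(k6 h e)
 j2 : ∀{p a b c d}-> 0' =< p -> p =< 1' -> a =< c -> b =< d ->(1' - p)* a + p * b =<(1' - p)* c + p * d
 j2{p}l u ac bd = cQ(aO(1' - p)(e7 u)ac)(aO p l bd)
 hV :(h : A -> B)(d : dx A)(f : B -> ℚ)-> aB(k6 h d)f == aB d(f ∘ h)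
 hV h(i8 a)f = refl
 hV h(wY p l u d e)f = aS(\ x y ->(1' - p)* x + p * y)(hV h d f)(hV h e f)
 bf :(d : dx A){f g : A -> ℚ}->(∀ a -> f a == g a)-> aB d f == aB d g
 bf(i8 a)eq = eq a
 bf(wY p l u d e)eq = aS(\ x y ->(1' - p)* x + p * y)(bf d eq)(bf e eq)
 bm :(d : dx A){f g : A -> ℚ}->(∀ a -> f a =< g a)-> aB d f =< aB d g
 bm(i8 a)le = le a
 bm(wY p l u d e)le = j2 l u(bm d le)(bm e le)
 eY :(d : dx A)(f g : A -> ℚ)-> aB d(\ a -> f a + g a)== aB d f + aB d g
 eY(i8 a)f g = refl
 eY(wY p l u d e)f g = ag(aS(\ x y ->(1' - p)* x + p * y)(eY d f g)(eY e f g))(a0 p(aB d f)(aB d g)(aB e f)(aB e g))where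
  a0 : ∀ p a b c d ->(1' - p)*(a + b)+ p *(c + d)==(1' - p)* a + p * c +((1' - p)* b + p * d)
  a0 = ap ar
 c7 :(d : dx A)(c : ℚ)(f : A -> ℚ)-> aB d(\ a -> c * f a)== c * aB d f
 c7(i8 a)c f = refl
 c7(wY p l u d e)c f = ag(aS(\ x y ->(1' - p)* x + p * y)(c7 d c f)(c7 e c f))(a0 p c(aB d f)(aB e f))where
  a0 : ∀ p c x y ->(1' - p)*(c * x)+ p *(c * y)== c *((1' - p)* x + p * y)
  a0 = ap ar
 j3 :(d : dx A)(f : A -> ℚ)(c : ℚ)-> aB d(\ a -> f a * c)== aB d f * c
 j3 d f c = ag(bf d(\ a -> e9(f a)c))(ag(c7 d c f)(e9 c _))
 bk :(d : dx A)(c : ℚ)-> aB d(\ _ -> c)== c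
 bk(i8 a)c = refl
 bk(wY p l u d e)c = ag(aS(\ x y ->(1' - p)* x + p * y)(bk d c)(bk e c))(a0 p c)where
  a0 : ∀ p c ->(1' - p)* c + p * c == c
  a0 = ap ar
 eP :(d : dx A){f : A -> ℚ}->(∀ a -> 0' =< f a)-> 0' =< aB d f
 eP d{f}le = aL(_=< aB d f)(bk d 0')(bm d le)
 qR :(d : dx A)(f g : A -> ℚ)-> aB d(\ a -> f a - g a)== aB d f - aB d g
 qR d f g = ag(eY d f(\ a -> - g a))(au(aB d f +_)(ag(bf d(\ a -> a0(g a)))(ag(c7 d(- 1')g)(aI(a0(aB d g))))))where
  a0 : ∀ x -> - x ==(- 1')* x
  a0 = ap ar
 gB :(d : dx A)(e : dx B)(f : A -> B -> ℚ)-> aB d(\ a -> aB e(f a))== aB e(\ b -> aB d(\ a -> f a b))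
 gB(i8 a)e f = refl
 gB(wY p l u d hP)e f = ag(aS(\ x y ->(1' - p)* x + p * y)(gB d e f)(gB hP e f))(aI(ag(eY e _ _)(aS _+_(c7 e(1' - p)_)(c7 e p _))))
 i9 :(d : dx A)(f : A -> ℚ)(c : ℚ)-> c =< aB d f -> ∃ \ a -> c =< f a
 i9(i8 a)f c le = a , le
 i9(wY p l u d e)f c le with c ≤? aB d f | c ≤? aB e f
 ... | yes q | _ = i9 d f c q
 ... | no _ | yes q = i9 e f c q
 ... | no F4 | no F5 = aA(za refl(D3 le lt))where
  m = aB d f ⊔ aB e f
  lt :(1' - p)* aB d f + p * aB e f < c
  lt = D3(j2 l u(p≤p⊔q(aB d f)(aB e f))(p≤q⊔p(aB d f)(aB e f)))(aL(_< c)(aI(a0 p m))GV)where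
   a0 : ∀ p c ->(1' - p)* c + p * c == c
   a0 = ap ar
   GV : m < c
   GV with ⊔-sel(aB d f)(aB e f)
   ... | aD eq = aL(_< c)(aI eq)(vO F4)
   ... | aG eq = aL(_< c)(aI eq)(vO F5)
 w3 :(d : dx A)(f : A -> ℚ)(c : ℚ)->(∀ a -> 0' =< f a)->(b : A -> bH)->(∀ a -> T(b a)-> c =< f a)-> c * aB d(ao ∘ b)=< aB d f
 w3 d f c oH b le = aL(_=< aB d f)(c7 d c _)(bm d pt)where
  pt : ∀ a -> c * ao(b a)=< f a
  pt a with b a | le a
  ... | true | g = aL(_=< f a)(aI(aF c))(g tt)
  ... | false | _ = aL(_=< f a)(aI(fJ c))(oH a)
 -- Jensen's inequality for powers, without calculus: by `r7` the power lies above its tangent line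
 -- at the mean `x`, and the linear part of that line averages to zero.
 kG :(d : dx A)(f : A -> ℚ)->(∀ a -> 0' =< f a)-> ∀ m -> aB d f ^ m =< aB d(\ a -> f a ^ m)
 kG d f oH zero = ad(aI(bk d 1'))
 kG d f oH(suc m)= begin x * x ^ m ≡⟨ ci x(x ^ m)m ⟩ x ^ m * x ≤⟨ step m ⟩ aB d(\ a -> f a ^ suc m)∎ where
  open RQ
  x = aB d f
  zq = eP d oH
  ci : ∀ a b(_ : ℕ)-> a * b == b * a
  ci a b _ = e9 a b
  r7 : ∀ m y -> 0' =< y -> x ^ m * x + ι(suc m)*(x ^ m *(y - x))=< y ^ suc m
  r7 zero y hT = ad(ag(au(\ i -> 1' * x + i *(1' *(y - x)))jZ)(a0 x y))where
   a0 : ∀ x y -> 1' * x + 1' *(1' *(y - x))== y * 1'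
   a0 = ap ar
  r7(suc m)y hT = af(bK(ι(suc m)* x ^ m *((y - x)*(y - x)))(a7(a7(aY(suc m))(aQ m zq))(jT(y - x)))(ag(a0 x y(x ^ m)(ι(suc m)))(au(\ i -> x * x ^ m * x + i *(x * x ^ m *(y - x))+ ι(suc m)* x ^ m *((y - x)*(y - x)))(aI(cV(suc m))))))(aO y hT(r7 m y hT))where
   a0 : ∀ x y z i -> y *(z * x + i *(z *(y - x)))== x * z * x +(1' + i)*(x * z *(y - x))+ i * z *((y - x)*(y - x))
   a0 = ap ar
  step : ∀ m -> x ^ m * x =< aB d(\ a -> f a ^ suc m)
  step m = af(ad(aI eq))(bm d(\ a -> r7 m(f a)(oH a)))where
   a0 : ∀ z i x -> z * x + i *(z *(x - x))== z * x
   a0 = ap ar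
   eq : aB d(\ a -> x ^ m * x + ι(suc m)*(x ^ m *(f a - x)))== x ^ m * x
   eq = ag(eY d(\ _ -> x ^ m * x)(\ a -> ι(suc m)*(x ^ m *(f a - x))))(ag(aS _+_(bk d(x ^ m * x))(ag(c7 d(ι(suc m))(\ a -> x ^ m *(f a - x)))(au(ι(suc m)*_)(ag(c7 d(x ^ m)(\ a -> f a - x))(au(x ^ m *_)(ag(qR d f(\ _ -> x))(au(\ w -> x - w)(bk d x))))))))(a0(x ^ m)(ι(suc m))x))
 aM : List A ->(A -> ℚ)-> ℚ
 aM [] f = 0'
 aM(x ∷ xs)f = f x + aM xs f
 bF :(xs : List A){f g : A -> ℚ}->(∀ a -> f a == g a)-> aM xs f == aM xs g
 bF [] eq = refl
 bF(x ∷ xs)eq = aS _+_(eq x)(bF xs eq)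
 cj :(xs : List A){f g : A -> ℚ}->(∀ a -> f a =< g a)-> aM xs f =< aM xs g
 cj [] le = bR
 cj(x ∷ xs)le = cQ(le x)(cj xs le)
 cZ :(xs : List A){f : A -> ℚ}->(∀ a -> 0' =< f a)-> 0' =< aM xs f
 cZ [] le = bR
 cZ(x ∷ xs)le = 0≤+(le x)(cZ xs le)
 l2 :(xs : List A)(f g : A -> ℚ)-> aM xs(\ a -> f a + g a)== aM xs f + aM xs g
 l2 [] f g = refl
 l2(x ∷ xs)f g = ag(au(f x + g x +_)(l2 xs f g))(a0(f x)(g x)(aM xs f)(aM xs g))where
  a0 : ∀ a b c d -> a + b +(c + d)== a + c +(b + d)
  a0 = ap ar
 fy :(xs : List A)(c : ℚ)(f : A -> ℚ)-> aM xs(\ a -> c * f a)== c * aM xs f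
 fy [] c f = aI(fJ c)
 fy(x ∷ xs)c f = ag(au(c * f x +_)(fy xs c f))(aI(tZ c(f x)_))
 bL :(xs : List A)(c : ℚ)-> aM xs(\ _ -> c)== ι(ah xs)* c
 bL [] c = aI(ag(au(_* c)iA)(bY c))
 bL(x ∷ xs)c = ag(au(c +_)(bL xs c))(ag(a0 c(ι(ah xs)))(au(_* c)(aI(cV(ah xs)))))where
  a0 : ∀ c i -> c + i * c ==(1' + i)* c
  a0 = ap ar
 oa :(xs ys : List A)(f : A -> ℚ)-> aM(xs ++ ys)f == aM xs f + aM ys f
 oa [] ys f = aI(bu _)
 oa(x ∷ xs)ys f = ag(au(f x +_)(oa xs ys f))(aI(+-assoc(f x)_ _))
 fM :(h : A -> B)(xs : List A)(f : B -> ℚ)-> aM(fd h xs)f == aM xs(f ∘ h)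
 fM h [] f = refl
 fM h(x ∷ xs)f = au(f(h x)+_)(fM h xs f)
 dB :(h : A -> List B)(xs : List A)(f : B -> ℚ)-> aM(ce h xs)f == aM xs(\ a -> aM(h a)f)
 dB h [] f = refl
 dB h(x ∷ xs)f = ag(oa(h x)_ f)(au(aM(h x)f +_)(dB h xs f))
 gC :(xs : List A)(d : dx B)(f : A -> B -> ℚ)-> aB d(\ b -> aM xs(\ a -> f a b))== aM xs(\ a -> aB d(f a))
 gC [] d f = bk d 0'
 gC(x ∷ xs)d f = ag(eY d _ _)(au(aB d(f x)+_)(gC xs d f))
 iC :(xs : List A)(ys : List B)(f : A -> B -> ℚ)-> aM xs(\ a -> aM ys(f a))== aM ys(\ b -> aM xs(\ a -> f a b))
 iC [] ys f = aI(ag(bL ys 0')(fJ(ι(ah ys))))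
 iC(x ∷ xs)ys f = ag(au(aM ys(f x)+_)(iC xs ys f))(aI(l2 ys _ _))
 aw :(A -> bH)-> List A -> List A
 aw b [] = []
 aw b(x ∷ xs)= if b x then x ∷ aw b xs else aw b xs
 c0 :(b : A -> bH)(xs : List A)(f : A -> ℚ)-> aM(aw b xs)f == aM xs(\ a -> ao(b a)* f a)
 c0 b [] f = refl
 c0 b(x ∷ xs)f with b x
 ... | true = aS _+_(aI(aH(f x)))(c0 b xs f)
 ... | false = ag(c0 b xs f)(aI(ag(au(_+ _)(bY(f x)))(bu _)))
 iD :(A -> bH)-> List A -> bH
 iD b [] = false
 iD b(x ∷ xs)= b x ∨ iD b xs
 lv : ∀ a b -> ao(a ∨ b)=< ao a + ao b
 lv true b = bK(ao b)(a8 b)refl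
 lv false b = ad(aI(bu(ao b)))
 hG :(b : A -> bH)(xs : List A)-> ao(iD b xs)=< aM xs(ao ∘ b)
 hG b [] = bR
 hG b(x ∷ xs)= af(lv(b x)_)(bA(ao(b x))(hG b xs))
 m4 :(d : dx B)(xs : List A)(b : A -> B -> bH)-> aB d(\ s -> ao(iD(\ x -> b x s)xs))=< aM xs(\ x -> aB d(ao ∘ b x))
 m4 d xs b = af(bm d(\ s -> hG(\ x -> b x s)xs))(ad(gC xs d(\ x s -> ao(b x s))))
 d0 :(b : B -> bH)(h : A -> B)(xs : List A)-> ah(aw b(fd h xs))== ah(aw(b ∘ h)xs)
 d0 b h [] = refl
 d0 b h(x ∷ xs)with b(h x)
 ... | true = au suc(d0 b h xs)
 ... | false = d0 b h xs

-- Random subsets: correlation, sprinkling, and a Janson-type lower tail.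

module P3 where
 open M6 using (zero;suc)
 open M9 using (∣_∣)
 open M7 using ([];_∷_)
 open M10 using ([];_∷_)
 open M0 using (ℕ;zero;suc)
 open M1 using (_×_)
 open M2 hiding (_÷_;∣_∣)
 open M3
 open M8 using ([];_∷_)
 open M4
 open P1
 open P2
 private variable
  N : ℕ
 cI :(p : ℚ)-> 0' =< p -> p =< 1' -> ∀ N -> dx(av N)
 cI p l u zero = i8 []
 cI p l u(suc N)= wY p l u(k6(false ∷_)(cI p l u N))(k6(true ∷_)(cI p l u N))
 _⊑_ : av N -> av N -> bH
 [] ⊑ [] = true
 (true ∷ F)⊑(b ∷ S)= b ∧ F ⊑ S
 (false ∷ F)⊑(b ∷ S)= F ⊑ S
 dC : av N -> av N -> bH
 dC [] [] = false
 dC(a ∷ F)(b ∷ S)=(a ∧ b)∨ dC F S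
 pa sm :(av N -> ℚ)-> Set
 pa g = ∀ S cu -> T(S ⊑ cu)-> g cu =< g S
 sm g = ∀ S cu -> T(S ⊑ cu)-> g S =< g cu
 hW :(S : av N)-> T(S ⊑ S)
 hW [] = tt
 hW(true ∷ S)= hW S
 hW(false ∷ S)= hW S
 eo :(F G S : av N)-> T(F ⊑ G)-> T(G ⊑ S)-> T(F ⊑ S)
 eo [] [] [] _ _ = tt
 eo(true ∷ F)(true ∷ G)(true ∷ S)p q = eo F G S p q
 eo(false ∷ F)(true ∷ G)(true ∷ S)p q = eo F G S p q
 eo(false ∷ F)(false ∷ G)(b ∷ S)p q = eo F G S p q
 gD :(F G : av N)-> T(F ⊑(F ∪ G))
 gD [] [] = tt
 gD(true ∷ F)(b ∷ G)= gD F G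
 gD(false ∷ F)(b ∷ G)= gD F G
 ep :(F G : av N)-> T(G ⊑(F ∪ G))
 ep [] [] = tt
 ep(true ∷ F)(true ∷ G)= ep F G
 ep(true ∷ F)(false ∷ G)= ep F G
 ep(false ∷ F)(true ∷ G)= ep F G
 ep(false ∷ F)(false ∷ G)= ep F G
 cn :(F G S : av N)->(F ∪ G)⊑ S ==(F ⊑ S)∧(G ⊑ S)
 cn [] [] [] = refl
 cn(true ∷ F)(true ∷ G)(true ∷ S)= cn F G S
 cn(true ∷ F)(true ∷ G)(false ∷ S)= refl
 cn(true ∷ F)(false ∷ G)(true ∷ S)= cn F G S
 cn(true ∷ F)(false ∷ G)(false ∷ S)= refl
 cn(false ∷ F)(true ∷ G)(true ∷ S)= cn F G S
 cn(false ∷ F)(true ∷ G)(false ∷ S)with F ⊑ S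
 ... | true = refl
 ... | false = refl
 cn(false ∷ F)(false ∷ G)(b ∷ S)= cn F G S
 dh :(F G S : av N)-> dC F G == false -> G ⊑(S ∪ F)== G ⊑ S
 dh [] [] [] eq = refl
 dh(false ∷ F)(true ∷ G)(true ∷ S)eq = dh F G S eq
 dh(false ∷ F)(true ∷ G)(false ∷ S)eq = refl
 dh(a ∷ F)(false ∷ G)(s ∷ S)eq with a
 ... | true = dh F G S eq
 ... | false = dh F G S eq
 module _ {p : ℚ} (l : 0' =< p) (u : p =< 1') where
  private
   dq :(av N -> ℚ)-> ℚ
   dq{N}= aB(cI p l u N)
  di : ∀{N}(f : av(suc N)-> ℚ)-> dq f ==(1' - p)* dq(f ∘(false ∷_))+ p * dq(f ∘(true ∷_))
  di{N}f = aS(\ x y ->(1' - p)* x + p * y)(hV _(cI p l u N)f)(hV _(cI p l u N)f)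
  -- Independence of disjoint sets of coordinates: the hypothesis says that `g` ignores the
  -- coordinates in `F`.
  cH :(F : av N)(g : av N -> ℚ)->(∀ S -> g(S ∪ F)== g S)-> dq(\ S -> ao(F ⊑ S)* g S)== p ^ ∣ F ∣ * dq g
  cH [] g Dl = refl
  cH(false ∷ F)g Dl = ag(di(\ S -> ao((false ∷ F)⊑ S)* g S))(ag(aS(\ x y ->(1' - p)* x + p * y)(cH F(g ∘(false ∷_))(\ S -> Dl(false ∷ S)))(cH F(g ∘(true ∷_))(\ S -> Dl(true ∷ S))))(ag(a0 p(p ^ ∣ F ∣)_ _)(au(p ^ ∣ F ∣ *_)(aI(di g)))))where
   a0 : ∀ p q x y ->(1' - p)*(q * x)+ p *(q * y)== q *((1' - p)* x + p * y)
   a0 = ap ar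
  cH{suc N}(true ∷ F)g Dl = ag(di(\ S -> ao((true ∷ F)⊑ S)* g S))(ag(aS(\ x y ->(1' - p)* x + p * y)(ag(bf(cI p l u N)(\ S -> bY(g(false ∷ S))))(bk(cI p l u N)0'))(cH F(g ∘(true ∷_))(\ S -> Dl(true ∷ S))))(ag(a0 p(p ^ ∣ F ∣)(dq(g ∘(true ∷_))))(au(p * p ^ ∣ F ∣ *_)(aI(ag(di g)(ag(au(\ z ->(1' - p)* z + p * dq(g ∘(true ∷_)))(bf(cI p l u N)(\ S -> ag(aI(Dl(false ∷ S)))(Dl(true ∷ S)))))(aZ p(dq(g ∘(true ∷_))))))))))where
   a0 : ∀ p q x ->(1' - p)* 0' + p *(q * x)== p * q * x
   a0 = ap ar
   aZ : ∀ p x ->(1' - p)* x + p * x == x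
   aZ = ap ar
  iV :(F : av N)-> dq(\ S -> ao(F ⊑ S))== p ^ ∣ F ∣
  iV{N}F = ag(bf(cI p l u N)(\ S -> aI(aF(ao(F ⊑ S)))))(ag(cH F(\ _ -> 1')(\ _ -> refl))(ag(au(p ^ ∣ F ∣ *_)(bk(cI p l u N)1'))(aF _)))
  -- Harris's inequality for an increasing event and a decreasing function. At a coordinate of `F`
  -- only the branch containing it survives, and there `g` is at most its average over both
  -- branches.
  b8 :(F : av N)(g : av N -> ℚ)-> pa g -> dq(\ S -> ao(F ⊑ S)* g S)=< p ^ ∣ F ∣ * dq g
  b8 [] g D8 = bR
  b8(false ∷ F)g D8 = begin dq(\ S -> ao((false ∷ F)⊑ S)* g S)≡⟨ di(\ S -> ao((false ∷ F)⊑ S)* g S)⟩(1' - p)* _ + p * _ ≤⟨ j2 l u(b8 F(g ∘(false ∷_))(\ S cu -> D8(false ∷ S)(false ∷ cu)))(b8 F(g ∘(true ∷_))(\ S cu -> D8(true ∷ S)(true ∷ cu)))⟩(1' - p)*(p ^ ∣ F ∣ * dq(g ∘(false ∷_)))+ p *(p ^ ∣ F ∣ * dq(g ∘(true ∷_)))≡⟨ a0 p(p ^ ∣ F ∣)_ _ ⟩ p ^ ∣ F ∣ *((1' - p)* dq(g ∘(false ∷_))+ p * dq(g ∘(true ∷_)))≡⟨ au(p ^ ∣ F ∣ *_)(aI(di g))⟩ p ^ ∣ F ∣ * dq g ∎ where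
   open RQ
   a0 : ∀ p q x y ->(1' - p)*(q * x)+ p *(q * y)== q *((1' - p)* x + p * y)
   a0 = ap ar
  b8{suc N}(true ∷ F)g D8 = begin dq(\ S -> ao((true ∷ F)⊑ S)* g S)≡⟨ di(\ S -> ao((true ∷ F)⊑ S)* g S)⟩(1' - p)* _ + p * _ ≤⟨ j2 l u(ad(ag(bf(cI p l u N)(\ S -> bY(g(false ∷ S))))(bk(cI p l u N)0')))(b8 F zr(\ S cu -> D8(true ∷ S)(true ∷ cu)))⟩(1' - p)* 0' + p *(p ^ ∣ F ∣ * dq zr)≡⟨ a0 p(p ^ ∣ F ∣)(dq zr)⟩ p * p ^ ∣ F ∣ * dq zr ≤⟨ aO _(aQ(suc ∣ F ∣)l)(af(ad(aI(aZ p(dq zr))))(af(j2 l u(bm(cI p l u N)(\ S -> D8(false ∷ S)(true ∷ S)(hW S)))bR)(ad(aI(di g)))))⟩ p * p ^ ∣ F ∣ * dq g ∎ where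
   open RQ
   zr = g ∘(true ∷_)
   a0 : ∀ p q x ->(1' - p)* 0' + p *(q * x)== p * q * x
   a0 = ap ar
   aZ : ∀ p x ->(1' - p)* x + p * x == x
   aZ = ap ar
 jU : ∀{p gZ}l u k7 j4 -> p =< gZ ->(f : av N -> ℚ)-> sm f -> aB(cI p l u N)f =< aB(cI gZ k7 j4 N)f
 jU{zero}l u k7 j4 le f FM = bR
 jU{suc N}{p}{gZ}l u k7 j4 le f FM = begin aB(cI p l u(suc N))f ≡⟨ di l u f ⟩(1' - p)* aB d pb + p * aB d l3 ≤⟨ j2 l u(jU l u k7 j4 le pb(\ S cu -> FM(false ∷ S)(false ∷ cu)))(jU l u k7 j4 le l3(\ S cu -> FM(true ∷ S)(true ∷ cu)))⟩(1' - p)* aB hP pb + p * aB hP l3 ≤⟨ bK((gZ - p)*(aB hP l3 - aB hP pb))(a7(e7 le)(e7(bm hP(\ S -> FM(false ∷ S)(true ∷ S)(hW S)))))(a0 p gZ(aB hP pb)(aB hP l3))⟩(1' - gZ)* aB hP pb + gZ * aB hP l3 ≡⟨ aI(di k7 j4 f)⟩ aB(cI gZ k7 j4(suc N))f ∎ where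
  open RQ
  d = cI p l u N
  hP = cI gZ k7 j4 N
  pb = f ∘(false ∷_)
  l3 = f ∘(true ∷_)
  a0 : ∀ p q a b ->(1' - q)* a + q * b ==(1' - p)* a + p * b +(q - p)*(b - a)
  a0 = ap ar
 -- Sprinkling: a coordinate is missed by both sets with probability `(1 - p)(1 - q)`, independently
 -- of all others.
 m5 : ∀{p q r}l u k7 j4 vS vT -> r == p + q - p * q ->(f : av N -> ℚ)-> aB(cI p l u N)(\ S -> aB(cI q k7 j4 N)(\ cu -> f(S ∪ cu)))== aB(cI r vS vT N)f
 m5{zero}l u k7 j4 vS vT eq f = refl
 m5{suc N}{p}{q}{r}l u k7 j4 vS vT eq f = begin aB(cI p l u(suc N))(\ S -> aB(cI q k7 j4(suc N))(\ cu -> f(S ∪ cu)))≡⟨ di l u(\ S -> aB(cI q k7 j4(suc N))(\ cu -> f(S ∪ cu)))⟩(1' - p)* aB d(\ S -> aB(cI q k7 j4(suc N))(\ cu -> f((false ∷ S)∪ cu)))+ p * aB d(\ S -> aB(cI q k7 j4(suc N))(\ cu -> f((true ∷ S)∪ cu)))≡⟨ aS(\ x y ->(1' - p)* x + p * y)(ag(bf d(\ S -> di k7 j4(\ cu -> f((false ∷ S)∪ cu))))(w4 pb l3))(ag(bf d(\ S -> di k7 j4(\ cu -> f((true ∷ S)∪ cu))))(w4 l3 l3))⟩(1' - p)*((1' - q)* E pb + q * E l3)+ p *((1' - q)* E l3 + q * E l3)≡⟨ a0 p q(E pb)(E l3)⟩(1' -(p + q - p * q))* E pb +(p + q - p * q)*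 E l3 ≡⟨ aS(\ x y ->(1' -(p + q - p * q))* x +(p + q - p * q)* y)(m5 l u k7 j4 vS vT eq pb)(m5 l u k7 j4 vS vT eq l3)⟩(1' -(p + q - p * q))* aB yS pb +(p + q - p * q)* aB yS l3 ≡⟨ au(\ r ->(1' - r)* aB yS pb + r * aB yS l3)(aI eq)⟩(1' - r)* aB yS pb + r * aB yS l3 ≡⟨ aI(di vS vT f)⟩ aB(cI r vS vT(suc N))f ∎ where
  open ≡-Reasoning
  d = cI p l u N
  hP = cI q k7 j4 N
  yS = cI r vS vT N
  pb = f ∘(false ∷_)
  l3 = f ∘(true ∷_)
  E :(av N -> ℚ)-> ℚ
  E g = aB d(\ S -> aB hP(\ cu -> g(S ∪ cu)))
  w4 : ∀ g h -> aB d(\ S ->(1' - q)* aB hP(\ cu -> g(S ∪ cu))+ q * aB hP(\ cu -> h(S ∪ cu)))==(1' - q)* E g + q * E h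
  w4 g h = ag(eY d _ _)(aS _+_(c7 d(1' - q)_)(c7 d q _))
  a0 : ∀ p q a b ->(1' - p)*((1' - q)* a + q * b)+ p *((1' - q)* b + q * b)==(1' -(p + q - p * q))* a +(p + q - p * q)* b
  a0 = ap ar
 -- `Q a2 S` equals `(1 - t) ^ X` with `X` the number of members of `a2` inside `S` (see `pJ`). A
 -- bound on its mean controls the probability that `X` is small, which is Janson's inequality for
 -- the lower tail.
 module Dm {p : ℚ} (l : 0' =< p) (u : p =< 1') {t : ℚ} (kH : 0' =< t) (xV : t =< 1') where
  Q : List(av N)-> av N -> ℚ
  Q [] S = 1'
  Q(F ∷ a2)S =(1' - t * ao(F ⊑ S))* Q a2 S
  private
   ga : ∀ b -> 0' =< 1' - t * ao b
   ga true = e7(aL(_=< 1')(aI(aF t))xV)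
   ga false = e7(aL(_=< 1')(aI(fJ t))ca)
   sn : ∀ b -> 1' - t * ao b =< 1'
   sn b = bK(t * ao b)(a7 kH(a8 b))(a0 t(ao b))where
    a0 : ∀ t x -> 1' ==(1' - t * x)+ t * x
    a0 = ap ar
  ja :(a2 : List(av N))(S : av N)-> 0' =< Q a2 S
  ja [] S = ca
  ja(F ∷ a2)S = a7(ga(F ⊑ S))(ja a2 S)
  jz :(a2 : List(av N))-> pa(Q a2)
  jz [] S cu _ = bR
  jz(F ∷ a2)S cu le = dS(ga(F ⊑ cu))(bA 1'(c4(aO t kH(dg{F ⊑ S}{F ⊑ cu}(\ q -> eo F S cu q le)))))(ja a2 cu)(jz a2 S cu le)
  pJ :(a2 : List(av N))(S : av N)-> Q a2 S ==(1' - t)^ ah(aw(_⊑ S)a2)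
  pJ [] S = refl
  pJ(F ∷ a2)S with F ⊑ S
  ... | true = aS _*_(au(\ z -> 1' - z)(aF t))(pJ a2 S)
  ... | false = ag(aS _*_(au(\ z -> 1' - z)(fJ t))(pJ a2 S))(aH _)
  private
   G : av N -> List(av N)-> List(av N)
   G F = aw(\ ct -> ha(dC F ct))
   pK :(F : av N)(a2 : List(av N))(S : av N)-> Q(G F a2)(S ∪ F)== Q(G F a2)S
   pK F [] S = refl
   pK F(ct ∷ a2)S with dC F ct in eq
   ... | true = pK F a2 S
   ... | false = aS(\ x y ->(1' - t * ao x)* y)(dh F ct S eq)(pK F a2 S)
   Y : av N -> List(av N)-> av N -> ℚ
   Y F a2 S = aM a2(\ ct -> ao(dC F ct)* ao(ct ⊑ S))
   vU :(F : av N)(a2 : List(av N))(S : av N)-> Q a2 S =< Q(G F a2)S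
   vU F [] S = bR
   vU F(ct ∷ a2)S with dC F ct
   ... | true = aL(_ =<_)(aH _)(dS(ga(ct ⊑ S))(sn(ct ⊑ S))(ja a2 S)(vU F a2 S))
   ... | false = aO _(ga(ct ⊑ S))(vU F a2 S)
   zt :(F : av N)(a2 : List(av N))(S : av N)-> Q(G F a2)S *(1' - t * Y F a2 S)=< Q a2 S
   zt F [] S = ad(a0 t)where
    a0 : ∀ t -> 1' *(1' - t * 0')== 1'
    a0 = ap ar
   zt F(ct ∷ a2)S with dC F ct
   ... | false = af(ad(a0 t x g y))(aO(1' - t * x)(ga(ct ⊑ S))(zt F a2 S))where
    x = ao(ct ⊑ S)
    g = Q(G F a2)S
    y = Y F a2 S
    a0 : ∀ t x g y ->(1' - t * x)* g *(1' - t *(0' * x + y))==(1' - t * x)*(g *(1' - t * y))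
    a0 = ap ar
   ... | true = af(bK(g *(t * t *(x * y)))(a7(ja(G F a2)S)(a7(a7 kH kH)(a7(a8(ct ⊑ S))(cZ a2(\ Er -> a7(a8(dC F Er))(a8(Er ⊑ S)))))))(a0 t x g y))(aO(1' - t * x)(ga(ct ⊑ S))(zt F a2 S))where
    x = ao(ct ⊑ S)
    g = Q(G F a2)S
    y = Y F a2 S
    a0 : ∀ t x g y ->(1' - t * x)*(g *(1' - t * y))== g *(1' - t *(1' * x + y))+ g *(t * t *(x * y))
    a0 = ap ar
  module _ {μ δ : ℚ} (zu : t * δ =< μ) where
   private
    -- Drop from the product the factors of the sets that meet `F`; the rest is independent of the
    -- event `F ⊑ S`. Putting the factors back costs at most `t` times the number of present sets
    -- meeting `F`, whose contribution Harris's inequality bounds by `δ`.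
    step :(F : av N)(a2 : List(av N))-> μ =< p ^ ∣ F ∣ -> aM a2(\ ct -> ao(dC F ct)* p ^ ∣ F ∪ ct ∣)=< δ -> aB(cI p l u N)(Q(F ∷ a2))=<(1' - t *(μ - t * δ))* aB(cI p l u N)(Q a2)
    step{N}F a2 zv zw = begin aB d(Q(F ∷ a2))≡⟨ bf d(\ S -> ci t(ao(F ⊑ S))(Q a2 S))⟩ aB d(\ S -> Q a2 S - t *(ao(F ⊑ S)* Q a2 S))≡⟨ qR d _ _ ⟩ aB d(Q a2)- aB d(\ S -> t *(ao(F ⊑ S)* Q a2 S))≡⟨ au(\ z -> aB d(Q a2)- z)(c7 d t(\ S -> ao(F ⊑ S)* Q a2 S))⟩ aB d(Q a2)- t * aB d(\ S -> ao(F ⊑ S)* Q a2 S)≤⟨ bA(aB d(Q a2))(c4(aO t kH ru))⟩ aB d(Q a2)- t *((μ - t * δ)* aB d(Q a2))≡⟨ aZ t(μ - t * δ)(aB d(Q a2))⟩(1' - t *(μ - t * δ))* aB d(Q a2)∎ where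
     open RQ
     d = cI p l u N
     g = G F a2
     ci : ∀ t x q ->(1' - t * x)* q == q - t *(x * q)
     ci = ap ar
     aZ : ∀ t c q -> q - t *(c * q)==(1' - t * c)* q
     aZ = ap ar
     d1 : ∀ t x q y -> x *(q *(1' - t * y))== x * q - t *(y *(x * q))
     d1 = ap ar
     Cq = eP d(ja g)
     cross : aB d(\ S -> Y F a2 S *(ao(F ⊑ S)* Q g S))=< δ * aB d(Q g)
     cross = begin aB d(\ S -> Y F a2 S *(ao(F ⊑ S)* Q g S))≡⟨ bf d(\ S -> ag(e9(Y F a2 S)_)(ag(aI(fy a2(ao(F ⊑ S)* Q g S)(\ ct -> ao(dC F ct)* ao(ct ⊑ S))))(bF a2(\ ct -> eq ct S))))⟩ aB d(\ S -> aM a2(\ ct -> ao(dC F ct)*(ao((F ∪ ct)⊑ S)* Q g S)))≡⟨ gC a2 d _ ⟩ aM a2(\ ct -> aB d(\ S -> ao(dC F ct)*(ao((F ∪ ct)⊑ S)* Q g S)))≤⟨ cj a2(\ ct -> af(ad(c7 d(ao(dC F ct))(\ S -> ao((F ∪ ct)⊑ S)* Q g S)))(af(aO(ao(dC F ct))(a8(dC F ct))(b8 l u(F ∪ ct)(Q g)(jz g)))(ad(zx(ao(dC F ct))(p ^ ∣ F ∪ ct ∣)(aB d(Q g))))))⟩ aM a2(\ ct -> aB d(Q g)*(ao(dC F ct)* p ^ ∣ F ∪ ct ∣))≡⟨ fy a2(aB d(Q g))(\ ct -> ao(dC F ct)* p ^ ∣ F ∪ ct ∣)⟩ aB d(Q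 g)* aM a2(\ ct -> ao(dC F ct)* p ^ ∣ F ∪ ct ∣)≤⟨ aO _ Cq zw ⟩ aB d(Q g)* δ ≡⟨ e9 _ δ ⟩ δ * aB d(Q g)∎ where
      m6 : ∀ x q m y -> x * q *(m * y)== m *(x * y * q)
      m6 = ap ar
      zx : ∀ m q e -> m *(q * e)== e *(m * q)
      zx = ap ar
      eq : ∀ ct S -> ao(F ⊑ S)* Q g S *(ao(dC F ct)* ao(ct ⊑ S))== ao(dC F ct)*(ao((F ∪ ct)⊑ S)* Q g S)
      eq ct S = ag(m6(ao(F ⊑ S))(Q g S)(ao(dC F ct))(ao(ct ⊑ S)))(au(\ z -> ao(dC F ct)*(z * Q g S))(ag(aI(cX(F ⊑ S)(ct ⊑ S)))(au ao(aI(cn F ct S)))))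
     ru :(μ - t * δ)* aB d(Q a2)=< aB d(\ S -> ao(F ⊑ S)* Q a2 S)
     ru = begin(μ - t * δ)* aB d(Q a2)≤⟨ aO _(e7 zu)(bm d(vU F a2))⟩(μ - t * δ)* aB d(Q g)≡⟨ zy μ t δ(aB d(Q g))⟩ μ * aB d(Q g)- t *(δ * aB d(Q g))≤⟨ cQ(af(aX _ Cq zv)(ad(aI(cH l u F(Q g)(pK F a2)))))(c4(aO t kH cross))⟩ aB d(\ S -> ao(F ⊑ S)* Q g S)- t * aB d(\ S -> Y F a2 S *(ao(F ⊑ S)* Q g S))≡⟨ au(\ z -> aB d(\ S -> ao(F ⊑ S)* Q g S)- z)(aI(c7 d t _))⟩ aB d(\ S -> ao(F ⊑ S)* Q g S)- aB d(\ S -> t *(Y F a2 S *(ao(F ⊑ S)* Q g S)))≡⟨ aI(qR d _ _)⟩ aB d(\ S -> ao(F ⊑ S)* Q g S - t *(Y F a2 S *(ao(F ⊑ S)* Q g S)))≤⟨ bm d(\ S -> af(ad(aI(d1 t(ao(F ⊑ S))(Q g S)(Y F a2 S))))(aO _(a8(F ⊑ S))(zt F a2 S)))⟩ aB d(\ S -> ao(F ⊑ S)* Q a2 S)∎ where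
      zy : ∀ μ t δ e ->(μ - t * δ)* e == μ * e - t *(δ * e)
      zy = ap ar
   pL :(a2 : List(av N))-> All(\ F -> μ =< p ^ ∣ F ∣ × aM a2(\ ct -> ao(dC F ct)* p ^ ∣ F ∪ ct ∣)=< δ)a2 -> 0' =< 1' - t *(μ - t * δ)-> aB(cI p l u N)(Q a2)=<(1' - t *(μ - t * δ))^ ah a2
   pL{N}[] _ _ = ad(bk(cI p l u N)1')
   pL(F ∷ a2)((zv , zw)∷ h)iu = af(step F a2 zv(af(w5 F F)zw))(aO _ iu(pL a2(All.map(\{ct}(a , b)-> a , af(w5 ct F)b)h)iu))where
    w5 : ∀ sp w6 -> aM a2(\ ct -> ao(dC sp ct)* p ^ ∣ sp ∪ ct ∣)=< ao(dC sp w6)* p ^ ∣ sp ∪ w6 ∣ + aM a2(\ ct -> ao(dC sp ct)* p ^ ∣ sp ∪ ct ∣)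
    w5 sp w6 = bK z(a7(a8(dC sp w6))(aQ ∣ sp ∪ w6 ∣ l))(Cj z _)where
        z = ao(dC sp w6)* p ^ ∣ sp ∪ w6 ∣

-- Copies of a pattern as edge sets, and their overlaps.

module P4 where
 open M6 using (zero;suc)
 open M9 using (∣_∣;_∈_;⊥)
 open M11
 open M7 using ([];_∷_)
 open M10 using ([];_∷_)
 open M12 using ([];_∷_)
 open M13 using (here;there)
 open M0 using (ℕ;zero;suc;_≤_;_+_)
 open M1 using (∃;_×_)
 open M8 using ([];_∷_;lookup)
 open M14 using (here;there) renaming (any? to anyᵛ?)
 open M4 hiding (J)
 open M15 using (toWitness)
 open P2 using (aw)
 open P3
 cA : ∀{a b}-> T a -> T b -> T(a ∧ b)
 cA{true}_ q = q
 bh : ∀{a b}-> T(a ∧ b)-> T a × T b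
 bh{true}q = tt , q
 lw : ∀{a b}-> T(a ∨ b)-> T a ⊎ T b
 lw{true}_ = aD tt
 lw{false}q = aG q
 gb : ∀{a b}-> T a -> T(a ∨ b)
 gb{true}_ = tt
 hq : ∀{a b}-> T b -> T(a ∨ b)
 hq{true}_ = tt
 hq{false}q = q
 lx : ∀{a}-> ¬ T a -> T(ha a)
 lx{true}f = f tt
 lx{false}f = tt
 gc : ∀{a}-> T(ha a)-> ¬ T a
 gc{false}_ q = q
 f1 : ∀{a}-> T a -> a == true
 f1{true}_ = refl
 ei : ∀{a}-> a == true -> T a
 ei refl = tt
 private variable
  N m n s : ℕ
  A B : Set
 gE :(F S : av N)-> T(F ⊑ S)-> F ⊆ S
 gE(true ∷ F)(true ∷ S)p Vec.here = Vec.here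
 gE(true ∷ F)(true ∷ S)p(Vec.there q)= Vec.there(gE F S p q)
 gE(false ∷ F)(b ∷ S)p(Vec.there q)= Vec.there(gE F S p q)
 hH :(F S : av N)-> F ⊆ S -> T(F ⊑ S)
 hH [] [] f = tt
 hH(true ∷ F)(b ∷ S)f with f Vec.here
 ... | Vec.here = hH F S(drop-∷-⊆ f)
 hH(false ∷ F)(b ∷ S)f = hH F S(\ q -> drop-there(f(Vec.there q)))
 gd :(F G : av N)-> T(dC F G)-> ∃ \ l -> l ∈ F × l ∈ G
 gd [] []()
 gd(true ∷ F)(true ∷ G)p = zero , Vec.here , Vec.here
 gd(true ∷ F)(false ∷ G)p = let l , a , b = gd F G p in suc l , Vec.there a , Vec.there b
 gd(false ∷ F)(_ ∷ G)p = let l , a , b = gd F G p in suc l , Vec.there a , Vec.there b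
 dD :(l : Fin N)(F : av N)-> l ∉ F -> ∣ ⁅ l ⁆ ∪ F ∣ == suc ∣ F ∣
 dD zero(true ∷ F)yT = aA(yT Vec.here)
 dD zero(false ∷ F)yT = au(suc ∘ ∣_∣)(∪-identityˡ F)
 dD(suc l)(true ∷ F)yT = au suc(dD l F(yT ∘ Vec.there))
 dD(suc l)(false ∷ F)yT = dD l F(yT ∘ Vec.there)
 c1 :(l : Fin N)(F : av N)-> ∣ ⁅ l ⁆ ∪ F ∣ ≤ suc ∣ F ∣
 c1 zero(true ∷ F)= bl(aa(ae(au ∣_∣(∪-identityˡ F)))(bB _))
 c1 zero(false ∷ F)= ae(au(suc ∘ ∣_∣)(∪-identityˡ F))
 c1(suc l)(true ∷ F)= bl(c1 l F)
 c1(suc l)(false ∷ F)= c1 l F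
 fX : List(Fin N)-> av N -> av N
 fX [] F = F
 fX(l ∷ ls)F = ⁅ l ⁆ ∪ fX ls F
 er :(ls : List(Fin N))(F : av N){x : Fin N}-> x ∈ fX ls F -> x L.∈ ls ⊎ x ∈ F
 er [] F p = aG p
 er(l ∷ ls)F p with x∈p∪q⁻ ⁅ l ⁆ _ p
 ... | aD q = aD(here(x∈⁅y⁆⇒x≡y l q))
 ... | aG q with er ls F q
 ... | aD r = aD(there r)
 ... | aG r = aG r
 gF :(ls : List(Fin N))(F : av N){x : Fin N}-> x L.∈ ls -> x ∈ fX ls F
 gF(l ∷ ls)F(here refl)= x∈p∪q⁺(aD(x∈⁅x⁆ l))
 gF(l ∷ ls)F(there p)= x∈p∪q⁺(aG(gF ls F p))
 hd :(ls : List(Fin N))(F : av N)-> eD ls -> All(_∉ F)ls -> ∣ fX ls F ∣ == ah ls + ∣ F ∣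
 hd [] F _ _ = refl
 hd(l ∷ ls)F(u ∷ us)(a ∷ as)= ag(dD l _ Cr)(au suc(hd ls F us as))where
  Cr : l ∉ fX ls F
  Cr q with er ls F q
  ... | aD r = All.lookup u r refl
  ... | aG r = a r
 fz :(ls : List(Fin N))(F : av N)-> ∣ fX ls F ∣ ≤ ah ls + ∣ F ∣
 fz [] F = bT
 fz(l ∷ ls)F = aa(c1 l _)(bl(fz ls F))
 pM :(ls : List(Fin N))(F G : av N)-> F ⊆ G -> eD ls -> All(_∉ F)ls -> All(_∈ G)ls -> ah ls + ∣ F ∣ ≤ ∣ G ∣
 pM ls F G zz u a b = aa(ae(aI(hd ls F u a)))(p⊆q⇒∣p∣≤∣q∣ sub)where
  sub : fX ls F ⊆ G
  sub q with er ls F q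
  ... | aD r = All.lookup b r
  ... | aG r = zz r
 ky :{A : Set}-> Vec A s -> Set
 ky α = ∀ x y -> lookup α x == lookup α y -> x == y
 ly :(α : Vec(Fin n)s)-> o8(ky α)
 ly α = D5 \ x -> D5 \ y ->(lookup α x ≟ᶠ lookup α y)→-dec(x ≟ᶠ y)
 bn : Vec(Fin n)s -> bH
 bn α = ⌊ ly α ⌋
 cS : ℕ -> Set
 cS s = List(Fin s × Fin s)
 cT : cS s -> Set
 cT es = eD es × All(\(x , y)-> x Fin.< y)es
 _∈?ᵛ_ :(x : Fin n)(α : Vec(Fin n)s)-> o8(x ∈ᵛ α)
 x ∈?ᵛ α = anyᵛ?(x ≟ᶠ_)α
 lW : av s -> Fin s × Fin s -> bH
 lW U(x , y)= lookup U x ∧ lookup U y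
 ch gX : cS s -> av s -> ℕ
 ch es U = ah(aw(lW U)es)
 gX es U = ah(aw(ha ∘ lW U)es)
 dT :(b : A -> bH)(xs : List A)-> ah(aw b xs)+ ah(aw(ha ∘ b)xs)== ah xs
 dT b [] = refl
 dT b(x ∷ xs)with b x
 ... | true = au suc(dT b xs)
 ... | false = ag(ip _ _)(au suc(dT b xs))
 lz :(es : cS s)(U : av s)-> ch es U + gX es U == ah es
 lz es U = dT(lW U)es
 aP :(b : A -> bH)(xs : List A){x : A}-> x L.∈ aw b xs -> x L.∈ xs × T(b x)
 aP b(x ∷ xs)p with b x in eq
 aP b(x ∷ xs)(here refl)| true = here refl , ei eq
 aP b(x ∷ xs)(there p)| true = let q , r = aP b xs p in there q , r
 ... | false = let q , r = aP b xs p in there q , r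
 cE :(b : A -> bH)(xs : List A){x : A}-> x L.∈ xs -> T(b x)-> x L.∈ aw b xs
 cE b(x ∷ xs)(here refl)t with b x
 ... | true = here refl
 cE b(y ∷ xs)(there p)t with b y
 ... | true = there(cE b xs p t)
 ... | false = cE b xs p t
 cF :(b : A -> bH){xs : List A}-> eD xs -> eD(aw b xs)
 cF b [] = []
 cF b{x ∷ xs}(u ∷ us)with b x
 ... | true = All.tabulate(\ p -> All.lookup u(ai(aP b xs p)))∷ cF b us
 ... | false = cF b us
 iE :(f : A -> B){xs : List A}->(∀{x y}-> x L.∈ xs -> y L.∈ xs -> f x == f y -> x == y)-> eD xs -> eD(fd f xs)
 iE f jn [] = []
 iE f{x ∷ xs}jn(u ∷ us)= go xs u there ∷ iE f(\ p q -> jn(there p)(there q))us where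
  go : ∀ ys -> All(x ≢_)ys ->(∀{y}-> y L.∈ ys -> y L.∈(x ∷ xs))-> All(f x ≢_)(fd f ys)
  go [] [] k = []
  go(y ∷ ys)(v ∷ vs)k =(\ eq -> v(jn(here refl)(k(here refl))eq))∷ go ys vs(k ∘ there)
 ∈-map⁻ :(f : A -> B)(xs : List A){y : B}-> y L.∈ fd f xs -> ∃ \ x -> x L.∈ xs × y == f x
 ∈-map⁻ f(x ∷ xs)(here eq)= x , here refl , eq
 ∈-map⁻ f(x ∷ xs)(there p)= let z , q , eq = ∈-map⁻ f xs p in z , there q , eq
 ∈-map⁺ :(f : A -> B)(xs : List A){x : A}-> x L.∈ xs -> f x L.∈ fd f xs
 ∈-map⁺ f(x ∷ xs)(here refl)= here refl
 ∈-map⁺ f(x ∷ xs)(there p)= there(∈-map⁺ f xs p)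
 -- The overlap of two copies, recorded as positions of the second one, so that sums over copies can
 -- be organised by subsets of the pattern.
 J : Vec(Fin n)m -> Vec(Fin n)s -> av s
 J α β = Vec.map(\ b -> ⌊ b ∈?ᵛ α ⌋)β
 l4 :(α : Vec(Fin n)m)(β : Vec(Fin n)s)(x : Fin s)-> lookup β x ∈ᵛ α -> T(lookup(J α β)x)
 l4 α β x p = aL T(aI(bv x _ β))(bc p)
 xW :(α : Vec(Fin n)m)(β : Vec(Fin n)s)(x : Fin s)-> T(lookup(J α β)x)-> lookup β x ∈ᵛ α
 xW α β x p = toWitness(aL T(bv x _ β)p)
 kI :(U : av s)(x y : Fin s)-> x ≢ y -> T(lookup U x)-> T(lookup U y)-> 2 ≤ ∣ U ∣
 kI{s}U x y vV p q = aL(\ z -> 2 + z ≤ ∣ U ∣)(∣⊥∣≡0 s)(pM(x ∷ y ∷ [])⊥ U(\ r -> aA(∉⊥ r))((vV ∷ [])∷ [] ∷ [])(∉⊥ ∷ ∉⊥ ∷ [])(fq x U(f1 p)∷ fq y U(f1 q)∷ []))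
 gf :(U : av s)(x : Fin s)-> T(lookup U x)-> 1 ≤ ∣ U ∣
 gf{s}U x p = aL(\ z -> 1 + z ≤ ∣ U ∣)(∣⊥∣≡0 s)(pM(x ∷ [])⊥ U(\ r -> aA(∉⊥ r))([] ∷ [])(∉⊥ ∷ [])(fq x U(f1 p)∷ []))
 -- The random graph enters only through `dN`, the coordinate of a pair of vertices in the random
 -- set; `br` lets a coordinate determine its pair up to order.
 module pc {n N : ℕ} (dN : Fin n → Fin n → Fin N)(br : ∀{x y cy cL}-> dN x y == dN cy cL ->(x == cy × y == cL)⊎(x == cL × y == cy))where
  cD : Vec(Fin n)s -> Fin s × Fin s -> Fin N
  cD α(x , y)= dN(lookup α x)(lookup α y)
  fa : cS s -> Vec(Fin n)s -> av N
  fa es α = fX(fd(cD α)es)⊥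
  l5 :(es : cS s)(α : Vec(Fin n)s){l : Fin N}-> l ∈ fa es α -> ∃ \ e -> e L.∈ es × l == cD α e
  l5 es α p with er(fd(cD α)es)⊥ p
  ... | aD q = ∈-map⁻(cD α)es q
  ... | aG q = aA(∉⊥ q)
  pd :(es : cS s)(α : Vec(Fin n)s){e : Fin s × Fin s}-> e L.∈ es -> cD α e ∈ fa es α
  pd es α p = gF(fd(cD α)es)⊥(∈-map⁺(cD α)es p)
  pN :(es : cS s)(α : Vec(Fin n)s)-> ∣ fa es α ∣ ≤ ah es
  pN es α = aa(fz(fd(cD α)es)⊥)(ae(ag(aS _+_(lq es)(∣⊥∣≡0 N))(aW _)))where
   lq : ∀ es -> ah(fd(cD α)es)== ah es
   lq [] = refl
   lq(_ ∷ es)= au suc(lq es)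
  m7 :(es : cS s)(α : Vec(Fin n)s)-> cT es -> ky α -> eD(fd(cD α)es)
  m7 es α(u , lt)jn = iE(cD α)Cs u where
   Cs : ∀{e lA}-> e L.∈ es -> lA L.∈ es -> cD α e == cD α lA -> e == lA
   Cs{x , y}{cy , cL}p q eq with br eq
   ... | aD(a , b)= aS _,_(jn _ _ a)(jn _ _ b)
   ... | aG(a , b)with refl ← jn x cL a | refl ← jn y cy b = aA(oE(All.lookup lt p)(All.lookup lt q))
  jA :(es : cS s)(β : Vec(Fin n)s)(t0 : Fin s × Fin s -> bH)(F G : av N)-> cT es -> ky β -> F ⊆ G -> fa es β ⊆ G ->(∀ e -> e L.∈ es -> T(t0 e)-> cD β e ∉ F)-> ah(aw t0 es)+ ∣ F ∣ ≤ ∣ G ∣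
  jA es β t0 F G(u , lt)jn zz Bu pO = aL(\ z -> z + ∣ F ∣ ≤ ∣ G ∣)(lq(aw t0 es))(pM(fd(cD β)(aw t0 es))F G zz(m7(aw t0 es)β(cF t0 u , All.tabulate(\ p -> All.lookup lt(ai(aP t0 es p))))jn)(All.tabulate \ p -> let e , q , eq = ∈-map⁻(cD β)_ p;r , t = aP t0 es q in aL(_∉ F)(aI eq)(pO e r t))(All.tabulate \ p -> let e , q , eq = ∈-map⁻(cD β)_ p;r , t = aP t0 es q in aL(_∈ G)(aI eq)(Bu(pd es β r))))where
   lq : ∀ es -> ah(fd(cD β)es)== ah es
   lq [] = refl
   lq(_ ∷ es)= au suc(lq es)
  private
   iW :(xs : List A)-> aw(\ _ -> true)xs == xs
   iW [] = refl
   iW(x ∷ xs)= au(x ∷_)(iW xs)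
  jB :(es : cS s)(α : Vec(Fin n)s)-> cT es -> ky α -> ah es ≤ ∣ fa es α ∣
  jB es α kJ jn = aL(_≤ ∣ fa es α ∣)(ag(aS _+_(au ah(iW es))(∣⊥∣≡0 N))(aW _))(jA es α(\ _ -> true)⊥(fa es α)kJ jn(\ q -> aA(∉⊥ q))(\ q -> q)(\ _ _ _ -> ∉⊥))
  iX :(es : cS s)(α : Vec(Fin n)s)(x y : Fin n)-> dN x y ∈ fa es α -> x ∈ᵛ α × y ∈ᵛ α
  iX es α x y p with l5 es α p
  ... |(a , b), _ , eq with br eq
  ... | aD(refl , refl)= mJ a α , mJ b α
  ... | aG(refl , refl)= mJ b α , mJ a α
  -- An edge of the second copy with an end outside the overlap cannot belong to the first copy,
  -- whose edges have both ends among its own vertices.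
  j5 :(es : cS s)(α β : Vec(Fin n)s)-> cT es -> ky α -> ky β -> ah es + gX es(J α β)≤ ∣ fa es α ∪ fa es β ∣
  j5 es α β kJ uR Es = aa(aK(gX es(J α β))(jB es α kJ uR))(aa(ae(el ∣ fa es α ∣ _))(jA es β(ha ∘ lW(J α β))(fa es α)(fa es α ∪ fa es β)kJ Es(\ q -> x∈p∪q⁺(aD q))(\ q -> x∈p∪q⁺(aG q))pO))where
   pO : ∀ e -> e L.∈ es -> T(ha(lW(J α β)e))-> cD β e ∉ fa es α
   pO(x , y)_ t q = let a , b = iX es α _ _ q in gc{lW(J α β)(x , y)}t(cA(l4 α β x a)(l4 α β y b))
  oI :(es : cS s)(α β : Vec(Fin n)s)-> cT es -> T(dC(fa es α)(fa es β))-> 2 ≤ ∣ J α β ∣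
  oI es α β(_ , lt)t with gd(fa es α)(fa es β)t
  ... | l , p , q with l5 es β q
  ... |(x , y), r , refl = let a , b = iX es α _ _ p in kI(J α β)x y(\{ refl -> aV refl(All.lookup lt r)})(l4 α β x a)(l4 α β y b)

-- Counting tuples by their overlap with a fixed copy.

module P5 where
 open M6 using (zero;suc)
 open M9 using (∣_∣)
 open M11 using (∣p∣≤n)
 open M7 using ([];_∷_)
 open M16 using (_∈_)
 open M10 using ([];_∷_)
 open M12 using ([];_∷_)
 open M13 using (here;there)
 open M0 using (ℕ;zero;suc)
 open M1 using (_×_)
 open M2 hiding (_÷_;∣_∣;floor)
 open M3
 open M8 using ([];_∷_;lookup;replicate)
 open M4 hiding (J)
 open M15 using (toWitness)
 open P1
 open P2
 open P3
 open P4
 private variable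
  A B : Set
  s : ℕ
 fr : Vec(List A)s -> List(Vec A s)
 fr [] = [] ∷ []
 fr(xs ∷ m8)= ce(\ x -> fd(x ∷_)(fr m8))xs
 hr :(xs : List A)(m8 : Vec(List A)s)(f : Vec A(suc s)-> ℚ)-> aM(fr(xs ∷ m8))f == aM xs(\ x -> aM(fr m8)(f ∘(x ∷_)))
 hr xs m8 f = ag(dB(\ x -> fd(x ∷_)(fr m8))xs f)(bF xs(\ x -> fM(x ∷_)(fr m8)f))
 ∈-concatMap⁺ :(h : A -> List B){x : A}{xs : List A}{y : B}-> x ∈ xs -> y ∈ h x -> y ∈ ce h xs
 ∈-concatMap⁺ h(here refl)q = dZ q
 ∈-concatMap⁺ h{xs = z ∷ _}(there p)q = c8(h z)(∈-concatMap⁺ h p q)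
 lB :(m8 : Vec(List A)s)(v : Vec A s)->(∀ x -> lookup v x ∈ lookup m8 x)-> v ∈ fr m8
 lB [] [] f = here refl
 lB(xs ∷ m8)(a ∷ v)f = ∈-concatMap⁺(\ x -> fd(x ∷_)(fr m8))(f zero)(∈-map⁺(a ∷_)(fr m8)(lB m8 v(f ∘ suc)))
 aJ : ∀ M s -> List(Vec(Fin M)s)
 aJ M s = fr(replicate s(ax M))
 ey : ∀{M s}(v : Vec(Fin M)s)-> v ∈ aJ M s
 ey [] = here refl
 ey{M}{suc s}(a ∷ v)= ∈-concatMap⁺(\ x -> fd(x ∷_)(aJ M s))(∈-allFin a)(∈-map⁺(a ∷_)(aJ M s)(ey v))
 m9 :{xs : List A}{x : A}(f : A -> ℚ)->(∀ a -> 0' =< f a)-> x ∈ xs -> f x =< aM xs f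
 m9{xs = x ∷ xs}f oH(here refl)= bK(aM xs f)(cZ xs oH)refl
 m9{xs = y ∷ xs}f oH(there p)= af(m9 f oH p)(bK(f y)(oH y)(Cj(f y)(aM xs f)))
 dj : ∀ s -> List(av s)
 dj zero = [] ∷ []
 dj(suc s)= fd(true ∷_)(dj s)++ fd(false ∷_)(dj s)
 gG :(U : av s)-> U ∈ dj s
 gG [] = here refl
 gG(true ∷ U)= dZ(∈-map⁺(true ∷_)(dj _)(gG U))
 gG(false ∷ U)= c8(fd(true ∷_)(dj _))(∈-map⁺(false ∷_)(dj _)(gG U))
 fN : ∀ s -> ah(dj s)== 2 ^' s
 fN zero = refl
 fN(suc s)= ag(i7(fd(true ∷_)(dj s)))(aS _+'_(ag(fK _(dj s))(fN s))(ag(fK _(dj s))(ag(fN s)(aI(aW _)))))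
 module _ {n : ℕ} where
  hX :(ys : List(Fin n))-> eD ys ->(a : Fin n)-> aM ys(\ b -> ao ⌊ b ≟ᶠ a ⌋)=< 1'
  hX [] _ a = ca
  hX(b ∷ ys)(u ∷ us)a with b ≟ᶠ a
  ... | no _ = af(ad(bu _))(hX ys us a)
  ... | yes refl = ad(ag(au(1' +_)(fA ys u))(dL 1'))where
   fA : ∀ ys -> All(b ≢_)ys -> aM ys(\ c -> ao ⌊ c ≟ᶠ b ⌋)== 0'
   fA [] [] = refl
   fA(c ∷ ys)(v ∷ vs)with c ≟ᶠ b
   ... | yes eq = aA(v(aI eq))
   ... | no _ = ag(bu _)(fA ys vs)
  j6 : ∀{m}(ys : List(Fin n))-> eD ys ->(α : Vec(Fin n)m)-> aM ys(\ b -> ao ⌊ b ∈?ᵛ α ⌋)=< ι m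
  j6 ys u [] = ad(ag(bF ys(\ b -> refl))(ag(bL ys 0')(ag(fJ(ι(ah ys)))(aI iA))))
  j6{suc m}ys u(a ∷ α)= begin aM ys(\ b -> ao ⌊ b ∈?ᵛ(a ∷ α)⌋)≤⟨ cj ys jv ⟩ aM ys(\ b -> ao ⌊ b ≟ᶠ a ⌋ + ao ⌊ b ∈?ᵛ α ⌋)≡⟨ l2 ys _ _ ⟩ aM ys(\ b -> ao ⌊ b ≟ᶠ a ⌋)+ aM ys(\ b -> ao ⌊ b ∈?ᵛ α ⌋)≤⟨ cQ(hX ys u a)(j6 ys u α)⟩ 1' + ι m ≡⟨ aI(cV m)⟩ ι(suc m)∎ where
   open RQ
   jv : ∀ b -> ao ⌊ b ∈?ᵛ(a ∷ α)⌋ =< ao ⌊ b ≟ᶠ a ⌋ + ao ⌊ b ∈?ᵛ α ⌋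
   jv b = af(dg{⌊ b ∈?ᵛ(a ∷ α)⌋}{⌊ b ≟ᶠ a ⌋ ∨ ⌊ b ∈?ᵛ α ⌋}Dn)(lv ⌊ b ≟ᶠ a ⌋ ⌊ b ∈?ᵛ α ⌋)where
    Dn : T ⌊ b ∈?ᵛ(a ∷ α)⌋ -> T(⌊ b ≟ᶠ a ⌋ ∨ ⌊ b ∈?ᵛ α ⌋)
    Dn t with toWitness{a? = b ∈?ᵛ(a ∷ α)}t
    ... | hereᵛ eq = gb(bc{a? = b ≟ᶠ a}eq)
    ... | thereᵛ q = hq{⌊ b ≟ᶠ a ⌋}(bc{a? = b ∈?ᵛ α}q)
 -- The constant of the overlap count: `2 ^ s` possible overlaps, and at most `(s + 1) ^ s` ways to
 -- send the overlapping positions into the vertices of the other copy.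
 κ : ℕ -> ℕ
 κ s = 2 ^' s *' suc s ^' s
 module sq {n N : ℕ} (dN : Fin n → Fin n → Fin N)(br : ∀{x y cy cL}-> dN x y == dN cy cL ->(x == cy × y == cL)⊎(x == cL × y == cy)){p : ℚ}(l : 0' =< p)(u : p =< 1'){M : ℕ}(y : Fin M -> Fin n)(j7 : ∀{a b}-> y a == y b -> a == b){s : ℕ}(es : cS s)(kJ : cT es)where
  open pc dN br
  at : Vec(Fin M)s -> Vec(Fin n)s
  at = Vec.map y
  cG : Vec(Fin M)s -> av N
  cG β = fa es(at β)
  hs :(β : Vec(Fin M)s)-> ky β -> ky(at β)
  hs β i a b eq = i a b(j7(ag(aI(bv a y β))(ag eq(bv b y β))))
  private
   ys = fd y(ax M)
   uc : eD ys
   uc = iE y(\ _ _ -> j7)(allFin⁺ M)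
   oJ : ah(ax M)== M
   oJ = cR(\ x -> x)
  -- Each position in `U` has at most `m` admissible values and each other position has `M`. The
  -- base `suc m` is at least 1, which later allows its exponent to be raised from the size of `U`
  -- to `s`.
  ob : ∀{m q}(α : Vec(Fin n)m)(U : av q)-> aM(aJ M q)(\ β -> ao(U ⊑ J α(Vec.map y β)))=< ι(suc m)^ ∣ U ∣ * ι M ^(q -' ∣ U ∣)
  ob α [] = bR
  ob{m}{suc q}α(true ∷ U)= begin aM(aJ M(suc q))(\ β -> ao((true ∷ U)⊑ J α(Vec.map y β)))≡⟨ hr(ax M)(replicate q(ax M))_ ⟩ aM(ax M)(\ b -> aM(aJ M q)(\ β -> ao(⌊ y b ∈?ᵛ α ⌋ ∧ U ⊑ J α(Vec.map y β))))≡⟨ bF(ax M)(\ b -> ag(bF(aJ M q)(\ β -> cX ⌊ y b ∈?ᵛ α ⌋ _))(ag(fy(aJ M q)(ao ⌊ y b ∈?ᵛ α ⌋)_)(e9(ao ⌊ y b ∈?ᵛ α ⌋)_)))⟩ aM(ax M)(\ b -> eZ * ao ⌊ y b ∈?ᵛ α ⌋)≡⟨ fy(ax M)eZ _ ⟩ eZ * aM(ax M)(\ b -> ao ⌊ y b ∈?ᵛ α ⌋)≤⟨ dS(cZ(aJ M q)(\ β -> a8(U ⊑ J α(Vec.map y β))))(ob α U)(cZ(ax M)(\ b -> a8 ⌊ y b ∈?ᵛ α ⌋))(af(ad(aI(fM y(ax M)_)))(af(j6 ys uc α)(bw(bB m))))⟩ ι(suc m)^ ∣ U ∣ * ι M ^(q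 -' ∣ U ∣)* ι(suc m)≡⟨ a0(ι(suc m)^ ∣ U ∣)(ι M ^(q -' ∣ U ∣))(ι(suc m))⟩ ι(suc m)* ι(suc m)^ ∣ U ∣ * ι M ^(q -' ∣ U ∣)∎ where
   open RQ
   eZ = aM(aJ M q)(\ β -> ao(U ⊑ J α(Vec.map y β)))
   a0 : ∀ a b c -> a * b * c == c * a * b
   a0 = ap ar
  ob{m}{suc q}α(false ∷ U)= begin aM(aJ M(suc q))(\ β -> ao((false ∷ U)⊑ J α(Vec.map y β)))≡⟨ hr(ax M)(replicate q(ax M))_ ⟩ aM(ax M)(\ b -> eZ)≡⟨ ag(bL(ax M)eZ)(au(\ i -> ι i * eZ)oJ)⟩ ι M * eZ ≤⟨ aO(ι M)(aY M)(ob α U)⟩ ι M *(ι(suc m)^ ∣ U ∣ * ι M ^(q -' ∣ U ∣))≡⟨ a0(ι(suc m)^ ∣ U ∣)(ι M ^(q -' ∣ U ∣))(ι M)⟩ ι(suc m)^ ∣ U ∣ * ι M ^(suc(q -' ∣ U ∣))≡⟨ au(\ i -> ι(suc m)^ ∣ U ∣ * ι M ^ i)(aI(FE 1(∣p∣≤n U)))⟩ ι(suc m)^ ∣ U ∣ * ι M ^(suc q -' ∣ U ∣)∎ where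
   open RQ
   eZ = aM(aJ M q)(\ β -> ao(U ⊑ J α(Vec.map y β)))
   a0 : ∀ a b c -> c *(a * b)== a *(c * b)
   a0 = ap ar
  module _ (c : ℕ) {R : ℚ} (nd : 0' =< R)(hR : ∀ U -> c <= ∣ U ∣ -> ι M ^(s -' ∣ U ∣)* p ^ gX es U =< R)where
   private
    w = p ^ ah es
   -- The sum is split by the overlap `U`: `j5` bounds the union from below, `ob` counts the tuples,
   -- and `hR` caps each term. The cut-off `c` is 2 for copies sharing an edge and 1 for copies
   -- sharing a vertex.
   ng :(α : Vec(Fin n)s)-> ky α -> aM(aJ M s)(\ β -> ao(bn β)*(ao(c <=b ∣ J α(at β)∣)* p ^ ∣ fa es α ∪ cG β ∣))=< w *(ι(κ s)* R)
   ng α uR = begin aM(aJ M s)(\ β -> ao(bn β)*(ao(c <=b ∣ J α(at β)∣)* p ^ ∣ fa es α ∪ cG β ∣))≤⟨ cj(aJ M s)ud ⟩ aM(aJ M s)(\ β -> aM(dj s)(\ U -> ao(c <=b ∣ U ∣)*(w * p ^ gX es U)* ao(U ⊑ J α(at β))))≡⟨ iC(aJ M s)(dj s)_ ⟩ aM(dj s)(\ U -> aM(aJ M s)(\ β -> ao(c <=b ∣ U ∣)*(w * p ^ gX es U)* ao(U ⊑ J α(at β))))≤⟨ cj(dj s)Et ⟩ aM(dj s)(\ U -> w *(ι(suc s)^ s * R))≡⟨ ag(bL(dj s)_)(ag(au(\ i -> ι i *(w *(ι(suc s)^ s * R)))(fN s))(ag(a0(ι(2 ^' s))w(ι(suc s)^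 s)R)(au(\ z -> w *(z * R))(ag(au(ι(2 ^' s)*_)(aI(mU(suc s)s)))(aI(cW(2 ^' s)(suc s ^' s)))))))⟩ w *(ι(κ s)* R)∎ where
    open RQ
    jw : 0' =< w
    jw = aQ(ah es)l
    a0 : ∀ a w b r -> a *(w *(b * r))== w *(a * b * r)
    a0 = ap ar
    uS : Vec(Fin M)s -> av s -> ℚ
    uS β U = ao(c <=b ∣ U ∣)*(w * p ^ gX es U)* ao(U ⊑ J α(at β))
    sr : ∀ β U -> 0' =< uS β U
    sr β U = a7(a7(a8(c <=b ∣ U ∣))(a7 jw(aQ(gX es U)l)))(a8(U ⊑ J α(at β)))
    ud : ∀ β -> ao(bn β)*(ao(c <=b ∣ J α(at β)∣)* p ^ ∣ fa es α ∪ cG β ∣)=< aM(dj s)(uS β)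
    ud β with ly β
    ... | no _ = af(ad(bY(ao(c <=b ∣ J α(at β)∣)* p ^ ∣ fa es α ∪ cG β ∣)))(cZ(dj s)(sr β))
    ... | yes Es = af(ad(aH _))(af(af(aO _(a8(c <=b ∣ U ∣))(af(f8 l u(j5 es α(at β)kJ uR(hs β Es)))(ad(zl p(ah es)(gX es U)))))(ad(aI(ag(au(ao(c <=b ∣ U ∣)*(w * p ^ gX es U)*_)(pI(hW U)))(aF _)))))(m9(uS β)(sr β)(gG U)))where
        U = J α(at β)
    Et : ∀ U -> aM(aJ M s)(\ β -> ao(c <=b ∣ U ∣)*(w * p ^ gX es U)* ao(U ⊑ J α(at β)))=< w *(ι(suc s)^ s * R)
    Et U with c <=b ∣ U ∣ in eq
    ... | false = af(ad(ag(bF(aJ M s)(\ β -> ag(au(_* ao(U ⊑ J α(at β)))(bY(w * p ^ gX es U)))(bY(ao(U ⊑ J α(at β))))))(ag(bL(aJ M s)0')(fJ(ι(ah(aJ M s)))))))(a7 jw(a7(aQ s(aY(suc s)))nd))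
    ... | true = begin aM(aJ M s)(\ β -> 1' *(w * p ^ gX es U)* ao(U ⊑ J α(at β)))≡⟨ ag(fy(aJ M s)(1' *(w * p ^ gX es U))_)(au(_* zA)(aH(w * p ^ gX es U)))⟩ w * p ^ gX es U * zA ≤⟨ aO(w * p ^ gX es U)(a7 jw(aQ(gX es U)l))(ob α U)⟩ w * p ^ gX es U *(ι(suc s)^ ∣ U ∣ * ι M ^(s -' ∣ U ∣))≡⟨ aZ w(p ^ gX es U)(ι(suc s)^ ∣ U ∣)(ι M ^(s -' ∣ U ∣))⟩ w *(ι(suc s)^ ∣ U ∣ *(ι M ^(s -' ∣ U ∣)* p ^ gX es U))≤⟨ aO w jw(dS(aQ ∣ U ∣(aY(suc s)))(m3(aL(_=< ι(suc s))jZ(bw(bl bI)))(∣p∣≤n U))(a7(aQ(s -' ∣ U ∣)(aY M))(aQ(gX es U)l))(hR U(lX c ∣ U ∣(ei eq))))⟩ w *(ι(suc s)^ s * R)∎ where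
     zA = aM(aJ M s)(\ β -> ao(U ⊑ J α(at β)))
     aZ : ∀ w e a b -> w * e *(a * b)== w *(a *(b * e))
     aZ = ap ar

-- Lower tail of copy counts, and extraction of vertex-disjoint copies.

module P6 where
 open M6 using (zero;suc)
 open M9 using (∣_∣)
 open M7 using ([];_∷_)
 open M16 using (_∈_)
 open M10 using ([];_∷_)
 open M12 using ([];_∷_)
 open M13 using (here)
 open M0 using (ℕ;zero;suc)
 open M1 using (∃;_×_)
 open M2 hiding (_÷_;∣_∣;floor)
 open M3
 open M8 using ([];_∷_)
 open M4 hiding (J)
 open P1
 open P2
 open P3
 open P4
 open P5
 private variable
  A B : Set
  n s : ℕ
 fe :(b : A -> bH)(xs : List A)-> ι(ah(aw b xs))== aM xs(ao ∘ b)
 fe b xs = ag(aI(ag(bL(aw b xs)1')(aF _)))(ag(c0 b xs(\ _ -> 1'))(bF xs(\ a -> aF(ao(b a)))))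
 GW : ∀ k r m -> 8 *' k *' r *' m == 2 *' m *' 2 *'(2 *' k *' r)
 GW = aU
 module ue {n N : ℕ} (dN : Fin n → Fin n → Fin N)(br : ∀{x y cy cL}-> dN x y == dN cy cL ->(x == cy × y == cL)⊎(x == cL × y == cy)){p : ℚ}(l : 0' =< p)(u : p =< 1'){P : ℕ}(pP : p * ι P == 1'){M : ℕ}(y : Fin M -> Fin n)(j7 : ∀{a b}-> y a == y b -> a == b){s : ℕ}(es : cS s)(kJ : cT es)where
  open pc dN br
  open sq dN br l u y j7 es kJ
  private
   e = ah es
   D = P ^' e
   w = p ^ e
   pf : ∀ k -> p ^ k * ι(P ^' k)== 1'
   pf k = ag(au(p ^ k *_)(mU P k))(ag(aI(b5 p(ι P)k))(ag(au(_^ k)pP)(1^ k)))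
   wD : w * ι D == 1'
   wD = pf e
   GX : 1 <= D
   GX with D | wD
   ... | zero | eq = aA(1≢0(ag(aI eq)(ag(au(w *_)iA)(fJ w))))
   ... | suc _ | _ = bl bI
   jw : 0' =< w
   jw = aQ e l
  -- Multiplying by `p ^ ch * P ^ ch = 1` completes the power of `p` to `w` and leaves a natural
  -- number, so that the hypotheses on overlaps can be stated in ℕ.
  qS :(c Rn : ℕ)->(∀ U -> c <= ∣ U ∣ -> M ^'(s -' ∣ U ∣)*' P ^' ch es U <= Rn)-> ∀ U -> c <= ∣ U ∣ -> ι M ^(s -' ∣ U ∣)* p ^ gX es U =< ι Rn * w
  qS c Rn h U F6 = begin a * p ^ gX es U ≡⟨ aI(aF _)⟩ a * p ^ gX es U * 1' ≡⟨ au(a * p ^ gX es U *_)(aI(pf(ch es U)))⟩ a * p ^ gX es U *(p ^ ch es U * b)≡⟨ a0 a(p ^ gX es U)(p ^ ch es U)b ⟩ a * b *(p ^ ch es U * p ^ gX es U)≡⟨ aS _*_(ag(au(_* b)(aI(mU M(s -' ∣ U ∣))))(aI(cW(M ^'(s -' ∣ U ∣))(P ^' ch es U))))(ag(aI(zl p(ch es U)(gX es U)))(au(p ^_)(lz es U)))⟩ ι(M ^'(s -' ∣ U ∣)*' P ^' ch es U)* w ≤⟨ aX w jw(bw(h U F6))⟩ ι Rn * w ∎ where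
   open RQ
   a = ι M ^(s -' ∣ U ∣)
   b = ι(P ^' ch es U)
   a0 : ∀ a x y b -> a * x *(y * b)== a * b *(y * x)
   a0 = ap ar
  module _ (dc : Vec (Fin M) s → bH) (cM : ∀ β → T (dc β) → ky β)(Rn : ℕ)(nh : P ^' ah es <= Rn)(hR : ∀ U -> 2 <= ∣ U ∣ -> M ^'(s -' ∣ U ∣)*' P ^' ch es U <= Rn)where
   qT : List(Vec(Fin M)s)
   qT = aw dc(aJ M s)
   Bv : av N -> ℕ
   Bv S = ah(aw(\ β -> cG β ⊑ S)qT)
   private
    R = ι Rn * w
    k = ι(κ s)
    k8 : 1 <= κ s
    k8 = aC(bz 2 s)(bz(suc s)s)
    K = 2 *' κ s *' Rn
    zB : 1 <= K
    zB = aC(aC(bl(bI{1}))k8)(aa GX nh)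
    rr = f9(ι K)(k5 zB)
    r = ai rr
    FN = ai(proj₂ rr)
    Kr : ι K * r == 1'
    Kr = proj₂(proj₂ rr)
    vW = bO FN
    -- With `δ = w κ Rn w` and `w = 1 / D`, the choice `t = D / (2 κ Rn)` makes `t δ` exactly
    -- `w / 2`. Each candidate then contributes the factor `1 - yy` with `yy = t w / 2 = r / 2`.
    t = ι D * r
    kH : 0' =< t
    kH = a7(aY D)vW
    w7 :(1' + 1')* t =< 1'
    w7 = begin(1' + 1')*(ι D * r)≡⟨ ag(au(\ z -> z *(ι D * r))(aI l1))(ag(aI(hp(ι 2)(ι D)r))(au(_* r)(aI(cW 2 D))))⟩ ι(2 *' D)* r ≤⟨ aX r vW(bw(aC(aL(_<= 2 *' κ s)(f4 2)(az 2 k8))nh))⟩ ι K * r ≡⟨ Kr ⟩ 1' ∎ where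
        open RQ
    w8 : t =< ½
    w8 = bZ(1' + 1')(da(1' + 1'))w7
    xV : t =< 1'
    xV = af w8 j1
    δ = w *(k * R)
    F7 : t * δ == ½ * w
    F7 = begin ι D * r *(w *(k *(ι Rn * w)))≡⟨ a0(ι D)r w k(ι Rn)⟩ ½ *((w * ι D)*((1' + 1')* k * ι Rn * r)* w)≡⟨ au(½ *_)(ag(au(_* w)(ag(aS _*_ wD(ag(au(_* r)GY)Kr))(aH 1')))(aH w))⟩ ½ * w ∎ where
     open ≡-Reasoning
     a0 : ∀ d r w k n -> d * r *(w *(k *(n * w)))== ½ *((w * d)*((1' + 1')* k * n * r)* w)
     a0 d r w k n = ag(j8 d r w k n)(ag(aI(aH _))(ag(au(_*(w * d *(k * n * r)* w))vX)(ci ½ d r w k n)))where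
      vX : 1' == ½ *(1' + 1')
      vX = refl
      j8 : ∀ d r w k n -> d * r *(w *(k *(n * w)))== w * d *(k * n * r)* w
      j8 = ap ar
      ci : ∀ h d r w k n -> h *(1' + 1')*(w * d *(k * n * r)* w)== h *((w * d)*((1' + 1')* k * n * r)* w)
      ci = ap ar
     GY :(1' + 1')* k * ι Rn == ι K
     GY = aI(ag(cW(2 *' κ s)Rn)(au(_* ι Rn)(ag(cW 2(κ s))(au(_* k)l1))))
    yy = ½ * r
    ss : 0' =< yy
    ss = a7 eX vW
    Cu : r =< 1'
    Cu = af(af(ad(aI(aH r)))(aX r vW(aL(_=< ι K)jZ(bw zB))))(ad Kr)
    l6 : yy =< 1'
    l6 = af(dS eX j1 vW Cu)(ad(aH 1'))
    t2 : 1' - t *(w - t * δ)== 1' - yy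
    t2 = au(\ z -> 1' - z)(ag(au(\ z -> t *(w - z))F7)(ag(a0(ι D)r w)(ag(au(\ z ->(½ * r)* z)wD)(aF(½ * r)))))where
     vX : 1' - ½ == ½
     vX = refl
     j8 : ∀ d r w h -> d * r *(w - h * w)==(1' - h)* r *(w * d)
     j8 = ap ar
     a0 : ∀ d r w -> d * r *(w - ½ * w)== ½ * r *(w * d)
     a0 d r w = ag(j8 d r w ½)(au(\ z -> z * r *(w * d))vX)
    open Dm l u kH xV
    a2 = fd cG qT
    xY : t * δ =< w
    xY = af(ad F7)(af(aX w jw j1)(ad(aH w)))
    Eu : All(\ F -> w =< p ^ ∣ F ∣ × aM a2(\ ct -> ao(dC F ct)* p ^ ∣ F ∪ ct ∣)=< δ)a2
    Eu = All.tabulate go where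
     go : ∀{F}-> F ∈ a2 -> w =< p ^ ∣ F ∣ × aM a2(\ ct -> ao(dC F ct)* p ^ ∣ F ∪ ct ∣)=< δ
     go q with ∈-map⁻ cG qT q
     ... | α , zC , refl = f8 l u(pN es(at α)),(begin aM a2(\ ct -> ao(dC(cG α)ct)* p ^ ∣ cG α ∪ ct ∣)≡⟨ ag(fM cG qT _)(c0 dc(aJ M s)_)⟩ aM(aJ M s)(\ β -> ao(dc β)*(ao(dC(cG α)(cG β))* p ^ ∣ cG α ∪ cG β ∣))≤⟨ cj(aJ M s)(\ β -> dS(a8(dc β))(dg{dc β}{bn β}(\ t -> bc{a? = ly β}(cM β t)))(a7(a8(dC(cG α)(cG β)))(aQ ∣ cG α ∪ cG β ∣ l))(aX _(aQ ∣ cG α ∪ cG β ∣ l)(dg{dC(cG α)(cG β)}{2 <=b ∣ J(at α)(at β)∣}(\ t -> f5(oI es(at α)(at β)kJ t)))))⟩ aM(aJ M s)(\ β -> ao(bn β)*(ao(2 <=b ∣ J(at α)(at β)∣)* p ^ ∣ cG α ∪ cG β ∣))≤⟨ ng 2(a7(aY Rn)jw)(qS 2 Rn hR)(at α)(hs α(cM α(proj₂(aP dc(aJ M s)zC))))⟩ δ ∎)where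
         open RQ
    Ev : ∀ S -> Q a2 S ==(1' - t)^ Bv S
    Ev S = ag(pJ a2 S)(au((1' - t)^_)(d0(_⊑ S)cG qT))
    zD : 0' < 1' - t
    zD = gA(da ½)(af(ad(aI ub))(bA 1'(c4 w8)))
    -- Here `2 t = 4 D yy`, so by Bernoulli the left side is at most `1 / (1 + 2 t)`, and this is at
    -- most `1 - t` because `2 t ≤ 1`.
    jp :(1' - yy)^(4 *' D)=< 1' - t
    jp = bZ(1' +(1' + 1')* t)(gA gW(bK((1' + 1')* t)(a7(wX(1' + 1'))kH)refl))(begin(1' +(1' + 1')* t)*(1' - yy)^(4 *' D)≤⟨ aX _(aQ(4 *' D)(e7 l6))(af(ad(au(1' +_)eq))(lu yy(4 *' D)ss))⟩(1' + yy)^(4 *' D)*(1' - yy)^(4 *' D)≡⟨ aI(b5(1' + yy)(1' - yy)(4 *' D))⟩((1' + yy)*(1' - yy))^(4 *' D)≤⟨ lZ(4 *' D)(a7(0≤+ ca ss)(e7 l6))(bK(yy * yy)(jT yy)(ci yy))⟩ 1' ≤⟨ bK(t *(1' -(1' + 1')* t))(a7 kH(e7 w7))(aZ t)⟩(1' +(1' + 1')* t)*(1' - t)∎)where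
     open RQ
     ci : ∀ y -> 1' ==(1' + y)*(1' - y)+ y * y
     ci = ap ar
     aZ : ∀ t ->(1' +(1' + 1')* t)*(1' - t)== 1' + t *(1' -(1' + 1')* t)
     aZ = ap ar
     d1 : ∀ h d r ->(1' + 1')* h *((1' + 1')*(d * r))==(1' + 1')*(1' + 1')* d *(h * r)
     d1 = ap ar
     eq :(1' + 1')* t == ι(4 *' D)* yy
     eq = ag(aI(aH((1' + 1')* t)))(ag(au(_*((1' + 1')* t))(aI vR))(ag(d1 ½(ι D)r)(au(\ z -> z * yy)(ag(au(\ z -> z * ι D)(aI(ag(cW 2 2)(aS _*_ l1 l1))))(aI(cW 4 D))))))
   -- Markov's inequality for `(1 - t) ^ X` loses the factor `(1 - t) ^ x`. By `jp`, `x * 4 D` of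
   -- the candidates pay for it; the remaining `8 κ Rn m` yield `½ ^ m`.
   pg :(x m : ℕ)-> x *'(4 *' P ^' ah es)+' 8 *' κ s *' Rn *' m <= ah qT -> aB(cI p l u N)(\ S -> ao(Bv S <=b x))=< ½ ^ m
   pg x m le = bZ((1' - t)^ x)(rt x zD)(begin(1' - t)^ x * aB d(\ S -> ao(Bv S <=b x))≤⟨ w3 d(Q a2)((1' - t)^ x)(ja a2)(\ S -> Bv S <=b x)(\ S q -> aL((1' - t)^ x =<_)(aI(Ev S))(f8(bO zD)xZ(lX(Bv S)x q)))⟩ aB d(Q a2)≤⟨ pL xY a2 Eu(aL(0' =<_)(aI t2)(e7 l6))⟩(1' - t *(w - t * δ))^ ah a2 ≡⟨ aS _^_ t2(fK cG qT)⟩(1' - yy)^ ah qT ≤⟨ f8(e7 l6)(bK yy ss(a0 yy))le ⟩(1' - yy)^(x *'(4 *' D)+' uT)≡⟨ zl(1' - yy)(x *'(4 *' D))uT ⟩(1' - yy)^(x *'(4 *' D))*(1' - yy)^ uT ≡⟨ au(_*(1' - yy)^ uT)(Cp(1' - yy)x(4 *' D))⟩((1' - yy)^(4 *' D))^ x *(1' - yy)^ uT ≤⟨ dS(aQ x(aQ(4 *' D)(e7 l6)))(j0 x(aQ(4 *' D)(e7 l6))jp)(aQ uT(e7 l6))(qQ uT m ss l6 st)⟩(1' - t)^ x * ½ ^ m ∎)where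
    open RQ
    d = cI p l u N
    uT = 8 *' κ s *' Rn *' m
    a0 : ∀ t -> 1' ==(1' - t)+ t
    a0 = ap ar
    xZ : 1' - t =< 1'
    xZ = bK t kH(a0 t)
    st : ι(2 *' m)=< ι uT * yy
    st = ad(aI(begin-equality ι uT * yy ≡⟨ au(\ z -> ι z * yy)(GW(κ s)Rn m)⟩ ι(2 *' m *' 2 *' K)* yy ≡⟨ au(_* yy)(ag(cW(2 *' m *' 2)K)(au(_* ι K)(ag(cW(2 *' m)2)(au(ι(2 *' m)*_)l1))))⟩ ι(2 *' m)*(1' + 1')* ι K *(½ * r)≡⟨ ci(ι(2 *' m))(1' + 1')(ι K)½ r ⟩ ι(2 *' m)*((1' + 1')* ½ *(ι K * r))≡⟨ au(ι(2 *' m)*_)(ag(aS _*_ vR Kr)(aH 1'))⟩ ι(2 *' m)* 1' ≡⟨ aF(ι(2 *' m))⟩ ι(2 *' m)∎))where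
     ci : ∀ m t k h r -> m * t * k *(h * r)== m *(t * h *(k * r))
     ci = ap ar
  -- Counts ordered pairs of present copies with a common vertex, over all injective tuples and not
  -- only over the candidates of one state. A single Markov bound on it therefore serves every
  -- state.
  hY : av N -> ℚ
  hY S = aM(aJ M s)(\ α -> aM(aJ M s)(\ β -> ao(bn α)*(ao(bn β)*(ao(1 <=b ∣ J(at α)(at β)∣)* ao((cG α ∪ cG β)⊑ S)))))
  module _ (e0 : ℕ) (hR : ∀ U → 1 <= ∣ U ∣ → M ^' (s -' ∣ U ∣) *' P ^' ch es U <= e0) where
   pQ : aB(cI p l u N)hY =< ι(ah(aJ M s))*(w *(ι(κ s)*(ι e0 * w)))
   pQ = begin aB d hY ≡⟨ ag(gC(aJ M s)d _)(bF(aJ M s)(\ α -> ag(gC(aJ M s)d _)(ag(bF(aJ M s)(\ β -> ag(c7 d(ao(bn α))_)(au(ao(bn α)*_)(ag(c7 d(ao(bn β))_)(au(ao(bn β)*_)(ag(c7 d(ao(1 <=b ∣ J(at α)(at β)∣))_)(au(ao(1 <=b ∣ J(at α)(at β)∣)*_)(iV l u(cG α ∪ cG β)))))))))(fy(aJ M s)(ao(bn α))_))))⟩ aM(aJ M s)(\ α -> ao(bn α)* aM(aJ M s)(\ β -> ao(bn β)*(ao(1 <=b ∣ J(at α)(at β)∣)* p ^ ∣ cG α ∪ cG β ∣)))≤⟨ cj(aJ M s)Cv ⟩ aM(aJ M s)(\ α -> c)≡⟨ bL(aJ M s)c ⟩ ι(ah(aJ M s))* c ∎ where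
    open RQ
    d = cI p l u N
    c = w *(ι(κ s)*(ι e0 * w))
    iu : 0' =< c
    iu = a7 jw(a7(aY(κ s))(a7(aY e0)jw))
    Cv : ∀ α -> ao(bn α)* aM(aJ M s)(\ β -> ao(bn β)*(ao(1 <=b ∣ J(at α)(at β)∣)* p ^ ∣ cG α ∪ cG β ∣))=< c
    Cv α with ly α
    ... | no _ = af(ad(bY(aM(aJ M s)(\ β -> ao(bn β)*(ao(1 <=b ∣ J(at α)(at β)∣)* p ^ ∣ cG α ∪ cG β ∣)))))iu
    ... | yes uR = af(ad(aH _))(ng 1(a7(aY e0)jw)(qS 1 e0 hR)(at α)(hs α uR))
 module _ {A : Set} (ov : A → A → bH) (Do : ∀ a b → T (ov a b) → T (ov b a)) where
  private
   pH : List A -> A -> ℕ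
   pH xs a = ah(aw(ov a)xs)
   dd :(b c : A -> bH)(xs : List A)-> ah(aw b(aw c xs))<= ah(aw b xs)
   dd b c [] = bI
   dd b c(x ∷ xs)with c x
   ... | false = aa(dd b c xs)(lq(b x))where
    lq : ∀ v -> ah(aw b xs)<= ah(if v then x ∷ aw b xs else aw b xs)
    lq true = bB _
    lq false = bT
   ... | true with b x
   ... | true = bl(dd b c xs)
   ... | false = dd b c xs
  -- Greedy choice: each chosen element excludes at most `t` members of the list, so `m * t` members
  -- suffice.
  su :(t m : ℕ)(xs : List A)-> 1 <= t -> m *' t <= ah xs ->(∀ a -> a ∈ xs -> ah(aw(ov a)xs)<= t)-> ∃ \(f : Fin m -> A)->(∀ i -> f i ∈ xs)×(∀ i j -> i ≢ j -> ¬ T(ov(f i)(f j)))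
  su t zero xs sv lq h =(\()),(\()), \()
  su t(suc m)[] sv lq h = aA(aV refl(aa(aa sv(a3 t _))lq))
  su t(suc m)xs@(x ∷ _)sv lq h with su t m(aw(ha ∘ ov x)xs)sv uU Ew where
   uU : m *' t <= ah(aw(ha ∘ ov x)xs)
   uU = rq t _ _(aa lq(aa(ae(aI(dT(ov x)xs)))(aK _(h x(here refl)))))
   Ew : ∀ a -> a ∈ aw(ha ∘ ov x)xs -> ah(aw(ov a)(aw(ha ∘ ov x)xs))<= t
   Ew a p = aa(dd(ov a)(ha ∘ ov x)xs)(h a(ai(aP(ha ∘ ov x)xs p)))
  ... | f , t3 , Cs = g , w9 , zE where
   g : Fin(suc m)-> A
   g zero = x
   g(suc i)= f i
   w9 : ∀ i -> g i ∈ xs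
   w9 zero = here refl
   w9(suc i)= ai(aP(ha ∘ ov x)xs(t3 i))
   F8 : ∀ i -> ¬ T(ov x(f i))
   F8 i = gc(proj₂(aP(ha ∘ ov x)xs(t3 i)))
   zE : ∀ i j -> i ≢ j -> ¬ T(ov(g i)(g j))
   zE zero zero sx _ = sx refl
   zE zero(suc j)sx q = F8 j q
   zE(suc i)zero sx q = F8 i(Do _ _ q)
   zE(suc i)(suc j)sx q = Cs i j(sx ∘ au suc)q
  -- By averaging, at most `X / 2` elements have more than `t` overlaps; the greedy choice runs on
  -- the others, of which at least `X / 2` remain.
  mK :(t m X : ℕ)(xs : List A)-> 1 <= t -> 2 *'(m *' t)<= X -> X <= ah xs -> aM xs(\ a -> aM xs(\ b -> ao(ov a b)))* ι 2 =< ι(X *' t)-> ∃ \(f : Fin m -> A)->(∀ i -> f i ∈ xs)×(∀ i j -> i ≢ j -> ¬ T(ov(f i)(f j)))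
  mK t m X xs sv Dp rZ Bw = let f , t3 , Cs = su t m Bx sv st zF in f ,(\ i -> ai(aP _ xs(t3 i))), Cs where
   Bx r0 : List A
   Bx = aw(\ a -> pH xs a <=b t)xs
   r0 = aw(\ a -> ha(pH xs a <=b t))xs
   zF : ∀ a -> a ∈ Bx -> ah(aw(ov a)Bx)<= t
   zF a p = aa(dd(ov a)_ xs)(lX _ t(proj₂(aP(\ a -> pH xs a <=b t)xs p)))
   sy : ι(ah r0)* ι t =< aM xs(\ a -> aM xs(\ b -> ao(ov a b)))
   sy = af(ad(ag(au(_* ι t)(fe(\ a -> ha(pH xs a <=b t))xs))(ag(e9 _(ι t))(aI(fy xs(ι t)(\ a -> ao(ha(pH xs a <=b t))))))))(cj xs pt)where
    pt : ∀ a -> ι t * ao(ha(pH xs a <=b t))=< aM xs(\ b -> ao(ov a b))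
    pt a with pH xs a <=b t in eq
    ... | true = af(ad(fJ(ι t)))(cZ xs(\ b -> a8(ov a b)))
    ... | false = af(ad(aF(ι t)))(af(bw(bW(dY(\ le -> aL T eq(f5 le)))))(ad(fe(ov a)xs)))
   uf : ah r0 *' 2 <= X
   uf = g9 _ _ t{{ℕ.>-nonZero sv}}(bS(begin ι(ah r0 *' 2 *' t)≡⟨ ag(cW(ah r0 *' 2)t)(au(_* ι t)(cW(ah r0)2))⟩ ι(ah r0)* ι 2 * ι t ≡⟨ a0(ι(ah r0))(ι 2)(ι t)⟩ ι(ah r0)* ι t * ι 2 ≤⟨ aX(ι 2)(aY 2)sy ⟩ _ ≤⟨ Bw ⟩ ι(X *' t)∎))where
    open RQ
    a0 : ∀ a b c -> a * b * c == a * c * b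
    a0 = ap ar
   st : m *' t <= ah Bx
   st = g9 _ _ 2(kA X _ _(begin m *' t *' 2 +' X ≡⟨ au(_+' X)(ck(m *' t)2)⟩ 2 *'(m *' t)+' X ≤⟨ aK X Dp ⟩ X +' X ≤⟨ fI rZ rZ ⟩ ah xs +' ah xs ≡⟨ ag(au(ah xs +'_)(aI(aW _)))(ck 2(ah xs))⟩ ah xs *' 2 ≡⟨ au(_*' 2)(aI(dT(\ a -> pH xs a <=b t)xs))⟩(ah Bx +' ah r0)*' 2 ≡⟨ lm 2(ah Bx)(ah r0)⟩ ah Bx *' 2 +' ah r0 *' 2 ≤⟨ bJ _ uf ⟩ ah Bx *' 2 +' X ∎))where
       open ℕₚ.≤-Reasoning

-- Uniform random tuples and clique densities.

module P7 where
 open M6 using (zero;suc)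
 open M7 using ([];_∷_;tabulate)
 open M0 using (ℕ;zero;suc)
 open M2 hiding (_÷_;∣_∣;floor)
 open M3
 open M8 using ([];_∷_;lookup;replicate)
 open M4
 open P1
 open P2
 open P4
 open P5
 private variable
  A B : Set
  s : ℕ
 kK : dx A ->(A -> dx B)-> dx B
 kK(i8 a)h = h a
 kK(wY p l u d e)h = wY p l u(kK d h)(kK e h)
 iF :(d : dx A)(h : A -> dx B)(f : B -> ℚ)-> aB(kK d h)f == aB d(\ a -> aB(h a)f)
 iF(i8 a)h f = refl
 iF(wY p l u d e)h f = aS(\ x y ->(1' - p)* x + p * y)(iF d h f)(iF e h f)
 bN : dx A -> ∀ s -> dx(Vec A s)
 bN d zero = i8 []
 bN d(suc s)= kK d(\ a -> k6(a ∷_)(bN d s))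
 eI :(d : dx A)(f : Vec A(suc s)-> ℚ)-> aB(bN d(suc s))f == aB d(\ a -> aB(bN d s)(f ∘(a ∷_)))
 eI{s = s}d f = ag(iF d _ f)(bf d(\ a -> hV(a ∷_)(bN d s)f))
 -- Independent coordinates are exchangeable, so any one of them may be drawn last; this singles out
 -- one entry of a random tuple.
 e1 :(d : dx A)(i : Fin(suc s))(f : Vec A(suc s)-> ℚ)-> aB(bN d(suc s))f == aB(bN d s)(\ v -> aB d(\ a -> f(d7 v i a)))
 e1{s = s}d zero f = ag(eI d f)(gB d(bN d s)(\ a v -> f(a ∷ v)))
 e1{s = suc s}d(suc i)f = ag(eI d f)(ag(bf d(\ b -> e1 d i(f ∘(b ∷_))))(aI(eI d(\ v -> aB d(\ a -> f(d7 v(suc i)a))))))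
 l7 :(d : dx A)(g : A -> ℚ)-> ∀ s -> aB(bN d s)(\ v -> Vec.foldr _(\ a r -> g a * r)1' v)== aB d g ^ s
 l7 d g zero = refl
 l7 d g(suc s)= ag(eI d _)(ag(bf d(\ a -> ag(c7(bN d s)(g a)_)(au(g a *_)(l7 d g s))))(j3 d g(aB d g ^ s)))
 ee : ∀ n -> dx(Fin(suc n))
 ee zero = i8 zero
 ee(suc n)= wY(ι(suc n)* r)(a7(aY(suc n))(bO FN))(af(aX r(bO FN)(bw(bB(suc n))))(ad eq))(i8 zero)(k6 suc(ee n))where
  r = ai(f9(ι(suc(suc n)))(cO(suc n)))
  FN = ai(proj₂(f9(ι(suc(suc n)))(cO(suc n))))
  eq = proj₂(proj₂(f9(ι(suc(suc n)))(cO(suc n))))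
 iY : ∀ n(g : Fin(suc n)-> A)(f : A -> ℚ)-> aM(tabulate g)f == ι(suc n)* aB(ee n)(f ∘ g)
 iY zero g f = ag(dL(f(g zero)))(aI(ag(au(_* f(g zero))jZ)(aH(f(g zero)))))
 iY(suc n)g f = ag(au(f(g zero)+_)(iY n(g ∘ suc)f))(ag(go(ι(suc n))(ι(suc(suc n)))r(f(g zero))(aB(ee n)(f ∘ g ∘ suc))(cV(suc n))eq)(au(\ z -> ι(suc(suc n))*((1' - ι(suc n)* r)* f(g zero)+ ι(suc n)* r * z))(aI(hV suc(ee n)(f ∘ g)))))where
  r = ai(f9(ι(suc(suc n)))(cO(suc n)))
  eq = proj₂(proj₂(f9(ι(suc(suc n)))(cO(suc n))))
  go : ∀ a b r x e -> b == 1' + a -> b * r == 1' -> x + a * e == b *((1' - a * r)* x + a * r * e)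
  go a b r x e xa xb = ag(au(\ z -> z + a * e)(j8 a b x xa))(ag(ci a b x e)(ag(au(\ z -> b * x - a * z * x + a * z * e)(aI xb))(aZ a b r x e)))where
   j8 : ∀ a b x -> b == 1' + a -> x == b * x - a * x
   j8 a _ x refl = a0 a x where
    a0 : ∀ a x -> x ==(1' + a)* x - a * x
    a0 = ap ar
   ci : ∀ a b x e -> b * x - a * x + a * e == b * x - a * 1' * x + a * 1' * e
   ci = ap ar
   aZ : ∀ a b r x e -> b * x - a *(b * r)* x + a *(b * r)* e == b *((1' - a * r)* x + a * r * e)
   aZ = ap ar
 jb : ∀ n(f : Fin(suc n)-> ℚ)-> aM(ax(suc n))f == ι(suc n)* aB(ee n)f
 jb n f = iY n(\ x -> x)f
 gg : ∀ n s(f : Vec(Fin(suc n))s -> ℚ)-> aM(aJ(suc n)s)f == ι(suc n)^ s * aB(bN(ee n)s)f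
 gg n zero f = ag(dL(f []))(aI(aH(f [])))
 gg n(suc s)f = begin aM(aJ(suc n)(suc s))f ≡⟨ hr(ax(suc n))(replicate s(ax(suc n)))f ⟩ aM(ax(suc n))(\ a -> aM(aJ(suc n)s)(f ∘(a ∷_)))≡⟨ bF(ax(suc n))(\ a -> gg n s(f ∘(a ∷_)))⟩ aM(ax(suc n))(\ a -> ι(suc n)^ s * aB(bN(ee n)s)(f ∘(a ∷_)))≡⟨ ag(fy(ax(suc n))(ι(suc n)^ s)_)(au(ι(suc n)^ s *_)(ag(jb n _)(au(ι(suc n)*_)(aI(eI(ee n)f)))))⟩ ι(suc n)^ s *(ι(suc n)* aB(bN(ee n)(suc s))f)≡⟨ a0(ι(suc n)^ s)(ι(suc n))_ ⟩ ι(suc n)* ι(suc n)^ s * aB(bN(ee n)(suc s))f ∎ where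
  open ≡-Reasoning
  a0 : ∀ a b c -> a *(b * c)== b * a * c
  a0 = ap ar
 bi :(A -> bH)-> Vec A s -> bH
 bi b [] = true
 bi b(x ∷ v)= b x ∧ bi b v
 gH :(b : A -> bH)(v : Vec A s)-> T(bi b v)-> ∀ x -> T(b(lookup v x))
 gH b(a ∷ v)t zero = ai(bh{b a}t)
 gH b(a ∷ v)t(suc x)= gH b v(proj₂(bh{b a}t))x
 he :(b : A -> bH)(v : Vec A s)(i : Fin(suc s))(a : A)-> ao(bi b(d7 v i a))== ao(b a)* ao(bi b v)
 he b v zero a = cX(b a)(bi b v)
 he b(c ∷ v)(suc i)a = ag(cX(b c)(bi b(d7 v i a)))(ag(au(ao(b c)*_)(he b v i a))(ag(a0(ao(b c))(ao(b a))(ao(bi b v)))(au(ao(b a)*_)(aI(cX(b c)(bi b v))))))where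
  a0 : ∀ x y z -> x *(y * z)== y *(x * z)
  a0 = ap ar
 c2 : Fin s ->(A -> bH)-> Vec A s -> bH
 c2 zero b(x ∷ v)= bi b v
 c2(suc i)b(x ∷ v)= b x ∧ c2 i b v
 fO :(b : A -> bH)(v : Vec A s)(i : Fin(suc s))(a : A)-> c2 i b(d7 v i a)== bi b v
 fO b v zero a = refl
 fO b(c ∷ v)(suc i)a = au(b c ∧_)(fO b v i a)
 module By {n : ℕ} (aR : Fin (suc n) → Fin (suc n) → bH) (oc : ∀ x y → aR x y == aR y x) where
  private
   V = Fin(suc n)
   d = ee n
  a5 : Vec V s -> bH
  a5 [] = true
  a5(a ∷ z)= bi(aR a)z ∧ a5 z
  fP :(v : Vec V s)(i : Fin(suc s))(a : V)-> ao(a5(d7 v i a))== ao(bi(aR a)v)* ao(a5 v)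
  fP v zero a = cX(bi(aR a)v)(a5 v)
  fP(c ∷ v)(suc i)a = begin ao(bi(aR c)(d7 v i a)∧ a5(d7 v i a))≡⟨ cX(bi(aR c)(d7 v i a))_ ⟩ ao(bi(aR c)(d7 v i a))* ao(a5(d7 v i a))≡⟨ aS _*_(he(aR c)v i a)(fP v i a)⟩ ao(aR c a)* ao(bi(aR c)v)*(ao(bi(aR a)v)* ao(a5 v))≡⟨ a0(ao(aR c a))(ao(bi(aR c)v))(ao(bi(aR a)v))(ao(a5 v))⟩ ao(aR c a)* ao(bi(aR a)v)*(ao(bi(aR c)v)* ao(a5 v))≡⟨ aS _*_(ag(au(\ z -> ao z * ao(bi(aR a)v))(oc c a))(aI(cX(aR a c)(bi(aR a)v))))(aI(cX(bi(aR c)v)(a5 v)))⟩ ao(aR a c ∧ bi(aR a)v)* ao(bi(aR c)v ∧ a5 v)∎ where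
   open ≡-Reasoning
   a0 : ∀ x y z w -> x * y *(z * w)== x * z *(y * w)
   a0 = ap ar
  -- The homomorphism density of the complete graph on `s` vertices.
  t : ℕ -> ℚ
  t s = aB(bN d s)(ao ∘ a5)
  pH : Vec V s -> ℚ
  pH z = aB d(\ a -> ao(bi(aR a)z))
  zG : ∀ s -> t(suc s)== aB(bN d s)(\ z -> ao(a5 z)* pH z)
  zG s = ag(e1 d zero(ao ∘ a5))(bf(bN d s)(\ z -> ag(bf d(\ a -> cX(bi(aR a)z)(a5 z)))(ag(j3 d(\ a -> ao(bi(aR a)z))(ao(a5 z)))(e9(pH z)(ao(a5 z))))))
  kH : ∀ s -> 0' =< t s
  kH s = eP(bN d s)(\ z -> a8(a5 z))
  private
   -- The homomorphism density of the complete graph on `s + 2` vertices with one edge removed.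
   S : ℕ -> ℚ
   S s = aB(bN d s)(\ z -> ao(a5 z)*(pH z * pH z))
   l8 :(b : A -> bH)(v : Vec A s)-> T(bi b v)->(i : Fin s)-> c2 i b v == true
   l8 b(x ∷ v)t zero = f1(proj₂(bh{b x}t))
   l8 b(x ∷ v)t(suc i)with b x
   ... | true = l8 b v t i
   hg :(b : A -> bH)(v : Vec A s)-> ¬ T(bi b v)-> ∀{q}(g : Fin s -> Fin q)-> aM(tabulate(\ i -> c2 i b v))ao =< 1'
   hg b [] f g = aA(f tt)
   hg b(x ∷ v)f{q}g with b x
   ... | false = af(ad(ag(au(ao(bi b v)+_)(x0 v))(dL _)))(hU(bi b v))where
    x0 : ∀{s}(v : Vec _ s)-> aM(tabulate{n = s}(\ i -> false))ao == 0'
    x0 [] = refl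
    x0(_ ∷ v)= ag(bu _)(x0 v)
   ... | true with bi b v in eq
   ... | true = aA(f tt)
   ... | false = af(ad(bu _))(hg b v(\ t -> aL T eq t)(g ∘ suc))
   sz :(b : A -> bH)(v : Vec A(suc s))-> aM(tabulate(\ i -> c2 i b v))ao =< 1' + ι s * ao(bi b v)
   sz{s = s}b v with bi b v in eq
   ... | false = af(hg b v(\ t -> aL T eq t)(\ i -> i))(ad(aI(ag(au(1' +_)(fJ(ι s)))(dL 1'))))
   ... | true = ad(ag(Bz(\ i -> c2 i b v)(l8 b v(ei eq)))(ag(cV s)(au(1' +_)(aI(aF(ι s))))))where
    Bz : ∀{q}(h : Fin q -> bH)->(∀ i -> h i == true)-> aM(tabulate h)ao == ι q
    Bz{zero}h p = aI iA
    Bz{suc q}h p = ag(aS _+_(au ao(p zero))(Bz(h ∘ suc)(p ∘ suc)))(aI(cV q))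
   od : ∀{q}(h : Fin q -> ℚ)(c : ℚ)->(∀ i -> h i == c)-> aM(tabulate h)(\ x -> x)== ι q * c
   od{zero}h c p = aI(ag(au(_* c)iA)(bY c))
   od{suc q}h c p = ag(aS _+_(p zero)(od(h ∘ suc)c(p ∘ suc)))(ag(a0 c(ι q))(au(_* c)(aI(cV q))))where
    a0 : ∀ c i -> c + i * c ==(1' + i)* c
    a0 = ap ar
   pR : ∀{q}(h : Fin q -> A)(f : A -> ℚ)-> aM(tabulate h)f == aM(tabulate(f ∘ h))(\ x -> x)
   pR{q = zero}h f = refl
   pR{q = suc q}h f = au(f(h zero)+_)(pR(h ∘ suc)f)
   ni : ∀{q}(hP : dx A)(h : Fin q -> A -> ℚ)-> aB hP(\ a -> aM(tabulate(\ i -> h i a))(\ x -> x))== aM(tabulate(\ i -> aB hP(h i)))(\ x -> x)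
   ni{q = zero}hP h = bk hP 0'
   ni{q = suc q}hP h = ag(eY hP(h zero)_)(au(aB hP(h zero)+_)(ni hP(h ∘ suc)))
   x1 : ∀{q}c(h : Fin q -> ℚ)-> aM(tabulate(\ i -> c * h i))(\ x -> x)== c * aM(tabulate h)(\ x -> x)
   x1{zero}c h = aI(fJ c)
   x1{suc q}c h = ag(au(c * h zero +_)(x1 c(h ∘ suc)))(aI(tZ c(h zero)_))
   -- Fix a clique on `s + 1` vertices and a further vertex `w`. If `w` sees the whole clique it
   -- sees every sub-clique with one vertex left out; otherwise it sees at most one of these `s + 1`
   -- sub-cliques. Averaging this count gives the inequality.
   sA : ∀ s -> ι(suc s)* S s =< t(suc s)+ ι s * t(suc(suc s))
   sA s = begin ι(suc s)* S s ≡⟨ aI(od uS(S s)x2)⟩ aM(tabulate uS)(\ x -> x)≡⟨ aI(ag(bf dz(\ z -> ni d(\ i w -> ao(a5 z)* ao(c2 i(aR w)z))))(ni dz(\ i z -> aB d(\ w -> ao(a5 z)* ao(c2 i(aR w)z)))))⟩ aB dz(\ z -> aB d(\ w -> aM(tabulate(\ i -> ao(a5 z)* ao(c2 i(aR w)z)))(\ x -> x)))≤⟨ bm dz(\ z -> bm d(\ w -> pt z w))⟩ aB dz(\ z -> aB d(\ w -> ao(a5 z)+ ι s *(ao(bi(aR w)z)* ao(a5 z))))≡⟨ bf dz(\ z -> ag(eY d(\ _ -> ao(a5 z))(\ w -> ι s *(ao(bi(aR w)z)* ao(a5 z))))(aS _+_(bk d(ao(a5 z)))(ag(c7 d(ι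 s)_)(au(ι s *_)(ag(j3 d(\ w -> ao(bi(aR w)z))(ao(a5 z)))(e9(pH z)(ao(a5 z))))))))⟩ aB dz(\ z -> ao(a5 z)+ ι s *(ao(a5 z)* pH z))≡⟨ ag(eY dz(ao ∘ a5)(\ z -> ι s *(ao(a5 z)* pH z)))(au(t(suc s)+_)(ag(c7 dz(ι s)_)(au(ι s *_)(aI(zG(suc s))))))⟩ t(suc s)+ ι s * t(suc(suc s))∎ where
    open RQ
    dz = bN d(suc s)
    uS : Fin(suc s)-> ℚ
    uS i = aB dz(\ z -> aB d(\ w -> ao(a5 z)* ao(c2 i(aR w)z)))
    x2 : ∀ i -> uS i == S s
    x2 i = ag(e1 d i(\ z -> aB d(\ w -> ao(a5 z)* ao(c2 i(aR w)z))))(bf(bN d s)(\ v -> ag(bf d(\ a -> ag(bf d(\ w -> aS _*_(fP v i a)(au ao(fO(aR w)v i a))))(c7 d(ao(bi(aR a)v)* ao(a5 v))(\ w -> ao(bi(aR w)v)))))(ag(j3 d(\ a -> ao(bi(aR a)v)* ao(a5 v))(pH v))(ag(au(_* pH v)(j3 d(\ a -> ao(bi(aR a)v))(ao(a5 v))))(a0(pH v)(ao(a5 v)))))))where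
     a0 : ∀ x c -> x * c * x == c *(x * x)
     a0 = ap ar
    pt : ∀ z w -> aM(tabulate(\ i -> ao(a5 z)* ao(c2 i(aR w)z)))(\ x -> x)=< ao(a5 z)+ ι s *(ao(bi(aR w)z)* ao(a5 z))
    pt z w = af(ad(x1(ao(a5 z))(\ i -> ao(c2 i(aR w)z))))(af(aO(ao(a5 z))(a8(a5 z))(af(ad(aI(pR(\ i -> c2 i(aR w)z)ao)))(sz(aR w)z)))(ad(a0(ao(a5 z))(ι s)(ao(bi(aR w)z)))))where
     a0 : ∀ c i x -> c *(1' + i * x)== c + i *(x * c)
     a0 = ap ar
   -- The square of `pH - y`, averaged over cliques, is nonnegative. This form of Cauchy-Schwarz
   -- needs no division by `t s`.
   Ey : ∀ s y -> 0' =< y -> y * t s =< t(suc s)-> y * t(suc s)=< S s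
   Ey s y hT h = af(bK(y *(t(suc s)- y * t s))(a7 hT(e7 h))(a0 y(t(suc s))(t s)))(af(ad(aI eq))(bm dz pt))where
    dz = bN d s
    a0 : ∀ y a b ->(y + y)* a +(-(y * y))* b == y * a + y *(a - y * b)
    a0 = ap ar
    eq : aB dz(\ z ->(y + y)*(ao(a5 z)* pH z)+(-(y * y))* ao(a5 z))==(y + y)* t(suc s)+(-(y * y))* t s
    eq = ag(eY dz(\ z ->(y + y)*(ao(a5 z)* pH z))(\ z ->(-(y * y))* ao(a5 z)))(aS _+_(ag(c7 dz(y + y)_)(au((y + y)*_)(aI(zG s))))(c7 dz(-(y * y))(ao ∘ a5)))
    pt : ∀ z ->(y + y)*(ao(a5 z)* pH z)+(-(y * y))* ao(a5 z)=< ao(a5 z)*(pH z * pH z)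
    pt z = bK(ao(a5 z)*((pH z - y)*(pH z - y)))(a7(a8(a5 z))(jT(pH z - y)))(aZ(ao(a5 z))y(pH z))where
     aZ : ∀ c y g -> c *(g * g)==(y + y)*(c * g)+(-(y * y))* c + c *((g - y)*(g - y))
     aZ = ap ar
  t1 : t 1 == 1'
  t1 = ag(eI d(ao ∘ a5))(bk d 1')
  -- The Moon-Moser inequality. The bound for `s` feeds `Ey`, which bounds `S s` from below, while
  -- `sA` bounds it from above by the next two clique densities.
  jc : ∀ s -> 0' =< 1' - ι s *(1' - t 2)->(1' - ι s *(1' - t 2))* t s =< t(suc s)
  jc zero _ = ad(ag(aS _*_(ag(au(\ z -> 1' - z *(1' - t 2))iA)(ag(au(\ z -> 1' - z)(bY(1' - t 2)))refl))refl)(ag(aH 1')(aI t1)))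
  jc(suc zero)_ = ad(ag(aS(\ a b ->(1' - a *(1' - t 2))* b)jZ t1)(a0(t 2)))where
   a0 : ∀ x ->(1' - 1' *(1' - x))* 1' == x
   a0 = ap ar
  jc(suc s@(suc _))h = bZ(ι s)(cO _)(begin ι s *(y(ι(suc s))* t(suc s))≡⟨ au(\ z -> ι s *(y z * t(suc s)))(cV s)⟩ ι s *(y(1' + ι s)* t(suc s))≡⟨ a0(ι s)(t 2)(t(suc s))⟩(1' + ι s)*(y(ι s)* t(suc s))- t(suc s)≤⟨ bC(- t(suc s))(aO(1' + ι s)(0≤+ ca(aY s))(Ey s(y(ι s))xc(jc s xc)))⟩(1' + ι s)* S s - t(suc s)≡⟨ au(\ z -> z * S s - t(suc s))(aI(cV s))⟩ ι(suc s)* S s - t(suc s)≤⟨ bC(- t(suc s))(sA s)⟩ t(suc s)+ ι s * t(suc(suc s))- t(suc s)≡⟨ aZ(t(suc s))(ι s * t(suc(suc s)))⟩ ι s * t(suc(suc s))∎)where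
   open RQ
   y : ℚ -> ℚ
   y i = 1' - i *(1' - t 2)
   pS : 0' =< 1' - t 2
   pS = e7(af(bm(bN d 2)(\ z -> hU(a5 z)))(ad(bk(bN d 2)1')))
   xc : 0' =< y(ι s)
   xc = af h(bA 1'(c4(aX(1' - t 2)pS(bw(bB s)))))
   a0 : ∀ i x u -> i *((1' -(1' + i)*(1' - x))* u)==(1' + i)*((1' - i *(1' - x))* u)- u
   a0 = ap ar
   aZ : ∀ a b -> a + b - a == b
   aZ = ap ar
  j9 : ∀ k η -> 0' =< η -> η =< 1' - ι k *(1' - t 2)-> η ^ k =< t(suc k)
  j9 k η qU h = go k bT where
   pS : 0' =< 1' - t 2
   pS = e7(af(bm(bN d 2)(\ z -> hU(a5 z)))(ad(bk(bN d 2)1')))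
   go : ∀ j -> j <= k -> η ^ j =< t(suc j)
   go zero _ = ad(aI t1)
   go(suc j)le = af(dS qU zH(aQ j qU)(go j(aa(bB j)le)))(jc(suc j)(af qU zH))where
    zH : η =< 1' - ι(suc j)*(1' - t 2)
    zH = af h(bA 1'(c4(aX(1' - t 2)pS(bw le))))

-- Weighted cliques under placement constraints.

module P8 where
 open M6 using (zero;suc)
 open M16 using (_∈_)
 open M13 using (here;there)
 open M7 using ([];_∷_)
 open M0 using (ℕ;zero;suc)
 open M1 using (_×_)
 open M2 hiding (_÷_;∣_∣;floor)
 open M3
 open M8 using ([];_∷_;lookup)
 open M4
 open P1
 open P2
 open P4
 open P5
 open P7
 private variable
  A B : Set
  s : ℕ
 jV :(i : Fin s)(b : A -> bH)(v : Vec A s)-> T(c2 i b v)-> ∀ x -> x ≢ i -> T(b(lookup v x))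
 jV zero b(a ∷ v)t zero vY = aA(vY refl)
 jV zero b(a ∷ v)t(suc x)vY = gH b v t x
 jV(suc i)b(a ∷ v)t zero vY = ai(bh{b a}t)
 jV(suc i)b(a ∷ v)t(suc x)vY = jV i b v(proj₂(bh{b a}t))x(vY ∘ au suc)
 sB :(A -> ℚ)-> Vec A s -> ℚ
 sB g = Vec.foldr _(\ a r -> g a * r)1'
 module dP {n : ℕ} (aR : Fin (suc n) → Fin (suc n) → bH) (oc : ∀ x y → aR x y == aR y x) (k : ℕ) where
  open By aR oc public
  V = Fin(suc n)
  -- A state of the embedding: the entry `(i , w)` records that `w` has been placed in part `i`.
  bP = List(Fin(suc k)× V)
  private
   d = ee n
   dz = bN d(suc k)
  BB : bP -> Vec V(suc k)-> bH
  BB [] z = true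
  BB((i , w)∷ L)z = c2 i(aR w)z ∧ BB L z
  P : bP -> Vec V(suc k)-> bH
  P L z = a5 z ∧ BB L z
  -- The weight of a state: the probability that a random tuple of `k + 1` vertices is a clique in
  -- which every placed vertex could replace the entry of its own part (`c2 i` skips position `i`).
  -- The embedding can go on while this stays bounded below.
  b0 : bP -> ℚ
  b0 L = aB dz(ao ∘ P L)
  f0 : Fin(suc k)× V -> Fin(suc k)× V -> bH
  f0(i , x)(j , y)= ⌊ i ≟ᶠ j ⌋ ∨ aR x y
  e2 : bP -> Fin(suc k)-> V -> bH
  e2 [] i w = true
  e2(e ∷ L)i w = f0(i , w)e ∧ e2 L i w
  sC : ∀ L z -> T(BB L z)-> ∀{i w}->(i , w)∈ L -> T(c2 i(aR w)z)
  sC((i , w)∷ L)z t(here refl)= ai(bh{c2 i(aR w)z}t)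
  sC((i , w)∷ L)z t(there p)= sC L z(proj₂(bh{c2 i(aR w)z}t))p
  uV : ∀ L z ->(∀{i w}->(i , w)∈ L -> T(c2 i(aR w)z))-> T(BB L z)
  uV [] z h = tt
  uV((i , w)∷ L)z h = cA{c2 i(aR w)z}(h(here refl))(uV L z(h ∘ there))
  jC : ∀ L i w -> T(e2 L i w)-> ∀{e}-> e ∈ L -> T(f0(i , w)e)
  jC(e ∷ L)i w t(here refl)= ai(bh{f0(i , w)e}t)
  jC(e ∷ L)i w t(there p)= jC L i w(proj₂(bh{f0(i , w)e}t))p
  oe : ∀ L i w ->(∀{e}-> e ∈ L -> T(f0(i , w)e))-> T(e2 L i w)
  oe [] i w h = tt
  oe(e ∷ L)i w h = cA{f0(i , w)e}(h(here refl))(oe L i w(h ∘ there))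
  lC : ∀ L -> b0 L =< 1'
  lC L = af(bm dz(\ z -> hU(P L z)))(ad(bk dz 1'))
  qV : ∀{L b1}->(∀{e}-> e ∈ L -> e ∈ b1)-> b0 b1 =< b0 L
  qV{L}{b1}sub = bm dz(\ z -> dg{P b1 z}{P L z}(\ t -> cA{a5 z}(ai(bh{a5 z}t))(uV L z(\ p -> sC b1 z(proj₂(bh{a5 z}t))(sub p)))))
  uX : b0 [] == t(suc k)
  uX = bf dz(\ z -> ag(cX(a5 z)true)(aF(ao(a5 z))))
  private
   og : ∀ i w L z -> ao(P((i , w)∷ L)z)== ao(c2 i(aR w)z)* ao(P L z)
   og i w L z = ag(cX(a5 z)_)(ag(au(ao(a5 z)*_)(cX(c2 i(aR w)z)(BB L z)))(ag(a0(ao(a5 z))(ao(c2 i(aR w)z))(ao(BB L z)))(au(ao(c2 i(aR w)z)*_)(aI(cX(a5 z)(BB L z))))))where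
    a0 : ∀ x y z -> x *(y * z)== y *(x * z)
    a0 = ap ar
   vZ : ∀ L i v a -> T(P L(d7 v i a))-> T(e2 L i a ∧ bi(aR a)v)
   vZ L i v a t = cA{e2 L i a}(oe L i a GZ)v0 where
    z = d7 v i a
    GZ : ∀{e}-> e ∈ L -> T(f0(i , a)e)
    GZ{j , w}p with i ≟ᶠ j
    ... | yes _ = tt
    ... | no sx = aL T(oc w a)(aL(T ∘ aR w)(FW v i a)(jV j(aR w)z(sC L z(proj₂(bh{a5 z}t))p)i sx))
    v0 : T(bi(aR a)v)
    v0 with a5 z | fP v i a | ai(bh{a5 z}t)
    ... | true | eq | _ with bi(aR a)v
    ... | true = tt
    ... | false = aA(1≢0(ag eq(bY(ao(a5 v)))))
  -- Cauchy-Schwarz with the `i`-th entry drawn twice: if both draws complete the same remaining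
  -- entries to an admissible clique, the second draw `w` is compatible with `L` and may be recorded
  -- as placed.
  jd : ∀ L i -> b0 L * b0 L =< aB d(\ w -> ao(e2 L i w)* b0((i , w)∷ L))
  jd L i = begin b0 L * b0 L ≡⟨ aS _*_ uZ uZ ⟩ aB dv ψ * aB dv ψ ≡⟨ au(aB dv ψ *_)(aI(aF(aB dv ψ)))⟩ aB dv ψ ^ 2 ≤⟨ kG dv ψ(\ v -> eP d(\ a -> a8(P L(d7 v i a))))2 ⟩ aB dv(\ v -> ψ v ^ 2)≤⟨ bm dv(\ v -> af(ad(au(ψ v *_)(aF(ψ v))))(aO(ψ v)(eP d(\ a -> a8(P L(d7 v i a))))(x3 v)))⟩ aB dv(\ v -> ψ v * φ v)≡⟨ aI(ag(e1 d i g)(bf dv(\ v -> ag(bf d(\ a -> au(ao(P L(d7 v i a))*_)(bf d(\ w -> au(\ q -> ao(e2 L i w)* ao q)(fO(aR w)v i a)))))(j3 d(\ a -> ao(P L(d7 v i a)))(φ v)))))⟩ aB dz g ≡⟨ bf dz(\ z -> ag(aI(c7 d(ao(P L z))(\ w -> ao(e2 L i w)* ao(c2 i(aR w)z))))(bf d(\ w -> ag(a0(ao(P L z))(ao(e2 L i w))(ao(c2 i(aR w)z)))(au(ao(e2 L i w)*_)(aI(og i w L z))))))⟩ aB dz(\ z -> aB d(\ w -> ao(e2 L i w)* ao(P((i , w)∷ L)z)))≡⟨ ag(gB dz d(\ z w -> ao(e2 L i w)* ao(P((i , w)∷ L)z)))(bf d(\ w -> c7 dz(ao(e2 L i w))(\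 z -> ao(P((i , w)∷ L)z))))⟩ aB d(\ w -> ao(e2 L i w)* b0((i , w)∷ L))∎ where
   open RQ
   dv = bN d k
   ψ φ : Vec V k -> ℚ
   ψ v = aB d(\ a -> ao(P L(d7 v i a)))
   φ v = aB d(\ w -> ao(e2 L i w)* ao(bi(aR w)v))
   uZ : b0 L == aB dv ψ
   uZ = e1 d i(ao ∘ P L)
   x3 : ∀ v -> ψ v =< φ v
   x3 v = bm d(\ a -> af(dg{P L(d7 v i a)}{e2 L i a ∧ bi(aR a)v}(vZ L i v a))(ad(cX(e2 L i a)_)))
   g : Vec V(suc k)-> ℚ
   g z = ao(P L z)* aB d(\ w -> ao(e2 L i w)* ao(c2 i(aR w)z))
   a0 : ∀ p f o -> p *(f * o)== f *(o * p)
   a0 = ap ar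
  bj : Fin(suc k)-> Vec V s -> bP -> bP
  bj i [] L = L
  bj i(w ∷ ws)L =(i , w)∷ bj i ws L
  -- Jensen's inequality: for a fixed clique the entries of the tuple are independent, so the
  -- average over tuples of length `s` is an `s`-th power of the average over one vertex.
  oK : ∀{m}(y : Fin(suc m)-> V)(b : Fin(suc m)-> bH)(i : Fin(suc k))(L : bP)-> ∀ s -> 1 <= s -> aB(ee m)(\ a -> ao(b a)* b0((i , y a)∷ L))^ s =< aB(bN(ee m)s)(\ β -> ao(bi b β)* b0(bj i(Vec.map y β)L))
  oK{m}y b i L s jx = begin aB dm(\ a -> ao(b a)* b0((i , y a)∷ L))^ s ≡⟨ au(_^ s)(ag(bf dm(\ a -> aI(c7 dz(ao(b a))(ao ∘ P((i , y a)∷ L)))))(ag(gB dm dz(\ a z -> ao(b a)* ao(P((i , y a)∷ L)z)))(bf dz(\ z -> ag(bf dm(\ a -> ag(au(ao(b a)*_)(og i(y a)L z))(a0(ao(b a))(ao(c2 i(aR(y a))z))(ao(P L z)))))(c7 dm(ao(P L z))(g z))))))⟩ aB dz(\ z -> ao(P L z)* φ z)^ s ≤⟨ kG dz(\ z -> ao(P L z)* φ z)(\ z -> a7(a8(P L z))(eP dm(\ a -> a7(a8(b a))(a8(c2 i(aR(y a))z)))))s ⟩ aB dz(\ z ->(ao(P L z)* φ z)^ s)≡⟨ bf dz(\ z -> ag(b5(ao(P L z))(φ z)s)(ag(au(_* φ z ^ s)(zI(P L z)s jx))(au(ao(P L z)*_)(aI(l7 dm(g z)s)))))⟩ aB dz(\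 z -> ao(P L z)* aB(bN dm s)(sB(g z)))≡⟨ ag(bf dz(\ z -> ag(aI(c7(bN dm s)(ao(P L z))(sB(g z))))(bf(bN dm s)(\ β -> aI(ph β z)))))(gB dz(bN dm s)_)⟩ aB(bN dm s)(\ β -> aB dz(\ z -> ao(bi b β)* ao(P(bj i(Vec.map y β)L)z)))≡⟨ bf(bN dm s)(\ β -> c7 dz(ao(bi b β))(ao ∘ P(bj i(Vec.map y β)L)))⟩ aB(bN dm s)(\ β -> ao(bi b β)* b0(bj i(Vec.map y β)L))∎ where
   open RQ
   dm = ee m
   g : Vec V(suc k)-> Fin(suc m)-> ℚ
   g z a = ao(b a)* ao(c2 i(aR(y a))z)
   φ : Vec V(suc k)-> ℚ
   φ z = aB dm(g z)
   a0 : ∀ x o p -> x *(o * p)== p *(x * o)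
   a0 = ap ar
   zI : ∀ b q -> 1 <= q -> ao b ^ q == ao b
   zI true q _ = 1^ q
   zI false(suc q)_ = bY(ao false ^ q)
   ph : ∀{q}(β : Vec(Fin(suc m))q)z -> ao(bi b β)* ao(P(bj i(Vec.map y β)L)z)== ao(P L z)* sB(g z)β
   ph [] z = e9 1'(ao(P L z))
   ph(a ∷ β)z = begin-equality ao(b a ∧ bi b β)* ao(P((i , y a)∷ bj i(Vec.map y β)L)z)≡⟨ aS _*_(cX(b a)(bi b β))(og i(y a)(bj i(Vec.map y β)L)z)⟩ ao(b a)* ao(bi b β)*(ao(c2 i(aR(y a))z)* ao(P(bj i(Vec.map y β)L)z))≡⟨ aZ(ao(b a))(ao(bi b β))(ao(c2 i(aR(y a))z))(ao(P(bj i(Vec.map y β)L)z))⟩ g z a *(ao(bi b β)* ao(P(bj i(Vec.map y β)L)z))≡⟨ au(g z a *_)(ph β z)⟩ g z a *(ao(P L z)* sB(g z)β)≡⟨ d1(g z a)(ao(P L z))(sB(g z)β)⟩ ao(P L z)* sB(g z)(a ∷ β)∎ where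
    aZ : ∀ x q o p -> x * q *(o * p)== x * o *(q * p)
    aZ = ap ar
    d1 : ∀ x p q -> x *(p * q)== p *(x * q)
    d1 = ap ar

-- Enumerated subgraphs and induced subgraphs.

module P9 where
 open M6 using (zero;suc)
 open M17 using (<-cmp)
 open M9 using (_∈_;inside)
 open M11 using (x∈p∩q⁻;x∈p∩q⁺;p∩q⊆p;_∈?_;_⊆?_)
 open M7 using ([];_∷_)
 open M18 using (∈-concatMap⁺)
 open M13 using (here;there)
 open M10 using ([];_∷_)
 open M0 using (ℕ;zero;suc;_≤_)
 open M1 using (_×_)
 open M8 using ([];_∷_;lookup;replicate)
 open M4 hiding ([_])
 open M15 using (toWitness)
 open M5
 open P4 using (cT)
 private variable
  n : ℕ
  A : Set
 rv : ∀{a b}->(T a -> T b)->(T b -> T a)-> a == b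
 rv{true}{true}f g = refl
 rv{true}{false}f g = aA(f _)
 rv{false}{true}f g = aA(g _)
 rv{false}{false}f g = refl
 pT :{x y : Fin n}-> x Fin.< y ->(x , y)∈ˡ jo n
 pT{n}{x}{y}lt = gV(\(x , y)-> x <?ᶠ y)(dM(∈-allFin x)(∈-allFin y))lt
 l9 :(G : a1 n){x y : Fin n}-> x Fin.< y -> T(adj G x y)->(x , y)∈ˡ ba G
 l9 G lt t = gV(\(x , y)-> T?(adj G x y))(pT lt)t
 hZ :(G : a1 n){x y : Fin n}->(x , y)∈ˡ ba G -> x Fin.< y × T(adj G x y)
 hZ{n}G p = let q , t = eO(\(x , y)-> T?(adj G x y)){xs = jo n}p in proj₂(eO(\(x , y)-> x <?ᶠ y){xs = bD(ax n)(ax n)}q), t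
 ma : ∀ n -> eD(jo n)
 ma n = FG(\(x , y)-> x <?ᶠ y)(lr(allFin⁺ n)(allFin⁺ n))
 fY :(G : a1 n)-> cT(ba G)
 fY{n}G = FG(\(x , y)-> T?(adj G x y))(ma n), All.tabulate(\ p -> ai(hZ G p))
 qW :(G : a1 n){x y : Fin n}-> T(adj G x y)->(x , y)∈ˡ ba G ⊎(y , x)∈ˡ ba G
 qW G{x}{y}t with <-cmp x y
 ... | tri< lt _ _ = aD(l9 G lt t)
 ... | tri≈ _ refl _ = aA(irrefl G t)
 ... | tri> _ _ gt = aG(l9 G gt(sym-adj G t))
 iG :(G : a1 n){x y : Fin n}->(x , y)∈ˡ ba G ⊎(y , x)∈ˡ ba G -> T(adj G x y)
 iG G(aD p)= proj₂(hZ G p)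
 iG G(aG p)= sym-adj G(proj₂(hZ G p))
 hh :(xs : List A)-> xs ∈ˡ bG xs
 hh [] = here refl
 hh(x ∷ xs)= c8(bG xs)(zb(x ∷_)(hh xs))
 db :{xs ys : List A}-> ys ∈ˡ bG xs -> ∀{y}-> y ∈ˡ ys -> y ∈ˡ xs
 db{xs = []}(here refl)q = q
 db{xs = x ∷ xs}p q with kx(bG xs)p
 ... | aD gZ = there(db gZ q)
 ... | aG gZ with zc(x ∷_)gZ
 db{xs = x ∷ xs}p(here refl)| aG gZ | ys , Ez , refl = here refl
 db{xs = x ∷ xs}p(there q)| aG gZ | ys , Ez , refl = there(db Ez q)
 dE :(m8 : Vec(List A)n)(v : Vec A n)->(∀ i -> lookup v i ∈ˡ lookup m8 i)-> v ∈ˡ em m8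
 dE [] [] h = here refl
 dE(xs ∷ m8)(a ∷ v)h = w1 _∷_(h zero)(dE m8 v(h ∘ suc))
 dF :(m8 : Vec(List A)n)(v : Vec A n)-> v ∈ˡ em m8 -> ∀ i -> lookup v i ∈ˡ lookup m8 i
 dF [] [] p()
 dF(xs ∷ m8)v p i with w2 _∷_ xs(em m8)p
 dF(xs ∷ m8).(a ∷ w)p zero | a , w , q , r , refl = q
 dF(xs ∷ m8).(a ∷ w)p(suc i)| a , w , q , r , refl = dF m8 w r i
 hI :(W : av n)-> W ∈ˡ F1 n
 hI{n}W = dE(replicate n(Bo ∷ inside ∷ []))W(\ i -> aL(lookup W i ∈ˡ_)(aI(mb i))(sD(lookup W i)))where
  mb : ∀{m}(i : Fin m)-> lookup(replicate m(Bo ∷ inside ∷ []))i == Bo ∷ inside ∷ []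
  mb zero = refl
  mb(suc i)= mb i
  sD : ∀ b -> b ∈ˡ(Bo ∷ inside ∷ [])
  sD false = here refl
  sD true = there(here refl)
 gh :(G : a1 n)(W : av n){x y : Fin n}-> T(adj(G [ W ])x y)-> x ∈ W × y ∈ W × T(adj G x y)
 gh G W{x}{y}t = toWitness{a? = x ∈? W ×-dec y ∈? W ×-dec T?(adj G x y)}t
 gi :(G : a1 n)(W : av n){x y : Fin n}-> x ∈ W -> y ∈ W -> T(adj G x y)-> T(adj(G [ W ])x y)
 gi G W{x}{y}a b t = bc{a? = x ∈? W ×-dec y ∈? W ×-dec T?(adj G x y)}(a , b , t)
 ff :(V : av n)(S : List(Fin n × Fin n)){x y : Fin n}-> T(adj(cs V S)x y)-> x ∈ V × y ∈ V × ¬ x == y ×((x , y)∈ˡ S ⊎(y , x)∈ˡ S)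
 ff V S{x}{y}t = toWitness{a? = x ∈? V ×-dec y ∈? V ×-dec ¬?(x ≟ᶠ y)×-dec((x , y)∈ˡ? S ⊎-dec(y , x)∈ˡ? S)}t
 fg :(V : av n)(S : List(Fin n × Fin n)){x y : Fin n}-> x ∈ V × y ∈ V × ¬ x == y ×((x , y)∈ˡ S ⊎(y , x)∈ˡ S)-> T(adj(cs V S)x y)
 fg V S{x}{y}h = bc{a? = x ∈? V ×-dec y ∈? V ×-dec ¬?(x ≟ᶠ y)×-dec((x , y)∈ˡ? S ⊎-dec(y , x)∈ˡ? S)}h
 -- Graphs contain functions and proofs, so an induced subgraph is only `≈` to a member of
 -- `subgraphs`; this is the listed representative.
 sE : a1 n -> av n -> a1 n
 sE G W = cs W(ba(G [ W ]))
 sF :(G : a1 n)(W : av n)-> W ⊆ verts G -> ∀ x y -> adj(sE G W)x y == adj(G [ W ])x y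
 sF G W EA x y = rv(\ t -> iG(G [ W ])(proj₂(proj₂(proj₂(ff W _ t)))))(\ t -> let a , b , c = gh G W t in fg W _(a , b ,(\{ refl -> irrefl G c }), qW(G [ W ])t))
 fh :(G : a1 n)(W : av n)-> W ⊆ verts G -> sE G W ∈ˡ e6 G
 fh{n}G W EA = ∈-concatMap⁺(\ W -> fd(cs W)(bG(ba(G [ W ])))){xs = c9(_⊆? verts G)(F1 n)}(Any.map(\{ refl -> zb(cs W)(hh(ba(G [ W ])))})(gV(_⊆? verts G)(hI W)EA))
 pU :(G : a1 n){J : a1 n}-> J ∈ˡ e6 G -> verts J ⊆ verts G ×(∀{x y}-> T(adj J x y)-> T(adj G x y))
 pU{n}G p with GS(FH(\ W -> fd(cs W)(bG(ba(G [ W ])))){xs = c9(_⊆? verts G)(F1 n)}p)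
 ... | W , F9 , q with zc(cs W)q
 ... | S , pV , refl = proj₂(eO(_⊆? verts G){xs = F1 n}F9), \{x}{y}t -> proj₂(proj₂(gh G W(iG(G [ W ])(map⊎(db pV)(db pV)(proj₂(proj₂(proj₂(ff W S t))))))))
 nonempty : a1 n -> List(a1 n)
 nonempty H = c9(\ J -> 1 ℕₚ.≤? v J)(e6 H)
 ht :(G : a1 n)(W : av n)-> 1 ≤ v(G [ W ])-> Any(G [ W ] ≈_)(nonempty G)
 ht G W lD = Any.map(\{ refl -> refl , \ x y -> ag(rv(\ t -> let a , b , c = gh G W t in gi G BC(x∈p∩q⁺(support G c , a))(x∈p∩q⁺(support G(sym-adj G c), b))c)(\ t -> let a , b , c = gh G BC t in gi G W(proj₂(x∈p∩q⁻(verts G)W a))(proj₂(x∈p∩q⁻(verts G)W b))c))(aI(sF G BC(p∩q⊆p(verts G)W)x y))})(gV(\ J -> 1 ℕₚ.≤? v J)(fh G BC(p∩q⊆p(verts G)W))lD)where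
  BC = verts G ∩ W

-- Deterministic embedding of some `H j` for a fixed colouring.

module Ha where
 open M6 using (zero;suc)
 open M9 using (∣_∣)
 open M11 using (x∈p∩q⁺)
 open M7 using ([];_∷_)
 open M16 using (_∈_)
 open M13 using (here;there)
 open M0 using (ℕ;zero;suc)
 open M1 using (∃;_×_)
 open M2 using (ℚ;_≤_)
 open M3 using (_≤?_;≤-trans)
 open M8 using ([];_∷_;lookup;tabulate)
 open M4 hiding ([_])
 open M15 using (toWitness)
 open M5 hiding (_≤ᴿ_)
 open P2 using (aw)
 open P4
 open P5 using (∈-concatMap⁺)
 open P8
 open P9
 dk :{A : Set}(b lE : A -> bH)(xs : List A)->(∀{a}-> T(b a)-> T(lE a))-> ah(aw b xs)<= ah(aw lE xs)
 dk b lE [] h = bI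
 dk b lE(x ∷ xs)h with b x | lE x | h{x}
 ... | true | true | _ = bl(dk b lE xs h)
 ... | true | false | g = aA(g tt)
 ... | false | true | _ = a6(dk b lE xs h)
 ... | false | false | _ = dk b lE xs h
 dU :{A : Set}(b lE : A -> bH)(xs : List A){x : A}->(∀{a}-> T(b a)-> T(lE a))-> x ∈ xs -> ¬ T(b x)-> T(lE x)-> ah(aw b xs)<' ah(aw lE xs)
 dU b lE(x ∷ xs)h(here refl)zJ x4 with b x | lE x
 ... | true | _ = aA(zJ tt)
 ... | false | true = bl(dk b lE xs h)
 dU b lE(y ∷ xs)h(there p)zJ x4 with b y | lE y | h{y}
 ... | true | true | _ = bl(dU b lE xs h p zJ x4)
 ... | true | false | g = aA(g tt)
 ... | false | true | _ = a6(dU b lE xs h p zJ x4)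
 ... | false | false | _ = dU b lE xs h p zJ x4
 lF :{A : Set}{xs : List A}{t : A}-> ah xs <= 0 -> ¬(t ∈ xs)
 lF{xs = []}_()
 fB : ∀{m}(W : av m)-> 1 <= ∣ W ∣ -> ∃ \ y -> y ∈ₛ W
 fB(true ∷ W)lD = zero , Vec.here
 fB(false ∷ W)lD = let y , p = fB W lD in suc y , Vec.there p
 module Core {n : ℕ} (aR : Fin (suc n) → Fin (suc n) → bH) (de : ∀ x y → aR x y == aR y x)(pW : ∀ x -> ¬ T(aR x x))(k : ℕ){r : ℕ}(𝐇 : Vec bq r)(c : Vec(Fin r)(suc n))(hj : ∀{s}-> cS s -> Vec(Fin(suc n))s -> bH)(ε : ℕ -> ℚ)(mc : ∀ x y -> x <= y -> ε y ≤ ε x)where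
  open dP aR de k
  K : ℕ
  K = suc k
  cf : Fin r -> ℕ
  cf j = ai(lookup 𝐇 j)
  H :(j : Fin r)-> a1(cf j)
  H j = proj₂(lookup 𝐇 j)
  Dq : ℚ -> bP -> Fin K -> Fin r -> ∀{s}-> a1 s -> Vec V s -> Set
  Dq σ L i j J α = ky α ×(∀ x -> lookup c(lookup α x)== j)×(∀ x -> T(e2 L i(lookup α x)))× T(hj(ba J)α)× σ ≤ b0(bj i α L)
  Cw : ∀ σ L i j{s}(J : a1 s)(α : Vec V s)-> o8(Dq σ L i j J α)
  Cw σ L i j J α = ly α ×-dec(D5 \ x -> lookup c(lookup α x)≟ᶠ j)×-dec(D5 \ x -> T?(e2 L i(lookup α x)))×-dec T?(hj(ba J)α)×-dec(σ ≤? b0(bj i α L))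
  pX : ℚ -> bP -> Fin K -> Fin r -> ∀{s}-> a1 s -> Set
  pX σ L i j J = ∃(Dq σ L i j J)
  pi : ∀ σ L i j{s}(J : a1 s)-> o8(pX σ L i j J)
  pi σ L i j{s}J = anyᵛ? s(Cw σ L i j J)
  _⊆ᴸ_ : bP -> bP -> Set
  L ⊆ᴸ b1 = ∀{e}-> e ∈ L -> e ∈ b1
  bM : ∀ i{s}(α : Vec V s)L{e}-> e ∈ bj i α L ->(∃ \ x -> e ==(i , lookup α x))⊎ e ∈ L
  bM i [] L p = aG p
  bM i(a ∷ α)L(here refl)= aD(zero , refl)
  bM i(a ∷ α)L(there p)with bM i α L p
  ... | aD(x , eq)= aD(suc x , eq)
  ... | aG q = aG q
  bU : ∀ i{s}(α : Vec V s)L -> L ⊆ᴸ bj i α L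
  bU i [] L p = p
  bU i(a ∷ α)L p = there(bU i α L p)
  bV : ∀ i{s}(α : Vec V s)L x ->(i , lookup α x)∈ bj i α L
  bV i(a ∷ α)L zero = here refl
  bV i(a ∷ α)L(suc x)= there(bV i α L x)
  oL : ∀ i{s}(α : Vec V s){L b1}-> L ⊆ᴸ b1 -> bj i α L ⊆ᴸ bj i α b1
  oL i α{L}{b1}sub p with bM i α L p
  ... | aD(x , refl)= bV i α b1 x
  ... | aG q = bU i α b1(sub q)
  c5 : ∀ i{s}(α : Vec V s)L -> ah(bj i α L)== s +' ah L
  c5 i [] L = refl
  c5 i(a ∷ α)L = au suc(c5 i α L)
  pj : ∀{σ sG L b1 i j s}{J : a1 s}-> sG ≤ σ -> b1 ⊆ᴸ L -> pX σ L i j J -> pX sG b1 i j J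
  pj{L = L}{b1}{i}x5 sub(α , a , b , f , e , g)= α , a , b ,(\ x -> oe b1 i(lookup α x)(\ p -> jC L i(lookup α x)(f x)(sub p))), e , ≤-trans x5(≤-trans g(qV(oL i α sub)))
  k9 : bP -> Set
  k9 L = ∀{e lA}-> e ∈ L -> lA ∈ L -> T(f0 e lA)
  sH : ∀ e lA -> T(f0 e lA)-> T(f0 lA e)
  sH(i , x)(j , y)t with lw{⌊ i ≟ᶠ j ⌋}t
  ... | aD p = gb(bc{a? = j ≟ᶠ i}(aI(toWitness{a? = i ≟ᶠ j}p)))
  ... | aG p = hq{⌊ j ≟ᶠ i ⌋}(aL T(de x y)p)
  rw : ∀ i x y -> T(f0(i , x)(i , y))
  rw i x y = gb(bc{a? = i ≟ᶠ i}refl)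
  mL : ∀ i{s}(α : Vec V s)L ->(∀ x -> T(e2 L i(lookup α x)))-> k9 L -> k9(bj i α L)
  mL i α L f m p q with bM i α L p | bM i α L q
  ... | aD(x , refl)| aD(y , refl)= rw i _ _
  ... | aD(x , refl)| aG pk = jC L i _(f x)pk
  ... | aG gZ | aD(y , refl)= sH _ _(jC L i _(f y)gZ)
  ... | aG gZ | aG pk = m gZ pk
  Triple : Set
  Triple = Fin K × Σ(Fin r)(\ j -> a1(cf j))
  gI : List Triple
  gI = ce(\ i -> ce(\ j -> fd(\ J -> i , j , J)(nonempty(H j)))(ax r))(ax K)
  kL : ∀ i j{J}-> J ∈ nonempty(H j)->(i , j , J)∈ gI
  kL i j p = ∈-concatMap⁺ _(∈-allFin i)(∈-concatMap⁺(\ j -> fd(\ J -> i , j , J)(nonempty(H j)))(∈-allFin j)(∈-map⁺ _ _ p))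
  g0 : ℚ -> bP -> Triple -> bH
  g0 σ L(i , j , J)= ⌊ pi σ L i j J ⌋
  md : ℚ -> bP -> Fin K ->(j : Fin r)-> a1(cf j)-> bH
  md σ L i j J = ha(g0 σ L(i , j , J))
  pl : ℚ -> bP ->(j : Fin r)-> Fin K -> List(a1(cf j))
  pl σ L j i = aw(md σ L i j)(nonempty(H j))
  -- The families of subgraphs that have no usable copy. Were they certificates for every `j`, the
  -- hypothesis `sI` would name a tuple of unusable graphs, contrary to `yU`. So they fail for some
  -- `j`, and failure means a partition of `H j` all of whose non-empty parts are usable.
  gJ : ℚ -> bP ->(j : Fin r)-> Vec(List(a1(cf j)))K
  gJ σ L j = tabulate(pl σ L j)
  je : ∀ σ L j i -> lookup(gJ σ L j)i == aw(md σ L i j)(nonempty(H j))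
  je σ L j i = a9(pl σ L j)i
  module _ (ej : ∀ j → 1 <= v (H j)) (U : a1 (suc n)) (BD : ∀ x → x ∈ₛ verts U)(pY : ∀ x y -> T(aR x y)-> T(adj U x y))(ka : ∀{s}(es : cS s)α -> T(hj es α)-> ∀{e}-> e ∈ es -> T(adj U(lookup α(ai e))(lookup α(proj₂ e))))(ez :(∀ j -> a1(cf j))-> Set)(sI :(a2 : ∀ j -> Vec(List(a1(cf j)))K)->(∀ j i -> ∃ \(b : a1(cf j)-> bH)-> lookup(a2 j)i == aw b(nonempty(H j)))->(∀ j -> cm(H j)K(a2 j))-> ∃ \ i -> ∃ \(A : ∀ j -> a1(cf j))->(∀ j -> A j ∈ lookup(a2 j)i)× ez A)(lG : bP)(nj X : ℕ)(h : ℕ)(dQ : ∀ j -> cf j <= h)(yU : ∀ L x -> x <' X -> lG ⊆ᴸ L -> k9 L -> ah L <= nj -> ε x ≤ b0 L -> ∀ i(A : ∀ j -> a1(cf j))->(∀ j -> A j ∈ nonempty(H j))-> ez A -> ∃ \ j -> pX(ε(suc x))L i j(A j))where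
   x6 : Set
   x6 = ∃ \ j -> ∃ \ f -> zf U c j(H j)f
   private
    module zK (j : Fin r) (aN : Vec (Fin K) (cf j)) (w : ℕ) where
     dp : Fin K -> a1(cf j)
     dp i = H j [ jQ aN i ]
     yV : Fin K -> bP -> Set
     yV i L = v(dp i)== 0 ⊎(∃ \ J -> ∃ \ α -> dp i ≈ J × ky α ×(∀ x -> lookup c(lookup α x)== j)× T(hj(ba J)α)×(∀ x ->(i , lookup α x)∈ L))
     EB : bP -> ℕ -> ℕ -> Set
     EB L y ℓ = ∃ \ b1 -> ∃ \ cL -> ∃ \ i -> ∃ \ J -> L ⊆ᴸ b1 × k9 b1 × ah b1 <= ah L +' ℓ *' h × ε cL ≤ b0 b1 × cL +' w <= y +' ℓ *' w × J ∈ nonempty(H j)× dp i ≈ J × ¬ pX(ε(cL +' w))b1 i j J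
     -- Places the parts of `H j` one after the other, moving down `w` levels for each. A part
     -- usable at the start may cease to be so; `EB` records the state, the level and the part at
     -- which this happens.
     ug : ∀ is L y -> k9 L -> ε y ≤ b0 L -> EB L y(ah is)⊎(∃ \ b1 -> L ⊆ᴸ b1 × k9 b1 ×(∀{i}-> i ∈ is -> yV i b1))
     ug [] L y m d = aG(L ,(\ p -> p), m , \())
     ug(i ∷ is)L y m d with 1 ℕₚ.≤? v(dp i)
     ... | no xd with ug is L y m d
     ... | aD(b1 , cL , mV , J , s , mu , lq , dy , yw , eZ)= aD(b1 , cL , mV , J , s , mu , aa lq(bJ(ah L)(bg _ h)), dy , aa yw(bJ y(bg _ w)), eZ)
     ... | aG(b1 , s , mu , f)= aG(b1 , s , mu , \{(here refl)-> aD(ln(fw(dY xd)));(there p)-> f p })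
     ug(i ∷ is)L y m d | yes lD with GS(ht(H j)(jQ aN i)lD)
     ... | J , la , eq with pi(ε(y +' w))L i j J
     ... | no Dr = aD(L , y , i , J ,(\ p -> p), m , a3 _ _ , d , bJ y(a3 w _), la , eq , Dr)
     ... | yes(α , uR , m2 , ft , cp , dn)with ug is(bj i α L)(y +' w)(mL i α L ft m)dn
     ... | aD(b1 , cL , mV , u0 , s , mu , lq , dy , yw , eZ)= aD(b1 , cL , mV , u0 ,(\ p -> s(bU i α L p)), mu , aa lq(aa(aK _(aa(ae(c5 i α L))(aK(ah L)(dQ j))))(ae(ag(au(_+' ah is *' h)(el h(ah L)))(r4(ah L)h _)))), dy , aa yw(ae(r4 y w _)), eZ)
     ... | aG(b1 , s , mu , f)= aG(b1 ,(\ p -> s(bU i α L p)), mu , \{(here refl)-> aG(J , α , eq , uR , m2 , cp , \ x -> s(bV i α L x));(there p)-> f p })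
     nk : ∀ x -> x ∈ₛ jQ aN(lookup aN x)
     nk x = fq x _(f1(aL T(aI(bv x _ aN))(bc{a? = lookup aN x ≟ᶠ lookup aN x}refl)))
     -- Gluing: edges inside one part come from the copy placed there, edges between parts from the
     -- dense relation `aR`, since any two placed vertices of different parts are adjacent in it.
     zL : ∀ L -> k9 L ->(∀ i -> yV i L)-> ∃ \ f -> zf U c j(H j)f
     zL L mu yW = f , u1 , jn , nl where
      me : ∀{i}-> yV i L -> Fin(cf j)-> V
      me(aD _)x = zero
      me(aG(_ , α , _))x = lookup α x
      at : Fin K -> Fin(cf j)-> V
      at i = me(yW i)
      pos : Fin(cf j)-> V
      pos x = at(lookup aN x)x
      f = tabulate pos
      x7 : ∀ x -> x ∈ₛ verts(H j)-> 1 <= v(dp(lookup aN x))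
      x7 x oz = gf(verts(dp(lookup aN x)))x(ei(gz(x∈p∩q⁺(oz , nk x))))
      BE : ∀ x -> x ∈ₛ verts(H j)-> lookup c(pos x)== j ×(lookup aN x , pos x)∈ L
      BE x oz with yW(lookup aN x)
      ... | aD eq = aA(aV(aI eq)(x7 x oz))
      ... | aG(J , α , _ , _ , m2 , _ , m)= m2 x , m x
      u2 : ∀{i}(s : yV i L)-> 1 <= v(dp i)-> ∀ x y -> me s x == me s y -> x == y
      u2(aD p)q = aA(aV(aI p)q)
      u2(aG(J , α , _ , uR , _))_ = uR
      sJ : ∀{i}(s : yV i L)-> 1 <= v(dp i)-> ∀ x y -> T(adj(dp i)x y)-> T(adj U(me s x)(me s y))
      sJ(aD p)q = aA(aV(aI p)q)
      sJ(aG(J , α ,(_ , Hb), _ , _ , cp , _))_ x y t with qW J(aL T(Hb x y)t)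
      ... | aD p = ka(ba J)α cp p
      ... | aG p = sym-adj U(ka(ba J)α cp p)
      v1 : ∀ x y -> x ∈ₛ verts(H j)-> lookup aN x == lookup aN y -> pos x == pos y -> x == y
      v1 x y oz Cx eq = u2(yW(lookup aN x))(x7 x oz)x y(ag eq(au(\ i -> at i y)(aI Cx)))
      uh : ∀ x y -> lookup aN x == lookup aN y -> T(adj(H j)x y)-> T(adj U(pos x)(pos y))
      uh x y Cx t = aL(\ z -> T(adj U(pos x)z))(au(\ i -> at i y)Cx)(sJ(yW(lookup aN x))(x7 x(support(H j)t))x y(gi(H j)(jQ aN(lookup aN x))(nk x)(aL(\ i -> y ∈ₛ jQ aN i)(aI Cx)(nk y))t))
      cross : ∀ x y -> x ∈ₛ verts(H j)-> y ∈ₛ verts(H j)-> lookup aN x ≢ lookup aN y -> T(aR(pos x)(pos y))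
      cross x y oz xe ne with lw{⌊ lookup aN x ≟ᶠ lookup aN y ⌋}(mu(proj₂(BE x oz))(proj₂(BE y xe)))
      ... | aD p = aA(ne(toWitness{a? = lookup aN x ≟ᶠ lookup aN y}p))
      ... | aG p = p
      u1 : ∀ x -> x ∈ₛ verts(H j)-> lookup f x ∈ₛ verts U × lookup c(lookup f x)== j
      u1 x oz = BD _ , ag(au(lookup c)(a9 pos x))(ai(BE x oz))
      jn : ∀ x y -> x ∈ₛ verts(H j)-> y ∈ₛ verts(H j)-> lookup f x == lookup f y -> x == y
      jn x y oz xe eq with ag(aI(a9 pos x))(ag eq(a9 pos y))| lookup aN x ≟ᶠ lookup aN y
      ... | nm | yes Cx = v1 x y oz Cx nm
      ... | nm | no ne = aA(pW(pos y)(aL(\ z -> T(aR z(pos y)))nm(cross x y oz xe ne)))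
      nl : ∀ x y -> T(adj(H j)x y)-> T(adj U(lookup f x)(lookup f y))
      nl x y t = lp(\ a b -> T(adj U a b))(aI(a9 pos x))(aI(a9 pos y))(go(lookup aN x ≟ᶠ lookup aN y))where
       go : o8(lookup aN x == lookup aN y)-> T(adj U(pos x)(pos y))
       go(yes Cx)= uh x y Cx t
       go(no ne)= pY _ _(cross x y(support(H j)t)(support(H j)(sym-adj(H j)t))ne)
   qX : ∀ f -> 1 <= K ^' f
   qX f = bz K f
   private
    lH :(j : Fin r)-> Vec(List(a1(cf j)))K -> Vec(Fin K)(cf j)-> Set
    lH j a2 aN = ¬(∃ \ i -> Any((H j [ jQ aN i ])≈_)(lookup a2 i))
    pm : ∀ j a2 aN -> o8(lH j a2 aN)
    pm j a2 aN = ¬?(FI \ i -> pG((H j [ jQ aN i ])≈?_)(lookup a2 i))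
    ui : ∀ j a2 -> cm(H j)K a2 ⊎ ∃(lH j a2)
    ui j a2 with anyᵛ?(cf j)(pm j a2)
    ... | yes p = aG p
    ... | no uQ = aD \ aN -> vP(FI \ i -> pG((H j [ jQ aN i ])≈?_)(lookup a2 i))(\ q -> uQ(aN , q))
    pZ :(a2 : ∀ j -> Vec(List(a1(cf j)))K)->(∀ j -> cm(H j)K(a2 j))⊎(∃ \ j -> ∃(lH j(a2 j)))
    pZ a2 with FI(\ j -> anyᵛ?(cf j)(pm j(a2 j)))
    ... | yes p = aG p
    ... | no uQ = aD go where
     go : ∀ j -> cm(H j)K(a2 j)
     go j with ui j(a2 j)
     ... | aD q = q
     ... | aG q = aA(uQ(j , q))
    nn : ∀ σ L j aN i{J}-> lH j(gJ σ L j)aN -> J ∈ nonempty(H j)->(H j [ jQ aN i ])≈ J -> T(g0 σ L(i , j , J))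
    nn σ L j aN i{J}EC la eq with g0 σ L(i , j , J)in e
    ... | true = tt
    ... | false = aA(EC(i , aL(Any((H j [ jQ aN i ])≈_))(aI(je σ L j i))(lose(cE(md σ L i j)(nonempty(H j))la(aL(T ∘ ha)(aI e)tt))eq)))
   -- Induction on a bound `f` for the number of usable triples. If the placing of parts gets stuck,
   -- a triple that was usable is so no longer. Usability at the later state and its level implies
   -- usability at the earlier ones, so the number drops. One attempt makes `K` moves of `K ^ f`
   -- levels, whence the budget `K ^ (f + 1)`.
   lc : ∀ f x L -> x +' K ^' f <= X -> lG ⊆ᴸ L -> k9 L -> ah L +' f *'(K *' h)<= nj -> ε x ≤ b0 L -> ah(aw(g0(ε(x +' K ^' f))L)gI)<= f -> x6
   lc f x L xX sub mu lq d Bw with pZ(gJ(ε(x +' K ^' f))L)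
   ... | aD oA = aA(zM(sI(gJ σ L)(\ j i -> md σ L i j , je σ L j i)oA))where
    σ = ε(x +' K ^' f)
    zM : ¬(∃ \ i -> ∃ \(A : ∀ j -> a1(cf j))->(∀ j -> A j ∈ lookup(gJ σ L j)i)× ez A)
    zM(i , A , d2 , xf)with yU L x(aa(aL(_<= x +' K ^' f)(el x 1)(bJ x(qX f)))xX)sub mu(aa(a3 _ _)lq)d i A(\ j -> ai(iw j))xf where
     iw : ∀ j -> A j ∈ nonempty(H j)× T(ha(g0 σ L(i , j , A j)))
     iw j = aP(md σ L i j)(nonempty(H j))(aL(A j ∈_)(je σ L j i)(d2 j))
    ... | j , al = gc(proj₂(aP(md σ L i j)(nonempty(H j))(aL(A j ∈_)(je σ L j i)(d2 j))))(bc{a? = pi σ L i j(A j)}(pj{J = A j}(mc(suc x)(x +' K ^' f)(aL(_<= x +' K ^' f)(el x 1)(bJ x(qX f))))(\ p -> p)al))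
   -- No triple is usable, yet the part of the partition that contains a vertex of `H j` would have
   -- to be.
   lc zero x L xX sub mu lq d Bw | aG(j , aN , EC)= aA(nr(fB(verts(H j))(ej j)))where
    σ = ε(x +' K ^' 0)
    open zK j aN 1
    nr : ¬(∃ \ y -> y ∈ₛ verts(H j))
    nr(y , xe)with GS(ht(H j)(jQ aN(lookup aN y))(gf(verts(dp(lookup aN y)))y(ei(gz(x∈p∩q⁺(xe , nk y))))))
    ... | J , la , eq = lF Bw(cE(g0 σ L)gI(kL(lookup aN y)j la)(nn σ L j aN(lookup aN y)EC la eq))
   lc(suc f)x L xX sub mu lq d Bw | aG(j , aN , EC)with zK.ug j aN(K ^' f)(ax K)L x mu d
   ... | aG(b1 , _ , zN , yW)= j , zK.zL j aN(K ^' f)b1 zN(\ i -> yW(∈-allFin i))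
   ... | aD(b1 , cL , i , J , s , zN , uU , hP , yw , la , eq , Dr)= lc f cL b1(aa(aL(\ z -> cL +' K ^' f <= x +' z *' K ^' f)BF yw)xX)(\ p -> s(sub p))zN(aa(aK _ uU)(aa(ae(ag(au(\ z -> ah L +' z *' h +' f *'(K *' h))BF)(r4(ah L)(K *' h)_)))lq))hP(fw(aa(dU(g0 sG b1)(g0 σ L)gI{i , j , J}(\{ {i , j , J}t -> bc{a? = pi σ L i j J}(pj{J = J}x5 s(toWitness{a? = pi sG b1 i j J}t))})(kL i j la)(\ t -> Dr(toWitness{a? = pi sG b1 i j J}t))(nn σ L j aN i EC la eq))Bw))where
    σ = ε(x +' K ^' suc f)
    sG = ε(cL +' K ^' f)
    BF : ah(ax K)== K
    BF = cR{n = K}(\ x -> x)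
    x5 : σ ≤ sG
    x5 = mc _ _(aL(\ z -> cL +' K ^' f <= x +' z *' K ^' f)BF yw)

-- The densities in terms of vertex sets, and the two leading graphs of a tuple.

module BG where
 open M6 using (zero;suc)
 open M9 using (∣_∣)
 open M11 using (x∈p∩q⁺;p∩q⊆p;∣p∩q∣≤∣q∣;∣⁅x⁆∣≡1;x∈⁅y⁆⇒x≡y)
 open M7 using ([];_∷_)
 open M16 using (_∈_)
 open M10 using ([];_∷_)
 open M12 using ([];_∷_)
 open M13 using (here;there)
 open M0 using (ℕ;zero;suc)
 open M1 using (∃;_×_)
 open M2 hiding (_÷_;∣_∣;floor)
 open M3
 open M8 using ([];_∷_;lookup;tabulate)
 open M4 hiding ([_])
 open M5
 open P1
 open P2 using (aw)
 open P4 using (ch; lW; kI; aP; bh; cA; ∈-map⁺; ∈-map⁻)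
 open P9
 open Data.List.Sort m₁-decreasing using (sort; sort-↭; sort-↗)
 private variable
  n r : ℕ
  A : Set
 Ga : ∀ n -> 0 ÷ suc n == 0'
 Ga n = 0/n≡0(suc n)
 v2 : ∀ j n -> j ÷ suc n == ι j *(1 ÷ suc n)
 v2 zero n = ag(Ga n)(aI(ag(au(_*(1 ÷ suc n))iA)(bY(1 ÷ suc n))))
 v2(suc j)n = ag(aI(+-÷ 1 j n))(ag(au(1 ÷ suc n +_)(v2 j n))(ag(a0(1 ÷ suc n)(ι j))(au(_*(1 ÷ suc n))(aI(cV j)))))where
  a0 : ∀ x i -> x + i * x ==(1' + i)* x
  a0 = ap ar
 ED : ∀ n -> suc n ÷ suc n == 1'
 ED n = D4(/-mono(suc n)n 1 0(ae(ck(suc n)1)))(/-mono 1 0(suc n)n(ae(ck 1(suc n))))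
 xg : ∀ n ->(1 ÷ suc n)* ι(suc n)== 1'
 xg n = ag(e9(1 ÷ suc n)(ι(suc n)))(ag(aI(v2(suc n)n))(ED n))
 gK : ∀ m n ->(m ÷ suc n)* ι(suc n)== ι m
 gK m n = ag(au(_* ι(suc n))(v2 m n))(ag(hp(ι m)(1 ÷ suc n)(ι(suc n)))(ag(au(ι m *_)(xg n))(aF(ι m))))
 xh : ∀ m n -> 0' =< m ÷ n
 xh m zero = bR
 xh m(suc n)= aL(_=< m ÷ suc n)(Ga 0)(/-mono 0 0 m n bI)
 jf :{x : ℚ}{xs : List ℚ}-> x ∈ xs -> x =< k4 xs
 jf{xs = y ∷ ys}(here refl)= p≤p⊔q y(k4 ys)
 jf{xs = y ∷ ys}(there p)= af(jf p)(p≤q⊔p y(k4 ys))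
 jg : ∀ xs -> 0' =< k4 xs
 jg [] = bR
 jg(x ∷ xs)= af(jg xs)(p≤q⊔p x(k4 xs))
 fi : ∀ xs -> 0' < k4 xs -> k4 xs ∈ xs
 fi [] lt = aA(za refl lt)
 fi(x ∷ xs)lt with ⊔-sel x(k4 xs)
 ... | aD eq = here eq
 ... | aG eq = aL(_∈(x ∷ xs))(aI eq)(there(fi xs(aL(0' <_)eq lt)))
 private
  e3 : ∀ y xs{x}-> x ∈(y ∷ xs)-> HB _⊓_ y xs =< x
  e3 y [](here refl)= bR
  e3 y(z ∷ xs)(here refl)= af(p⊓q≤q z _)(e3 y xs(here refl))
  e3 y(z ∷ xs)(there(here refl))= p⊓q≤p z _
  e3 y(z ∷ xs)(there(there p))= af(p⊓q≤q z _)(e3 y xs(there p))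
  iZ : ∀ y xs -> HB _⊓_ y xs ∈(y ∷ xs)
  iZ y [] = here refl
  iZ y(z ∷ xs)with ⊓-sel z(HB _⊓_ y xs)
  ... | aD eq = there(here eq)
  ... | aG eq with iZ y xs
  ... | here nm = here(ag eq nm)
  ... | there p = there(there(aL(_∈ xs)(aI eq)p))
 ns : ∀{xs x}-> x ∈ xs -> F2 xs =< x
 ns{y ∷ xs}p = e3 y xs p
 iH : ∀{x xs}-> x ∈ xs -> F2 xs ∈ xs
 iH{xs = y ∷ xs}_ = iZ y xs
 hu :{P : A -> Set}(f : A -> ℚ)(P? : ∀ a -> o8(P a))(xs : List A){x : A}-> x ∈ xs -> P x -> f x =< k4(fd f(c9 P? xs))
 hu f P? xs p q = jf(∈-map⁺ f(c9 P? xs)(gV P? p q))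
 d8 :{P : A -> Set}(f : A -> ℚ)(P? : ∀ a -> o8(P a))(xs : List A)-> 0' < k4(fd f(c9 P? xs))-> ∃ \ x -> x ∈ xs × P x × k4(fd f(c9 P? xs))== f x
 d8 f P? xs lt with ∈-map⁻ f(c9 P? xs)(fi(fd f(c9 P? xs))lt)
 ... | x , oz , eq = let p , q = eO P?{xs = xs}oz in x , p , q , eq
 cq :{P Q : A -> Set}(P? : ∀ a -> o8(P a))(Q? : ∀ a -> o8(Q a))(b : A -> bH)(xs : List A)->(∀ a -> P a -> T(b a)-> Q a)-> ah(aw b(c9 P? xs))<= ah(c9 Q? xs)
 cq P? Q? b [] h = bI
 cq P? Q? b(x ∷ xs)h with P? x | Q? x
 ... | no _ | yes _ = a6(cq P? Q? b xs h)
 ... | no _ | no _ = cq P? Q? b xs h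
 ... | yes p | q with b x | h x p
 ... | false | _ with q
 ... | yes _ = a6(cq P? Q? b xs h)
 ... | no _ = cq P? Q? b xs h
 cq P? Q? b(x ∷ xs)h | yes p | yes _ | true | _ = bl(cq P? Q? b xs h)
 cq P? Q? b(x ∷ xs)h | yes p | no Hc | true | g = aA(Hc(g tt))
 cv :{P Q : A -> Set}(P? : ∀ a -> o8(P a))(Q? : ∀ a -> o8(Q a))(b : A -> bH)(xs : List A)->(∀ a -> Q a -> P a × T(b a))-> ah(c9 Q? xs)<= ah(aw b(c9 P? xs))
 cv P? Q? b [] h = bI
 cv P? Q? b(x ∷ xs)h with P? x | Q? x
 ... | no uQ | yes q = aA(uQ(ai(h x q)))
 ... | no _ | no _ = cv P? Q? b xs h
 ... | yes _ | yes q with b x | proj₂(h x q)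
 ... | true | _ = bl(cv P? Q? b xs h)
 cv P? Q? b(x ∷ xs)h | yes _ | no _ with b x
 ... | true = a6(cv P? Q? b xs h)
 ... | false = cv P? Q? b xs h
 kb :{W : av n}{x : Fin n}-> x ∈ₛ W -> T(lookup W x)
 kb{W = _ ∷ W}Vec.here = tt
 kb{W = _ ∷ W}(Vec.there p)= kb p
 kd :{W : av n}{x : Fin n}-> T(lookup W x)-> x ∈ₛ W
 kd{W = true ∷ W}{zero}t = Vec.here
 kd{W = _ ∷ W}{suc x}t = Vec.there(kd t)
 p0 :(G : a1 n)(U : av n)-> ch(ba G)U <= e(sE G(verts G ∩ U))
 p0{n}G U = cq(\(x , y)-> T?(adj G x y))(\(x , y)-> T?(adj(sE G(verts G ∩ U))x y))(lW U)(jo n)(\(x , y)t b -> aL T(aI(sF G(verts G ∩ U)(p∩q⊆p(verts G)U)x y))(let bx , by = bh{lookup U x}b in gi G(verts G ∩ U)(x∈p∩q⁺(support G t , kd bx))(x∈p∩q⁺(support G(sym-adj G t), kd by))t))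
 mf :(G : a1 n){K : a1 n}-> K ∈ e6 G -> e K <= ch(ba G)(verts K)
 mf{n}G{K}p = cv(\(x , y)-> T?(adj G x y))(\(x , y)-> T?(adj K x y))(lW(verts K))(jo n)(\(x , y)t -> proj₂(pU G p)t , cA{lookup(verts K)x}(kb(support K t))(kb(support K(sym-adj K t))))
 jW :(G : a1 n)(U : av n)-> ∣ U ∣ <= 1 -> ch(ba G)U == 0
 jW G U le with aw(lW U)(ba G)in eq
 ... | [] = refl
 ... |(x , y)∷ _ = aA(aV refl(aa(kI U x y(\{ refl -> aV refl(ai(hZ G(ai iw)))})(ai(bh{lookup U x}(proj₂ iw)))(proj₂(bh{lookup U x}(proj₂ iw))))le))where
  iw :(x , y)∈ ba G × T(lW U(x , y))
  iw = aP(lW U)(ba G)(aL((x , y)∈_)(aI eq)(here refl))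
 module _ where
  g1 : a1 n -> ℚ
  g1 K = e K ÷(v K -' 1)
  jh : ∀ m w -> 2 <= w -> m ÷(w -' 1)* ι(w -' 1)== ι m
  jh m(suc(suc w))_ = gK m w
  jh m(suc zero)(bl())
  zO :(K : a1 n)-> o8(2 <= v K)
  zO K = 2 ℕₚ.≤? v K
  BH :(K : a1 n)-> o8(1 <= v K)
  BH K = 1 ℕₚ.≤? v K
  nu : ∀{r1}-> ℚ -> a1 r1 -> ℚ
  nu a K =(a + e K ÷ 1)*(1 ÷ v K)
  nw : ∀ a m w -> 1 <= w ->(a + m ÷ 1)*(1 ÷ w)* ι w == a + ι m
  nw a m(suc w)_ = ag(hp(a + m ÷ 1)(1 ÷ suc w)(ι(suc w)))(ag(au((a + m ÷ 1)*_)(xg w))(ag(aF(a + m ÷ 1))(au(a +_)(aI(zk m)))))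
 private
  fB : ∀{m}(W : av m)-> 1 <= ∣ W ∣ -> ∃ \ y -> y ∈ₛ W
  fB(true ∷ W)lD = zero , Vec.here
  fB(false ∷ W)lD = let y , p = fB W lD in suc y , Vec.there p
 sK :(G : a1 n)-> 0' =< gT G
 sK G = jg(fd g1(c9 zO(e6 G)))
 mg :(G : a1 n)(U : av n)-> ∣ verts G ∩ U ∣ <= 1 -> ch(ba G)U == 0
 mg G U le = ln(aa(aa(p0 G U)(mf G(fh G(verts G ∩ U)(p∩q⊆p(verts G)U))))(ae(jW G(verts G ∩ U)le)))
 -- On a fixed vertex set the induced subgraph has the most edges, so both densities are governed by
 -- the counts `ch`. `pn` and `p1` are the upper bounds for all sets; `oM` and `mM` give sets that
 -- reach them.
 pn :(G : a1 n)(U : av n)-> ι(ch(ba G)U)=< gT G * ι(∣ U ∣ -' 1)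
 pn G U = go(2 ℕₚ.≤? ∣ W ∣)where
  W = verts G ∩ U
  go : o8(2 <= ∣ W ∣)-> ι(ch(ba G)U)=< gT G * ι(∣ U ∣ -' 1)
  go(yes v3)= af(bw(p0 G U))(af(ad(aI(jh(e(sE G W))∣ W ∣ v3)))(dS(xh(e(sE G W))(∣ W ∣ -' 1))(hu g1 zO(e6 G)(fh G W(p∩q⊆p(verts G)U))v3)(aY(∣ W ∣ -' 1))(bw(rs 1(∣p∩q∣≤∣q∣(verts G)U)))))
  go(no Ds)= af(ad(ag(au ι(mg G U(fw(dY Ds))))iA))(a7(sK G)(aY(∣ U ∣ -' 1)))
 oM :(G : a1 n)-> 0' < gT G -> ∃ \ U -> 2 <= ∣ U ∣ × gT G * ι(∣ U ∣ -' 1)=< ι(ch(ba G)U)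
 oM G lt = go(d8 g1 zO(e6 G)lt)where
  go :(∃ \ K -> K ∈ e6 G × 2 <= v K × gT G == g1 K)-> ∃ \ U -> 2 <= ∣ U ∣ × gT G * ι(∣ U ∣ -' 1)=< ι(ch(ba G)U)
  go(K , Dt , v3 , eq)= verts K , v3 , af(ad(ag(au(_* ι(v K -' 1))eq)(jh(e K)(v K)v3)))(bw(mf G Dt))
 p1 : ∀{n r1}(B : a1 n)(G : a1 r1)-> 1 <= v G ->(U : av r1)-> 1 <= ∣ U ∣ -> gT B + ι(ch(ba G)U)=< m₁[ B , G ] * ι ∣ U ∣
 p1{n}{r1}B G zP U h0 = go(1 ℕₚ.≤? ∣ W ∣)where
  W = verts G ∩ U
  du :(X : av r1)->(∀{x}-> x ∈ₛ X -> x ∈ₛ verts G)-> 1 <= ∣ X ∣ -> gT B + ι(e(sE G X))=< m₁[ B , G ] * ι ∣ X ∣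
  du X Gb lD = af(ad(aI(nw(gT B)(e(sE G X))∣ X ∣ lD)))(aX(ι ∣ X ∣)(aY ∣ X ∣)(hu(nu(gT B))BH(e6 G)(fh G X Gb)lD))
  zQ : 0' =< m₁[ B , G ]
  zQ = jg(fd(nu(gT B))(c9 BH(e6 G)))
  -- Covers sets `U` that miss the graph: a single vertex of `G` already gives `m₁ B`.
  nx :(∃ \ y -> y ∈ₛ verts G)-> gT B =< m₁[ B , G ]
  nx(y , xe)= af(bK(ι(e(sE G ⁅ y ⁆)))(aY(e(sE G ⁅ y ⁆)))refl)(af(du ⁅ y ⁆(\ q -> aL(_∈ₛ verts G)(aI(x∈⁅y⁆⇒x≡y y q))xe)(ae(aI(∣⁅x⁆∣≡1 y))))(ad(ag(au(\ z -> m₁[ B , G ] * ι z)(∣⁅x⁆∣≡1 y))(ag(au(m₁[ B , G ] *_)jZ)(aF m₁[ B , G ])))))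
  go : o8(1 <= ∣ W ∣)-> gT B + ι(ch(ba G)U)=< m₁[ B , G ] * ι ∣ U ∣
  go(yes lD)= af(bA(gT B)(bw(p0 G U)))(af(du W(p∩q⊆p(verts G)U)lD)(aO m₁[ B , G ] zQ(bw(∣p∩q∣≤∣q∣(verts G)U))))
  go(no xd)= af(ad(ag(au(gT B +_)(ag(au ι(mg G U(aa(fw(dY xd))bI)))iA))(dL(gT B))))(af(nx(fB(verts G)zP))(af(ad(aI(aF m₁[ B , G ])))(aO m₁[ B , G ] zQ(aL(_=< ι ∣ U ∣)jZ(bw h0)))))
 mM : ∀{n r1}(B : a1 n)(G : a1 r1)-> 0' < m₁[ B , G ] -> ∃ \ U -> 1 <= ∣ U ∣ × m₁[ B , G ] * ι ∣ U ∣ =< gT B + ι(ch(ba G)U)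
 mM{n}{r1}B G lt = go(d8(nu(gT B))BH(e6 G)lt)where
  go :(∃ \ K -> K ∈ e6 G × 1 <= v K × m₁[ B , G ] == nu(gT B)K)-> ∃ \ U -> 1 <= ∣ U ∣ × m₁[ B , G ] * ι ∣ U ∣ =< gT B + ι(ch(ba G)U)
  go(K , Dt , lD , eq)= verts K , lD , af(ad(ag(au(_* ι(v K))eq)(nw(gT B)(e K)(v K)lD)))(bA(gT B)(bw(mf G Dt)))
 μ : bq -> ℚ
 μ(_ , G)= gT G
 jD :(w : Vec A(suc r))(j : Fin(suc r))-> e5 w ↭ lookup w j ∷ e5(t8 w j)
 jD(x ∷ w)zero = GT
 jD(x ∷ y ∷ w)(suc j)= FJ(prep x(jD(y ∷ w)j))(swap x _ GT)
 eJ :(w : Vec A(suc r))(j i : Fin(suc r))-> i ≢ j -> lookup w i ∈ e5(t8 w j)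
 eJ(x ∷ w)zero zero ne = aA(ne refl)
 eJ(x ∷ w)zero(suc i)ne = iw w i where
  iw : ∀{q}(w : Vec _ q)i -> lookup w i ∈ e5 w
  iw(x ∷ w)zero = here refl
  iw(x ∷ w)(suc i)= there(iw w i)
 eJ(x ∷ y ∷ w)(suc j)zero ne = here refl
 eJ(x ∷ y ∷ w)(suc j)(suc i)ne = there(eJ(y ∷ w)j i(ne ∘ au suc))
 dA :(w : Vec A r){x : A}-> x ∈ e5 w -> ∃ \ i -> lookup w i == x
 dA(y ∷ w)(here refl)= zero , refl
 dA(y ∷ w)(there p)= let i , eq = dA w p in suc i , eq
 fQ :(w : Vec A(suc r))(j : Fin(suc r)){x : A}-> x ∈ e5(t8 w j)-> ∃ \ i -> i ≢ j × lookup w i == x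
 fQ(y ∷ w)zero p = let i , eq = dA w p in suc i ,(\()), eq
 fQ(y ∷ z ∷ w)(suc j)(here refl)= zero ,(\()), refl
 fQ(y ∷ z ∷ w)(suc j)(there p)= let i , ne , eq = fQ(z ∷ w)j p in suc i , ne ∘ Data.Fin.Properties.suc-injective , eq
 -- Recovers positions of the tuple from the sorted list: `a4` carries the largest and `d6` the
 -- second largest `m₁`.
 po : Vec bq r -> ℚ -> Set
 po As b = ∃ \ a4 -> ∃ \ d6 -> d6 ≢ a4 ×(∀ j -> j ≢ a4 -> μ(lookup As j)=< μ(lookup As d6))× μ(lookup As d6)=< μ(lookup As a4)× b == m₁[ proj₂(lookup As d6), proj₂(lookup As a4)]
 private
  mh :(As : Vec bq(suc(suc r)))(S : List bq)-> S ↭ e5 As -> AllPairs(\ A B -> μ B =< μ A)S -> po As(βSorted S)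
  mh As [] yX _ = aA(Hs(ag(aI(n9 As))(D6(Eg yX))))
  mh As(B ∷ [])yX _ = aA(Hs(ℕₚ.suc-injective(ag(aI(n9 As))(D6(Eg yX)))))
  mh As(B₁ ∷ yY ∷ Bs)yX((v4 ∷ _)∷(BI ∷ _))= go(dA As(t9 yX(here refl)))where
   go :(∃ \ a4 -> lookup As a4 == B₁)-> po As m₁[ proj₂ yY , proj₂ B₁ ]
   go(a4 , zR)= ny(fQ As a4(t9 eZ(here refl)))where
    eZ :(yY ∷ Bs)↭ e5(t8 As a4)
    eZ = drop-∷{x = B₁}(FJ yX(aL(\ B -> e5 As ↭ B ∷ e5(t8 As a4))zR(jD As a4)))
    ny :(∃ \ d6 -> d6 ≢ a4 × lookup As d6 == yY)-> po As m₁[ proj₂ yY , proj₂ B₁ ]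
    ny(d6 , ne , zS)= a4 , d6 , ne , iI , lp(\ A B -> μ A =< μ B)(aI zS)(aI zR)v4 , aS(\ A B -> m₁[ proj₂ A , proj₂ B ])(aI zS)(aI zR)where
     below : ∀{A}-> A ∈(yY ∷ Bs)-> μ A =< μ yY
     below(here eq)= ad(au μ eq)
     below(there p)= All.lookup BI p
     iI : ∀ j -> j ≢ a4 -> μ(lookup As j)=< μ(lookup As d6)
     iI j EE = aL(\ B -> μ(lookup As j)=< μ B)(aI zS)(below(t9(Eg eZ)(eJ As a4 j EE)))
 p2 :(As : Vec bq r)-> 2 <= r -> po As(b9 As)
 p2{suc(suc r)}As _ = mh As(sort(e5 As))(sort-↭(e5 As))(Eh(\{x}{y}{z}p q -> af q p)(sort-↗(e5 As)))
 p2{suc zero}As(bl())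
 qY :(f : A -> ℚ)(x : A)(xs : List A)-> ∃ \ y -> y ∈(x ∷ xs)×(∀{z}-> z ∈(x ∷ xs)-> f y =< f z)
 qY f x [] = x , here refl , \{(here refl)-> bR }
 qY f x(y ∷ ys)with qY f y ys
 ... | m , Gc , le with GR(f x)(f m)
 ... | aD p = x , here refl , \{(here refl)-> bR ;(there q)-> af p(le q)}
 ... | aG p = m , there Gc , \{(here refl)-> p ;(there q)-> le q }
 -- Take from each family a member of least `m₁`, and let `a4` and `d6` be the two leading
 -- positions. Exchange the member at `a4` for another graph `A`. If `A` leads, the definition of
 -- `m₁[_,_]` supplies the set `U`; otherwise the new leader has `m₁` at most `μ D`, and then so is
 -- the value of the tuple, giving `b ≤ μ D`.
 sL :(fj : Vec(List bq)r)-> 2 <= r ->(∀ j -> ∃ \ A -> A ∈ lookup fj j)->(b : ℚ)-> 0' < b ->(∀ As ->(∀ j -> lookup As j ∈ lookup fj j)-> b =< b9 As)-> ∃ \ a4 -> ∃ \ d6 -> d6 ≢ a4 × ∃ \(D : bq)-> D ∈ lookup fj d6 ×(∀{A}-> A ∈ lookup fj d6 -> μ D =< μ A)×(∀{A}-> A ∈ lookup fj a4 -> μ D =< μ A ×(b =< μ D ⊎(∃ \ U -> 1 <= ∣ U ∣ × b * ι ∣ U ∣ =< μ D + ι(ch(ba(proj₂ A))U))))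
 sL{r}fj eG ne b FO hb = a4 , d6 , fs , lookup nA d6 , xi d6 ,(\{A}d2 -> uj d6 d2), \{A}d2 -> af oN(uj a4 d2), x8 A d2 where
  p3 : ∀ j -> ∃ \ y -> y ∈ lookup fj j ×(∀{z}-> z ∈ lookup fj j -> μ y =< μ z)
  p3 j with lookup fj j | ne j
  ... | x ∷ xs | _ = qY μ x xs
  nA : Vec bq r
  nA = tabulate(\ j -> ai(p3 j))
  zT : ∀ j -> lookup nA j == ai(p3 j)
  zT j = a9(\ j -> ai(p3 j))j
  xi : ∀ j -> lookup nA j ∈ lookup fj j
  xi j = aL(_∈ lookup fj j)(aI(zT j))(ai(proj₂(p3 j)))
  uj : ∀ j{z}-> z ∈ lookup fj j -> μ(lookup nA j)=< μ z
  uj j p = af(ad(au μ(zT j)))(proj₂(proj₂(p3 j))p)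
  v5 = p2 nA eG
  a4 = ai v5
  d6 = ai(proj₂ v5)
  fs = ai(proj₂(proj₂ v5))
  iI = ai(proj₂(proj₂(proj₂ v5)))
  oN = ai(proj₂(proj₂(proj₂(proj₂ v5))))
  a = μ(lookup nA d6)
  x8 : ∀ A -> A ∈ lookup fj a4 -> b =< a ⊎(∃ \ U -> 1 <= ∣ U ∣ × b * ι ∣ U ∣ =< a + ι(ch(ba(proj₂ A))U))
  x8 A d2 = result(p2 p4 eG)where
   p4 = nA [ a4 ]≔ A
   yZ : lookup p4 a4 == A
   yZ = Ht a4 nA A
   ji : ∀{j}-> j ≢ a4 -> lookup p4 j == lookup nA j
   ji ne = FX ne nA A
   zU : ∀ j -> lookup p4 j ∈ lookup fj j
   zU j with j ≟ᶠ a4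
   ... | yes refl = aL(_∈ lookup fj j)(aI yZ)d2
   ... | no ne = aL(_∈ lookup fj j)(aI(ji ne))(xi j)
   result : po p4(b9 p4)-> b =< a ⊎(∃ \ U -> 1 <= ∣ U ∣ × b * ι ∣ U ∣ =< a + ι(ch(ba(proj₂ A))U))
   result(BJ , EF , rx , Hz , Du , Gd)= go(mM r2 pq(gA FO y0))(BJ ≟ᶠ a4)where
    pq = proj₂(lookup p4 BJ)
    r2 = proj₂(lookup p4 EF)
    y0 : b =< m₁[ r2 , pq ]
    y0 = aL(b =<_)Gd(hb p4 zU)
    a0 : ∀ a i -> a + a * i ==(1' + i)* a
    a0 = ap ar
    go :(∃ \ U -> 1 <= ∣ U ∣ × m₁[ r2 , pq ] * ι ∣ U ∣ =< gT r2 + ι(ch(ba pq)U))-> o8(BJ == a4)-> b =< a ⊎(∃ \ U -> 1 <= ∣ U ∣ × b * ι ∣ U ∣ =< a + ι(ch(ba(proj₂ A))U))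
    go(U , h0 , le)(yes refl)= aG(aL(\ G -> ∃ \(U : av(ai G))-> 1 <= ∣ U ∣ × b * ι ∣ U ∣ =< a + ι(ch(ba(proj₂ G))U))yZ(U , h0 , af(aX(ι ∣ U ∣)(aY ∣ U ∣)y0)(af le(bC(ι(ch(ba pq)U))(af(ad(au μ(ji rx)))(iI EF rx))))))
    go(U , h0 , le)(no ry)= aD(bZ(ι ∣ U ∣)(k5 h0)(begin ι ∣ U ∣ * b ≡⟨ e9(ι ∣ U ∣)b ⟩ b * ι ∣ U ∣ ≤⟨ aX(ι ∣ U ∣)(aY ∣ U ∣)y0 ⟩ m₁[ r2 , pq ] * ι ∣ U ∣ ≤⟨ le ⟩ gT r2 + ι(ch(ba pq)U)≤⟨ cQ(af Du sM)(af(pn pq U)(aX(ι(∣ U ∣ -' 1))(aY(∣ U ∣ -' 1))sM))⟩ a + a * ι(∣ U ∣ -' 1)≡⟨ a0 a(ι(∣ U ∣ -' 1))⟩(1' + ι(∣ U ∣ -' 1))* a ≡⟨ au(_* a)(ag(aI(cV(∣ U ∣ -' 1)))(au ι(hQ h0)))⟩ ι ∣ U ∣ * a ∎))where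
     open RQ
     sM : gT pq =< a
     sM = af(ad(au μ(ji ry)))(iI BJ ry)

-- Certificates and the critical parameter.

module Ge where
 open M6 using (zero;suc)
 open M9 using (∣_∣)
 open M7 using ([];_∷_)
 open M16 using (_∈_)
 open M13 using (here)
 open M0 using (ℕ;zero;suc)
 open M1 using (∃;_×_)
 open M2 hiding (_÷_;∣_∣;floor;truncate)
 open M3
 open M8 using ([];_∷_;lookup;tabulate;replicate)
 open M19 using (tabulate-cong)
 open M4 hiding ([_])
 open M5
 open P1
 open P2 using (aw)
 open P4 using (∈-map⁺; ∈-map⁻)
 open P9
 open BG
 private variable
  n r K : ℕ
  A : Set
 d3 :(b : A -> bH)(xs : List A)-> aw b xs ∈ bG xs
 d3 b [] = here refl
 d3 b(x ∷ xs)with b x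
 ... | true = c8(bG xs)(∈-map⁺(x ∷_)(bG xs)(d3 b xs))
 ... | false = dZ(d3 b xs)
 sN :{v w : Vec A n}->(∀ i -> lookup v i == lookup w i)-> v == w
 sN{v = v}{w}h = ag(aI(ua v))(ag(tabulate-cong h)(ua w))
 private
  rA :(G : a1 n)(i mV : Fin K)-> mV ≢ i -> v(G [ jQ(replicate n i)mV ])== 0
  rA{n}G i mV ne = go(verts G)where
   go : ∀{m}(W : av m)-> ∣ W ∩ jQ(replicate m i)mV ∣ == 0
   go [] = refl
   go(b ∷ W)with i ≟ᶠ mV
   ... | yes eq = aA(ne(aI eq))
   go(true ∷ W)| no _ = go W
   go(false ∷ W)| no _ = go W
 -- Colouring every vertex `i` leaves all other parts empty, and the families hold only non-empty
 -- graphs, so the certified part must be the `i`-th.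
 ld :(G : a1 n)(df : Vec(List(a1 n))K)-> cm G K df ->(∀ i{J}-> J ∈ lookup df i -> 1 <= v J)-> ∀ i -> ∃ \ J -> J ∈ lookup df i
 ld{n}{K}G df oA ne i = go(oA(replicate n i))where
  go :(∃ \ mV -> Any((G [ jQ(replicate n i)mV ])≈_)(lookup df mV))-> ∃ \ J -> J ∈ lookup df i
  go(mV , Gf)with GS Gf | mV ≟ᶠ i
  ... | J , la , eq | yes refl = J , la
  ... | J , la , eq | no Hd = aA(aV(ag(aI(rA G i mV Hd))(au ∣_∣(ai eq)))(ne mV la))
 module mi (k : ℕ) {r : ℕ} (𝐇 : Vec bq r) where
  private
   eA = suc k
  cf : Fin r -> ℕ
  cf j = ai(lookup 𝐇 j)
  H :(j : Fin r)-> a1(cf j)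
  H j = proj₂(lookup 𝐇 j)
  mj : Fin r -> Set
  mj j = Vec(List(a1(cf j)))eA
  hv :(j : Fin r)-> a1(cf j)-> bq
  hv j J = cf j , J
  private
   h1 :(j : Fin r)-> mj j -> Vec(List bq)eA
   h1 j = Vec.map(fd(hv j))
   dR : Vec(Vec(List bq)eA)r -> Fin eA -> ℚ
   dR f2 i = βFamilies(Vec.map(\ a2 -> lookup a2 i)f2)
   nB : Vec(Vec(List bq)eA)r -> ℚ
   nB f2 = F2(fd(dR f2)(ax eA))
   h2 : Vec(List(Vec(List bq)eA))r
   h2 = Vec.map(\ H -> qP H eA)𝐇
   x9 : ∀ j(df : mj j)-> cm(H j)eA df ->(∀ i -> lookup df i ∈ hS(H j))-> h1 j df ∈ qP(lookup 𝐇 j)eA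
   x9 j df oA tY = ∈-map⁺(h1 j)(c9(jR(H j)eA)(em(replicate eA(hS(H j)))))(gV(jR(H j)eA)(dE(replicate eA(hS(H j)))df(\ i -> aL(lookup df i ∈_)(aI(lookup-replicate i(hS(H j))))(tY i)))oA)
   sO : ∀ j{a2}-> a2 ∈ qP(lookup 𝐇 j)eA -> ∃ \(df : mj j)-> cm(H j)eA df ×(∀ i{J}-> J ∈ lookup df i -> J ∈ nonempty(H j))× a2 == h1 j df
   sO j p = go(∈-map⁻(h1 j)(c9(jR(H j)eA)(em(replicate eA(hS(H j)))))p)where
    go : ∀{a2}->(∃ \ df -> df ∈ c9(jR(H j)eA)(em(replicate eA(hS(H j))))× a2 == h1 j df)-> ∃ \(df : mj j)-> cm(H j)eA df ×(∀ i{J}-> J ∈ lookup df i -> J ∈ nonempty(H j))× a2 == h1 j df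
    go(df , q , eq)= df , proj₂(jv q),(\ i{J}la -> db(aL(lookup df i ∈_)(lookup-replicate i(hS(H j)))(dF(replicate eA(hS(H j)))df(ai(jv q))i))la), eq where
     jv : df ∈ c9(jR(H j)eA)(em(replicate eA(hS(H j))))-> df ∈ em(replicate eA(hS(H j)))× cm(H j)eA df
     jv = eO(jR(H j)eA){xs = em(replicate eA(hS(H j)))}
  hw : ∀{n}(G : a1 n){J}-> J ∈ nonempty G -> 1 <= v J
  hw G p = proj₂(eO(\ J -> 1 ℕₚ.≤? v J){xs = e6 G}p)
  -- Filtered families are among the enumerated ones, so these certificates compete in the maximum
  -- that defines `β`; the two nested minima are attained at some part and some tuple.
  ke :(a2 : ∀ j -> mj j)->(∀ j i -> ∃ \(b : a1(cf j)-> bH)-> lookup(a2 j)i == aw b(nonempty(H j)))->(∀ j -> cm(H j)eA(a2 j))-> ∃ \ i -> ∃ \(A : ∀ j -> a1(cf j))->(∀ j -> A j ∈ lookup(a2 j)i)× b9(tabulate(\ j -> hv j(A j)))=< β 𝐇 eA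
  ke a2 G0 oA = go(∈-map⁻(dR f2)(ax eA)(iH(∈-map⁺(dR f2)(ax eA)(∈-allFin zero))))where
   f2 : Vec(Vec(List bq)eA)r
   f2 = tabulate(\ j -> h1 j(a2 j))
   tY : ∀ j i -> lookup(a2 j)i ∈ hS(H j)
   tY j i = aL(_∈ hS(H j))(aI(proj₂(G0 j i)))(d3(ai(G0 j i))(nonempty(H j)))
   iw : f2 ∈ em h2
   iw = dE h2 f2(\ j -> lp _∈_(aI(a9(\ j -> h1 j(a2 j))j))(aI(bv j(\ H -> qP H eA)𝐇))(x9 j(a2 j)(oA j)(tY j)))
   v6 : nB f2 =< β 𝐇 eA
   v6 = jf(∈-map⁺ nB(em h2)iw)
   go :(∃ \ i -> i ∈ ax eA × nB f2 == dR f2 i)-> ∃ \ i -> ∃ \(A : ∀ j -> a1(cf j))->(∀ j -> A j ∈ lookup(a2 j)i)× b9(tabulate(\ j -> hv j(A j)))=< β 𝐇 eA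
   go(i , _ , eq)= ny(∈-map⁻ b9(em fj)(iH(∈-map⁺ b9(em fj)some)))where
    fj : Vec(List bq)r
    fj = Vec.map(\ a2 -> lookup a2 i)f2
    at : ∀ j -> lookup fj j == fd(hv j)(lookup(a2 j)i)
    at j = ag(bv j(\ a2 -> lookup a2 i)f2)(ag(au(\ a2 -> lookup a2 i)(a9(\ j -> h1 j(a2 j))j))(bv i(fd(hv j))(a2 j)))
    FP : ∀ j -> ∃ \ J -> J ∈ lookup(a2 j)i
    FP j = ld(H j)(a2 j)(oA j)(\ i la -> hw(H j)(db(tY j i)la))i
    some : tabulate(\ j -> hv j(ai(FP j)))∈ em fj
    some = dE fj _(\ j -> lp _∈_(aI(a9(\ j -> hv j(ai(FP j)))j))(aI(at j))(∈-map⁺(hv j)(lookup(a2 j)i)(proj₂(FP j))))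
    ny :(∃ \ As -> As ∈ em fj × F2(fd b9(em fj))== b9 As)-> ∃ \ i -> ∃ \(A : ∀ j -> a1(cf j))->(∀ j -> A j ∈ lookup(a2 j)i)× b9(tabulate(\ j -> hv j(A j)))=< β 𝐇 eA
    ny(As , kM , nm)= i ,(\ j -> ai(iJ j)),(\ j -> ai(proj₂(iJ j))), af(ad(ag(au b9 Cy)(ag(aI nm)(aI eq))))v6 where
     iJ : ∀ j -> ∃ \ J -> J ∈ lookup(a2 j)i × lookup As j == hv j J
     iJ j = ∈-map⁻(hv j)(lookup(a2 j)i)(aL(lookup As j ∈_)(at j)(dF fj As kM j))
     Cy : tabulate(\ j -> hv j(ai(iJ j)))== As
     Cy = sN(\ j -> ag(a9(\ j -> hv j(ai(iJ j)))j)(aI(proj₂(proj₂(iJ j)))))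
  -- The maximum starts from 0, so it is the positivity of `β` that makes it the value of actual
  -- certificates.
  gj : 0' < β 𝐇 eA -> ∃ \(df : ∀ j -> mj j)->(∀ j -> cm(H j)eA(df j))×(∀ j i{J}-> J ∈ lookup(df j)i -> J ∈ nonempty(H j))×(∀ i As ->(∀ j -> lookup As j ∈ fd(hv j)(lookup(df j)i))-> β 𝐇 eA =< b9 As)
  gj sP = go(∈-map⁻ nB(em h2)(fi(fd nB(em h2))sP))where
   go :(∃ \ f2 -> f2 ∈ em h2 × k4(fd nB(em h2))== nB f2)-> ∃ \(df : ∀ j -> mj j)->(∀ j -> cm(H j)eA(df j))×(∀ j i{J}-> J ∈ lookup(df j)i -> J ∈ nonempty(H j))×(∀ i As ->(∀ j -> lookup As j ∈ fd(hv j)(lookup(df j)i))-> β 𝐇 eA =< b9 As)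
   go(f2 , zV , eq)=(\ j -> ai(iJ j)),(\ j -> ai(proj₂(iJ j))),(\ j i -> ai(proj₂(proj₂(iJ j)))i), du where
    iJ : ∀ j -> ∃ \(df : mj j)-> cm(H j)eA df ×(∀ i{J}-> J ∈ lookup df i -> J ∈ nonempty(H j))× lookup f2 j == h1 j df
    iJ j = sO j(aL(lookup f2 j ∈_)(bv j(\ H -> qP H eA)𝐇)(dF h2 f2 zV j))
    du : ∀ i As ->(∀ j -> lookup As j ∈ fd(hv j)(lookup(ai(iJ j))i))-> β 𝐇 eA =< b9 As
    du i As kM = af(ad eq)(af(ns(∈-map⁺(dR f2)(ax eA)(∈-allFin i)))(ns(∈-map⁺ b9(em fj)iw)))where
     fj : Vec(List bq)r
     fj = Vec.map(\ a2 -> lookup a2 i)f2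
     at : ∀ j -> lookup fj j == fd(hv j)(lookup(ai(iJ j))i)
     at j = ag(bv j(\ a2 -> lookup a2 i)f2)(ag(au(\ a2 -> lookup a2 i)(proj₂(proj₂(proj₂(iJ j)))))(bv i(fd(hv j))(ai(iJ j))))
     iw : As ∈ em fj
     iw = dE fj As(\ j -> aL(lookup As j ∈_)(aI(at j))(kM j))

-- From probabilities over the reals to random subsets with rational probability.

module EG where
 open M6 using (zero;suc)
 open M17 using (<-cmp)
 open M9 using (⊤)
 open M11 using (∈⊤)
 open M7 using ([];_∷_;tabulate)
 open M16 using (_∈_)
 open M10 using ([];_∷_)
 open M12 using ([];_∷_)
 open M13 using (here;there)
 open M0 using (ℕ;zero;suc)
 open M20 using (_C_)
 open M1 using (∃;_×_)
 open M2 hiding (_÷_;floor;truncate)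
 open M3 hiding (<-cmp)
 open M8 using ([];_∷_;lookup)
 open M4 hiding ([_])
 open M15 using (toWitness)
 open M5
 open P1
 open P2
 open P3
 open P4 using (∈-map⁻)
 open P9
 private variable
  A : Set
  N : ℕ
 -- The expectation as a polynomial in the edge probability, defined at every rational, because
 -- approximants of a real in [0,1] may lie slightly outside.
 iq : ℚ -> ∀ N ->(av N -> ℚ)-> ℚ
 iq p zero f = f []
 iq p(suc N)f =(1' - p)* iq p N(f ∘(false ∷_))+ p * iq p N(f ∘(true ∷_))
 lI : ∀{p}l u(f : av N -> ℚ)-> iq p N f == aB(cI p l u N)f
 lI{zero}l u f = refl
 lI{suc N}{p}l u f = ag(aS(\ x y ->(1' - p)* x + p * y)(lI l u(f ∘(false ∷_)))(lI l u(f ∘(true ∷_))))(aI(di l u f))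
 module y1 where
  -- For `|x| ≤ 2` the two branch weights satisfy `|1 - x| + |x| ≤ 3 + 2`, so 5 is the growth factor
  -- per coordinate; `Bq` is the resulting Lipschitz constant.
  mW : ℚ
  mW = ι 5
  Bq : ℕ -> ℚ
  Bq zero = 0'
  Bq(suc N)= Bq N +(mW ^ N + mW ^ N)
  sQ : 0' =< mW
  sQ = aY 5
  p5 : ∀ N -> 0' =< Bq N
  p5 zero = bR
  p5(suc N)= 0≤+(p5 N)(0≤+(aQ N sQ)(aQ N sQ))
  private
   ya : mW ==(1' +(1' + 1'))+(1' + 1')
   ya = ag(o9 3 2)(aS _+_(ag(cV 2)(au(1' +_)l1))l1)
   uk : ∀{a b c d}-> ∣ a ∣ =< c -> ∣ b ∣ =< d -> ∣ a * b ∣ =< c * d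
   uk{a}{b}ac bd = af(ad(∣p*q∣≡∣p∣*∣q∣ a b))(dS(r5 a)ac(r5 b)bd)
  iK : ∀{x}-> ∣ x ∣ =< 1' + 1' ->(f : av N -> ℚ)->(∀ S -> ∣ f S ∣ =< 1')-> ∣ iq x N f ∣ =< mW ^ N
  iK{zero}hx f hf = hf []
  iK{suc N}{x}hx f hf = begin ∣(1' - x)* BK + x * BL ∣ ≤⟨ mI((1' - x)* BK)(x * BL)⟩ ∣(1' - x)* BK ∣ + ∣ x * BL ∣ ≤⟨ cQ(uk{1' - x}{BK}(af(yR 1' x)(bA 1' hx))(iK hx(f ∘(false ∷_))(\ S -> hf(false ∷ S))))(uk{x}{BL}hx(iK hx(f ∘(true ∷_))(\ S -> hf(true ∷ S))))⟩(1' +(1' + 1'))* mW ^ N +(1' + 1')* mW ^ N ≡⟨ aI(Bn(mW ^ N)(1' +(1' + 1'))(1' + 1'))⟩((1' +(1' + 1'))+(1' + 1'))* mW ^ N ≡⟨ au(_* mW ^ N)(aI ya)⟩ mW * mW ^ N ∎ where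
   open RQ
   BK = iq x N(f ∘(false ∷_))
   BL = iq x N(f ∘(true ∷_))
  nC : ∀{x y}-> ∣ x ∣ =< 1' + 1' -> 0' =< y -> y =< 1' ->(f : av N -> ℚ)->(∀ S -> ∣ f S ∣ =< 1')-> ∣ iq x N f - iq y N f ∣ =< Bq N * ∣ x - y ∣
  nC{zero}{x}{y}hx hT kF f hf = af(ad(au ∣_∣(D2(f []))))(a7(bR{0'})(r5(x - y)))
  nC{suc N}{x}{y}hx hT kF f hf = begin ∣((1' - x)* qZ + x * q0)-((1' - y)* xj + y * B₁)∣ ≡⟨ au ∣_∣(a0 x y qZ q0 xj B₁)⟩ ∣((1' - y)*(qZ - xj)+ y *(q0 - B₁))+(q0 - qZ)*(x - y)∣ ≤⟨ af(mI((1' - y)*(qZ - xj)+ y *(q0 - B₁))((q0 - qZ)*(x - y)))(bC ∣(q0 - qZ)*(x - y)∣(mI((1' - y)*(qZ - xj))(y *(q0 - B₁))))⟩(∣(1' - y)*(qZ - xj)∣ + ∣ y *(q0 - B₁)∣)+ ∣(q0 - qZ)*(x - y)∣ ≤⟨ cQ(cQ(uk{1' - y}{qZ - xj}(ad(lY(e7 kF)))(nC hx hT kF(f ∘(false ∷_))(\ S -> hf(false ∷ S))))(uk{y}{q0 - B₁}(ad(lY hT))(nC hx hT kF(f ∘(true ∷_))(\ S -> hf(true ∷ S)))))(uk{q0 - qZ}{x - y}(af(yR q0 qZ)(cQ(iK hx(f ∘(true ∷_))(\ S -> hf(true ∷ S)))(iK hx(f ∘(false ∷_))(\ S -> hf(false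 ∷ S)))))bR)⟩((1' - y)*(Bq N * ∣ x - y ∣)+ y *(Bq N * ∣ x - y ∣))+(mW ^ N + mW ^ N)* ∣ x - y ∣ ≡⟨ aZ y(Bq N)(mW ^ N)∣ x - y ∣ ⟩(Bq N +(mW ^ N + mW ^ N))* ∣ x - y ∣ ∎ where
   open RQ
   qZ = iq x N(f ∘(false ∷_))
   q0 = iq x N(f ∘(true ∷_))
   xj = iq y N(f ∘(false ∷_))
   B₁ = iq y N(f ∘(true ∷_))
   a0 : ∀ x y a b c d ->((1' - x)* a + x * b)-((1' - y)* c + y * d)==((1' - y)*(a - c)+ y *(b - d))+(b - a)*(x - y)
   a0 = ap ar
   aZ : ∀ y l f z ->((1' - y)*(l * z)+ y *(l * z))+(f + f)* z ==(l +(f + f))* z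
   aZ = ap ar
 open y1
 ix : ℚ -> ℚ
 ix x = 0' ⊔(x ⊓ 1')
 eK : ∀ x -> 0' =< ix x
 eK x = p≤p⊔q 0'(x ⊓ 1')
 eL : ∀ x -> ix x =< 1'
 eL x with ⊔-sel 0'(x ⊓ 1')
 ... | aD eq = af(ad eq)ca
 ... | aG eq = af(ad eq)(p⊓q≤q x 1')
 q1 : ∀{x c}-> 0' =< c -> x =< c -> ix x =< c
 q1{x}{c}iu EH with ⊔-sel 0'(x ⊓ 1')
 ... | aD eq = af(ad eq)iu
 ... | aG eq = af(ad eq)(af(p⊓q≤p x 1')EH)
 ul : ∀{x c}-> c =< 1' -> c =< x -> c =< ix x
 ul{x}{c}rB EI with ⊓-sel x 1'
 ... | aD eq = af(af EI(ad(aI eq)))(p≤q⊔p 0'(x ⊓ 1'))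
 ... | aG eq = af(af rB(ad(aI eq)))(p≤q⊔p 0'(x ⊓ 1'))
 oO : ∀{x η}-> 0' =< η -> 0' =< x + η -> x =< 1' + η -> ∣ x - ix x ∣ =< η
 oO{x}{η}qU lo hi = ∣-∣≤ x(ix x)η up EJ where
  up : x =< ix x + η
  up with ⊓-sel x 1'
  ... | aD eq = af(bK η qU refl)(bC η(af(ad(aI eq))(p≤q⊔p 0'(x ⊓ 1'))))
  ... | aG eq = af hi(bC η(af(ad(aI eq))(p≤q⊔p 0'(x ⊓ 1'))))
  EJ : ix x =< x + η
  EJ = q1{x}lo(bK η qU refl)
 v7 :(xs : List A)-> av(ah xs)-> List A
 v7 [] [] = []
 v7(x ∷ xs)(true ∷ S)= x ∷ v7 xs S
 v7(x ∷ xs)(false ∷ S)= v7 xs S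
 ml :(xs : List A)(S : av(ah xs)){x : A}-> x ∈ v7 xs S -> x ∈ xs
 ml [] []()
 ml(x ∷ xs)(true ∷ S)(here eq)= here eq
 ml(x ∷ xs)(true ∷ S)(there p)= there(ml xs S p)
 ml(x ∷ xs)(false ∷ S)p = there(ml xs S p)
 iL :(xs : List A)(S : av(ah xs)){x : A}(p : x ∈ xs)-> T(lookup S(xT p))-> x ∈ v7 xs S
 iL(x ∷ xs)(true ∷ S)(here eq)t = here eq
 iL(x ∷ xs)(true ∷ S)(there p)t = there(iL xs S p t)
 iL(x ∷ xs)(false ∷ S)(there p)t = iL xs S p t
 fC :(xs : List A)-> eD xs ->(S : av(ah xs)){x : A}(p : x ∈ xs)-> x ∈ v7 xs S -> T(lookup S(xT p))
 fC(x ∷ xs)(u ∷ us)(true ∷ S)(here eq)q = tt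
 fC(x ∷ xs)(u ∷ us)(true ∷ S)(there p)(here refl)= aA(All.lookup u p refl)
 fC(x ∷ xs)(u ∷ us)(true ∷ S)(there p)(there q)= fC xs us S p q
 fC(x ∷ xs)(u ∷ us)(false ∷ S)(here refl)q = aA(All.lookup u(ml xs S q)refl)
 fC(x ∷ xs)(u ∷ us)(false ∷ S)(there p)q = fC xs us S p q
 g2 :(xs : List A){f g : A -> ℚ}->(∀{a}-> a ∈ xs -> f a == g a)-> aM xs f == aM xs g
 g2 [] h = refl
 g2(x ∷ xs)h = aS _+_(h(here refl))(g2 xs(h ∘ there))
 fR :{xs ys : List A}-> ys ∈ bG xs -> ah ys <= ah xs
 fR{xs = []}(here refl)= bI
 fR{xs = x ∷ xs}p with kx(bG xs)p
 ... | aD q = a6(fR{xs = xs}q)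
 ... | aG q with ∈-map⁻(x ∷_)(bG xs)q
 ... | zs , r , refl = bl(fR{xs = xs}r)
 -- A coordinate rejected by `P?` does not affect `F`; its two branches are equal and average to
 -- themselves. Hence the random set may live on more coordinates than there are possible edges.
 gL :(p : ℚ){P : A -> Set}(P? : ∀ a -> o8(P a))(xs : List A)(F : List A -> ℚ)-> aM(bG(c9 P? xs))(\ S -> p ^ ah S *(1' - p)^(ah(c9 P? xs)-' ah S)* F S)== iq p(ah xs)(\ S -> F(c9 P?(v7 xs S)))
 gL p P? [] F = ag(dL _)(ag(au(_* F [])(aH 1'))(aH(F [])))
 gL p P?(x ∷ xs)F with P? x
 ... | no He = ag(gL p P? xs F)(a0 p(iq p(ah xs)(\ S -> F(c9 P?(v7 xs S)))))where
  a0 : ∀ p x -> x ==(1' - p)* x + p * x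
  a0 = ap ar
 ... | yes px = begin aM(bG ys ++ fd(x ∷_)(bG ys))w ≡⟨ ag(oa(bG ys)_ w)(au(aM(bG ys)w +_)(fM(x ∷_)(bG ys)w))⟩ aM(bG ys)w + aM(bG ys)(w ∘(x ∷_))≡⟨ aS _+_(ag(g2(bG ys)EK)(fy(bG ys)(1' - p)BM))(ag(bF(bG ys)Cz)(fy(bG ys)p BN))⟩(1' - p)* aM(bG ys)BM + p * aM(bG ys)BN ≡⟨ aS(\ a b ->(1' - p)* a + p * b)(gL p P? xs F)(gL p P? xs(F ∘(x ∷_)))⟩(1' - p)* iq p(ah xs)(\ S -> F(c9 P?(v7 xs S)))+ p * iq p(ah xs)(\ S -> F(x ∷ c9 P?(v7 xs S)))∎ where
  open ≡-Reasoning
  ys = c9 P? xs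
  w BM BN : List _ -> ℚ
  w S = p ^ ah S *(1' - p)^(suc(ah ys)-' ah S)* F S
  BM S = p ^ ah S *(1' - p)^(ah ys -' ah S)* F S
  BN S = p ^ ah S *(1' - p)^(ah ys -' ah S)* F(x ∷ S)
  ci : ∀ q a b f -> a *(q * b)* f == q *(a * b * f)
  ci = ap ar
  aZ : ∀ q a b f -> q * a * b * f == q *(a * b * f)
  aZ = ap ar
  EK : ∀{S}-> S ∈ bG ys -> w S ==(1' - p)* BM S
  EK{S}pV = ag(au(\ k -> p ^ ah S *(1' - p)^ k * F S)(FE 1(fR{xs = ys}pV)))(ci(1' - p)(p ^ ah S)((1' - p)^(ah ys -' ah S))(F S))
  Cz : ∀ S -> w(x ∷ S)== p * BN S
  Cz S = aZ p(p ^ ah S)((1' - p)^(ah ys -' ah S))(F(x ∷ S))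
 dG :{Q : A -> Set}(Q? : ∀ a -> o8(Q a))(xs S : List A)-> eD xs -> S ∈ bG xs ->(∀{a}-> a ∈ xs ->(Q a -> a ∈ S)×(a ∈ S -> Q a))-> ah(c9 Q? xs)== ah S
 dG Q? [] S u(here refl)h = refl
 dG Q?(x ∷ xs)S(u ∷ us)pV h with kx(bG xs)pV
 dG Q?(x ∷ xs)S(u ∷ us)pV h | aD q with Q? x
 ... | yes qx = aA(All.lookup u(db q(ai(h(here refl))qx))refl)
 ... | no _ = dG Q? xs S us q(h ∘ there)
 dG Q?(x ∷ xs)S(u ∷ us)pV h | aG q with ∈-map⁻(x ∷_)(bG xs)q | Q? x
 ... | cu , r , refl | yes _ = au suc(dG Q? xs cu us r(\ p ->(\ qa -> w5 p(ai(h(there p))qa)),(\ s -> proj₂(h(there p))(there s))))where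
  w5 : ∀{a}-> a ∈ xs -> a ∈(x ∷ cu)-> a ∈ cu
  w5 p(here refl)= aA(All.lookup u p refl)
  w5 p(there s)= s
 ... | cu , r , refl | no Gg = aA(Gg(proj₂(h(here refl))(here refl)))
 nD : ∀ n(S : List(Fin n × Fin n))-> S ∈ bG(jo n)-> e(cs ⊤ S)== ah S
 nD n S pV = dG _(jo n)S(ma n)pV(\{(x , y)}p -> EL p , Dv p)where
  lt : ∀{x y}->(x , y)∈ jo n -> x Fin.< y
  lt p = proj₂(eO(\(x , y)-> x <?ᶠ y){xs = bD(ax n)(ax n)}p)
  EL : ∀{x y}->(x , y)∈ jo n -> T(adj(cs ⊤ S)x y)->(x , y)∈ S
  EL p t with proj₂(proj₂(proj₂(ff ⊤ S t)))
  ... | aD q = q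
  ... | aG q = aA(oE(lt p)(lt(db pV q)))
  Dv : ∀{x y}->(x , y)∈ jo n ->(x , y)∈ S -> T(adj(cs ⊤ S)x y)
  Dv p q = fg ⊤ S(∈⊤ , ∈⊤ ,(\{ refl -> aV refl(lt p)}), aD q)
 module _ where
  cp : ∀ n -> List(Fin n × Fin n)
  cp n = bD(ax n)(ax n)
  oh : ∀{B C : Set}(xs : List B)(ys : List C)(f : B × C -> ℚ)-> aM(bD xs ys)f == aM xs(\ x -> aM ys(\ y -> f(x , y)))
  oh [] ys f = refl
  oh(x ∷ xs)ys f = ag(oa(fd(x ,_)ys)_ f)(aS _+_(fM(x ,_)ys f)(oh xs ys f))
  et :{P : A -> Set}(P? : ∀ a -> o8(P a))(xs : List A)-> ι(ah(c9 P? xs))== aM xs(\ a -> ao ⌊ P? a ⌋)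
  et P? [] = iA
  et P?(x ∷ xs)with P? x
  ... | yes _ = ag(cV _)(au(1' +_)(et P? xs))
  ... | no _ = ag(et P? xs)(aI(bu _))
  kN : ∀{n}{B : Set}(g : Fin n -> A)(h : A -> B)(f : B -> ℚ)-> aM(tabulate(h ∘ g))f == aM(tabulate g)(f ∘ h)
  kN{n = zero}g h f = refl
  kN{n = suc n}g h f = au(f(h(g zero))+_)(kN(g ∘ suc)h f)
  hl : ∀ n(f : Fin(suc n)-> ℚ)-> aM(ax(suc n))f == f zero + aM(ax n)(f ∘ suc)
  hl n f = au(f zero +_)(kN(\ x -> x)suc f)
  p6 : ∀ n -> aM(cp n)(\(x , y)-> ao ⌊ x <?ᶠ y ⌋)== ι(n C 2)
  p6 zero = aI iA
  p6(suc n)= begin aM(cp(suc n))(\(x , y)-> ao ⌊ x <?ᶠ y ⌋)≡⟨ ag(oh(ax(suc n))(ax(suc n))(\(x , y)-> lt x y))(hl n(\ x -> aM(ax(suc n))(lt x)))⟩ aM(ax(suc n))(lt zero)+ aM(ax n)(\ x -> aM(ax(suc n))(lt(suc x)))≡⟨ aS _+_(ag(hl n(lt zero))(ag(bu(aM(ax n)(lt zero ∘ suc)))(ag(bL(ax n)1')(ag(aF(ι(ah(ax n))))(au ι(lq n))))))(bF(ax n)(\ x -> ag(hl n(lt(suc x)))(ag(bu(aM(ax n)(lt(suc x)∘ suc)))(bF(ax n)(\ y -> au ao(shift x y))))))⟩ ι n + aM(ax n)(\ x -> aM(ax n)(\ y -> ao ⌊ x <?ᶠ y ⌋))≡⟨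 au(ι n +_)(ag(aI(oh(ax n)(ax n)(\(x , y)-> ao ⌊ x <?ᶠ y ⌋)))(p6 n))⟩ ι n + ι(n C 2)≡⟨ ag(aI(o9 n(n C 2)))(au ι(ag(au(_+' n C 2)(aI(Hu n)))(m1 n 1)))⟩ ι(suc n C 2)∎ where
   open ≡-Reasoning
   lt : ∀{m}-> Fin m -> Fin m -> ℚ
   lt x y = ao ⌊ x <?ᶠ y ⌋
   lq : ∀ n -> ah(ax n)== n
   lq n = Data.List.Properties.length-tabulate(\ x -> x)where
       import Data.List.Properties
   shift : ∀(x y : Fin n)-> ⌊ suc x <?ᶠ suc y ⌋ == ⌊ x <?ᶠ y ⌋
   shift x y = rv(\ t -> bc{a? = x <?ᶠ y}(fw(toWitness{a? = suc x <?ᶠ suc y}t)))(\ t -> bc{a? = suc x <?ᶠ suc y}(bl(toWitness{a? = x <?ᶠ y}t)))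
 zW : ∀{m n}-> ι m == ι n -> m == n
 zW eq = FF(bS(ad eq))(bS(ad(aI eq)))
 p7 : ∀ n -> ah(jo n)== n C 2
 p7 n = zW(ag(et(\(x , y)-> x <?ᶠ y)(cp n))(p6 n))
 -- One coordinate per ordered pair. `cP` reads only the pairs with smaller first entry, and `gL`
 -- shows that this yields the right distribution.
 mm : ℕ -> ℕ
 mm n = ah(cp n)
 cP : ∀ n -> av(mm n)-> a1 n
 cP n S = cs ⊤(c9(\(x , y)-> x <?ᶠ y)(v7(cp n)S))
 v8 : ∀ x n j -> seq(x ^ᴿ n)j == seq x j ^ n
 v8 x zero j = refl
 v8 x(suc n)j = au(seq x j *_)(v8 x n j)
 p8 : ∀ n(q : [0,1]){P : a1 n -> Set}(P? : FK P)j -> seq(ℙ n q P?)j == iq(seq(ai q)j)(mm n)(\ S -> ao ⌊ P?(cP n S)⌋)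
 p8 n q P? j = begin seq(ℙ n q P?)j ≡⟨ r8(c9 P?(fd(cs ⊤)(bG(jo n))))⟩ aM(c9 P?(fd(cs ⊤)(bG(jo n))))(\ R -> seq(weight n q R)j)≡⟨ ag(jj(fd(cs ⊤)(bG(jo n))))(fM(cs ⊤)(bG(jo n))_)⟩ aM(bG(jo n))(\ S -> ao ⌊ P?(cs ⊤ S)⌋ * seq(weight n q(cs ⊤ S))j)≡⟨ g2(bG(jo n))zX ⟩ aM(bG(jo n))(\ S -> p ^ ah S *(1' - p)^(ah(jo n)-' ah S)* ao ⌊ P?(cs ⊤ S)⌋)≡⟨ gL p(\(x , y)-> x <?ᶠ y)(cp n)(\ S -> ao ⌊ P?(cs ⊤ S)⌋)⟩ iq p(mm n)(\ S -> ao ⌊ P?(cP n S)⌋)∎ where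
  open ≡-Reasoning
  p = seq(ai q)j
  r8 : ∀ Rs -> seq(sumᴿ(fd(weight n q)Rs))j == aM Rs(\ R -> seq(weight n q R)j)
  r8 [] = refl
  r8(R ∷ Rs)= au(seq(weight n q R)j +_)(r8 Rs)
  jj : ∀{f : a1 n -> ℚ}Rs -> aM(c9 P? Rs)f == aM Rs(\ R -> ao ⌊ P? R ⌋ * f R)
  jj [] = refl
  jj{f}(R ∷ Rs)with P? R
  ... | yes _ = aS _+_(aI(aH(f R)))(jj Rs)
  ... | no _ = ag(jj Rs)(aI(ag(au(_+ aM Rs(\ R -> ao ⌊ P? R ⌋ * f R))(bY(f R)))(bu _)))
  zX : ∀{S}-> S ∈ bG(jo n)-> ao ⌊ P?(cs ⊤ S)⌋ * seq(weight n q(cs ⊤ S))j == p ^ ah S *(1' - p)^(ah(jo n)-' ah S)* ao ⌊ P?(cs ⊤ S)⌋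
  zX{S}pV = ag(e9(ao ⌊ P?(cs ⊤ S)⌋)_)(au(_* ao ⌊ P?(cs ⊤ S)⌋)(aS _*_(ag(v8(ai q)(e(cs ⊤ S))j)(au(p ^_)(nD n S pV)))(ag(v8(fL 1' +ᴿ -ᴿ ai q)((n C 2)-' e(cs ⊤ S))j)(aS(\ a b ->(1' - p)^(a -' b))(aI(p7 n))(nD n S pV)))))
 module zY (n : ℕ) (q : [0,1]) {P : a1 n → Set} (P? : FK P) where
  iy : av(mm n)-> ℚ
  iy S = ao ⌊ P?(cP n S)⌋
  private
   um : ∀ S -> ∣ iy S ∣ =< 1'
   um S = af(ad(lY(a8 ⌊ P?(cP n S)⌋)))(hU ⌊ P?(cP n S)⌋)
   L = Bq(mm n)
   uo : ∀ a b{ε}-> ∣ a - b ∣ =< ε -> a =< b + ε × b =< a + ε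
   uo a b{ε}h = af(ad(a0 a b))(bA b(af(nE(a - b))h)), af(ad(a0 b a))(bA a(af(af(nE(b - a))(ad(ag(au ∣_∣(aZ a b))(∣-p∣≡∣p∣(a - b)))))h))where
    nE : ∀ p -> p =< ∣ p ∣
    nE p with GR 0' p
    ... | aD b3 = ad(aI(lY b3))
    ... | aG EM = af EM(r5 p)
    a0 : ∀ a b -> a == b +(a - b)
    a0 = ap ar
    aZ : ∀ a b -> b - a == -(a - b)
    aZ = ap ar
   close : ∀ ε -> 0' < ε -> ∃ \ J -> ∀ j -> J <= j -> let x = seq(ai q)j in iq x(mm n)iy =< aB(cI(ix x)(eK x)(eL x)(mm n))iy + ε × aB(cI(ix x)(eK x)(eL x)(mm n))iy =< iq x(mm n)iy + ε
   close ε 0<ε = v9 ℕ.⊔ Dw , \ j le -> uo(iq(seq(ai q)j)(mm n)iy)_(du j(xa j(aa(kD v9 Dw)le))(xb j(aa(kE v9 Dw)le)))where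
    r = f9(1' + L)(gA gW(bK L(p5(mm n))refl))
    uq = ε * ai r
    yb : 0' < uq
    yb = r6 0<ε(ai(proj₂ r))
    -- The first term makes the Lipschitz error at most `ε`; the cap at 1 keeps `|x| ≤ 2`, the range
    -- where the Lipschitz bound holds.
    η = uq ⊓ 1'
    y2 : 0' < η
    y2 with ⊓-sel uq 1'
    ... | aD eq = aL(0' <_)(aI eq)yb
    ... | aG eq = aL(0' <_)(aI eq)gW
    v9 = ai(ai(proj₂ q)η y2)
    xa = proj₂(ai(proj₂ q)η y2)
    Dw = ai(proj₂(proj₂ q)η y2)
    xb = proj₂(proj₂(proj₂ q)η y2)
    du : ∀ j -> 0' =< seq(ai q)j + η -> seq(ai q)j =< 1' + η -> ∣ iq(seq(ai q)j)(mm n)iy - aB(cI(ix(seq(ai q)j))(eK(seq(ai q)j))(eL(seq(ai q)j))(mm n))iy ∣ =< ε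
    du j lo hi = begin ∣ iq x(mm n)iy - aB(cI y(eK x)(eL x)(mm n))iy ∣ ≡⟨ au(\ z -> ∣ iq x(mm n)iy - z ∣)(aI(lI(eK x)(eL x)iy))⟩ ∣ iq x(mm n)iy - iq y(mm n)iy ∣ ≤⟨ nC rC(eK x)(eL x)iy um ⟩ L * ∣ x - y ∣ ≤⟨ dS(p5(mm n))(bK 1' ca(Cj 1' L))(r5(x - y))(af(oO(bO y2)lo hi)(p⊓q≤p uq 1'))⟩(1' + L)*(ε * ai r)≡⟨ a0(1' + L)ε(ai r)⟩ ε *((1' + L)* ai r)≡⟨ ag(au(ε *_)(proj₂(proj₂ r)))(aF ε)⟩ ε ∎ where
     open RQ
     x = seq(ai q)j
     y = ix x
     a0 : ∀ a b c -> a *(b * c)== b *(a * c)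
     a0 = ap ar
     rC : ∣ x ∣ =< 1' + 1'
     rC with ∣p∣≡p∨∣p∣≡-p x
     ... | aD eq = af(ad eq)(af hi(bA 1'(p⊓q≤q uq 1')))
     ... | aG eq = af(ad eq)(af(bK(x + η)lo(aZ x η))(af(p⊓q≤q uq 1')(bK 1' ca refl)))where
      aZ : ∀ x η -> η == - x +(x + η)
      aZ = ap ar
  ur : ∀ c δ -> 0' =< c ->(∃ \ J -> ∀ j -> J <= j -> seq(ai q)j =< c)->(∀ p l u -> p =< c -> aB(cI p l u(mm n))iy =< δ)-> ℙ n q P? ≤ᴿ fL δ
  ur c δ iu(J , hJ)h ε 0<ε = J ℕ.⊔ u0 , \ j le -> let x = seq(ai q)j in af(ad(p8 n q P? j))(af(ai(zZ j(aa(kE J u0)le)))(bC ε(h(ix x)(eK x)(eL x)(q1 iu(hJ j(aa(kD J u0)le))))))where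
   u0 = ai(close ε 0<ε)
   zZ = proj₂(close ε 0<ε)
  uu : ∀ c δ -> c =< 1' ->(∃ \ J -> ∀ j -> J <= j -> c =< seq(ai q)j)->(∀ p l u -> c =< p -> δ =< aB(cI p l u(mm n))iy)-> fL δ ≤ᴿ ℙ n q P?
  uu c δ rB(J , hJ)h ε 0<ε = J ℕ.⊔ u0 , \ j le -> let x = seq(ai q)j in af(h(ix x)(eK x)(eL x)(ul rB(hJ j(aa(kD J u0)le))))(af(proj₂(zZ j(aa(kE J u0)le)))(ad(au(_+ ε)(aI(p8 n q P? j)))))where
   u0 = ai(close ε 0<ε)
   zZ = proj₂(close ε 0<ε)
  yc : ∀ ε -> 0' < ε -> fL(0' - ε)≤ᴿ ℙ n q P?
  yc ε 0<ε kf p9 = ai(close kf p9), \ j le -> let x = seq(ai q)j in af(af(bK ε(bO 0<ε)(a0 ε))(eP(cI(ix x)(eK x)(eL x)(mm n))(\ S -> a8 ⌊ P?(cP n S)⌋)))(af(proj₂(proj₂(close kf p9)j le))(ad(au(_+ kf)(aI(p8 n q P? j)))))where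
   a0 : ∀ ε -> 0' ==(0' - ε)+ ε
   a0 = ap ar
  yd : ∀ ε -> 0' < ε -> ℙ n q P? ≤ᴿ fL(1' + ε)
  yd ε 0<ε kf p9 = ai(close kf p9), \ j le -> let x = seq(ai q)j in af(ad(p8 n q P? j))(af(ai(proj₂(close kf p9)j le))(bC kf(af(af(bm(cI(ix x)(eK x)(eL x)(mm n))(\ S -> hU ⌊ P?(cP n S)⌋))(ad(bk(cI(ix x)(eK x)(eL x)(mm n))1')))(bK ε(bO 0<ε)refl))))
 module kO (n : ℕ) where
  private
   order : Fin n -> Fin n -> Fin n × Fin n
   order x y = if ⌊ x <?ᶠ y ⌋ then(x , y)else(y , x)
   iw : ∀ xy -> xy ∈ cp n
   iw(x , y)= dM(∈-allFin x)(∈-allFin y)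
   nF : ∀ x y -> order x y ==(x , y)⊎ order x y ==(y , x)
   nF x y with ⌊ x <?ᶠ y ⌋
   ... | true = aD refl
   ... | false = aG refl
  dN : Fin n -> Fin n -> Fin(mm n)
  dN x y = xT(iw(order x y))
  br : ∀{x y cy cL}-> dN x y == dN cy cL ->(x == cy × y == cL)⊎(x == cL × y == cy)
  br{x}{y}{cy}{cL}eq with nF x y | nF cy cL | ag(Bp(iw(order x y)))(ag(au(List.lookup(cp n))eq)(aI(Bp(iw(order cy cL)))))
  ... | aD a | aD b | e with ag(aI a)(ag e b)
  ... | refl = aD(refl , refl)
  br eq | aD a | aG b | e with ag(aI a)(ag e b)
  ... | refl = aG(refl , refl)
  br eq | aG a | aD b | e with ag(aI a)(ag e b)
  ... | refl = aG(refl , refl)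
  br eq | aG a | aG b | e with ag(aI a)(ag e b)
  ... | refl = aD(refl , refl)
  private
   q2 : eD(cp n)
   q2 = lr(allFin⁺ n)(allFin⁺ n)
   sR : ∀{x y}-> x Fin.< y -> order x y ==(x , y)
   sR{x}{y}lt with x <?ᶠ y
   ... | yes _ = refl
   ... | no Hf = aA(Hf lt)
   sS : ∀{x y}-> y Fin.< x -> order x y ==(y , x)
   sS{x}{y}gt with x <?ᶠ y
   ... | yes l = aA(oE l gt)
   ... | no _ = refl
   q3 : ∀{a b}S -> a Fin.< b -> T(lookup S(xT(iw(a , b))))->(a , b)∈ c9(\(x , y)-> x <?ᶠ y)(v7(cp n)S)
   q3{a}{b}S lt t = gV(\(x , y)-> x <?ᶠ y)(iL(cp n)S(iw(a , b))t)lt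
  xk : ∀ S{x y}-> x ≢ y -> T(lookup S(dN x y))-> T(adj(cP n S)x y)
  xk S{x}{y}vV t with <-cmp x y
  ... | tri< lt _ _ = fg ⊤ _(∈⊤ , ∈⊤ , vV , aD(q3 S lt(aL(\ o -> T(lookup S(xT(iw o))))(sR lt)t)))
  ... | tri≈ _ eq _ = aA(vV eq)
  ... | tri> _ _ gt = fg ⊤ _(∈⊤ , ∈⊤ , vV , aG(q3 S gt(aL(\ o -> T(lookup S(xT(iw o))))(sS gt)t)))
  xl : ∀ S{x y}-> T(adj(cP n S)x y)-> T(lookup S(dN x y))
  xl S{x}{y}t with proj₂(proj₂(proj₂(ff ⊤(c9(\(x , y)-> x <?ᶠ y)(v7(cp n)S))t)))
  ... | aD p = let q , lt = eO(\(x , y)-> x <?ᶠ y){xs = v7(cp n)S}p in aL(\ o -> T(lookup S(xT(iw o))))(aI(sR lt))(fC(cp n)q2 S(iw(x , y))q)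
  ... | aG p = let q , lt = eO(\(x , y)-> x <?ᶠ y){xs = v7(cp n)S}p in aL(\ o -> T(lookup S(xT(iw o))))(aI(sS lt))(fC(cp n)q2 S(iw(y , x))q)

-- A positive proportion of all tuples are good candidates.

module FQ where
 open M6 using (zero;suc)
 open M7 using (_∷_)
 open M0 using (ℕ;zero;suc)
 open M1 using (∃)
 open M2 hiding (_÷_;∣_∣;floor;truncate)
 open M3
 open M8 using (_∷_;lookup)
 open M14 using (here;there)
 open M4 hiding (J)
 open P1
 open P2
 open P4
 open P5
 open P7
 open P8
 private variable
  s n : ℕ
 ef :(v : Vec(Fin n)s){a : Fin n}-> a ∈ᵛ v -> ∃ \ x -> lookup v x == a
 ef(b ∷ v)(here eq)= zero , aI eq
 ef(b ∷ v)(there p)= let x , eq = ef v p in suc x , eq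
 qb :{a : Fin n}{v : Vec(Fin n)s}-> ¬(a ∈ᵛ v)-> ky v -> ky(a ∷ v)
 qb xm iv zero zero eq = refl
 qb{v = v}xm iv zero(suc y)eq = aA(xm(aL(_∈ᵛ v)(aI eq)(iw v y)))where
  iw : ∀{s n}(v : Vec(Fin n)s)y -> lookup v y ∈ᵛ v
  iw(b ∷ v)zero = here refl
  iw(b ∷ v)(suc y)= there(iw v y)
 qb{v = v}xm iv(suc x)zero eq = aA(xm(aL(_∈ᵛ v)eq(iw v x)))where
  iw : ∀{s n}(v : Vec(Fin n)s)y -> lookup v y ∈ᵛ v
  iw(b ∷ v)zero = here refl
  iw(b ∷ v)(suc y)= there(iw v y)
 qb xm iv(suc x)(suc y)eq = au suc(iv x y eq)
 qc :(a : Fin n)(v : Vec(Fin n)s)-> ao(ha(bn(a ∷ v)))=< ao ⌊ a ∈?ᵛ v ⌋ + ao(ha(bn v))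
 qc a v = af(dg{ha(bn(a ∷ v))}{⌊ a ∈?ᵛ v ⌋ ∨ ha(bn v)}Dn)(lv ⌊ a ∈?ᵛ v ⌋(ha(bn v)))where
  Dn : T(ha(bn(a ∷ v)))-> T(⌊ a ∈?ᵛ v ⌋ ∨ ha(bn v))
  Dn t with a ∈?ᵛ v | ly v
  ... | yes _ | _ = tt
  ... | no _ | no _ = tt
  ... | no xm | yes iv = aA(gc{bn(a ∷ v)}t(bc{a? = ly(a ∷ v)}(qb xm iv)))
 nG : ∀ m(v : Vec(Fin(suc m))s)-> ι(suc m)* aB(ee m)(\ a -> ao ⌊ a ∈?ᵛ v ⌋)=< ι s
 nG m v = af(ad(aI(jb m(\ a -> ao ⌊ a ∈?ᵛ v ⌋))))(j6(ax(suc m))(allFin⁺(suc m))v)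
 jE : ∀ m s -> ι(suc m)* aB(bN(ee m)s)(\ v -> ao(ha(bn v)))=< ι s * ι s
 jE m zero = ad(ag(fJ(ι(suc m)))(aI(ag(au(_* ι 0)iA)(bY(ι 0)))))
 jE m(suc s)= begin M * aB(bN d(suc s))(\ v -> ao(ha(bn v)))≡⟨ au(M *_)(eI d(\ v -> ao(ha(bn v))))⟩ M * aB d(\ a -> aB dv(\ v -> ao(ha(bn(a ∷ v)))))≤⟨ aO M(aY(suc m))(bm d(\ a -> bm dv(\ v -> qc a v)))⟩ M * aB d(\ a -> aB dv(\ v -> ao ⌊ a ∈?ᵛ v ⌋ + ao(ha(bn v))))≡⟨ au(M *_)(ag(bf d(\ a -> eY dv(\ v -> ao ⌊ a ∈?ᵛ v ⌋)(\ v -> ao(ha(bn v)))))(ag(eY d(\ a -> aB dv(\ v -> ao ⌊ a ∈?ᵛ v ⌋))(\ a -> eZ))(aS _+_(gB d dv(\ a v -> ao ⌊ a ∈?ᵛ v ⌋))(bk d eZ))))⟩ M *(aB dv(\ v -> aB d(\ a -> ao ⌊ a ∈?ᵛ v ⌋))+ eZ)≡⟨ ag(tZ M _ eZ)(au(_+ M * eZ)(aI(c7 dv M(\ v -> aB d(\ a -> ao ⌊ a ∈?ᵛ v ⌋)))))⟩ aB dv(\ v -> M * aB d(\ a -> ao ⌊ a ∈?ᵛ v ⌋))+ M * eZ ≤⟨ cQ(af(bm dv(nG m))(ad(bk dv(ι s))))(jE m s)⟩ ι s + ι s * ι s ≤⟨ bK(1' + ι s)(0≤+ ca(aY s))(ag(aS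 _*_(cV s)(cV s))(a0(ι s)))⟩ ι(suc s)* ι(suc s)∎ where
  open RQ
  M = ι(suc m)
  d = ee m
  dv = bN d s
  eZ = aB dv(\ v -> ao(ha(bn v)))
  a0 : ∀ x ->(1' + x)*(1' + x)== x + x * x +(1' + x)
  a0 = ap ar
 oi : ℚ -> ℚ -> bH
 oi σ x = ⌊ σ ≤? x ⌋
 module xn {n : ℕ} (aR : Fin (suc n) → Fin (suc n) → bH) (oc : ∀ x y → aR x y == aR y x) (k : ℕ) where
  open dP aR oc k
  eE : ∀{m}->(Fin(suc m)-> V)->(Fin(suc m)-> bH)-> Fin(suc k)-> bP -> ℚ -> Vec(Fin(suc m))s -> bH
  eE y b i L σ β = bn β ∧(bi b β ∧ oi σ(b0(bj i(Vec.map y β)L)))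
  mn :(jn uv : bH)(σ x : ℚ)-> 0' =< σ -> x =< 1' -> ao uv * x =< ao(jn ∧(uv ∧ oi σ x))+(ao(ha jn)+ σ)
  mn jn false σ x h3 oP = af(ad(bY x))(0≤+(a8(jn ∧ false))(0≤+(a8(ha jn))h3))
  mn false true σ x h3 oP = af(ad(aH x))(af oP(bK σ h3(bu(1' + σ))))
  mn true true σ x h3 oP with σ ≤? x
  ... | yes _ = af(ad(aH x))(af oP(bK(0' + σ)(af h3(ad(aI(bu σ))))refl))
  ... | no uQ = af(ad(aH x))(af(bO(vO uQ))(ad(aI(ag(bu(0' + σ))(bu σ)))))
  -- Jensen's bound `oK` gives mean weight at least `θ ^ h`. The factor 4 leaves room for two losses
  -- of `σ`: tuples with repeated entries, and tuples whose weight falls below `σ`.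
  jF : ∀{m}(y : Fin(suc m)-> V)(b : Fin(suc m)-> bH)(i : Fin(suc k))(L : bP)(θ σ : ℚ)(h : ℕ)-> 0' =< θ -> θ =< 1' -> 0' =< σ -> ι 4 * σ =< θ ^ h -> ι h * ι h =< ι(suc m)* σ -> θ =< aB(ee m)(\ a -> ao(b a)* b0((i , y a)∷ L))-> ∀ s -> 1 <= s -> s <= h -> σ =< aB(bN(ee m)s)(\ β -> ao(eE y b i L σ β))
  jF{m}y b i L θ σ h eg dt h3 lf EN y3 s jx jy = cancel(begin ι 4 * σ ≤⟨ lf ⟩ θ ^ h ≤⟨ f8 eg dt jy ⟩ θ ^ s ≤⟨ j0 s eg y3 ⟩ aB(ee m)(\ a -> ao(b a)* b0((i , y a)∷ L))^ s ≤⟨ oK y b i L s jx ⟩ aB dv(\ β -> ao(bi b β)* b0(bj i(Vec.map y β)L))≤⟨ bm dv(\ β -> mn(bn β)(bi b β)σ(b0(bj i(Vec.map y β)L))h3(lC(bj i(Vec.map y β)L)))⟩ aB dv(\ β -> ao(eE y b i L σ β)+(ao(ha(bn β))+ σ))≡⟨ ag(eY dv(\ β -> ao(eE y b i L σ β))(\ β -> ao(ha(bn β))+ σ))(au(G +_)(ag(eY dv(\ β -> ao(ha(bn β)))(\ _ -> σ))(au(NI +_)(bk dv σ))))⟩ G +(NI + σ)≤⟨ bA G(bC σ ye)⟩ G +(σ + σ)∎)where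
   open RQ
   dv = bN(ee m)s
   G = aB dv(\ β -> ao(eE y b i L σ β))
   NI = aB dv(\ β -> ao(ha(bn β)))
   ye : NI =< σ
   ye = bZ(ι(suc m))(cO m)(af(jE m s)(af(dS(aY s)(bw jy)(aY s)(bw jy))EN))
   cancel : ι 4 * σ =< G +(σ + σ)-> σ =< G
   cancel le = af(bK σ h3 refl)(af(ad(ag(a0 σ)(au(\ z -> z * σ -(σ + σ))(aI(ag(cW 2 2)(aS _*_ l1 l1))))))(af(bC(-(σ + σ))le)(ad(aZ G σ))))where
    a0 : ∀ σ -> σ + σ ==((1' + 1')*(1' + 1'))* σ -(σ + σ)
    a0 = ap ar
    aZ : ∀ g σ -> g +(σ + σ)-(σ + σ)== g
    aZ = ap ar
  mo : ∀{m}(y : Fin(suc m)-> V)(b : Fin(suc m)-> bH)(i : Fin(suc k))(L : bP)(σ : ℚ)(aN s : ℕ)-> 1' =< ι aN * σ -> σ =< aB(bN(ee m)s)(\ β -> ao(eE y b i L σ β))-> suc m ^' s <= aN *' ah(aw(eE y b i L σ)(aJ(suc m)s))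
  mo{m}y b i L σ aN s oj h = bS(begin ι(suc m ^' s)≡⟨ ag(mU(suc m)s)(aI(aF(ι(suc m)^ s)))⟩ ι(suc m)^ s * 1' ≤⟨ aO(ι(suc m)^ s)(aQ s(aY(suc m)))(af oj(aO(ι aN)(aY aN)h))⟩ ι(suc m)^ s *(ι aN * G)≡⟨ a0(ι(suc m)^ s)(ι aN)G ⟩ ι aN *(ι(suc m)^ s * G)≡⟨ au(ι aN *_)(ag(aI(gg m s(ao ∘ eE y b i L σ)))(aI(uw(aJ(suc m)s))))⟩ ι aN * ι(ah(aw(eE y b i L σ)(aJ(suc m)s)))≡⟨ aI(cW aN _)⟩ ι(aN *' ah(aw(eE y b i L σ)(aJ(suc m)s)))∎)where
   open RQ
   G = aB(bN(ee m)s)(\ β -> ao(eE y b i L σ β))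
   a0 : ∀ a c g -> a *(c * g)== c *(a * g)
   a0 = ap ar
   uw : ∀ xs -> ι(ah(aw(eE y b i L σ)xs))== aM xs(ao ∘ eE y b i L σ)
   uw xs = ag(aI(ag(bL(aw(eE y b i L σ)xs)1')(aF _)))(ag(c0(eE y b i L σ)xs(\ _ -> 1'))(bF xs(\ a -> aF(ao(eE y b i L σ a)))))

-- Disjoint copies of one pattern in the random graph.

module Dx where
 open M6 using (zero;suc)
 open M9 using (∣_∣)
 open M7 using ([];_∷_)
 open M16 using (_∈_)
 open M0 using (ℕ;zero;suc)
 open M1 using (∃;_×_)
 open M2 hiding (_÷_;∣_∣;floor;truncate)
 open M3
 open M21 using (⊤)
 open M8 using ([];_∷_;lookup)
 open M4 hiding (J)
 open M15 using (toWitness)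
 open P1
 open P2
 open P3
 open P4
 open P5
 open P6
 open P7 using (bN; ee; gg)
 open P8
 open FQ
 private variable
  A B : Set
 CA : ∀{n s}(α β : Vec(Fin n)s)-> T(1 <=b ∣ J α β ∣)-> T(1 <=b ∣ J β α ∣)
 CA α β t with qd(J α β)(lX 1 _ t)where
  qd : ∀{s}(U : av s)-> 1 <= ∣ U ∣ -> ∃ \ x -> T(lookup U x)
  qd(true ∷ U)_ = zero , tt
  qd(false ∷ U)p = let x , q = qd U p in suc x , q
 ... | x , q with ef α(xW α β x q)
 ... | y , eq = f5(gf(J β α)y(l4 β α y(aL(_∈ᵛ β)(aI eq)(mJ x β))))
 yf : ∀{n s}(α β : Vec(Fin n)s)x y -> lookup α x == lookup β y -> T(1 <=b ∣ J α β ∣)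
 yf α β x y eq = f5(gf(J α β)y(l4 α β y(aL(_∈ᵛ α)eq(mJ x α))))
 u3 : ∀{r M}(κ : Fin M -> Fin r)-> 1 <= M -> ∃ \ j -> M <= r *' ah(aw(\ m -> ⌊ κ m ≟ᶠ j ⌋)(ax M))
 u3{r}{M}κ rD with FI(\ j -> M ℕₚ.≤? r *' BO j)where
  BO : Fin r -> ℕ
  BO j = ah(aw(\ m -> ⌊ κ m ≟ᶠ j ⌋)(ax M))
 ... | yes p = p
 ... | no uQ = aA(aV refl(gQ lt(bS(af(ad total)le))))where
  BO : Fin r -> ℕ
  BO j = ah(aw(\ m -> ⌊ κ m ≟ᶠ j ⌋)(ax M))
  CB : 1 <= r
  CB = go(κ(oN rD))where
   oN : ∀{M}-> 1 <= M -> Fin M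
   oN(bl _)= zero
   go : ∀{r}-> Fin r -> 1 <= r
   go zero = bl bI
   go(suc _)= bl bI
  zA : ∀ qe(xs : List(Fin r))-> aM xs(\ j -> ao ⌊ qe ≟ᶠ j ⌋)== aM xs(\ j -> ao ⌊ j ≟ᶠ qe ⌋)
  zA qe xs = bF xs(\ j -> au ao(sw qe j))where
   sw : ∀ a b -> ⌊ a ≟ᶠ b ⌋ == ⌊ b ≟ᶠ a ⌋
   sw a b with a ≟ᶠ b | b ≟ᶠ a
   ... | yes _ | yes _ = refl
   ... | no _ | no _ = refl
   ... | yes p | no q = aA(q(aI p))
   ... | no p | yes q = aA(p(aI q))
  wa : ∀ qe -> aM(ax r)(\ j -> ao ⌊ qe ≟ᶠ j ⌋)== 1'
  wa qe = ag(zA qe(ax r))(D4(hX(ax r)(allFin⁺ r)qe)(af(ad(aI(pI(bc{a? = qe ≟ᶠ qe}refl))))(m9(\ j -> ao ⌊ j ≟ᶠ qe ⌋)(\ j -> a8 ⌊ j ≟ᶠ qe ⌋)(∈-allFin qe))))where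
   open M22 using (allFin⁺)
   open M18 using (∈-allFin)
  lq : ∀ m -> ah(ax m)== m
  lq m = Data.List.Properties.length-tabulate(\ x -> x)where
      import Data.List.Properties
  total : ι(r *' M)== ι r * aM(ax r)(\ j -> ι(BO j))
  total = ag(cW r M)(au(ι r *_)(aI(ag(bF(ax r)(\ j -> fe(\ m -> ⌊ κ m ≟ᶠ j ⌋)(ax M)))(ag(iC(ax r)(ax M)(\ j m -> ao ⌊ κ m ≟ᶠ j ⌋))(ag(bF(ax M)(\ m -> wa(κ m)))(ag(bL(ax M)1')(ag(aF _)(au ι(lq M)))))))))
  le : ι r * aM(ax r)(\ j -> ι(BO j))=< ι(r *'(M -' 1))
  le = af(ad(aI(fy(ax r)(ι r)(\ j -> ι(BO j)))))(af(cj(ax r)pt)(ad(ag(bL(ax r)(ι(M -' 1)))(ag(au(\ z -> ι z * ι(M -' 1))(lq r))(aI(cW r(M -' 1)))))))where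
   pt : ∀ j -> ι r * ι(BO j)=< ι(M -' 1)
   pt j = af(ad(aI(cW r(BO j))))(bw(ℕₚ.<⇒≤pred(dY(\ q -> uQ(j , q)))))
  lt : r *'(M -' 1)<' r *' M
  lt = FV r{{ℕ.>-nonZero CB}}(ℕₚ.∸-monoʳ-<{M}(bl bI)rD)
 -- The data common to all rounds: the dense relation, the numbering of pairs, and an edge
 -- probability `p = 1 / P` with `P` natural, so that powers of `p` cancel against integers.
 record h4 : Set where
  field
   n k : ℕ
   aR : Fin(suc n)-> Fin(suc n)-> bH
   de : ∀ x y -> aR x y == aR y x
   N : ℕ
   dN : Fin(suc n)-> Fin(suc n)-> Fin N
   br : ∀{x y cy cL}-> dN x y == dN cy cL ->(x == cy × y == cL)⊎(x == cL × y == cy)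
   p : ℚ
   b3 : 0' =< p
   cU : p =< 1'
   P : ℕ
   pP : p * ι P == 1'
 module pr (ir : h4) where
  open h4 ir public
  open xn aR de k public
  open dP aR de k public using (V; bP; b0; e2; bj)
  open pc dN br public
  μ : dx(av N)
  μ = cI p b3 cU N
  -- First-round copies use only such vertices: the second round selects one vertex from each copy
  -- and needs every selected vertex to keep weight `ρ` on its own.
  gM : bP -> Fin(suc k)-> ℚ -> V -> bH
  gM L i ρ w = e2 L i w ∧ oi ρ(b0((i , w)∷ L))
  CC : 1 <= P
  CC with P | pP
  ... | zero | eq = aA(1≢0(ag(aI eq)(ag(au(p *_)iA)(fJ p))))
  ... | suc _ | _ = bl bI
  module BP {s : ℕ} (es : cS s) (kJ : cT es) where
   D : ℕ
   D = P ^' ah es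
   sT : 1 <= D
   sT = bz P{{ℕ.>-nonZero CC}}(ah es)
   w : ℚ
   w = p ^ ah es
   jw : 0' =< w
   jw = aQ(ah es)b3
   wD : w * ι D == 1'
   wD = ag(au(w *_)(mU P(ah es)))(ag(aI(b5 p(ι P)(ah es)))(ag(au(_^ ah es)pP)(1^(ah es))))
   open ue dN br b3 cU pP {suc n} (λ x → x) (λ eq → eq) es kJ public
   open sq dN br b3 cU {suc n} (λ x → x) (λ eq → eq) es kJ public using (at; cG; hs)
   oQ : ah(aJ(suc n)s)== suc n ^' s
   oQ = ux(ag(aI(ag(bL(aJ(suc n)s)1')(aF _)))(ag(gg n s(\ _ -> 1'))(ag(au(ι(suc n)^ s *_)(bk(bN(ee n)s)1'))(ag(aF _)(aI(mU(suc n)s))))))where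
    ux : ∀{a b}-> ι a == ι b -> a == b
    ux eq = FF(bS(ad eq))(bS(ad(aI eq)))
   u4 :(Rn : ℕ)-> 1 <= s ->(∀ U -> 1 <= ∣ U ∣ -> suc n ^'(s -' ∣ U ∣)*' P ^' ch es U <= Rn)-> D <= Rn
   u4 Rn jx hR = aa(ae(aI eq))(hR ⊤ₛ(aa jx(ae(aI(∣⊤∣≡n s)))))where
    open M9 using () renaming (⊤ to ⊤ₛ)
    open M11 using (∣⊤∣≡n)
    open M19 using (lookup-replicate)
    fA :(xs : cS s)-> ah(aw(ha ∘ lW ⊤ₛ)xs)== 0
    fA [] = refl
    fA((x , y)∷ xs)rewrite lookup-replicate x true | lookup-replicate y true = fA xs
    pu : ch es ⊤ₛ == ah es
    pu = ag(aI(aW _))(ag(au(ch es ⊤ₛ +'_)(aI(fA es)))(lz es ⊤ₛ))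
    eq : suc n ^'(s -' ∣ ⊤ₛ{s}∣)*' P ^' ch es ⊤ₛ == D
    eq = ag(aS(\ a b -> suc n ^' a *' P ^' b)(ag(au(s -'_)(∣⊤∣≡n s))(wW s))pu)(bp D)
   module z0 (L : bP) (i : Fin (suc k)) (ρ σ : ℚ) (aN Rn M Δ m : ℕ) (jx : 1 <= s) (eQ : 1 <= aN) (gk : 1 <= Δ)(hR : ∀ U -> 1 <= ∣ U ∣ -> suc n ^'(s -' ∣ U ∣)*' P ^' ch es U <= Rn)(hm : 16 *' κ s *' Rn *' m *' aN <= suc n ^' s)(hM : 272 *' M *' aN *' aN *' Δ *' κ s *' Rn <= suc n ^' s)where
    dc : Vec V s -> bH
    dc = eE(\ x -> x)(gM L i ρ)i L σ
    cM : ∀ β -> T(dc β)-> ky β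
    cM β t = toWitness{a? = ly β}(ai(bh{bn β}t))
    private
     rE : ∀ U -> 2 <= ∣ U ∣ -> suc n ^'(s -' ∣ U ∣)*' P ^' ch es U <= Rn
     rE U le = hR U(aa(bl bI)le)
     nh = u4 Rn jx hR
     Nv = suc n ^' s
    ol : List(Vec V s)
    ol = qT dc cM Rn nh rE
    xo : av N -> ℕ
    xo = Bv dc cM Rn nh rE
    private
     instance
      Dy : ℕ.NonZero(8 *' D)
      Dy = ℕ.>-nonZero(aC(bl(bI{7}))sT)
      EO : ℕ.NonZero D
      EO = ℕ.>-nonZero sT
     Tn = ah ol
     -- One eighth of `Tn / D`, the order of the expected number of present candidates.
     x = Tn /ₙ(8 *' D)
    pv : av N -> bH
    pv S = xo S <=b x
    t4 : ℚ
    t4 = ι Δ *(ι Nv *(w *(ι(κ s)*(ι Rn * w))))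
    fD : av N -> bH
    fD S = oi t4(hY S)
    module _ (hc : Nv <= aN *' ah (aw dc (aJ (suc n) s))) where
     qf : aB μ(ao ∘ pv)=< ½ ^ m
     qf = pg dc cM Rn nh rE x m(kB 2(begin 2 *'(x *'(4 *' D)+' 8 *' κ s *' Rn *' m)≡⟨ ph x D(κ s)Rn m ⟩ x *'(8 *' D)+' 16 *' κ s *' Rn *' m ≤⟨ fI(oF Tn(8 *' D))(g9 _ _ aN{{ℕ.>-nonZero eQ}}(aa hm(aa hc(ae(ck aN Tn)))))⟩ Tn +' Tn ≡⟨ au(Tn +'_)(aI(aW Tn))⟩ 2 *' Tn ∎))where
      open ℕₚ.≤-Reasoning
      ph : ∀ x D k r m -> 2 *'(x *'(4 *' D)+' 8 *' k *' r *' m)== x *'(8 *' D)+' 16 *' k *' r *' m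
      ph = aU
     private
      -- The number of overlaps tolerated per copy. Rounding up adds one `D`, which is at most
      -- `aN Δ κ Rn` and turns 16 into 17; this is the origin of `272 = 16 * 17`.
      t =(16 *' aN *' Δ *' κ s *' Rn)/ₙ D +' 1
      Z = 16 *' aN *' Δ *' κ s *' Rn
      z1 : Z <= t *' D
      z1 = aa(ae(gS Z D))(aa(aK _(bW(Ck Z D)))(ae(ag(el D _)(aI(ag(lm D(Z /ₙ D)1)(au((Z /ₙ D)*' D +'_)(bp D)))))))
      CD : t *' D <= Z +' D
      CD = aa(ae(ag(lm D(Z /ₙ D)1)(au((Z /ₙ D)*' D +'_)(bp D))))(aK D(oF Z D))
      k8 : 1 <= κ s
      k8 = aC(bz 2 s)(bz(suc s)s)
      z2 : Z +' D <= 17 *'(aN *' Δ *' κ s *' Rn)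
      z2 = aa(bJ Z(aa nh(aL(_<= aN *' Δ *' κ s *' Rn)(bp Rn)(aT Rn(aC(aC eQ gk)k8)))))(ae(go aN Δ(κ s)Rn))where
       go : ∀ c d k r -> 16 *' c *' d *' k *' r +' c *' d *' k *' r == 17 *'(c *' d *' k *' r)
       go = aU
      module _ (S : av N) (wb : ¬ T (pv S)) where
       X = xo S
       z3 : Nv <= X *'(8 *' D *' aN)
       z3 = aa hc(aa(az aN EP)(ae(go aN X D)))where
        go : ∀ c x d -> c *'(x *'(8 *' d))== x *'(8 *' d *' c)
        go = aU
        zg : x <' X
        zg = dY(\ le -> wb(f5 le))
        EP : Tn <= X *'(8 *' D)
        EP = aa(ae(gS Tn(8 *' D)))(aa(aK(x *'(8 *' D))(bW(Ck Tn(8 *' D))))(aT(8 *' D)zg))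
       yg : 2 *'(M *' t)<= X
       yg = g9 _ _(8 *' D *' aN){{ℕ.>-nonZero(aC(aC(bl(bI{7}))sT)eQ)}}(begin 2 *'(M *' t)*'(8 *' D *' aN)≡⟨ wc M t D aN ⟩ 16 *' M *' aN *'(t *' D)≤⟨ az(16 *' M *' aN)(aa CD z2)⟩ 16 *' M *' aN *'(17 *'(aN *' Δ *' κ s *' Rn))≡⟨ CE M aN Δ(κ s)Rn ⟩ 272 *' M *' aN *' aN *' Δ *' κ s *' Rn ≤⟨ hM ⟩ Nv ≤⟨ z3 ⟩ X *'(8 *' D *' aN)∎)where
        open ℕₚ.≤-Reasoning
        wc : ∀ m t d c -> 2 *'(m *' t)*'(8 *' d *' c)== 16 *' m *' c *'(t *' d)
        wc = aU
        CE : ∀ m c d k r -> 16 *' m *' c *'(17 *'(c *' d *' k *' r))== 272 *' m *' c *' c *' d *' k *' r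
        CE = aU
       yh : t4 * ι 2 =< ι(X *' t)
       yh = bZ(ι(8 *' aN *'(D *' D)))(k5(aC(aC(bl(bI{7}))eQ)(aC sT sT)))(begin ι(8 *' aN *'(D *' D))*(t4 * ι 2)≡⟨ au(_*(t4 * ι 2))(ag(cW(8 *' aN)(D *' D))(au(ι(8 *' aN)*_)(cW D D)))⟩ ι(8 *' aN)*(ι D * ι D)*(t4 * ι 2)≡⟨ a0(ι(8 *' aN))(ι D)(ι Δ)(ι Nv)w(ι(κ s))(ι Rn)(ι 2)⟩ ι(8 *' aN)* ι 2 * ι Δ * ι(κ s)* ι Rn * ι Nv *((w * ι D)*(w * ι D))≡⟨ ag(aS(\ a b -> ι(8 *' aN)* ι 2 * ι Δ * ι(κ s)* ι Rn * ι Nv *(a * b))wD wD)(ag(au(ι(8 *' aN)* ι 2 * ι Δ * ι(κ s)* ι Rn * ι Nv *_)(aH 1'))(aF _))⟩ ι(8 *' aN)* ι 2 * ι Δ * ι(κ s)* ι Rn * ι Nv ≡⟨ aI(ag(cW(8 *' aN *' 2 *' Δ *' κ s *' Rn)Nv)(au(_* ι Nv)(ag(cW(8 *' aN *' 2 *' Δ *' κ s)Rn)(au(_* ι Rn)(ag(cW(8 *' aN *' 2 *' Δ)(κ s))(au(_* ι(κ s))(ag(cW(8 *' aN *' 2)Δ)(au(_* ι Δ)(cW(8 *' aN)2)))))))))⟩ ι(8 *' aN *' 2 *' Δ *' κ s *' Rn *' Nv)≤⟨ bw(aa(ae(au(_*' Nv)(CF aN Δ(κ s)Rn)))(aa(aC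 z1 z3)(ae(wc t D X aN))))⟩ ι(8 *' aN *'(D *' D)*'(X *' t))≡⟨ cW(8 *' aN *'(D *' D))(X *' t)⟩ ι(8 *' aN *'(D *' D))* ι(X *' t)∎)where
        open RQ
        CF : ∀ c d k r -> 8 *' c *' 2 *' d *' k *' r == 16 *' c *' d *' k *' r
        CF = aU
        wc : ∀ t d x c -> t *' d *'(x *'(8 *' d *' c))== 8 *' c *'(d *' d)*'(x *' t)
        wc = aU
        a0 : ∀ e d dl nv w k rn D9 -> e *(d * d)*(dl *(nv *(w *(k *(rn * w))))* D9)== e * D9 * dl * k * rn * nv *((w * d)*(w * d))
        a0 = ap ar
     -- Outside both bad events there are more than `x` present candidates and few overlapping
     -- pairs, so averaging and greedy choice in `mK` leave `M` disjoint copies.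
     mN : ∀ S -> ¬ T(pv S)-> ¬ T(fD S)-> ∃ \(f : Fin M -> Vec V s)->(∀ a -> T(dc(f a))× T(cG(f a)⊑ S))×(∀ a b -> a ≢ b -> ¬ T(1 <=b ∣ J(at(f a))(at(f b))∣))
     mN S wb y4 = use(mK(\ α β -> 1 <=b ∣ J(at α)(at β)∣)(\ α β -> CA(at α)(at β))t M(X S wb)eF(bg 1 _)(yg S wb)bT(af(aX(ι 2)(aY 2)(af wd(bO(vO(\ le -> y4(bc{a? = t4 ≤? hY S}le))))))(yh S wb)))where
      eF : List(Vec V s)
      eF = aw(\ β -> cG β ⊑ S)ol
      use :(∃ \(f : Fin M -> Vec V s)->(∀ a -> f a ∈ eF)×(∀ a b -> a ≢ b -> ¬ T(1 <=b ∣ J(at(f a))(at(f b))∣)))-> _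
      use(f , t3 , Cs)= f ,(\ a -> let q , c = aP(\ β -> cG β ⊑ S)ol(t3 a)in proj₂(aP dc(aJ(suc n)s)q), c), Cs
      wd : aM eF(\ α -> aM eF(\ β -> ao(1 <=b ∣ J(at α)(at β)∣)))=< hY S
      wd = begin aM eF(\ α -> aM eF(\ β -> ov α β))≡⟨ ag(c0(\ β -> cG β ⊑ S)ol _)(ag(c0 dc(aJ(suc n)s)_)(bF(aJ(suc n)s)(\ α -> au(\ z -> ao(dc α)*(ao(cG α ⊑ S)* z))(ag(c0(\ β -> cG β ⊑ S)ol _)(c0 dc(aJ(suc n)s)_)))))⟩ aM(aJ(suc n)s)(\ α -> ao(dc α)*(ao(cG α ⊑ S)* aM(aJ(suc n)s)(\ β -> ao(dc β)*(ao(cG β ⊑ S)* ov α β))))≤⟨ cj(aJ(suc n)s)(\ α -> af(ad(EQ α))(cj(aJ(suc n)s)(pt α)))⟩ hY S ∎ where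
       open RQ
       ov : Vec V s -> Vec V s -> ℚ
       ov α β = ao(1 <=b ∣ J(at α)(at β)∣)
       xp : ∀ α -> ao(dc α)=< ao(bn α)
       xp α = dg{dc α}{bn α}(\ t -> ai(bh{bn α}t))
       EQ : ∀ α -> ao(dc α)*(ao(cG α ⊑ S)* aM(aJ(suc n)s)(\ β -> ao(dc β)*(ao(cG β ⊑ S)* ov α β)))== aM(aJ(suc n)s)(\ β -> ao(dc α)*(ao(cG α ⊑ S)*(ao(dc β)*(ao(cG β ⊑ S)* ov α β))))
       EQ α = aI(ag(fy(aJ(suc n)s)(ao(dc α))_)(au(ao(dc α)*_)(fy(aJ(suc n)s)(ao(cG α ⊑ S))_)))
       pt : ∀ α β -> ao(dc α)*(ao(cG α ⊑ S)*(ao(dc β)*(ao(cG β ⊑ S)* ov α β)))=< ao(bn α)*(ao(bn β)*(ov α β * ao((cG α ∪ cG β)⊑ S)))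
       pt α β = af(ad(a0(ao(dc α))(ao(cG α ⊑ S))(ao(dc β))(ao(cG β ⊑ S))(ov α β)))(af(dS(a8(dc α))(xp α)(a7(a8(dc β))z4)(dS(a8(dc β))(xp β)z4 bR))(ad(au(\ z -> ao(bn α)*(ao(bn β)*(ov α β * z)))(ag(aI(cX(cG α ⊑ S)(cG β ⊑ S)))(au ao(aI(cn(cG α)(cG β)S)))))))where
        z = ov α β *(ao(cG α ⊑ S)* ao(cG β ⊑ S))
        z4 : 0' =< z
        z4 = a7(a8(1 <=b ∣ J(at α)(at β)∣))(a7(a8(cG α ⊑ S))(a8(cG β ⊑ S)))
        a0 : ∀ a c b d o -> a *(c *(b *(d * o)))== a *(b *(o *(c * d)))
        a0 = ap ar
    lJ : ι Δ * aB μ(ao ∘ fD)=< 1'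
    lJ = bZ xr z5(begin xr *(ι Δ * aB μ(ao ∘ fD))≡⟨ a0 xr(ι Δ)(aB μ(ao ∘ fD))⟩ t4 * aB μ(ao ∘ fD)≤⟨ w3 μ hY t4 z6 fD(\ S t -> toWitness{a? = t4 ≤? hY S}t)⟩ aB μ hY ≤⟨ pQ Rn hR ⟩ ι(ah(aJ(suc n)s))*(w *(ι(κ s)*(ι Rn * w)))≡⟨ au(\ z -> ι z *(w *(ι(κ s)*(ι Rn * w))))oQ ⟩ xr ≡⟨ aI(aF xr)⟩ xr * 1' ∎)where
     open RQ
     xr = ι Nv *(w *(ι(κ s)*(ι Rn * w)))
     a0 : ∀ e d x -> e *(d * x)== d * e * x
     a0 = ap ar
     Gh : 0' < w
     Gh = oR jw(\ eq -> 1≢0(ag(aI wD)(ag(au(_* ι D)(aI eq))(bY(ι D)))))where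
      oR : ∀{a b}-> a =< b -> a ≢ b -> a < b
      oR{a}{b}le ne = vO(\ ge -> ne(D4 le ge))
     z5 : 0' < xr
     z5 = r6(k5(bz(suc n)s))(r6 Gh(r6(k5(aC(bz 2 s)(bz(suc s)s)))(r6(k5(aa sT nh))Gh)))
     z6 : ∀ S -> 0' =< hY S
     z6 S = cZ(aJ(suc n)s)(\ α -> cZ(aJ(suc n)s)(\ β -> a7(a8(bn α))(a7(a8(bn β))(a7(a8(1 <=b ∣ J(at α)(at β)∣))(a8((cG α ∪ cG β)⊑ S))))))

-- Two-round exposure for tuples with a positive second density.

module CG where
 open M6 using (zero;suc)
 open M9 using (∣_∣;⊥)
 open M11 using (∉⊥)
 open M7 using ([];_∷_)
 open M16 using (_∈_)
 open M13 using (here;there)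
 open M10 using ([];_∷_)
 open M0 using (ℕ;zero;suc)
 open M1 using (∃;_×_)
 open M2 hiding (_÷_;∣_∣;floor;truncate)
 open M3
 open M21 using (⊤)
 open M8 using ([];_∷_;lookup;tabulate;replicate)
 open M4 hiding (J)
 open M15 using (toWitness)
 open P1
 open P2
 open P3
 open P4
 open P5
 open P6
 open P7 using (ee; jb; bi; gH; kK; iF)
 open P8
 open FQ
 open Dx
 private variable
  A B : Set
 f3 : ∀ m n o .{{_ : ℕ.NonZero n}}-> m *' n <= o -> m <= o /ₙ n
 f3 m n o le = aa(ae(aI(m*n/n≡m m n)))(Hv n le)
 -- The property holds outside an event of probability at most `δ`. The exceptional event is a
 -- Boolean function, so the property itself may be undecidable.
 kC : dx A -> ℚ ->(A -> Set)-> Set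
 kC{A}d δ 𝒫 = ∃ \(gU : A -> bH)-> aB d(ao ∘ gU)=< δ ×(∀ a -> ¬ T(gU a)-> 𝒫 a)
 dH :(d : dx A){δ jk : ℚ}{𝒫 𝒬 : A -> Set}-> δ =< jk ->(∀ a -> 𝒫 a -> 𝒬 a)-> kC d δ 𝒫 -> kC d jk 𝒬
 dH d le f(gU , b , h)= gU , af b le , \ a nb -> f a(h a nb)
 fS :(d : dx A){δ : ℚ}{𝒫 : A -> Set}-> 0' =< δ ->(∀ a -> 𝒫 a)-> kC d δ 𝒫
 fS d sU h =(\ _ -> false), af(ad(bk d 0'))sU , \ a _ -> h a
 q4 :(d : dx A){δ jk : ℚ}{𝒫 𝒬 : A -> Set}-> kC d δ 𝒫 -> kC d jk 𝒬 -> kC d(δ + jk)(\ a -> 𝒫 a × 𝒬 a)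
 q4 d(cN , iM , xa)(b4 , mX , xb)=(\ a -> cN a ∨ b4 a), af(bm d(\ a -> lv(cN a)(b4 a)))(af(ad(eY d(ao ∘ cN)(ao ∘ b4)))(cQ iM mX)), \ a nb -> xa a(\ t -> nb(gb t)), xb a(\ t -> nb(hq{cN a}t))
 mp :(d : dx A)(xs : List B){δ : ℚ}{𝒫 : B -> A -> Set}->(∀ x -> kC d δ(𝒫 x))-> kC d(ι(ah xs)* δ)(\ a -> ∀{x}-> x ∈ xs -> 𝒫 x a)
 mp d []{δ}h = fS d(ad(aI(ag(au(_* δ)iA)(bY δ))))(\ a())
 mp d(x ∷ xs){δ}h = dH d(ad(ag(a0 δ(ι(ah xs)))(au(_* δ)(aI(cV(ah xs))))))(\{ a(p , q)(here refl)-> p;a(p , q)(there r)-> q r })(q4 d(h x)(mp d xs h))where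
  a0 : ∀ δ l -> δ + l * δ ==(1' + l)* δ
  a0 = ap ar
 om :(d : dx A)(gU : A -> bH){δ : ℚ}-> aB d(ao ∘ gU)=< δ -> kC d δ(\ a -> ¬ T(gU a))
 om d gU le = gU , le , \ a nb -> nb
 gl : dx A -> dx B -> dx(A × B)
 gl d e = kK d(\ a -> k6(a ,_)e)
 hz :(d : dx A)(e : dx B)(f : A × B -> ℚ)-> aB(gl d e)f == aB d(\ a -> aB e(\ b -> f(a , b)))
 hz d e f = ag(iF d _ f)(bf d(\ a -> hV(a ,_)e f))
 uy :(d : dx A)(e : dx B){δ : ℚ}{𝒫 : A -> Set}-> kC d δ 𝒫 -> kC(gl d e)δ(𝒫 ∘ ai)
 uy d e(gU , le , h)= gU ∘ ai , af(ad(ag(hz d e _)(bf d(\ a -> bk e(ao(gU a))))))le , \ ab nb -> h(ai ab)nb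
 -- The exceptional event of the second round may depend on the outcome of the first; where the
 -- first round failed, everything is declared exceptional.
 sV :(d : dx A)(e : dx B){δ jk : ℚ}{𝒫 : A -> Set}{𝒬 : A -> B -> Set}-> 0' =< jk -> kC d δ 𝒫 ->(∀ a -> 𝒫 a -> kC e jk(𝒬 a))-> kC(gl d e)(δ + jk)(\ ab -> 𝒬(ai ab)(proj₂ ab))
 sV{A = A}{B = B}d e{δ}{jk}{𝒫}{𝒬}y5(gU , le , h)k = u5 , du , BQ where
  iI :(a : A)(v : bH)->(¬ T v -> 𝒫 a)-> B -> bH
  iI a true g b = true
  iI a false g b = ai(k a(g(\())))b
  u5 : A × B -> bH
  u5(a , b)= iI a(gU a)(h a)b
  pt : ∀ a v(g : ¬ T v -> 𝒫 a)-> aB e(\ b -> ao(iI a v g b))=< ao v + jk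
  pt a true g = af(ad(bk e 1'))(bK jk y5 refl)
  pt a false g = af(ai(proj₂(k a(g(\())))))(ad(aI(bu jk)))
  du : aB(gl d e)(ao ∘ u5)=< δ + jk
  du = af(ad(hz d e _))(af(bm d(\ a -> pt a(gU a)(h a)))(af(ad(ag(eY d(ao ∘ gU)(\ _ -> jk))(au(aB d(ao ∘ gU)+_)(bk d jk))))(bC jk le)))
  z7 : ∀ a b v(g : ¬ T v -> 𝒫 a)-> ¬ T(iI a v g b)-> 𝒬 a b
  z7 a b true g nb = aA(nb tt)
  z7 a b false g nb = proj₂(proj₂(k a(g(\()))))b nb
  BQ : ∀ ab -> ¬ T(u5 ab)-> 𝒬(ai ab)(proj₂ ab)
  BQ(a , b)nb = z7 a b(gU a)(h a)nb
 gm : ∀ M s -> ι(ah(aJ M s))== ι M ^ s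
 gm M s = ag(aI(ag(bL(aJ M s)1')(aF _)))(go s)where
  go : ∀ s -> aM(aJ M s)(\ _ -> 1')== ι M ^ s
  go zero = dL 1'
  go(suc s)= ag(hr(ax M)(replicate s(ax M))(\ _ -> 1'))(ag(bL(ax M)(aM(aJ M s)(\ _ -> 1')))(aS _*_(au ι(cR{n = M}(\ x -> x)))(go s)))
 qg : ∀{s h}-> s <= h -> κ s <= κ h
 qg{s}{h}le = aC(bX 2 le)(aa(b7 s(bl le))(bX(suc h)le))
 module z8 (ir : h4) where
  open pr ir
  xt : ∀{q}(S : av q)-> T(⊥ ⊑ S)
  xt S = hH ⊥ S(\ p -> aA(∉⊥ p))
  module wf {sW : ℕ} (y : Fin (suc sW) → V) (j7 : ∀ {a b} → y a == y b → a == b){s : ℕ}(es : cS s)(kJ : cT es)(b : Fin(suc sW)-> bH)(L : bP)(i : Fin(suc k))(σ : ℚ)where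
   open sq dN br b3 cU y j7 es kJ using (cG)
   private
    M = suc sW
   dc : Vec(Fin M)s -> bH
   dc = eE y b i L σ
   cM : ∀ β -> T(dc β)-> ky β
   cM β t = toWitness{a? = ly β}(ai(bh{bn β}t))
   nH :(aN Rn m : ℕ)-> M ^' s <= aN *' ah(aw dc(aJ M s))->(es == [] ⊎(P ^' ah es <= Rn ×(∀ U -> 2 <= ∣ U ∣ -> M ^'(s -' ∣ U ∣)*' P ^' ch es U <= Rn)× 8 *' κ s *' Rn *' m *' aN <= M ^' s))-> kC μ(½ ^ m)(\ S -> ∃ \ β -> T(dc β)× T(cG β ⊑ S))
   nH aN Rn m hc(aD refl)= fS μ(aQ m eX)(\ S -> go S(aw dc(aJ M s))(\ p -> proj₂(aP dc(aJ M s)p))hc)where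
    go : ∀ S(xs : List(Vec(Fin M)s))->(∀{β}-> β ∈ xs -> T(dc β))-> M ^' s <= aN *' ah xs -> ∃ \ β -> T(dc β)× T(cG β ⊑ S)
    go S [] f le = aA(aV refl(aa(bz M s)(aa le(ae(fx aN)))))
    go S(β ∷ xs)f le = β , f(here refl), xt S
   nH aN Rn m hc(aG(u4 , hR , hm))= dH μ bR some(om μ(\ S -> Bv dc cM Rn u4 hR S <=b 0)(pg dc cM Rn u4 hR 0 m(g9 _ _ aN{{nz}}(aa hm(aa hc(ae(ck aN _)))))))where
    open ue dN br b3 cU pP y j7 es kJ
    nz : ℕ.NonZero aN
    nz = ℕ.>-nonZero(z9 aN hc)where
     z9 : ∀ c -> M ^' s <= c *' ah(aw dc(aJ M s))-> 1 <= c
     z9 zero le = aA(aV refl(aa(bz M s)le))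
     z9(suc c)le = bl bI
    some : ∀ S -> ¬ T(Bv dc cM Rn u4 hR S <=b 0)-> ∃ \ β -> T(dc β)× T(cG β ⊑ S)
    some S n0 = go(aw(\ β -> cG β ⊑ S)(qT dc cM Rn u4 hR))(\ p -> p)n0 where
     go : ∀ xs ->(∀{β}-> β ∈ xs -> β ∈ aw(\ β -> cG β ⊑ S)(qT dc cM Rn u4 hR))-> ¬ T(ah xs <=b 0)-> ∃ \ β -> T(dc β)× T(cG β ⊑ S)
     go [] f n0 = aA(n0 tt)
     go(β ∷ _)f n0 = let q , t = aP(\ β -> cG β ⊑ S)(qT dc cM Rn u4 hR)(f(here refl))in β , proj₂(aP dc(aJ M s)q), t
 -- The inequality "value of the tuple at most `B / E`" in natural numbers: `a4` is the leading
 -- graph, and `α / E` bounds the `m₁` of all the others.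
 record cx {r : ℕ} (s : Fin r → ℕ) (es : ∀ j → cS (s j)) (B E : ℕ) : Set where
  field
   a4 : Fin r
   α : ℕ
   Dz : ∀ U -> 1 <= ∣ U ∣ -> α +' E *' ch(es a4)U <= B *' ∣ U ∣
   eZ : ∀ j -> j ≢ a4 -> ∀ U -> E *' ch(es j)U <= α *'(∣ U ∣ -' 1)
 module Gi (ir : h4) {r : ℕ} (B E z : ℕ) (oS : 1 <= z) (BR : h4.P ir == z ^' E) (h : ℕ) where
  open pr ir
  open z8 ir
  Nv : ℕ
  Nv = suc n
  qi : Vec(Fin r)Nv -> av N -> bP -> Fin(suc k)-> ℚ -> Fin r -> ∀{s}-> cS s -> Set
  qi c S L i σ j{s}es = ∃ \(α : Vec V s)-> ky α ×(∀ x -> lookup c(lookup α x)== j)×(∀ x -> T(e2 L i(lookup α x)))× T(fa es α ⊑ S)× σ =< b0(bj i α L)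
  P^ : ∀ e -> P ^' e == z ^'(E *' e)
  P^ e = ag(au(_^' e)BR)(cz z E e)
  module _ {s : Fin r → ℕ} {es : ∀ j → cS (s j)} (kJ : ∀ j → cT (es j)) (jx : ∀ j → 1 <= s j) (jy : ∀ j → s j <= h)(cd : cx s es B E)(kg : 1 <= cx.α cd)(ε ρ θ σ : ℚ)(eg : 0' =< θ)(dt : θ =< 1')(h3 : 0' =< σ)(lf : ι 4 * σ =< θ ^ h)(qj : ι r * θ =< ρ)(pw : ρ + ρ =< ε * ε)(h5 : 0' =< ε)(q5 : 0' =< ρ)(kP : θ =< ρ)(aN Δ ek C : ℕ)(oj : 1' =< ι aN * σ)(eQ : 1 <= aN)(gk : 1 <= Δ)(yi : 2 *'(h *' r)<= 2 ^' ek)(nI : 1 <= ek)(jG : 16 *' κ h *' aN <= C)(kQ : 272 *'(8 *' κ h *' aN *' ek)*' aN *' aN *' Δ *' κ h <= C)(qk : C *' z ^' B <= suc n)(kh : ι h * ι h =< ι(suc n)* σ)(q6 : ι h * ι h =< ι z * σ)(Ls : List bP)(i : Fin(suc k))where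
   open cx cd
   private
    instance
     Aa : ℕ.NonZero z
     Aa = ℕ.>-nonZero oS
    k8 : ∀ q -> 1 <= κ q
    k8 q = aC(bz 2 q)(bz(suc q)q)
    Kc = 8 *' κ h *' aN *' ek
    nJ : 1 <= Kc
    nJ = aC(aC(aC(bl(bI{7}))(k8 h))eQ)nI
    rF = z ^' α
    u6 : 1 <= rF
    u6 = bz z α
    oo : z <= rF
    oo = aa(ae(aI(f6 z)))(bX z kg)
    -- `Dz` guarantees of the order of `z ^ α` disjoint copies of the leading graph, and by `eZ` a
    -- set of `z ^ α` vertices, up to a constant factor, is the scale at which the other graphs
    -- appear.
    M = Kc *' rF
    rD : 1 <= M
    rD = aC nJ u6
    Ab : 1 <= C
    Ab = aa(aC(aC(bl(bI{15}))(k8 h))eQ)jG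
    e8 = s a4
    instance
     DA : ℕ.NonZero(C *' rF)
     DA = ℕ.>-nonZero(aC Ab u6)
    -- `Dz` together with `C z ^ B ≤ n + 1` says that every count in `hR` is at most this quotient;
    -- the factor `z ^ α` in the denominator is what makes the failure probability `½ ^ (z ^ α)`.
    Rn =(Nv ^' e8)/ₙ(C *' rF)
    uz : Rn *'(C *' rF)<= Nv ^' e8
    uz = oF(Nv ^' e8)(C *' rF)
    C^ : ∀ u -> 1 <= u -> C *' z ^'(B *' u)<= Nv ^' u
    C^(suc u)_ = aa(aT(z ^'(B *' suc u))(aL(_<= C ^' suc u)(f4 C)(az C(bz C{{ℕ.>-nonZero Ab}}u))))(aa(ae(ag(au(C ^' suc u *'_)(aI(cz z B(suc u))))(aI(b6 C(z ^' B)(suc u)))))(b7(suc u)qk))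
    sX : ∀{q}(U : av q)-> ∣ U ∣ <= q
    sX U = Data.Fin.Subset.Properties.∣p∣≤n U where
        import Data.Fin.Subset.Properties
    xu : ∀ x{q}(U : av q)-> x ^'(q -' ∣ U ∣)*' x ^' ∣ U ∣ == x ^' q
    xu x{q}U = ag(aI(gR x(q -' ∣ U ∣)∣ U ∣))(au(x ^'_)(m0(sX U)))
    hR : ∀ U -> 1 <= ∣ U ∣ -> Nv ^'(e8 -' ∣ U ∣)*' P ^' ch(es a4)U <= Rn
    hR U h0 = f3 _(C *' rF)_(begin Nv ^'(e8 -' ∣ U ∣)*' P ^' ch(es a4)U *'(C *' rF)≡⟨ au(\ q -> Nv ^'(e8 -' ∣ U ∣)*' q *'(C *' rF))(P^(ch(es a4)U))⟩ a *' z ^'(E *' ch(es a4)U)*'(C *' rF)≡⟨ go a(z ^'(E *' ch(es a4)U))C rF ⟩ a *'(C *'(rF *' z ^'(E *' ch(es a4)U)))≡⟨ au(\ q -> a *'(C *' q))(aI(gR z α _))⟩ a *'(C *' z ^'(α +' E *' ch(es a4)U))≤⟨ az a(az C(bX z(Dz U h0)))⟩ a *'(C *' z ^'(B *' ∣ U ∣))≤⟨ az a(C^ ∣ U ∣ h0)⟩ a *' Nv ^' ∣ U ∣ ≡⟨ xu Nv U ⟩ Nv ^' e8 ∎)where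
     open ℕₚ.≤-Reasoning
     a = Nv ^'(e8 -' ∣ U ∣)
     go : ∀ a e c x -> a *' e *'(c *' x)== a *'(c *'(x *' e))
     go = aU
    hm : 16 *' κ e8 *' Rn *' rF *' aN <= Nv ^' e8
    hm = aa(ae(go(κ e8)Rn rF aN))(aa(az Rn(aT rF(aa(aT aN(az 16(qg(jy a4))))jG)))uz)where
     go : ∀ k r x c -> 16 *' k *' r *' x *' c == r *'(16 *' k *' c *' x)
     go = aU
    hM : 272 *' M *' aN *' aN *' Δ *' κ e8 *' Rn <= Nv ^' e8
    hM = aa(ae(go Kc rF aN Δ(κ e8)Rn))(aa(az Rn(aT rF(aa(az(272 *' Kc *' aN *' aN *' Δ)(qg(jy a4)))kQ)))uz)where
     go : ∀ kc x c d k r -> 272 *'(kc *' x)*' c *' c *' d *' k *' r == r *'(272 *' kc *' c *' c *' d *' k *' x)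
     go = aU
    module Pt = BP (es a4) (kJ a4)
    module e0 (L : bP) = Pt.z0 L i ρ σ aN Rn M Δ rF (jx a4) eQ gk hR hm hM
    sY : ∀ L -> ε =< b0 L -> Nv ^' e8 <= aN *' ah(aw(e0.dc L)(aJ(suc n)e8))
    sY L fk = mo(\ x -> x)(gM L i ρ)i L σ aN e8 oj(jF(\ x -> x)(gM L i ρ)i L θ σ h eg dt h3 lf kh(af kP uA)e8(jx a4)(jy a4))where
     open dP aR de k using (jd; lC)
     d = ee n
     CH : ∀(f : bH)x -> x =< 1' -> ao f * x =< ao(f ∧ oi ρ x)* x + ρ
     CH false x oP = af(ad(bY x))(af q5(ad(aI(ag(au(_+ ρ)(bY x))(bu ρ)))))
     CH true x oP with ρ ≤? x
     ... | yes _ = bK ρ q5 refl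
     ... | no uQ = af(ad(aH x))(af(bO(vO uQ))(ad(aI(ag(au(_+ ρ)(bY x))(bu ρ)))))
     uA : ρ =< aB d(\ w -> ao(gM L i ρ w)* b0((i , w)∷ L))
     uA = begin ρ ≡⟨ a0 ρ ⟩ ρ + ρ - ρ ≤⟨ bC(- ρ)(af pw(af(dS h5 fk h5 fk)(jd L i)))⟩ aB d(\ w -> ao(e2 L i w)* b0((i , w)∷ L))- ρ ≤⟨ bC(- ρ)(bm d(\ w -> CH(e2 L i w)(b0((i , w)∷ L))(lC((i , w)∷ L))))⟩ aB d(\ w -> ao(gM L i ρ w)* b0((i , w)∷ L)+ ρ)- ρ ≡⟨ au(\ q -> q - ρ)(ag(eY d(\ w -> ao(gM L i ρ w)* b0((i , w)∷ L))(\ _ -> ρ))(au(G +_)(bk d ρ)))⟩ G + ρ - ρ ≡⟨ aZ G ρ ⟩ G ∎ where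
      open RQ
      G = aB d(\ w -> ao(gM L i ρ w)* b0((i , w)∷ L))
      a0 : ∀ x -> x == x + x - x
      a0 = ap ar
      aZ : ∀ g x -> g + x - x == g
      aZ = ap ar
    h6 : bP -> av N -> Set
    h6 L S = ∃ \(f : Fin M -> Vec V e8)->(∀ a -> T(e0.dc L(f a))× T(Pt.cG(f a)⊑ S))×(∀ a b -> a ≢ b -> ¬ T(1 <=b ∣ J(Pt.at(f a))(Pt.at(f b))∣))
    BS = f9(ι Δ)(k5 gk)
    -- The overlap event is taken once, at the empty state, because `hY` does not mention the state;
    -- only the exponentially unlikely event is summed over `Ls`.
    rG : kC μ(ai BS + ι(ah Ls)* ½ ^ rF)(\ S -> ∀{L}-> L ∈ Ls -> ε =< b0 L -> h6 L S)
    rG = dH μ bR(\ S(nc , nf){L}BT fk -> e0.mN L(sY L fk)S(nf BT fk)nc)(q4 μ(om μ(e0.fD [])sZ)(mp μ Ls{𝒫 = \ L S -> ε =< b0 L -> ¬ T(e0.pv L S)}Bw))where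
     sZ : aB μ(ao ∘ e0.fD [])=< ai BS
     sZ = bZ(ι Δ)(k5 gk)(af(e0.lJ [])(ad(aI(proj₂(proj₂ BS)))))
     Bw : ∀ L -> kC μ(½ ^ rF)(\ S -> ε =< b0 L -> ¬ T(e0.pv L S))
     Bw L with ε ≤? b0 L
     ... | yes fk = dH μ bR(\ S nf _ -> nf)(om μ(e0.pv L)(e0.qf L(sY L fk)))
     ... | no u7 = fS μ(aQ rF eX)(\ S fk -> aA(u7 fk))
    iN : av N -> bP -> av N -> Set
    iN gn L f7 = ∀ c -> ∃ \ j -> qi c(gn ∪ f7)L i σ j(es j)
    module _ (gn : av N) (L : bP) (tY : h6 L gn) where
     private
      f = ai tY
      DB : ∃ \ sW -> M == suc sW
      DB = go M rD where
       go : ∀ m -> 1 <= m -> ∃ \ sW -> m == suc sW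
       go(suc m)_ = m , refl
     r9 : ∀ a x -> T(gM L i ρ(lookup(f a)x))
     r9 a x = gH(gM L i ρ)(f a)(ai(bh{bi(gM L i ρ)(f a)}(proj₂(bh{bn(f a)}(ai(ai(proj₂ tY)a))))))x
     lK : ∀(β : Vec V e8)x -> lookup(Pt.at β)x == lookup β x
     lK β x = bv x(\ v -> v)β
     -- The colouring enters the second round only through the position `lL` of a vertex avoiding
     -- colour `a4` in each first-round copy and the colour `sa` of that vertex. So a union bound
     -- over `(e8 * r) ^ M` cases replaces one over all colourings.
     module q7 (lL : Vec (Fin e8) M) (sa : Vec (Fin r) M) (j : Fin r) (ql : j ≢ a4)(wZ : M <= r *' ah(aw(\ m -> ⌊ lookup sa m ≟ᶠ j ⌋)(ax M)))where
      y : Fin M -> V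
      y a = lookup(f a)(lookup lL a)
      j7 : ∀{a b}-> y a == y b -> a == b
      j7{a}{b}eq with a ≟ᶠ b
      ... | yes p = p
      ... | no ne = aA(proj₂(proj₂ tY)a b ne(yf(Pt.at(f a))(Pt.at(f b))(lookup lL a)(lookup lL b)(ag(lK(f a)(lookup lL a))(ag eq(aI(lK(f b)(lookup lL b)))))))
      b : Fin M -> bH
      b a = ⌊ lookup sa a ≟ᶠ j ⌋
      rH : av N -> Set
      rH S = ∃ \(β : Vec(Fin M)(s j))-> ky β ×(∀ x -> T(b(lookup β x)))× σ =< b0(bj i(Vec.map y β)L)× T(fa(es j)(Vec.map y β)⊑ S)
      nH : kC μ(½ ^(M *' ek))rH
      nH = go(ai DB)(proj₂ DB)y j7 b{refl}wZ(\ a -> r9 a(lookup lL a))where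
       go : ∀ sW -> M == suc sW -> ∀{m}(y : Fin m -> V)(j7 : ∀{a b}-> y a == y b -> a == b)(b : Fin m -> bH)-> {m == M}-> m <= r *' ah(aw b(ax m))->(∀ a -> T(gM L i ρ(y a)))-> kC μ(½ ^(M *' ek))(\ S -> ∃ \(β : Vec(Fin m)(s j))-> ky β ×(∀ x -> T(b(lookup β x)))× σ =< b0(bj i(Vec.map y β)L)× T(fa(es j)(Vec.map y β)⊑ S))
       go sW eq{zero}y j7 b{Ac}wZ ER = aA(aV(ag Ac refl)rD)
       go sW eq{suc m}y j7 b{Ac}wZ ER = dH μ bR(\{ S(β , t , cp)-> β , g3.cM β t ,(\ x -> gH b β(ai(bh{bi b β}(proj₂(bh{bn β}t))))x), toWitness{a? = σ ≤? b0(bj i(Vec.map y β)L)}(proj₂(bh{bi b β}(proj₂(bh{bn β}t)))), cp })(g3.nH aN lM(M *' ek)lN s0)where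
        module g3 = wf y j7 (es j) (kJ j) b L i σ
        Ad : θ =< aB(ee m)(\ a -> ao(b a)* b0((i , y a)∷ L))
        Ad = begin θ ≡⟨ aI(aF θ)⟩ θ * 1' ≤⟨ aO θ eg q8 ⟩ θ *(ι r * aB(ee m)(ao ∘ b))≡⟨ a0 θ(ι r)(aB(ee m)(ao ∘ b))⟩ ι r * θ * aB(ee m)(ao ∘ b)≤⟨ aX(aB(ee m)(ao ∘ b))(eP(ee m)(\ a -> a8(b a)))qj ⟩ ρ * aB(ee m)(ao ∘ b)≡⟨ aI(c7(ee m)ρ(ao ∘ b))⟩ aB(ee m)(\ a -> ρ * ao(b a))≤⟨ bm(ee m)(\ a -> af(ad(e9 ρ(ao(b a))))(aO(ao(b a))(a8(b a))(toWitness{a? = ρ ≤? b0((i , y a)∷ L)}(proj₂(bh{e2 L i(y a)}(ER a))))))⟩ aB(ee m)(\ a -> ao(b a)* b0((i , y a)∷ L))∎ where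
         open RQ
         a0 : ∀ t r e -> t *(r * e)== r * t * e
         a0 = ap ar
         aZ : ∀ r m e -> r *(m * e)== m *(r * e)
         aZ = ap ar
         q8 : 1' =< ι r * aB(ee m)(ao ∘ b)
         q8 = bZ(ι(suc m))(cO m)(af(ad(aF(ι(suc m))))(af(bw wZ)(ad(ag(cW r(ah(aw b(ax(suc m)))))(ag(au(ι r *_)(ag(fe b(ax(suc m)))(jb m(ao ∘ b))))(aZ(ι r)(ι(suc m))(aB(ee m)(ao ∘ b))))))))
        Ae : ι h * ι h =< ι(suc m)* σ
        Ae = af q6(aX σ h3(bw(aa oo(aa(aL(_<= M)(bp rF)(aT rF nJ))(ae(aI Ac))))))
        lN : suc m ^' s j <= aN *' ah(aw g3.dc(aJ(suc m)(s j)))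
        lN = mo y b i L σ aN(s j)oj(jF y b i L θ σ h eg dt h3 lf Ae Ad(s j)(jx j)(jy j))
        instance
         DC : ℕ.NonZero(suc m *' Kc)
         DC = ℕ.>-nonZero(aC(bl(bI{m}))nJ)
        lM =(suc m ^' s j)/ₙ(suc m *' Kc)
        wg : lM *'(suc m *' Kc)<= suc m ^' s j
        wg = oF(suc m ^' s j)(suc m *' Kc)
        Af : ∀ u -> 2 <= u -> z ^'(α *'(u -' 1))*'(suc m *' Kc)<= suc m ^' u
        Af(suc(suc u))_ = aa(ae(ny(z ^'(α *' suc u))(suc m)Kc))(az(suc m)(aa(az(z ^'(α *' suc u))(aL(_<= Kc ^' suc u)(f4 Kc)(az Kc(bz Kc{{ℕ.>-nonZero nJ}}u))))(ae(ag(ck(z ^'(α *' suc u))(Kc ^' suc u))(ag(au(Kc ^' suc u *'_)(aI(cz z α(suc u))))(ag(aI(b6 Kc rF(suc u)))(au(_^' suc u)(aI Ac))))))))where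
         ny : ∀ a m k -> a *'(m *' k)== m *'(a *' k)
         ny = aU
        Af(suc zero)(bl())
        rE : ∀ U -> 2 <= ∣ U ∣ -> suc m ^'(s j -' ∣ U ∣)*' P ^' ch(es j)U <= lM
        rE U mO = f3 _(suc m *' Kc)_(aa(ae(ag(au(\ q -> suc m ^'(s j -' ∣ U ∣)*' q *'(suc m *' Kc))(P^(ch(es j)U)))(ew(suc m ^'(s j -' ∣ U ∣))_ _)))(aa(az(suc m ^'(s j -' ∣ U ∣))(aa(aT(suc m *' Kc)(bX z(eZ j ql U)))(Af ∣ U ∣ mO)))(ae(xu(suc m)U))))
        CI : 8 *' κ(s j)*' lM *'(M *' ek)*' aN <= suc m ^' s j
        CI = aa(ae(ag(au(\ q -> 8 *' κ(s j)*' lM *'(q *' ek)*' aN)(aI Ac))(ny(κ(s j))lM(suc m)ek aN)))(aa(az lM(az(suc m)(aT ek(aT aN(az 8(qg(jy j)))))))wg)where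
         ny : ∀ k r m q c -> 8 *' k *' r *'(m *' q)*' c == r *'(m *'(8 *' k *' c *' q))
         ny = aU
        -- A pattern with an edge has at least two vertices, so `rE` applies to its whole vertex
        -- set; an edgeless pattern needs no random edge.
        s0 : es j == [] ⊎(P ^' ah(es j)<= lM ×(∀ U -> 2 <= ∣ U ∣ -> suc m ^'(s j -' ∣ U ∣)*' P ^' ch(es j)U <= lM)× 8 *' κ(s j)*' lM *'(M *' ek)*' aN <= suc m ^' s j)
        s0 = gp(es j)refl where
         open M9 using () renaming (⊤ to ⊤ₛ)
         open M11 using (∣⊤∣≡n)
         open M19 using (lookup-replicate)
         fA : ∀(xs : cS(s j))-> ah(aw(ha ∘ lW ⊤ₛ)xs)== 0
         fA [] = refl
         fA((x , y)∷ xs)rewrite lookup-replicate x true | lookup-replicate y true = fA xs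
         yj : ch(es j)⊤ₛ == ah(es j)
         yj = ag(aI(aW _))(ag(au(ch(es j)⊤ₛ +'_)(aI(fA(es j))))(lz(es j)⊤ₛ))
         D9 : ∀{q}(x y : Fin q)-> x Fin.< y -> 2 <= q
         D9{suc zero}zero(suc())_
         D9{suc(suc q)}x y lt = bl(bl bI)
         gp : ∀ xs -> xs == es j -> es j == [] ⊎(P ^' ah(es j)<= lM ×(∀ U -> 2 <= ∣ U ∣ -> suc m ^'(s j -' ∣ U ∣)*' P ^' ch(es j)U <= lM)× 8 *' κ(s j)*' lM *'(M *' ek)*' aN <= suc m ^' s j)
         gp [] e = aD(aI e)
         gp((x , y)∷ _)e = aG(aa(ae(aI(ag(aS(\ a q -> suc m ^' a *' P ^' q)(ag(au(s j -'_)(∣⊤∣≡n(s j)))(wW(s j)))yj)(bp _))))(rE ⊤ₛ(aa CJ(ae(aI(∣⊤∣≡n(s j)))))), rE , CI)where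
          CJ : 2 <= s j
          CJ = D9 x y(All.lookup(proj₂(kJ j))(aL((x , y)∈_)e(here refl)))
     module _ where
      sb : Vec(Fin r)M -> Fin r -> Set
      sb sa j = M <= r *' ah(aw(\ m -> ⌊ lookup sa m ≟ᶠ j ⌋)(ax M))
      s1 : av N -> Set
      s1 S = ∀{lL}-> lL ∈ aJ e8 M -> ∀{sa}-> sa ∈ aJ r M -> ∀{j}-> j ∈ ax r ->(ql : j ≢ a4)(wZ : sb sa j)-> q7.rH lL sa j ql wZ S
      zX : ∀ lL sa j -> kC μ(½ ^(M *' ek))(\ S ->(ql : j ≢ a4)(wZ : sb sa j)-> q7.rH lL sa j ql wZ S)
      zX lL sa j with j ≟ᶠ a4 | M ℕₚ.≤? r *' ah(aw(\ m -> ⌊ lookup sa m ≟ᶠ j ⌋)(ax M))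
      ... | yes eq | _ = fS μ(aQ(M *' ek)eX)(\ S ne -> aA(ne eq))
      ... | no _ | no np = fS μ(aQ(M *' ek)eX)(\ S _ wZ -> aA(np wZ))
      ... | no ne | yes pp = dH μ bR(\ S F _ _ -> F)(q7.nH lL sa j ne pp)
     s2 : kC μ(ι(ah(aJ e8 M))*(ι(ah(aJ r M))*(ι(ah(ax r))* ½ ^(M *' ek))))s1
     s2 = mp μ(aJ e8 M)(\ lL -> mp μ(aJ r M)(\ sa -> mp μ(ax r)(\ j -> zX lL sa j)))
     wh : ι(ah(aJ e8 M))*(ι(ah(aJ r M))*(ι(ah(ax r))* ½ ^(M *' ek)))=< ι r * ½ ^ M
     wh = begin ι(ah(aJ e8 M))*(ι(ah(aJ r M))*(ι(ah(ax r))* ½ ^(M *' ek)))≡⟨ aS _*_(gm e8 M)(aS _*_(gm r M)(aS _*_(au ι(cR{n = r}(\ x -> x)))(Cp ½ M ek)))⟩ ι e8 ^ M *(ι r ^ M *(ι r *(½ ^ ek)^ M))≡⟨ a0(ι e8 ^ M)(ι r ^ M)(ι r)((½ ^ ek)^ M)⟩ ι r *(ι e8 ^ M * ι r ^ M *(½ ^ ek)^ M)≡⟨ au(ι r *_)(ag(au(_*(½ ^ ek)^ M)(aI(b5(ι e8)(ι r)M)))(aI(b5(ι e8 * ι r)(½ ^ ek)M)))⟩ ι r *(ι e8 * ι r * ½ ^ ek)^ M ≤⟨ aO(ι r)(aY r)(j0 M(a7(a7(aY e8)(aY r))(aQ ek eX))ki)⟩ ι r * ½ ^ M ∎ where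
      open RQ
      a0 : ∀ a b c d -> a *(b *(c * d))== c *(a * b * d)
      a0 = ap ar
      yl : ∀ q -> ι(2 ^' q)* ½ ^ q == 1'
      yl q = ag(au(_* ½ ^ q)(ag(mU 2 q)(au(_^ q)l1)))(ag(aI(b5(1' + 1')½ q))(ag(au(_^ q)vR)(1^ q)))
      -- `2 ^ ek` is at least `2 h r`, so the choice of a vertex and a colour for each copy is
      -- beaten with a factor one half per copy to spare.
      ki : ι e8 * ι r * ½ ^ ek =< ½
      ki = bZ(ι 2)(cO 1)(begin ι 2 *(ι e8 * ι r * ½ ^ ek)≡⟨ ag(aI(hp(ι 2)(ι e8 * ι r)(½ ^ ek)))(au(_* ½ ^ ek)(ag(au(ι 2 *_)(aI(cW e8 r)))(aI(cW 2(e8 *' r)))))⟩ ι(2 *'(e8 *' r))* ½ ^ ek ≤⟨ aX(½ ^ ek)(aQ ek eX)(bw(aa(az 2(aT r(jy a4)))yi))⟩ ι(2 ^' ek)* ½ ^ ek ≡⟨ yl ek ⟩ 1' ≡⟨ aI(ag(au(_* ½)l1)vR)⟩ ι 2 * ½ ∎)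
     -- Either some first-round copy has colour `a4` throughout, or each has a vertex of another
     -- colour; a most frequent colour `j` among these vertices satisfies the hypothesis of the
     -- second round.
     wi : ∀ f7 -> s1 f7 -> iN gn L f7
     wi f7 DD c with FI(\ a -> D5(\ x -> lookup c(lookup(f a)x)≟ᶠ a4))
     ... | yes(a , mono)= a4 , Pt.at(f a), Pt.hs(f a)(e0.cM L(f a)(ai(ai(proj₂ tY)a))),(\ x -> ag(au(lookup c)(lK(f a)x))(mono x)),(\ x -> aL(\ v -> T(e2 L i v))(aI(lK(f a)x))(ai(bh{e2 L i(lookup(f a)x)}(r9 a x)))), eo(fa(es a4)(Pt.at(f a)))gn(gn ∪ f7)(proj₂(ai(proj₂ tY)a))(gD gn f7), toWitness{a? = σ ≤? b0(bj i(Pt.at(f a))L)}(proj₂(bh{bi(gM L i ρ)(f a)}(proj₂(bh{bn(f a)}(ai(ai(proj₂ tY)a))))))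
     ... | no xv = hA(u3(\ a -> gY a)rD)where
      ji : ∀ a -> ∃ \ x -> lookup c(lookup(f a)x)≢ a4
      ji a = zd e8(\ x -> lookup c(lookup(f a)x)== a4)(\ x -> lookup c(lookup(f a)x)≟ᶠ a4)(\ h -> xv(a , h))
      gY : Fin M -> Fin r
      gY a = lookup c(lookup(f a)(ai(ji a)))
      lL : Vec(Fin e8)M
      lL = tabulate(\ a -> ai(ji a))
      sa : Vec(Fin r)M
      sa = tabulate gY
      Ag : ∀ a -> lookup sa a == gY a
      Ag = a9 gY
      jl : ∀ j(xs : List(Fin M))-> ah(aw(\ a -> ⌊ gY a ≟ᶠ j ⌋)xs)== ah(aw(\ a -> ⌊ lookup sa a ≟ᶠ j ⌋)xs)
      jl j [] = refl
      jl j(a ∷ xs)rewrite Ag a with gY a ≟ᶠ j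
      ... | yes _ = au suc(jl j xs)
      ... | no _ = jl j xs
      hA :(∃ \ j -> M <= r *' ah(aw(\ m -> ⌊ gY m ≟ᶠ j ⌋)(ax M)))-> ∃ \ j -> qi c(gn ∪ f7)L i σ j(es j)
      hA(j , wZ)= j , Vec.map Ch.y β , qm , kR , ym , eo(fa(es j)(Vec.map Ch.y β))f7(gn ∪ f7)cp(ep gn f7), dn where
       ql : j ≢ a4
       ql refl = aV refl(aa rD(aa wZ(ae(ag(au(r *'_)(fA(ax M)))(fx r)))))where
        fA : ∀ xs -> ah(aw(\ a -> ⌊ gY a ≟ᶠ a4 ⌋)xs)== 0
        fA [] = refl
        fA(a ∷ xs)with gY a ≟ᶠ a4
        ... | yes eq = aA(proj₂(ji a)eq)
        ... | no _ = fA xs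
       q8 : sb sa j
       q8 = aL(\ q -> M <= r *' q)(jl j(ax M))wZ
       module Ch = q7 lL sa j ql q8
       ES = DD(ey lL)(ey sa)(∈-allFin j)ql q8
       β = ai ES
       Es = ai(proj₂ ES)
       Hg = ai(proj₂(proj₂ ES))
       dn = ai(proj₂(proj₂(proj₂ ES)))
       cp = proj₂(proj₂(proj₂(proj₂ ES)))
       qm : ky(Vec.map Ch.y β)
       qm x cy eq = Es x cy(Ch.j7(ag(aI(bv x Ch.y β))(ag eq(bv cy Ch.y β))))
       kR : ∀ x -> lookup c(lookup(Vec.map Ch.y β)x)== j
       kR x = ag(au(lookup c)(ag(bv x Ch.y β)(au(lookup(f a))(a9(\ a -> ai(ji a))a))))(ag(aI(Ag a))(toWitness{a? = lookup sa a ≟ᶠ j}(Hg x)))where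
           a = lookup β x
       ym : ∀ x -> T(e2 L i(lookup(Vec.map Ch.y β)x))
       ym x = aL(\ v -> T(e2 L i v))(aI(bv x Ch.y β))(ai(bh{e2 L i(Ch.y(lookup β x))}(r9(lookup β x)(lookup lL(lookup β x)))))
   s3 : kC(gl μ μ)(ai BS + ι(ah Ls)* ½ ^ rF + ι(ah Ls)*(ι r * ½ ^ M))(\ S -> ∀{L}-> L ∈ Ls -> ε =< b0 L -> iN(ai S)L(proj₂ S))
   s3 = sV μ μ{𝒬 = \ gn f7 -> ∀{L}-> L ∈ Ls -> ε =< b0 L -> iN gn L f7}(a7(aY(ah Ls))(a7(aY r)(aQ M eX)))rG(\ gn tY -> jH Ls(\{L}p -> tY p))where
    jH : ∀{gn}(s4 : List bP)->(∀{L}-> L ∈ s4 -> ε =< b0 L -> h6 L gn)-> kC μ(ι(ah s4)*(ι r * ½ ^ M))(\ f7 -> ∀{L}-> L ∈ s4 -> ε =< b0 L -> iN gn L f7)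
    jH [] tY = fS μ(ad(aI(ag(au(_*(ι r * ½ ^ M))iA)(bY(ι r * ½ ^ M)))))(\ f7())
    jH{gn}(L ∷ s4)tY = dH μ(ad(ag(a0(ι r * ½ ^ M)(ι(ah s4)))(au(_*(ι r * ½ ^ M))(aI(cV(ah s4))))))(\{ f7(p , q)(here refl)-> p;f7(p , q)(there u)-> q u })(q4 μ wa(jH s4(tY ∘ there)))where
     a0 : ∀ δ l -> δ + l * δ ==(1' + l)* δ
     a0 = ap ar
     wa : kC μ(ι r * ½ ^ M)(\ f7 -> ε =< b0 L -> iN gn L f7)
     wa with ε ≤? b0 L
     ... | yes fk = dH μ{𝒫 = s1 gn L(tY(here refl)fk)}(wh gn L(tY(here refl)fk))(\ f7(a : s1 gn L(tY(here refl)fk)f7)_ -> wi gn L(tY(here refl)fk)f7(\{lL}-> a{lL}))(s2 gn L(tY(here refl)fk))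
     ... | no u7 = fS μ(a7(aY r)(aQ M eX))(\ f7 fk -> aA(u7 fk))

-- Levels of weight, and copies placed before the main step.

module ET where
 open M6 using (zero;suc)
 open M9 using (∣_∣)
 open M7 using ([];_∷_;replicate)
 open M10 using ([];_∷_)
 open M12 using ([];_∷_)
 open M16 using (_∈_)
 open M13 using (here;there)
 open M0 using (ℕ;zero;suc)
 open M1 using (∃;_×_)
 open M2 hiding (_÷_;∣_∣;floor;truncate)
 open M3
 open M8 using ([];_∷_;lookup)
 open M4 hiding (J)
 open M15 using (toWitness)
 open P1
 open P2
 open P3
 open P4
 open P5
 open P7 using (ee; bN; eI; bi; gH)
 open P8
 open FQ
 open Dx
 open CG
 yn :{A : Set}{d : dx A}{q : ℕ}{δ : ℚ}{𝒫 : A × Vec A q -> Set}-> kC(gl d(bN d q))δ 𝒫 -> kC(bN d(suc q))δ(\ v -> 𝒫(Vec.head v , Vec.tail v))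
 yn{d = d}{q}(gU , le , h)=(\ v -> gU(Vec.head v , Vec.tail v)), af(ad(ag(eI d(\ v -> ao(gU(Vec.head v , Vec.tail v))))(aI(hz d(bN d q)(ao ∘ gU)))))le , \ v nb -> h(Vec.head v , Vec.tail v)nb
 mq :{A : Set}(xs : List A)-> eD xs -> ∀ s -> s <= ah xs -> ∃ \(v : Vec A s)->(∀ x y -> lookup v x == lookup v y -> x == y)×(∀ x -> lookup v x ∈ xs)
 mq xs u zero _ = [] ,(\()), \()
 mq(x ∷ xs)(px ∷ u)(suc s)(bl le)with mq xs u s le
 ... | v , iv , DE = x ∷ v , jn , iw where
  jn : ∀ a b -> lookup(x ∷ v)a == lookup(x ∷ v)b -> a == b
  jn zero zero eq = refl
  jn zero(suc b)eq = aA(All.lookup px(DE b)eq)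
  jn(suc a)zero eq = aA(All.lookup px(DE a)(aI eq))
  jn(suc a)(suc b)eq = au suc(iv a b eq)
  iw : ∀ a -> lookup(x ∷ v)a ∈ x ∷ xs
  iw zero = here refl
  iw(suc a)= there(DE a)
 u8 : ∀{N q}-> Vec(av N)q -> av N
 u8 [] = Data.Fin.Subset.⊥
 u8(S ∷ Ss)= S ∪ u8 Ss
 module lg (h r : ℕ) (fu : 1 <= h) (fv : 1 <= r) (γ : ℚ) (h7 : 0' < γ) (dI : γ =< 1') where
  private
   Ea : ∃ \ q -> 0' < q × ι r * q == 1'
   Ea = f9(ι r)(k5 fv)
   q = ai Ea
   jI : 0' < ½
   jI = da ½
   Ah : q =< 1'
   Ah = af(ad(aI(aH q)))(af(aX q(bO(ai(proj₂ Ea)))(af(ad(aI jZ))(bw fv)))(ad(proj₂(proj₂ Ea))))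
  -- The three losses of one placement: `ε² / 2` from Cauchy-Schwarz after discarding light or used
  -- vertices, division by `r` for passing to a frequent colour, and `θ ^ h / 4` from Jensen with
  -- the factor 4 of `jF`.
  wj uB Ai : ℚ -> ℚ
  wj e = ½ *(e * e)
  uB e = wj e * q
  Ai e = ½ *(½ * uB e ^ h)
  ε : ℕ -> ℚ
  ε zero = γ
  ε(suc x)= Ai(ε x)
  ρ θ : ℕ -> ℚ
  ρ x = wj(ε x)
  θ x = uB(ε x)
  private
   Unit : ℚ -> Set
   Unit e = 0' < e × e =< 1'
   q9 : ∀{a b}-> Unit a -> Unit b -> Unit(a * b)
   q9{a}{b}(G1 , Aj)(FO , EU)= r6 G1 FO , af(dS(bO G1)Aj(bO FO)EU)(ad(aH 1'))
   sc : Unit ½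
   sc = jI , j1
   u9 : ∀{e}-> Unit e -> Unit(wj e)
   u9{e}u = q9{½}{e * e}sc(q9{e}{e}u u)
   sd : ∀{e}-> Unit e -> Unit(uB e)
   sd{e}u = q9{wj e}{q}(u9{e}u)(ai(proj₂ Ea), Ah)
   yo : ∀{e}-> Unit e -> Unit(Ai e)
   yo{e}u = q9{½}{½ * uB e ^ h}sc(q9{½}{uB e ^ h}sc(rt h(ai ut), lZ h(bO(ai ut))(proj₂ ut)))where
       ut = sd{e}u
   kS : ∀ x -> Unit(ε x)
   kS zero = h7 , dI
   kS(suc x)= yo{ε x}(kS x)
   jp : ∀{a b}-> 0' =< b -> a =< 1' -> a * b =< b
   jp{a}{b}EV Aj = af(aX b EV Aj)(ad(aH b))
  0<ε : ∀ x -> 0' < ε x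
  0<ε x = ai(kS x)
  h5 : ∀ x -> 0' =< ε x
  h5 x = bO(0<ε x)
  q5 : ∀ x -> 0' =< ρ x
  q5 x = bO(ai(u9{ε x}(kS x)))
  eg : ∀ x -> 0' =< θ x
  eg x = bO(ai(sd{ε x}(kS x)))
  dt : ∀ x -> θ x =< 1'
  dt x = proj₂(sd{ε x}(kS x))
  kP : ∀ x -> θ x =< ρ x
  kP x = af(ad(e9(ρ x)q))(jp{q}{ρ x}(q5 x)Ah)
  qj : ∀ x -> ι r * θ x =< ρ x
  qj x = ad(ag(a0(ι r)(ρ x)q)(ag(au(ρ x *_)(proj₂(proj₂ Ea)))(aF(ρ x))))where
   a0 : ∀ i r q -> i *(r * q)== r *(i * q)
   a0 = ap ar
  pw : ∀ x -> ρ x + ρ x =< ε x * ε x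
  pw x = ad(ag(a0 ½(ε x * ε x))(ag(au(_*(ε x * ε x))vR)(aH(ε x * ε x))))where
   a0 : ∀ a e -> a * e + a * e ==(1' + 1')* a * e
   a0 = ap ar
  lf : ∀ x -> ι 4 * ε(suc x)=< θ x ^ h
  lf x = ad(ag(au(_* ε(suc x))(ag(cW 2 2)(aS _*_ l1 l1)))(ag(a0 ½(θ x ^ h))(ag(aS(\ a b -> a * b * θ x ^ h)vR vR)(ci(θ x ^ h)))))where
   a0 : ∀ a t ->(1' + 1')*(1' + 1')*(a *(a * t))==(1' + 1')* a *((1' + 1')* a)* t
   a0 = ap ar
   ci : ∀ t -> 1' * 1' * t == t
   ci = ap ar
  nK : ∀ x -> ε(suc x)=< ρ x
  nK x = af(jp{½}{½ * θ x ^ h}(a7 eX(aQ h(eg x)))j1)(af(jp{½}{θ x ^ h}(aQ h(eg x))j1)(af(f8(eg x)(dt x)fu)(af(ad(aF(θ x)))(kP x))))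
  rb : ∀ x -> ε(suc x)=< ε x
  rb x = af(nK x)(af(jp{½}{ε x * ε x}(a7(h5 x)(h5 x))j1)(jp{ε x}{ε x}(h5 x)(proj₂(kS x))))
  mc : ∀ x y -> x <= y -> ε y =< ε x
  mc x y x≤y = aL(\ z -> ε z =< ε x)(m0 x≤y)(go(y -' x))where
   go : ∀ d -> ε(d +' x)=< ε x
   go zero = bR
   go(suc d)= af(rb(d +' x))(go d)
 module vb (ir : h4) where
  open pr ir
  open z8 ir
  open dP aR de k using (f0; jC)
  private
   Nv : ℕ
   Nv = suc n
  record s5 (h m aN : ℕ) : Set where
   field
    dp : Fin(suc k)
    {bt}: ℕ
    bQ : cS bt
    py : cT bQ
    s6 : 1 <= bt
    qn : bt <= h
    cb : bQ == [] ⊎ ∃ \ Rn -> P ^' ah bQ <= Rn ×(∀ U -> 2 <= ∣ U ∣ -> Nv ^'(bt -' ∣ U ∣)*' P ^' ch bQ U <= Rn)× 8 *' κ bt *' Rn *' m *' aN <= Nv ^' bt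
  open s5
  s7 :(L : bP)-> Vec V(ah(fd proj₂ L))
  s7 L = fromList(fd proj₂ L)
  qo : ∀ L{e}-> e ∈ L -> proj₂ e ∈ᵛ s7 L
  qo L p = FY(∈-map⁺ proj₂ L p)
  -- Besides being compatible with the state, the copy avoids all vertices placed before, so
  -- repeating a task produces disjoint copies.
  record fT (S : av N) (L : bP) {h m aN} (t : s5 h m aN) (σ : ℚ) (α : Vec V (bt t)) : Set where
   field
    jn : ky α
    DF : ∀ x -> T(e2 L(dp t)(lookup α x))
    iz : ∀ x{e}-> e ∈ L -> proj₂ e ≢ lookup α x
    eF : T(fa(bQ t)α ⊑ S)
    dense : σ =< b0(bj(dp t)α L)
  module _ {h : ℕ} (ε ρ θ σ : ℚ) (h5 : 0' =< ε) (eg : 0' =< θ) (dt : θ =< 1') (kP : θ =< ρ) (h3 : 0' =< σ) (lf : ι 4 * σ =< θ ^ h) (pw : ρ + ρ =< ε * ε)(m aN : ℕ)(oj : 1' =< ι aN * σ)(kh : ι h * ι h =< ι Nv * σ)where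
   EW :(t : s5 h m aN)(L : bP)-> ι(ah L)=< ι Nv * ρ -> ε =< b0 L -> kC μ(½ ^ m)(\ S -> ∃(fT S L t σ))
   EW t L BU fk = dH μ bR qq(rd(cb t))where
    i = dp t
    s = bt t
    vs = s7 L
    b : V -> bH
    b w = e2 L i w ∧ ha ⌊ w ∈?ᵛ vs ⌋
    module g3 = wf {n} (λ x → x) (λ eq → eq) (bQ t) (py t) b L i σ
    CH : ∀(f g : bH)x -> x =< 1' -> ao f * x =< ao(f ∧ ha g)* x + ao g
    CH false g x oP = af(ad(bY x))(0≤+(ad(aI(bY x)))(a8 g))
    CH true false x oP = ad(aI(dL(1' * x)))
    CH true true x oP = af(ad(aH x))(af oP(ad(aI(ag(au(_+ 1')(bY x))(bu 1')))))
    used : aB(ee n)(\ w -> ao ⌊ w ∈?ᵛ vs ⌋)=< ρ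
    used = bZ(ι Nv)(cO n)(af(nG n vs)(af(ad(au ι(fK proj₂ L)))BU))
    G = aB(ee n)(\ w -> ao(b w)* b0((i , w)∷ L))
    Ad : θ =< G
    Ad = af kP(begin ρ ≡⟨ a0 ρ ⟩ ρ + ρ - ρ ≤⟨ bC(- ρ)(af pw(af(dS h5 fk h5 fk)(jd L i)))⟩ aB(ee n)(\ w -> ao(e2 L i w)* b0((i , w)∷ L))- ρ ≤⟨ bC(- ρ)(bm(ee n)(\ w -> CH(e2 L i w)⌊ w ∈?ᵛ vs ⌋(b0((i , w)∷ L))(lC((i , w)∷ L))))⟩ aB(ee n)(\ w -> ao(b w)* b0((i , w)∷ L)+ ao ⌊ w ∈?ᵛ vs ⌋)- ρ ≡⟨ au(\ q -> q - ρ)(eY(ee n)(\ w -> ao(b w)* b0((i , w)∷ L))(\ w -> ao ⌊ w ∈?ᵛ vs ⌋))⟩ G + aB(ee n)(\ w -> ao ⌊ w ∈?ᵛ vs ⌋)- ρ ≤⟨ bC(- ρ)(bA G used)⟩ G + ρ - ρ ≡⟨ aZ G ρ ⟩ G ∎)where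
     open RQ
     open dP aR de k using (jd; lC)
     a0 : ∀ x -> x == x + x - x
     a0 = ap ar
     aZ : ∀ g x -> g + x - x == g
     aZ = ap ar
    lN : Nv ^' s <= aN *' ah(aw g3.dc(aJ Nv s))
    lN = mo(\ x -> x)b i L σ aN s oj(jF(\ x -> x)b i L θ σ h eg dt h3 lf kh Ad s(s6 t)(qn t))
    rH : av N -> Set
    rH S = ∃ \ β -> T(g3.dc β)× T(fa(bQ t)(Vec.map(\ x -> x)β)⊑ S)
    rd :(bQ t == [] ⊎ ∃ \ Rn -> P ^' ah(bQ t)<= Rn ×(∀ U -> 2 <= ∣ U ∣ -> Nv ^'(bt t -' ∣ U ∣)*' P ^' ch(bQ t)U <= Rn)× 8 *' κ(bt t)*' Rn *' m *' aN <= Nv ^' bt t)-> kC μ(½ ^ m)rH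
    rd(aD eq)= g3.nH aN 0 m lN(aD eq)
    rd(aG(Rn , xa , xb , Gj))= g3.nH aN Rn m lN(aG(xa , xb , Gj))
    qq : ∀ S -> rH S -> ∃(fT S L t σ)
    qq S(β , DG , cp)= β , record { jn = g3.cM β DG ;DF = \ x -> ai(bh{e2 L i(lookup β x)}(Ak x));iz = \ x{e}p eq -> gc{⌊ lookup β x ∈?ᵛ vs ⌋}(proj₂(bh{e2 L i(lookup β x)}(Ak x)))(bc{a? = lookup β x ∈?ᵛ vs}(aL(_∈ᵛ vs)eq(qo L p)));eF = aL(\ γ -> T(fa(bQ t)γ ⊑ S))(map-id β)cp ;dense = aL(\ γ -> σ =< b0(bj i γ L))(map-id β)(toWitness{a? = σ ≤? b0(bj i(Vec.map(\ x -> x)β)L)}(proj₂(bh{bi b β}(proj₂(bh{bn β}DG)))))} where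
     Ak : ∀ x -> T(b(lookup β x))
     Ak = gH b β(ai(bh{bi b β}(proj₂(bh{bn β}DG))))
  module vc {h m aN r : ℕ} (fu : 1 <= h) (fv : 1 <= r) (γ : ℚ) (h7 : 0' < γ) (dI : γ =< 1') where
   open lg h r fu fv γ h7 dI
   data cc (S : av N) : ℕ → bP → List (s5 h m aN) → bP → Set where
    [] : ∀{x L}-> cc S x L [] L
    _∷_ : ∀{x L t ts b1 α}-> fT S L t(ε(suc x))α -> cc S(suc x)(bj(dp t)α L)ts b1 -> cc S x L(t ∷ ts)b1
   pz : ∀{S cu L t σ α}-> T(S ⊑ cu)-> fT S L{h}{m}{aN}t σ α -> fT cu L t σ α
   pz{S}{cu}{t = t}{α = α}sub τ = record { jn = fT.jn τ;DF = fT.DF τ;iz = fT.iz τ;eF = eo(fa(bQ t)α)S cu(fT.eF τ)sub;dense = fT.dense τ }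
   g4 : ∀{S cu x L ts b1}-> T(S ⊑ cu)-> cc S x L ts b1 -> cc cu x L ts b1
   g4 sub [] = []
   g4 sub(τ ∷ hB)= pz sub τ ∷ g4 sub hB
   h8 : ∀{S x L ts b1}-> ε x =< b0 L -> cc S x L ts b1 -> ε(x +' ah ts)=< b0 b1
   h8{x = x}{L}d [] = aL(\ z -> ε z =< b0 L)(aI(aW x))d
   h8{x = x}{ts = t ∷ ts}{b1}d(τ ∷ hB)= aL(\ z -> ε z =< b0 b1)(aI(ip x(ah ts)))(h8(fT.dense τ)hB)
   c5 : ∀ i{s}(α : Vec V s)L -> ah(bj i α L)== s +' ah L
   c5 i [] L = refl
   c5 i(a ∷ α)L = au suc(c5 i α L)
   hn : ∀{S x L ts b1}-> cc S x L ts b1 -> ah b1 <= ah ts *' h +' ah L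
   hn [] = bT
   hn{L = L}{t ∷ ts}(_∷_{α = α}τ hB)= aa(hn hB)(aa(bJ(ah ts *' h)(aa(ae(c5(dp t)α L))(aK(ah L)(qn t))))(ae(a0(ah ts *' h)h(ah L))))where
    a0 : ∀ a b c -> a +'(b +' c)== b +' a +' c
    a0 = aU
   module _ (X : ℕ) (jJ : 1' =< ι aN * ε X) (kh : ι h * ι h =< ι Nv * ε X) (vd : ι (X *' h) =< ι Nv * ε X) where
    -- Every task has its own independent round, so the state reached so far can be conditioned on.
    -- The number of tasks does not depend on the size of the graph, and a fixed `m` makes the total
    -- failure small.
    qr : ∀ ts x L -> x +' ah ts <= X -> ah L <= x *' h -> ε x =< b0 L -> kC(bN μ(ah ts))(ι(ah ts)* ½ ^ m)(\ Ss -> ∃(cc(u8 Ss)x L ts))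
    qr [] x L _ _ _ = fS(bN μ 0){𝒫 = \ _ -> ∃(cc _ x L [])}(ad(aI(ag(au(_* ½ ^ m)iA)(bY(½ ^ m)))))(\ _ -> L , [])
    qr(t ∷ ts)x L xX BU fk = dH(bN μ(suc(ah ts)))(ad(ag(a0(½ ^ m)(ι(ah ts)))(au(_* ½ ^ m)(aI(cV(ah ts))))))qq(yn{d = μ}(sV μ(bN μ(ah ts)){𝒫 = \ S -> ∃(fT S L t(ε(suc x)))}{𝒬 = 𝒬}(a7(aY(ah ts))(aQ m eX))oN eZ))where
     a0 : ∀ a l -> a + l * a ==(1' + l)* a
     a0 = ap ar
     zg : suc x <= X
     zg = aa(aa(bl(a3 x(ah ts)))(ae(aI(ip x(ah ts)))))xX
     𝒬 : av N -> Vec(av N)(ah ts)-> Set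
     𝒬 S Ss = ∃ \ α -> fT S L t(ε(suc x))α × ∃(cc(u8 Ss)(suc x)(bj(dp t)α L)ts)
     rZ : ε X =< ε(suc x)
     rZ = mc(suc x)X zg
     oN : kC μ(½ ^ m)(\ S -> ∃(fT S L t(ε(suc x))))
     oN = EW(ε x)(ρ x)(θ x)(ε(suc x))(h5 x)(eg x)(dt x)(kP x)(h5(suc x))(lf x)(pw x)m aN(af jJ(aO(ι aN)(aY aN)rZ))(af kh(aO(ι Nv)(aY Nv)rZ))t L(af(bw(aa BU(aT h(bW zg))))(af vd(aO(ι Nv)(aY Nv)(af rZ(nK x)))))fk
     eZ : ∀ S -> ∃(fT S L t(ε(suc x)))-> kC(bN μ(ah ts))(ι(ah ts)* ½ ^ m)(𝒬 S)
     eZ S(α , τ)= dH(bN μ(ah ts))bR(\ Ss hB -> α , τ , hB)(qr ts(suc x)(bj(dp t)α L)(aa(ae(aI(ip x(ah ts))))xX)(aa(ae(c5(dp t)α L))(fI(qn t)BU))(fT.dense τ))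
     qq : ∀(Ss : Vec(av N)(suc(ah ts)))-> 𝒬(Vec.head Ss)(Vec.tail Ss)-> ∃(cc(u8 Ss)x L(t ∷ ts))
     qq(S ∷ Ss)(α , τ , b1 , hB)= b1 , pz(gD S(u8 Ss))τ ∷ g4(ep S(u8 Ss))hB
   bM : ∀ i{s}(α : Vec V s)L{e}-> e ∈ bj i α L ->(∃ \ x -> e ==(i , lookup α x))⊎ e ∈ L
   bM i [] L p = aG p
   bM i(a ∷ α)L(here refl)= aD(zero , refl)
   bM i(a ∷ α)L(there p)with bM i α L p
   ... | aD(x , eq)= aD(suc x , eq)
   ... | aG q = aG q
   bU : ∀ i{s}(α : Vec V s)L{e}-> e ∈ L -> e ∈ bj i α L
   bU i [] L p = p
   bU i(a ∷ α)L p = there(bU i α L p)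
   bV : ∀ i{s}(α : Vec V s)L x ->(i , lookup α x)∈ bj i α L
   bV i(a ∷ α)L zero = here refl
   bV i(a ∷ α)L(suc x)= there(bV i α L x)
   h9 : ∀{S x L ts b1}-> cc S x L ts b1 -> ∀{e}-> e ∈ L -> e ∈ b1
   h9 [] p = p
   h9{L = L}{t ∷ ts}(_∷_{α = α}τ hB)p = h9 hB(bU(dp t)α L p)
   mr : bP -> Set
   mr L = ∀{e lA}-> e ∈ L -> lA ∈ L -> T(f0 e lA)
   fb : ∀{S x L ts b1}-> cc S x L ts b1 -> mr L -> mr b1
   fb [] co = co
   fb{L = L}{t ∷ ts}(_∷_{α = α}τ hB)co = fb hB step where
    i = dp t
    yZ : ∀ a b -> T(f0(i , a)(i , b))
    yZ a b = gb(bc{a? = i ≟ᶠ i}refl)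
    flip : ∀ e lA -> T(f0 e lA)-> T(f0 lA e)
    flip(a , x)(b , y)t with lw{⌊ a ≟ᶠ b ⌋}t
    ... | aD p = gb(bc{a? = b ≟ᶠ a}(aI(toWitness{a? = a ≟ᶠ b}p)))
    ... | aG p = hq{⌊ b ≟ᶠ a ⌋}(aL T(de x y)p)
    step : mr(bj i α L)
    step p q with bM i α L p | bM i α L q
    ... | aD(x , refl)| aD(y , refl)= yZ _ _
    ... | aD(x , refl)| aG pk = jC L i _(fT.DF τ x)pk
    ... | aG gZ | aD(y , refl)= flip _ _(jC L i _(fT.DF τ y)gZ)
    ... | aG gZ | aG pk = co gZ pk
   module DH (m2 : V → Fin r) (a4 : Fin r) (S : av N) where
    wk : Fin(suc k)-> ∀{s}-> cS s -> bP -> Set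
    wk i{s}es L = ∃ \(α : Vec V s)-> ky α ×(∀ x -> m2(lookup α x)== a4)× T(fa es α ⊑ S)×(∀ x ->(i , lookup α x)∈ L)
    ve : Fin(suc k)-> ℕ -> bP -> bP -> Set
    ve i q L b1 = ∃ \(f : Fin q -> V)->(∀{a b}-> f a == f b -> a == b)×(∀ a -> m2(f a)≢ a4)×(∀ a ->(i , f a)∈ b1)×(∀ a{e}-> e ∈ L -> proj₂ e ≢ f a)
    extract : ∀ t q{x L ts b1}-> cc S x L(replicate q t ++ ts)b1 -> wk(dp t)(bQ t)b1 ⊎ ve(dp t)q L b1
    extract t zero hB = aG((\()),(\{ {()} }),(\()),(\()),(\()))
    extract t(suc q){x}{L}{ts}{b1}(_∷_{α = α}τ hB)with D5(\ x -> m2(lookup α x)≟ᶠ a4)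
    ... | yes mono = aD(α , fT.jn τ , mono , fT.eF τ , \ x -> h9 hB(bV(dp t)α L x))
    ... | no xv with extract t q hB
    ... | aD w = aD w
    ... | aG(f , Al , Am , t3 , CK)= aG(g , wl , An , w9 , Ao)where
     Eb : ∃ \ x -> m2(lookup α x)≢ a4
     Eb = zd _(\ x -> m2(lookup α x)== a4)(\ x -> m2(lookup α x)≟ᶠ a4)xv
     w = lookup α(ai Eb)
     g : Fin(suc q)-> V
     g zero = w
     g(suc a)= f a
     Ap : ∀ a -> w ≢ f a
     Ap a = CK a(bV(dp t)α L(ai Eb))
     wl : ∀{a b}-> g a == g b -> a == b
     wl{zero}{zero}eq = refl
     wl{zero}{suc b}eq = aA(Ap b eq)
     wl{suc a}{zero}eq = aA(Ap a(aI eq))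
     wl{suc a}{suc b}eq = au suc(Al eq)
     An : ∀ a -> m2(g a)≢ a4
     An zero = proj₂ Eb
     An(suc a)= Am a
     w9 : ∀ a ->(dp t , g a)∈ b1
     w9 zero = h9 hB(bV(dp t)α L(ai Eb))
     w9(suc a)= t3 a
     Ao : ∀ a{e}-> e ∈ L -> proj₂ e ≢ g a
     Ao zero p = fT.iz τ(ai Eb)p
     Ao(suc a)p = CK a(bU(dp t)α L p)
    i0 : ∀{x L}ts{CL b1}-> cc S x L(ts ++ CL)b1 -> ∃ \ cy -> ∃ \ Gk -> cc S cy Gk CL b1
    i0 [] hB = _ , _ , hB
    i0(t ∷ ts)(_ ∷ hB)= i0 ts hB
    jK : ∀{x L t q ts b1}-> t ∈ ts -> cc S x L(ce(replicate q)ts)b1 -> wk(dp t)(bQ t)b1 ⊎ ve(dp t)q [] b1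
    jK{t = t}{q}(here refl)hB with extract t q hB
    ... | aD w = aD w
    ... | aG(f , a , b , d , _)= aG(f , a , b , d , \ _())
    jK{q = q}{ts = t ∷ ts}(there p)hB = let _ , _ , DI = i0(replicate q t)hB in jK p DI
    -- For tuples in which all graphs but the one at `a4` are edgeless. Among `r * h` disjoint
    -- copies of that graph one has colour `a4` throughout, or else each provides a vertex of
    -- another colour; then `h` of these share a colour `j`, and an edgeless graph needs nothing but
    -- vertices.
    oT :{s : Fin r -> ℕ}(es : ∀ j -> cS(s j))->(∀ j -> s j <= h)->(∀ j -> j ≢ a4 -> es j == [])-> ∀{x L t ts b1}-> t ∈ ts -> _==_{A = Σ ℕ cS}(bt t , bQ t)(s a4 , es a4)-> cc S x L(ce(replicate(r *' h))ts)b1 -> ∃ \ j -> ∃ \(α : Vec V(s j))-> ky α ×(∀ x -> m2(lookup α x)== j)× T(fa(es j)α ⊑ S)×(∀ x ->(dp t , lookup α x)∈ b1)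
    oT{s}es jy eZ{t = t}{ts}{b1}Gl eq hB = go(jK Gl hB)where
     i = dp t
     go : wk i(bQ t)b1 ⊎ ve i(r *' h)[] b1 -> ∃ \ j -> ∃ \(α : Vec V(s j))-> ky α ×(∀ x -> m2(lookup α x)== j)× T(fa(es j)α ⊑ S)×(∀ x ->(i , lookup α x)∈ b1)
     go(aD w)= a4 , aL(\(q : Σ ℕ cS)-> wk i(proj₂ q)b1)eq w
     go(aG(f , Al , Am , t3 , _))= j , Vec.map f β , jn , gY , aL(\ q -> T(fa q(Vec.map f β)⊑ S))(aI(eZ j ql))(xt S), iw where
      wZ = u3(m2 ∘ f)(aC fv fu)
      j = ai wZ
      vf = aw(\ a -> ⌊ m2(f a)≟ᶠ j ⌋)(ax(r *' h))
      DJ : h <= ah vf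
      DJ = kB r{{ℕ.>-nonZero fv}}(proj₂ wZ)
      Gm = mq vf(cF _(allFin⁺(r *' h)))(s j)(aa(jy j)DJ)
      β = ai Gm
      Aq : ∀ x -> m2(f(lookup β x))== j
      Aq x = toWitness{a? = m2(f(lookup β x))≟ᶠ j}(proj₂(aP(\ a -> ⌊ m2(f a)≟ᶠ j ⌋)(ax(r *' h))(proj₂(proj₂ Gm)x)))
      some : ∃ \ a -> a ∈ vf
      some with vf | aa fu DJ
      ... | a ∷ _ | _ = a , here refl
      ql : j ≢ a4
      ql nm = let a , Gn = some in Am a(ag(toWitness{a? = m2(f a)≟ᶠ j}(proj₂(aP(\ a -> ⌊ m2(f a)≟ᶠ j ⌋)(ax(r *' h))Gn)))nm)
      jn : ky(Vec.map f β)
      jn x y nm = ai(proj₂ Gm)x y(Al(ag(aI(bv x f β))(ag nm(bv y f β))))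
      gY : ∀ x -> m2(lookup(Vec.map f β)x)== j
      gY x = ag(au m2(bv x f β))(Aq x)
      iw : ∀ x ->(i , lookup(Vec.map f β)x)∈ b1
      iw x = aL(\ v ->(i , v)∈ b1)(aI(bv x f β))(t3(lookup β x))

-- Integer exponents, and the embedding supplied with random copies.

module EX where
 open M6 using (zero;suc)
 open M9 using (∣_∣)
 open M7 using ([];_∷_;replicate)
 open M16 using (_∈_)
 open M13 using (here;there)
 open M10 using ([];_∷_)
 open M0 using (ℕ;zero;suc)
 open M1 using (∃;_×_)
 open M2 hiding (_÷_;∣_∣;floor;truncate)
 open M3
 open M8 using ([];_∷_;lookup;tabulate)
 open M4 hiding (J;[_])
 open M5
 open P1
 open P2 using (aw)
 open P3 using (_⊑_)
 open P4
 open P5 using (κ)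
 open P8
 open P9
 open Ha
 open BG
 open Dx
 open CG
 open ET
 private variable
  r : ℕ
 se : ∀{s}(es : cS s)-> ch es ⊤ₛ == ah es
 se{s}es = ag(aI(aW _))(ag(au(ch es ⊤ₛ +'_)(aI(fA es)))(lz es ⊤ₛ))where
  fA : ∀(xs : cS s)-> ah(aw(ha ∘ lW ⊤ₛ)xs)== 0
  fA [] = refl
  fA((x , y)∷ xs)rewrite lookup-replicate x true | lookup-replicate y true = fA xs
 _! : ℕ -> ℕ
 zero ! = 1
 suc n ! = suc n *' n !
 oU : ∀ n -> 1 <= n !
 oU zero = bl bI
 oU(suc n)= aC(bl(bI{n}))(oU n)
 BV : ∀ w h -> 1 <= w -> w <= h -> ∃ \ q -> h ! == w *' q
 BV w zero Ar Au = aA(aV refl(aa Ar Au))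
 BV w(suc h)Ar Au with ℕₚ.m≤n⇒m<n∨m≡n Au
 ... | aG refl = h ! , refl
 ... | aD(bl Av)= let q , eq = BV w h Ar Av in suc h *' q , ag(au(suc h *'_)eq)(a0(suc h)w q)where
  a0 : ∀ a b c -> a *'(b *' c)== b *'(a *' c)
  a0 = aU
 -- The denominator of a maximising quotient is a vertex number minus one, hence between 1 and `h`,
 -- and so divides `h !`.
 ia : ∀{n}(G : a1 n)(h : ℕ)-> n <= h -> ∃ \ w -> gT G * ι(h !)== ι w
 ia{n}G h Aw = go(<-cmp 0'(gT G))where
  open M23 using (Tri;tri<;tri≈;tri>)
  uC : 0' == gT G -> ∃ \ w -> gT G * ι(h !)== ι w
  uC eq = 0 , ag(au(_* ι(h !))(aI eq))(ag(bY(ι(h !)))(aI iA))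
  wm :(∃ \ K -> K ∈ e6 G × 2 <= v K × gT G == g1 K)-> ∃ \ w -> gT G * ι(h !)== ι w
  wm(K , _ , v3 , eq)= e K *' q ,(begin gT G * ι(h !)≡⟨ aS _*_ eq(ag(au ι Hh)(cW(v K -' 1)q))⟩ g1 K *(ι(v K -' 1)* ι q)≡⟨ aI(hp(g1 K)(ι(v K -' 1))(ι q))⟩ g1 K * ι(v K -' 1)* ι q ≡⟨ au(_* ι q)(jh(e K)(v K)v3)⟩ ι(e K)* ι q ≡⟨ aI(cW(e K)q)⟩ ι(e K *' q)∎)where
   open ≡-Reasoning
   d = BV(v K -' 1)h(rs 1 v3)(aa(ℕₚ.m∸n≤m(v K)1)(aa(Data.Fin.Subset.Properties.∣p∣≤n(verts K))Aw))
   q = ai d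
   Hh = proj₂ d
  go : Tri(0' < gT G)(0' == gT G)(gT G < 0')-> ∃ \ w -> gT G * ι(h !)== ι w
  go(tri< 0< _ _)= wm(d8 g1 zO(e6 G)0<)
  go(tri≈ _ eq _)= uC eq
  go(tri> _ _ gt)= aA(za refl(gA gt(sK G)))
 ms :(As : Vec bq r)-> 2 <= r ->(h : ℕ)->(∀ j -> ai(lookup As j)<= h)->(∀ j -> 1 <= v(proj₂(lookup As j)))->(b : ℚ)(cN b4 : ℕ)-> b * ι b4 == ι cN -> b9 As =< b -> cx(\ j -> ai(lookup As j))(\ j -> ba(proj₂(lookup As j)))(cN *' h !)(b4 *' h !)
 ms{r}As eG h Go zP b cN b4 bb le = go(p2 As eG)where
  Q = h !
  go : po As(b9 As)-> cx(\ j -> ai(lookup As j))(\ j -> ba(proj₂(lookup As j)))(cN *' Q)(b4 *' Q)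
  go(a4 , d6 , FR , iI , _ , eq)= record{ a4 = a4;α = α;Dz = Dz;eZ = eZ } where
   a = gT(proj₂(lookup As d6))
   t5 = ia(proj₂(lookup As d6))h(Go d6)
   α = b4 *' ai t5
   E = b4 *' Q
   aE : a * ι E == ι α
   aE = ag(au(a *_)(cW b4 Q))(ag(a0 a(ι b4)(ι Q))(ag(au(ι b4 *_)(proj₂ t5))(aI(cW b4(ai t5)))))where
    a0 : ∀ a b c -> a *(b * c)== b *(a * c)
    a0 = ap ar
   bE : b * ι E == ι(cN *' Q)
   bE = ag(au(b *_)(cW b4 Q))(ag(aI(hp b(ι b4)(ι Q)))(ag(au(_* ι Q)bb)(aI(cW cN Q))))
   s8 = ba(proj₂(lookup As a4))
   Dz : ∀ U -> 1 <= ∣ U ∣ -> α +' E *' ch s8 U <= cN *' Q *' ∣ U ∣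
   Dz U h0 = bS(begin ι(α +' E *' ch s8 U)≡⟨ ag(o9 α(E *' ch s8 U))(aS _+_(aI aE)(cW E(ch s8 U)))⟩ a * ι E + ι E * ι(ch s8 U)≡⟨ a0 a(ι E)(ι(ch s8 U))⟩ ι E *(a + ι(ch s8 U))≤⟨ aO(ι E)(aY E)(af(p1(proj₂(lookup As d6))(proj₂(lookup As a4))(zP a4)U h0)(aX(ι ∣ U ∣)(aY ∣ U ∣)(af(ad(aI eq))le)))⟩ ι E *(b * ι ∣ U ∣)≡⟨ aZ(ι E)b(ι ∣ U ∣)⟩ b * ι E * ι ∣ U ∣ ≡⟨ ag(au(_* ι ∣ U ∣)bE)(aI(cW(cN *' Q)∣ U ∣))⟩ ι(cN *' Q *' ∣ U ∣)∎)where
    open RQ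
    a0 : ∀ a e x -> a * e + e * x == e *(a + x)
    a0 = ap ar
    aZ : ∀ e b u -> e *(b * u)== b * e * u
    aZ = ap ar
   eZ : ∀ j -> j ≢ a4 -> ∀ U -> E *' ch(ba(proj₂(lookup As j)))U <= α *'(∣ U ∣ -' 1)
   eZ j ql U = bS(begin ι(E *' ch es U)≡⟨ cW E(ch es U)⟩ ι E * ι(ch es U)≤⟨ aO(ι E)(aY E)(af(pn(proj₂(lookup As j))U)(aX(ι(∣ U ∣ -' 1))(aY(∣ U ∣ -' 1))(iI j ql)))⟩ ι E *(a * ι(∣ U ∣ -' 1))≡⟨ ag(a0(ι E)a(ι(∣ U ∣ -' 1)))(ag(au(_* ι(∣ U ∣ -' 1))aE)(aI(cW α(∣ U ∣ -' 1))))⟩ ι(α *'(∣ U ∣ -' 1))∎)where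
    open RQ
    es = ba(proj₂(lookup As j))
    a0 : ∀ e b u -> e *(b * u)== b * e * u
    a0 = ap ar
 module nL (k : ℕ) {r : ℕ} (𝐇 : Vec bq r) (h : ℕ) where
  K : ℕ
  K = suc k
  cf : Fin r -> ℕ
  cf j = ai(lookup 𝐇 j)
  H :(j : Fin r)-> a1(cf j)
  H j = proj₂(lookup 𝐇 j)
  Triple : Set
  Triple = Fin K × Σ(Fin r)(\ j -> a1(cf j))
  gI : List Triple
  gI = ce(\ i -> ce(\ j -> fd(\ J -> i , j , J)(nonempty(H j)))(ax r))(ax K)
  -- There are `W` triples with `r * h` preliminary copies each. After these `jL` levels the
  -- recursion `lc` may use `K ^ W` more, and `nj` bounds the length of every state that occurs.
  W jL X nj : ℕ
  W = ah gI
  jL = W *'(r *' h)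
  X = jL +' K ^' W
  nj = jL *' h +' W *'(K *' h)
  fl : List(Vec bq r)
  fl = em(tabulate(\ j -> fd(cf j ,_)(nonempty(H j))))
 module wn (ir : h4) {r : ℕ} (fv : 1 <= r) (𝐇 : Vec bq r) (ej : ∀ j → 1 <= v (proj₂ (lookup 𝐇 j)))(h : ℕ)(fu : 1 <= h)(dQ : ∀ j -> ai(lookup 𝐇 j)<= h)(m aN : ℕ)(γ : ℚ)(h7 : 0' < γ)(dI : γ =< 1')(fE : ∀{s}-> a1 s -> bH)where
  open pr ir
  open vb ir
  open vc {h} {m} {aN} {r} fu fv γ h7 dI
  open lg h r fu fv γ h7 dI
  open nL k 𝐇 h public
  nM : ∀{s}-> cS s -> Set
  nM{s}es = es == [] ⊎ ∃ \ Rn -> P ^' ah es <= Rn ×(∀ U -> 2 <= ∣ U ∣ -> suc n ^'(s -' ∣ U ∣)*' P ^' ch es U <= Rn)× 8 *' κ s *' Rn *' m *' aN <= suc n ^' s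
  kj : ∀ j -> 1 <= cf j
  kj j = aa(ej j)(Data.Fin.Subset.Properties.∣p∣≤n(verts(H j)))
  module _ (cb : ∀ {s} (J : a1 s) → 1 <= s → s <= h → T (fE J) → nM (ba J)) where
   open s5 using (dp; bt; bQ)
   -- Graphs rejected by the test receive an edgeless placeholder, so that the task list has one
   -- entry per triple.
   vg :(t : Triple)(b : bH)->(T b -> nM(ba(proj₂(proj₂ t))))-> s5 h m aN
   vg(i , j , J)true f = record{ dp = i;bQ = ba J;py = fY J;s6 = kj j;qn = dQ j;cb = f tt }
   vg(i , j , J)false f = record{ dp = i;bt = cf j;bQ = [];py = [] , [];s6 = kj j;qn = dQ j;cb = aD refl } where
       open M12 using ([])
   vh : Triple -> s5 h m aN
   vh t = vg t(fE(proj₂(proj₂ t)))(cb(proj₂(proj₂ t))(kj(ai(proj₂ t)))(dQ(ai(proj₂ t))))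
   uD : ∀ t -> dp(vh t)== ai t
   uD t@(i , j , J)with fE J | cb J(kj j)(dQ j)
   ... | true | _ = refl
   ... | false | _ = refl
   qs : ∀ i j J -> T(fE J)-> _==_{A = Σ ℕ cS}(bt(vh(i , j , J)), bQ(vh(i , j , J)))(cf j , ba J)
   qs i j J t with fE J | cb J(kj j)(dQ j)
   ... | true | _ = refl
   t2 fm : List(s5 h m aN)
   t2 = fd vh gI
   fm = ce(replicate(r *' h))t2
   eR : ah fm == jL
   eR = ag(go t2)(au(_*'(r *' h))(fK vh gI))where
    go : ∀ ts -> ah(ce(replicate(r *' h))ts)== ah ts *'(r *' h)
    go [] = refl
    go(t ∷ ts)= ag(i7(replicate(r *' h)t))(aS _+'_(FL(r *' h))(go ts))
   module _ (pW : ∀ x → ¬ T (aR x x)) (kk : γ =< b0 []) (S : av N) (U : a1 (suc n)) (op : ∀ x → x ∈ₛ verts U) (pY : ∀ x y → T (aR x y) → T (adj U x y))(vi : ∀{x y}-> x ≢ y -> T(lookup S(dN x y))-> T(adj U x y)){lG : bP}(CM : cc S 0 [] fm lG)(ez Positive :(∀ j -> a1(cf j))-> Set)(sI :(a2 : ∀ j -> Vec(List(a1(cf j)))K)->(∀ j i -> ∃ \(b : a1(cf j)-> bH)-> lookup(a2 j)i == aw b(nonempty(H j)))->(∀ j -> cm(H j)K(a2 j))-> ∃ \ i -> ∃ \(A : ∀ j -> a1(cf j))->(∀ j -> A j ∈ lookup(a2 j)i)× ez A)(gp : ∀ A ->(∀ j -> A j ∈ nonempty(H j))-> ez A ->(∃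 \ a4 -> T(fE(A a4))×(∀ j -> j ≢ a4 -> ba(A j)== []))⊎ Positive A)(yU : ∀ c L x -> x <' X -> ah L <= nj -> ε x =< b0 L -> ∀ i A ->(∀ j -> A j ∈ nonempty(H j))-> Positive A -> ∃ \ j -> ∃ \(α : Vec V(cf j))-> ky α ×(∀ x -> lookup c(lookup α x)== j)×(∀ x -> T(e2 L i(lookup α x)))× T(fa(ba(A j))α ⊑ S)× ε(suc x)=< b0(bj i α L))where
    private
     hj : ∀{s}-> cS s -> Vec V s -> bH
     hj [] α = true
     hj(e ∷ es)α = adj U(lookup α(ai e))(lookup α(proj₂ e))∧ hj es α
     ka : ∀{s}(es : cS s)α -> T(hj es α)-> ∀{e}-> e ∈ es -> T(adj U(lookup α(ai e))(lookup α(proj₂ e)))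
     ka(e ∷ es)α t(here refl)= ai(bh{adj U(lookup α(ai e))(lookup α(proj₂ e))}t)
     ka(e ∷ es)α t(there p)= ka es α(proj₂(bh{adj U(lookup α(ai e))(lookup α(proj₂ e))}t))p
     vj : ∀{s}(es : cS s)(α : Vec V s)->(∀{e}-> e ∈ es -> T(adj U(lookup α(ai e))(lookup α(proj₂ e))))-> T(hj es α)
     vj [] α f = tt
     vj(e ∷ es)α f = cA{adj U(lookup α(ai e))(lookup α(proj₂ e))}(f(here refl))(vj es α(f ∘ there))
     pA : ∀{s}(es : cS s)-> cT es ->(α : Vec V s)-> ky α -> T(fa es α ⊑ S)-> T(hj es α)
     pA es(_ , lt)α uR sub = vj es α(\{e}p -> vi(\ eq -> aV(au Fin.toℕ(uR _ _ eq))(All.lookup lt p))(ei(Data.Vec.Properties.[]=⇒lookup(gE(fa es α)S sub(pd es α p)))))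
     yp : ∀{e lA : Fin K × V}-> e ∈ lG -> lA ∈ lG -> T(dP.f0 aR de k e lA)
     yp = fb CM(\())
    module _ (c : Vec (Fin r) (suc n)) where
     private
      module C = Core aR de pW k 𝐇 c hj ε mc
      yq : ∀ L x -> x <' X -> lG C.⊆ᴸ L -> C.k9 L -> ah L <= nj -> ε x =< b0 L -> ∀ i(A : ∀ j -> a1(cf j))->(∀ j -> A j ∈ nonempty(H j))-> ez A -> ∃ \ j -> C.pX(ε(suc x))L i j(A j)
      yq L x zg sub mu lq fk i A d2 xf = go(gp A d2 xf)where
       go :((∃ \ a4 -> T(fE(A a4))×(∀ j -> j ≢ a4 -> ba(A j)== []))⊎ Positive A)-> ∃ \ j -> C.pX(ε(suc x))L i j(A j)
       go(aG pos)= let j , α , uR , m2 , ft , im , dn = yU c L x zg lq fk i A d2 pos in j , α , uR , m2 , ft , pA(ba(A j))(fY(A j))α uR im , dn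
       -- The copy consists of vertices of the base state, hence of `L`; recording them again does
       -- not lower the weight.
       go(aD(a4 , vk , eZ))= qq(DH.oT(\ v -> lookup c v)a4 S(\ j -> ba(A j))dQ eZ(∈-map⁺ vh gI(C.kL i a4(d2 a4)))(qs i a4(A a4)vk)CM)where
        qq :(∃ \ j -> ∃ \(α : Vec V(cf j))-> ky α ×(∀ x -> lookup c(lookup α x)== j)× T(fa(ba(A j))α ⊑ S)×(∀ x ->(dp(vh(i , a4 , A a4)), lookup α x)∈ lG))-> ∃ \ j -> C.pX(ε(suc x))L i j(A j)
        qq(j , α , uR , m2 , im , zC)= j , α , uR , m2 ,(\ x -> dP.oe aR de k L i(lookup α x)(\ p -> mu(DK x)p)), pA(ba(A j))(fY(A j))α uR im , af(rb x)(af fk(dP.qV aR de k iJ))where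
         DK : ∀ x ->(i , lookup α x)∈ L
         DK x = sub(aL(\ i ->(i , lookup α x)∈ lG)(uD(i , a4 , A a4))(zC x))
         iJ : ∀{e}-> e ∈ bj i α L -> e ∈ L
         iJ p with C.bM i α L p
         ... | aD(x , refl)= DK x
         ... | aG q = q
      lO : ∀{A : Set}(b : A -> bH)xs -> ah(aw b xs)<= ah xs
      lO b [] = bI
      lO b(x ∷ xs)with b x
      ... | true = bl(lO b xs)
      ... | false = a6(lO b xs)
     yr : ∃ \ j -> ∃ \ f -> zf U c j(H j)f
     yr = C.lc ej U op pY ka ez sI lG nj X h dQ yq W jL lG bT(\ p -> p)yp(aK(W *'(K *' h))(aa(hn CM)(ae(ag(aW _)(au(_*' h)eR)))))(aL(\ z -> ε z =< b0 lG)eR(h8 kk CM))(lO(C.g0 _ lG)gI)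
    xw : U ⟶ 𝐇
    xw c = yr c

-- From edge density to clique weight; merging independent rounds.

module EY where
 open M6 using (zero;suc)
 open M7 using ([];_∷_)
 open M0 using (ℕ;zero;suc)
 open M20 using (_C_)
 open M1 using (_×_)
 open M2 hiding (_÷_;∣_∣;floor;truncate)
 open M3
 open M8 using ([];_∷_)
 open M4 hiding (J;[_])
 open M15 using (toWitness)
 open M5
 open P1
 open P2
 open P3
 open P4
 open P5
 open P7
 open P8
 open P9
 open BG using (gK)
 open EG
 ib :{A : Set}{P : A -> Set}(P? : ∀ a -> o8(P a))(f : A -> ℚ)(xs : List A)-> aM(c9 P? xs)f == aM xs(\ a -> ao ⌊ P? a ⌋ * f a)
 ib P? f [] = refl
 ib P? f(x ∷ xs)with P? x
 ... | yes _ = aS _+_(aI(aH(f x)))(ib P? f xs)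
 ... | no _ = ag(ib P? f xs)(aI(ag(au(_+ aM xs(\ a -> ao ⌊ P? a ⌋ * f a))(bY(f x)))(bu _)))
 s9 : ∀ n -> 2 *'(suc n C 2)== suc n *' n
 s9 zero = refl
 s9(suc n)= begin 2 *'(suc(suc n)C 2)≡⟨ au(2 *'_)(aI(m1(suc n)1))⟩ 2 *'(suc n C 1 +' suc n C 2)≡⟨ au(\ a -> 2 *'(a +' suc n C 2))(Hu(suc n))⟩ 2 *'(suc n +' suc n C 2)≡⟨ ℕₚ.*-distribˡ-+ 2(suc n)(suc n C 2)⟩ 2 *' suc n +' 2 *'(suc n C 2)≡⟨ au(2 *' suc n +'_)(s9 n)⟩ 2 *' suc n +' suc n *' n ≡⟨ a0 n ⟩ suc(suc n)*' suc n ∎ where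
  open ≡-Reasoning
  a0 : ∀ n -> 2 *' suc n +' suc n *' n == suc(suc n)*' suc n
  a0 = aU
 uE : ∀{n}(G : a1 n)-> jS G * ι(v G C 2)== ι(e G)⊎ v G C 2 == 0
 uE G with v G C 2
 ... | zero = aG refl
 ... | suc m = aD(gK(e G)m)
 module _ {n : ℕ} (G : a1 (suc n)) (k : ℕ) where
  c3 : ∀ x y -> adj G x y == adj G y x
  c3 x y = rv(sym-adj G)(sym-adj G)
  open dP (adj G) c3 k using (t; a5; b0; uX; j9)
  private
   M = suc n
   vl :(Fin M -> Fin M -> ℚ)-> ℚ
   vl f = aM(ax M)(\ x -> aM(ax M)(f x))
  Ax : vl(\ x y -> ao(adj G x y))== ι M * ι M * t 2
  Ax = begin vl(\ x y -> ao(adj G x y))≡⟨ bF(ax M)(\ x -> bF(ax M)(\ y -> aI(ag(dL _)(au ao(sD(adj G x y))))))⟩ vl(\ x y -> aM(fr [])(\ w -> ao(a5(x ∷ y ∷ w))))≡⟨ bF(ax M)(\ x -> aI(hr(ax M)[](\ w -> ao(a5(x ∷ w)))))⟩ aM(ax M)(\ x -> aM(fr(ax M ∷ []))(\ w -> ao(a5(x ∷ w))))≡⟨ aI(hr(ax M)(ax M ∷ [])(ao ∘ a5))⟩ aM(aJ M 2)(ao ∘ a5)≡⟨ gg n 2(ao ∘ a5)⟩ ι M ^ 2 * t 2 ≡⟨ au(_* t 2)(au(ι M *_)(aF(ι M)))⟩ ι M * ι M * t 2 ∎ where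
   open ≡-Reasoning
   sD : ∀ b ->(b ∧ true)∧ true ∧ true == b
   sD true = refl
   sD false = refl
  lP : ι(e G)== vl(\ x y -> ao(⌊ x <?ᶠ y ⌋ ∧ adj G x y))
  lP = ag(et BW(jo M))(ag(nN(cp M))(oh(ax M)(ax M)(\(x , y)-> ao(⌊ x <?ᶠ y ⌋ ∧ adj G x y))))where
   BW :(xy : Fin M × Fin M)-> o8(T(adj G(ai xy)(proj₂ xy)))
   BW(x , y)= T?(adj G x y)
   sD : ∀ b -> ⌊ T? b ⌋ == b
   sD true = refl
   sD false = refl
   nN : ∀ xs -> aM(c9(\(x , y)-> x <?ᶠ y)xs)(\ a -> ao ⌊ BW a ⌋)== aM xs(\(x , y)-> ao(⌊ x <?ᶠ y ⌋ ∧ adj G x y))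
   nN xs = ag(ib(\(x , y)-> x <?ᶠ y)(\ a -> ao ⌊ BW a ⌋)xs)(bF xs(\(x , y)-> ag(au(\ b -> ao ⌊ x <?ᶠ y ⌋ * ao b)(sD(adj G x y)))(aI(cX ⌊ x <?ᶠ y ⌋(adj G x y)))))
  CN : ι(e G)+ ι(e G)=< ι M * ι M * t 2
  CN = begin ι(e G)+ ι(e G)≡⟨ aS _+_ lP(ag lP(iC(ax M)(ax M)F))⟩ vl(\ x y -> ao(⌊ x <?ᶠ y ⌋ ∧ adj G x y))+ vl(\ y x -> ao(⌊ x <?ᶠ y ⌋ ∧ adj G x y))≡⟨ aI(ag(bF(ax M)(\ x -> l2(ax M)(F x)(\ y -> F y x)))(l2(ax M)(\ x -> aM(ax M)(F x))(\ x -> aM(ax M)(\ y -> F y x))))⟩ vl(\ x y -> ao(⌊ x <?ᶠ y ⌋ ∧ adj G x y)+ ao(⌊ y <?ᶠ x ⌋ ∧ adj G y x))≤⟨ cj(ax M)(\ x -> cj(ax M)(\ y -> pt x y))⟩ vl(\ x y -> ao(adj G x y))≡⟨ Ax ⟩ ι M * ι M * t 2 ∎ where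
   open RQ
   F : Fin M -> Fin M -> ℚ
   F x y = ao(⌊ x <?ᶠ y ⌋ ∧ adj G x y)
   pt : ∀ x y -> ao(⌊ x <?ᶠ y ⌋ ∧ adj G x y)+ ao(⌊ y <?ᶠ x ⌋ ∧ adj G y x)=< ao(adj G x y)
   pt x y with x <?ᶠ y | y <?ᶠ x
   ... | yes p | yes q = aA(oE p q)
   ... | yes p | no _ = ad(dL _)
   ... | no _ | yes q = ad(ag(bu _)(au ao(c3 y x)))
   ... | no _ | no _ = a8(adj G x y)
  wo : ∀ x -> v G == M -> 1 <= n -> x =< jS G -> x * ι n =< ι M * t 2
  wo x vG rI DM = go(uE G)where
   yt : v G C 2 ≢ 0
   yt eq = aV(aI(ag(aI(s9 n))(au(2 *'_)(ag(au(_C 2)(aI vG))eq))))(aC(bl(bI{n}))rI)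
   go : jS G * ι(v G C 2)== ι(e G)⊎ v G C 2 == 0 -> x * ι n =< ι M * t 2
   go(aG eq)= aA(yt eq)
   go(aD eq)= bZ(ι M)(cO n)(begin ι M *(x * ι n)≡⟨ ag(a0(ι M)x(ι n))(au(x *_)(ag(aI(cW M n))(ag(au ι(aI(s9 n)))(cW 2(M C 2)))))⟩ x *(ι 2 * ι(M C 2))≤⟨ aX(ι 2 * ι(M C 2))(a7(aY 2)(aY(M C 2)))DM ⟩ jS G *(ι 2 * ι(M C 2))≡⟨ ag(aZ(jS G)(ι 2)(ι(M C 2)))(aS _*_ l1(ag(au(\ z -> jS G * ι(z C 2))(aI vG))eq))⟩(1' + 1')* ι(e G)≡⟨ d1(ι(e G))⟩ ι(e G)+ ι(e G)≤⟨ CN ⟩ ι M * ι M * t 2 ≡⟨ hp(ι M)(ι M)(t 2)⟩ ι M *(ι M * t 2)∎)where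
    open RQ
    a0 : ∀ a b c -> a *(b * c)== b *(a * c)
    a0 = ap ar
    aZ : ∀ a b c -> a *(b * c)== b *(a * c)
    aZ = ap ar
    d1 : ∀ a ->(1' + 1')* a == a + a
    d1 = ap ar
  -- With `y = (k - 1) / k` the excess `2 δ` makes the Moon-Moser factor `1 - k (1 - t 2)` at least
  -- `δ`. The second `δ` absorbs the diagonal, as `t 2` is normalised by all pairs of vertices and
  -- the density by distinct ones.
  oV : ∀ y δ -> 1 <= k -> y * ι k == ι k - 1' -> 0' =< δ -> v G == M -> 1 <= n -> y +(δ + δ)=< jS G -> ι k =< δ * ι(n -' 1)-> δ ^ k =< b0 []
  oV y δ tc yk sU vG rI le Ec = af(j9 k δ sU(bZ(ι M)(cO n)EZ))(ad(aI uX))where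
   open RQ
   EZ : ι M * δ =< ι M *(1' - ι k *(1' - t 2))
   EZ = begin ι M * δ ≡⟨ au(_* δ)(cV n)⟩(1' + ι n)* δ ≤⟨ bK(δ * ι(n -' 1)- ι k)(e7 Ec)(ag(a0(ι n)δ(ι k))(au(\ z ->(1' + ι n)* δ +(δ * z - ι k))dc))⟩(δ + δ)* ι n - ι k ≤⟨ bK 1' ca(ci(ι k)(ι n)δ)⟩(1' - ι k)+ 1' *((δ + δ)* ι n)≤⟨ bA(1' - ι k)(aX((δ + δ)* ι n)(a7(0≤+ sU sU)(aY n))(af(ad(aI jZ))(bw tc)))⟩(1' - ι k)+ ι k *((δ + δ)* ι n)≡⟨ aZ(ι k)(ι n)δ(ι M)(cV n)⟩ ι M *(1' - ι k)+((ι k - 1')* ι n + ι k *((δ + δ)* ι n))≡⟨ au(\ z -> ι M *(1' - ι k)+(z * ι n + ι k *((δ + δ)* ι n)))(aI yk)⟩ ι M *(1' - ι k)+(y * ι k * ι n + ι k *((δ + δ)* ι n))≡⟨ d1(ι M)(ι k)y(ι n)δ ⟩ ι M *(1' - ι k)+ ι k *((y +(δ + δ))* ι n)≤⟨ bA(ι M *(1' - ι k))(aO(ι k)(aY k)(wo(y +(δ + δ))vG rI le))⟩ ι M *(1' - ι k)+ ι k *(ι M * t 2)≡⟨ m6(ι M)(ι k)(t 2)⟩ ι M *(1' - ι k *(1' - t 2))∎ where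
    dc : ι n - 1' == ι(n -' 1)
    dc = ag(au(_- 1')(ag(au ι(aI(hQ rI)))(cV(n -' 1))))(j8(ι(n -' 1)))where
     j8 : ∀ x -> 1' + x - 1' == x
     j8 = ap ar
    a0 : ∀ n δ k ->(δ + δ)* n - k ==(1' + n)* δ +(δ *(n - 1')- k)
    a0 = ap ar
    ci : ∀ k n δ ->(1' - k)+ 1' *((δ + δ)* n)==(δ + δ)* n - k + 1'
    ci = ap ar
    aZ : ∀ k n δ M -> M == 1' + n ->(1' - k)+ k *((δ + δ)* n)== M *(1' - k)+((k - 1')* n + k *((δ + δ)* n))
    aZ k n δ M refl = td k n δ where
     td : ∀ k n δ ->(1' - k)+ k *((δ + δ)* n)==(1' + n)*(1' - k)+((k - 1')* n + k *((δ + δ)* n))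
     td = ap ar
    d1 : ∀ M k y n δ -> M *(1' - k)+(y * k * n + k *((δ + δ)* n))== M *(1' - k)+ k *((y +(δ + δ))* n)
    d1 = ap ar
    m6 : ∀ M k t -> M *(1' - k)+ k *(M * t)== M *(1' - k *(1' - t))
    m6 = ap ar
 -- The quotient of `j + 1` by `Y` passes the test that defines the approximant of the root, so the
 -- approximant is at least that quotient; the remainder costs one unit.
 te : ∀ a b n Y -> 1 <= a -> 1 <= Y -> n ^' b <= Y ^' a -> ∀ j -> suc j <= suc(rootNumerator a b n j)*' Y
 te a b n Y G2 uF le j = aa(bW lt)(aT Y(bl E0))where
  instance
   E1 : ℕ.NonZero Y
   E1 = ℕ.>-nonZero uF
  m = suc j /ₙ Y
  lt : suc j <' suc m *' Y
  lt = ℕₚ.≤-<-trans(ae(gS(suc j)Y))(ℕₚ.+-monoˡ-<(m *' Y)(Ck(suc j)Y))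
  CO : m ^' a *' n ^' b <= suc j ^' a
  CO = aa(az(m ^' a)le)(aa(ae(aI(b6 m Y a)))(b7 a(oF(suc j)Y)))
  E0 : m <= rootNumerator a b n j
  E0 with vN(rootNumerator a b n j)m
  ... | tri< Hi _ _ = aA(Hx(\ m -> m ^' a *' n ^' b ℕₚ.≤? suc j ^' a)(suc j)m Hi(m/n≤m(suc j)Y)CO)
  ... | tri≈ _ eq _ = ae(aI eq)
  ... | tri> _ _ gt = bW gt
 lQ : ∀{N}l u(f : av N -> ℚ)-> aB(cI 0' l u N)f == f tX
 lQ{zero}l u f = refl
 lQ{suc N}l u f = ag(di l u f)(ag(a0(aB(cI 0' l u N)(f ∘(false ∷_)))(aB(cI 0' l u N)(f ∘(true ∷_))))(lQ l u(f ∘(false ∷_))))where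
  a0 : ∀ a b ->(1' - 0')* a + 0' * b == a
  a0 = ap ar
 module _ {N : ℕ} {p : ℚ} (b3 : 0' =< p) (cU : p =< 1') where
  private
   μ = cI p b3 cU N
  -- The union of several rounds is again a product random set; of its parameter only the bound
  -- `q p` is kept, which together with monotonicity suffices.
  record gN (q : ℕ) (E : (av N → ℚ) → ℚ) : Set where
   field
    t6 : ℚ
    fU : 0' =< t6
    gr : t6 =< 1'
    jM : t6 =< ι q * p
    nO : ∀ f -> E f == aB(cI t6 fU gr N)f
  open gN
  combine : ∀{q pk E xx}-> gN q E -> gN pk xx -> gN(q +' pk)(\ f -> E(\ S -> xx(\ cu -> f(S ∪ cu))))
  combine{q}{pk}{E}{xx}x y = record { t6 = a + b - a * b ;fU = af(0≤+(a7(fU x)(e7(gr y)))(fU y))(ad(a0 a b));gr = bK((1' - a)*(1' - b))(a7(e7(gr x))(e7(gr y)))(ci a b);jM = af(bK(a * b)(a7(fU x)(fU y))(aZ a b))(af(cQ(jM x)(jM y))(ad(ag(aI(Bn p(ι q)(ι pk)))(au(_* p)(aI(o9 q pk))))));nO = \ f -> ag(nO x(\ S -> xx(\ cu -> f(S ∪ cu))))(ag(bf(cI a(fU x)(gr x)N)(\ S -> nO y(\ cu -> f(S ∪ cu))))(m5(fU x)(gr x)(fU y)(gr y)_ _ refl f))} where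
   a = t6 x
   b = t6 y
   a0 : ∀ a b -> a *(1' - b)+ b == a + b - a * b
   a0 = ap ar
   ci : ∀ a b -> 1' == a + b - a * b +(1' - a)*(1' - b)
   ci = ap ar
   aZ : ∀ a b -> a + b == a + b - a * b + a * b
   aZ = ap ar
  lR : gN 1(aB μ)
  lR = record{ t6 = p;fU = b3;gr = cU;jM = ad(aI(ag(au(_* p)jZ)(aH p)));nO = \ _ -> refl }
 module _ {n : ℕ} (G : a1 n) where
  open kO n
  qt : ∀ S cu -> T(S ⊑ cu)-> ∀{x y}-> T(adj(cP n S)x y)-> T(adj(cP n cu)x y)
  qt S cu sub{x}{y}t = xk cu(\{ refl -> irrefl(cP n S){x}t })(ei(gz(gE S cu sub(fq(dN x y)S(f1(xl S t))))))
  i1 : ∀(R : a1 n){x y}-> T(adj(G ∪ᴳ R)x y)-> T(adj G x y)⊎ T(adj R x y)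
  i1 R{x}{y}t = toWitness{a? = T?(adj G x y)⊎-dec T?(adj R x y)}t
  i2 : ∀(R : a1 n){x y}-> T(adj G x y)⊎ T(adj R x y)-> T(adj(G ∪ᴳ R)x y)
  i2 R{x}{y}t = bc{a? = T?(adj G x y)⊎-dec T?(adj R x y)}t
  rJ : ∀{r}(𝐇 : Vec bq r)S cu -> T(S ⊑ cu)->(G ∪ᴳ cP n S)⟶ 𝐇 ->(G ∪ᴳ cP n cu)⟶ 𝐇
  rJ 𝐇 S cu sub Gp c with Gp c
  ... | j , f , u1 , jn , nl = j , f , u1 , jn , \ x y t -> i2(cP n cu)([ aD ,(\ q -> aG(qt S cu sub q))]′(i1(cP n S)(nl x y t)))

-- All random events combined.

module Gq where
 open M6 using (zero;suc)
 open M9 using (∣_∣)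
 open M11 using (anySubset?;∣⊤∣≡n)
 open M7 using ([];_∷_)
 open M16 using (_∈_)
 open M13 using (here;there)
 open M0 using (ℕ;zero;suc)
 open M1 using (∃;_×_)
 open M2 hiding (_÷_;∣_∣;floor;truncate)
 open M3
 open M8 using ([];_∷_;lookup;tabulate)
 open M4 hiding (J;[_])
 open M15 using (toWitness)
 open M5
 open P1
 open P2
 open P3 using (cI; jU; _⊑_; eo; gD; ep)
 open P4
 open P5 using (κ; ∈-concatMap⁺)
 open P7 using (bN; eI)
 open P9
 open BG using (jW)
 open Ge using (module mi)
 open Dx
 open CG
 open ET
 open EX
 open EY using (gN; combine; lR; lQ)
 mt :{A B : Set}(d : dx A)(xs : List B){δ : ℚ}{𝒫 : B -> A -> Set}->(∀{x}-> x ∈ xs -> kC d δ(𝒫 x))-> kC d(ι(ah xs)* δ)(\ a -> ∀{x}-> x ∈ xs -> 𝒫 x a)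
 mt d []{δ}h = fS d(ad(aI(ag(au(_* δ)iA)(bY δ))))(\ a())
 mt d(x ∷ xs){δ}h = dH d(ad(ag(a0 δ(ι(ah xs)))(au(_* δ)(aI(cV(ah xs))))))(\{ a(p , q)(here refl)-> p;a(p , q)(there r)-> q r })(q4 d(h(here refl))(mt d xs(h ∘ there)))where
  a0 : ∀ δ l -> δ + l * δ ==(1' + l)* δ
  a0 = ap ar
 tf :{A B : Set}(d : dx A)(e : dx B){δ : ℚ}{𝒫 : B -> Set}-> kC e δ 𝒫 -> kC(gl d e)δ(𝒫 ∘ proj₂)
 tf d e{δ}(gU , le , h)= gU ∘ proj₂ , af(ad(hz d e _))(af(bm d(\ a -> le))(ad(bk d δ))), \ ab nb -> h(proj₂ ab)nb
 wp :{A : Set}(d : dx A){δ : ℚ}{𝒫 : A -> Set}(f : A -> bH)->(∀ a -> 𝒫 a -> T(f a))-> kC d δ 𝒫 -> 1' - δ =< aB d(ao ∘ f)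
 wp d{δ}f Dn(gU , le , h)= begin 1' - δ ≤⟨ bA 1'(c4 le)⟩ 1' - aB d(ao ∘ gU)≡⟨ au(_- aB d(ao ∘ gU))(aI(bk d 1'))⟩ aB d(\ _ -> 1')- aB d(ao ∘ gU)≡⟨ aI(qR d(\ _ -> 1')(ao ∘ gU))⟩ aB d(\ a -> 1' - ao(gU a))≤⟨ bm d(\ a -> pt(gU a)(f a)(\ nb -> Dn a(h a nb)))⟩ aB d(ao ∘ f)∎ where
  open RQ
  pt : ∀ b c ->(¬ T b -> T c)-> 1' - ao b =< ao c
  pt true c g = a8 c
  pt false true g = bR
  pt false false g = aA(g(\()))
 th :{A : Set}(d : dx A){δ : ℚ}{𝒫 : A -> Set}-> δ < 1' -> kC d δ 𝒫 -> ∃ 𝒫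
 th d{δ}Gr(gU , le , h)= go(i9 d(\ a -> 1' - ao(gU a))(1' - δ)(af(bA 1'(c4 le))(ad(ag(au(_- aB d(ao ∘ gU))(aI(bk d 1')))(aI(qR d(\ _ -> 1')(ao ∘ gU)))))))where
  go :(∃ \ a -> 1' - δ =< 1' - ao(gU a))-> ∃ _
  go(a , p)= a , h a(\ t -> za refl(gA Gr(lD(aL(\ z -> 1' - δ =< 1' - z)(pI t)p))))where
   lD : 1' - δ =< 1' - 1' -> 1' =< δ
   lD q = af(ad(a0 δ))(af(bC δ q)(ad(ag(au(_+ δ)(D2 1'))(bu δ))))where
    a0 : ∀ δ -> 1' == 1' - δ + δ
    a0 = ap ar
 ti :{A B C : Set}(xs : List A)(ys : List B)(zs : List C){x : A}{y : B}{z : C}-> x ∈ xs -> y ∈ ys -> z ∈ zs ->(x , y , z)∈ bD xs(bD ys zs)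
 ti xs ys zs p q r = dM p(dM q r)
 uG : ∀{a b}(e : Fin a × Fin b)-> e ∈ bD(ax a)(ax b)
 uG(x , y)= dM(∈-allFin x)(∈-allFin y)
 eM :{A : Set}-> List A -> ℕ -> List(List A)
 eM as zero = [] ∷ []
 eM as(suc ℓ)= [] ∷ ce(\ a -> fd(a ∷_)(eM as ℓ))as
 g5 :{A : Set}(as : List A)->(∀ a -> a ∈ as)-> ∀ w ℓ -> ah w <= ℓ -> w ∈ eM as ℓ
 g5 as uv [] zero _ = here refl
 g5 as uv [](suc ℓ)_ = here refl
 g5 as uv(a ∷ w)(suc ℓ)(bl le)= there(∈-concatMap⁺(\ a -> fd(a ∷_)(eM as ℓ))(uv a)(∈-map⁺(a ∷_)(eM as ℓ)(g5 as uv w ℓ le)))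
 gO :{A : Set}(as : List A)-> ∀ ℓ -> ah(eM as ℓ)<= suc(ah as)^' ℓ
 gO as zero = bT
 gO as(suc ℓ)= aa(bl(aa(ae(go as))(az(ah as)(gO as ℓ))))(aK(ah as *' suc(ah as)^' ℓ)(bz(suc(ah as))ℓ))where
  go : ∀ bs -> ah(ce(\ a -> fd(a ∷_)(eM as ℓ))bs)== ah bs *' ah(eM as ℓ)
  go [] = refl
  go(b ∷ bs)= ag(i7(fd(b ∷_)(eM as ℓ)))(aS _+'_(fK(b ∷_)(eM as ℓ))(go bs))
 module _ {r : ℕ} (B E : ℕ) where
  Ay : bq -> Set
  Ay(s , J)= ¬(∃ \(U : av s)-> B *' ∣ U ∣ <' E *' ch(ba J)U)
  mP : ∀ G -> o8(Ay G)
  mP(s , J)= ¬?(anySubset?(\ U -> B *' ∣ U ∣ ℕₚ.<? E *' ch(ba J)U))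
  -- Degenerate tuples: one graph with no subset too dense for `p`, all others edgeless. When the
  -- second density is 0 the tuple is of this kind (`jq`), `z ^ α` does not grow, and the two-round
  -- argument is replaced by `oT`.
  kl :(Fin r -> bq)-> Set
  kl g = ∃ \ a4 -> Ay(g a4)×(∀ j -> j ≢ a4 -> e(proj₂(g j))== 0)
  vm : ∀ g -> o8(kl g)
  vm g = FI \ a4 -> mP(g a4)×-dec D5(\ j -> ¬?(j ≟ᶠ a4)→-dec(e(proj₂(g j))ℕₚ.≟ 0))
  nP : ∀{g E2}->(∀ j -> g j == E2 j)-> kl g -> kl E2
  nP eq(a4 , ra , eZ)= a4 , aL Ay(eq a4)ra , \ j ne -> aL(\ G -> e(proj₂ G)== 0)(eq j)(eZ j ne)
  jq : ∀ g(cd : cx(\ j -> ai(g j))(\ j -> ba(proj₂(g j)))B E)-> 1 <= E -> cx.α cd == 0 -> kl g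
  jq g cd ic vn = a4 , vk , fA where
   open cx cd
   vk : Ay(g a4)
   vk(U , lt)with 1 ℕₚ.≤? ∣ U ∣
   ... | yes h0 = aV refl(gQ lt(aa(bg _ α)(Dz U h0)))
   ... | no BX = ℕₚ.n≮0(gQ lt(ae(ag(au(E *'_)(jW(proj₂(g a4))U(bW(dY BX))))(fx E))))
   fA : ∀ j -> j ≢ a4 -> e(proj₂(g j))== 0
   fA j ne = ln(kB E{{ℕ.>-nonZero ic}}(aa(ae(au(E *'_)(aI(se(ba(proj₂(g j)))))))(aa(eZ j ne ⊤ₛ)(ae(ag(au(_*'(∣ ⊤ₛ{ai(g j)}∣ -' 1))vn)(aI(fx E)))))))
 -- The constants fixed before the size of the graph: `aN` is at least the inverse of the lowest
 -- level, `Δ` is the factor in Markov's inequality, `ek` beats the choices of vertex and colour,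
 -- and `C` dominates all other products.
 record re (r h cN b4 : ℕ) (γ : ℚ) : Set where
  field
   eG : 2 <= r
   fu : 1 <= h
   ie : 1 <= b4
   h7 : 0' < γ
   dI : γ =< 1'
   X aN m Δ ek C : ℕ
   jJ : 1' =< ι aN * lg.ε h r fu(bW eG)γ h7 dI X
   eQ : 1 <= aN
   gk : 1 <= Δ
   yi : 2 *'(h *' r)<= 2 ^' ek
   nI : 1 <= ek
   jG : 16 *' κ h *' aN <= C
   kQ : 272 *'(8 *' κ h *' aN *' ek)*' aN *' aN *' Δ *' κ h <= C
   oq : 8 *' κ h *' m *' aN <= C
   km : 1 <= C
  fv : 1 <= r
  fv = bW eG
  open lg h r fu fv γ h7 dI public
  B E : ℕ
  B = cN *' h !
  E = b4 *' h !
 module _ {N : ℕ} {p : ℚ} (b3 : 0' =< p) (cU : p =< 1') where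
  private
   μ = cI p b3 cU N
  mw : ∀{q E xx}->(∀ f -> xx f == E f)-> gN{N}b3 cU q E -> gN{N}b3 cU q xx
  mw eq x = record{ gN x;nO = \ f -> ag(eq f)(gN.nO x f)}
  jN : ∀ q -> gN b3 cU q(\ f -> aB(bN μ q)(f ∘ u8))
  jN zero = record{ t6 = 0';fU = bR;gr = ca;jM = ad(aI(ag(au(_* p)iA)(bY p)));nO = \ f -> aI(lQ bR ca f)}
  jN(suc q)= mw(\ f -> eI μ(f ∘ u8))(combine b3 cU(lR b3 cU)(jN q))
  oW : ∀ q -> gN b3 cU(q +' 2)(\ f -> aB(gl(bN μ q)(gl μ μ))(\(Ss , gn , f7)-> f(u8 Ss ∪(gn ∪ f7))))
  oW q = mw(\ f -> ag(hz(bN μ q)(gl μ μ)_)(bf(bN μ q)(\ Ss -> hz μ μ _)))(combine b3 cU(jN q)(combine b3 cU(lR b3 cU)(lR b3 cU)))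
 module _ (ir : h4) {r h cN b4 : ℕ} {γ : ℚ} (FS : re r h cN b4 γ) where
  open re FS
  open h4 ir
  module y6 (𝐇 : Vec bq r) (ej : ∀ j → 1 <= v (proj₂ (lookup 𝐇 j))) (dQ : ∀ j → ai (lookup 𝐇 j) <= h)(z : ℕ)(oS : 1 <= z)(BR : P == z ^' E)(qk : C *' z ^' B <= suc n)(q6 : ι h * ι h =< ι z * ε X)(kh : ι h * ι h =< ι(suc n)* ε X)where
   open pr ir using (μ; V; bP; b0; e2; bj; fa)
   module A = wn ir fv 𝐇 ej h fu dQ m aN γ h7 dI (λ {s} J → ⌊ mP {r} B E (s , J) ⌋)
   private
    ic : 1 <= E
    ic = aC ie(oU h)
    instance
     E3 : ℕ.NonZero C
     E3 = ℕ.>-nonZero km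
   cb : ∀{s}(J : a1 s)-> 1 <= s -> s <= h -> T ⌊ mP{r}B E(s , J)⌋ -> A.nM(ba J)
   cb{s}J jx jy t = aG(Rn , aL(_<= Rn)(ag(aS(\ a b -> suc n ^' a *' P ^' b)(ag(au(s -'_)(∣⊤∣≡n s))(wW s))(se es))(bp _))(hR ⊤ₛ(aL(1 <=_)(aI(∣⊤∣≡n s))jx)),(\ U mO -> hR U(bW mO)), hm)where
    es = ba J
    vk = toWitness{a? = mP{r}B E(s , J)}t
    Rn =(suc n ^' s)/ₙ C
    uz : Rn *' C <= suc n ^' s
    uz = oF(suc n ^' s)C
    yl : ∀ u -> 1 <= u -> z ^'(B *' u)*' C <= suc n ^' u
    yl(suc u)_ = aa(ae(ag(au(_*' C)(ag(aI(cz z B(suc u)))(ck(z ^' B)_)))(ag(ew((z ^' B)^' u)(z ^' B)C)(ck((z ^' B)^' u)_))))(aC(aa(ae(ck(z ^' B)C))qk)(b7 u(aa(aa(ae(aI(bp(z ^' B))))(aT(z ^' B)km))qk)))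
    hR : ∀ U -> 1 <= ∣ U ∣ -> suc n ^'(s -' ∣ U ∣)*' P ^' ch es U <= Rn
    hR U h0 = f3 _ C _(begin suc n ^'(s -' ∣ U ∣)*' P ^' ch es U *' C ≡⟨ au(\ q -> suc n ^'(s -' ∣ U ∣)*' q *' C)(ag(au(_^' ch es U)BR)(cz z E(ch es U)))⟩ suc n ^'(s -' ∣ U ∣)*' z ^'(E *' ch es U)*' C ≤⟨ aT C(az(suc n ^'(s -' ∣ U ∣))(bX z{{ℕ.>-nonZero oS}}(GQ(\ lt -> vk(U , lt)))))⟩ suc n ^'(s -' ∣ U ∣)*' z ^'(B *' ∣ U ∣)*' C ≡⟨ ew(suc n ^'(s -' ∣ U ∣))(z ^'(B *' ∣ U ∣))C ⟩ suc n ^'(s -' ∣ U ∣)*'(z ^'(B *' ∣ U ∣)*' C)≤⟨ az(suc n ^'(s -' ∣ U ∣))(yl ∣ U ∣ h0)⟩ suc n ^'(s -' ∣ U ∣)*' suc n ^' ∣ U ∣ ≡⟨ ag(aI(gR(suc n)(s -' ∣ U ∣)∣ U ∣))(au(suc n ^'_)(m0(Data.Fin.Subset.Properties.∣p∣≤n U)))⟩ suc n ^' s ∎)where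
        open ℕₚ.≤-Reasoning
    hm : 8 *' κ s *' Rn *' m *' aN <= suc n ^' s
    hm = aa(ae(a0(κ s)Rn m aN))(aa(az Rn(aa(aT aN(aT m(az 8(qg jy))))oq))uz)where
     a0 : ∀ k R m c -> 8 *' k *' R *' m *' c == R *'(8 *' k *' m *' c)
     a0 = aU
   module Bk = Gi ir {r} B E z oS BR h
   open nL k 𝐇 h using (fl)
   gs :(∀ j -> a1(A.cf j))-> Vec bq r
   gs As = tabulate(\ j -> A.cf j , As j)
   oX : ∀ As ->(∀ j -> As j ∈ nonempty(A.H j))-> gs As ∈ fl
   oX As kM = dE(tabulate(\ j -> fd(A.cf j ,_)(nonempty(A.H j))))(gs As)(\ j -> lp _∈_(aI(a9(\ j -> A.cf j , As j)j))(aI(a9(\ j -> fd(A.cf j ,_)(nonempty(A.H j)))j))(∈-map⁺(A.cf j ,_)(nonempty(A.H j))(kM j)))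
   yu : bq -> Set
   yu G = 1 <= v(proj₂ G)× ai G <= h
   CP : ∀{As}-> As ∈ fl -> ∀ j -> yu(lookup As j)
   CP{As}p j = go(∈-map⁻(A.cf j ,_)(nonempty(A.H j))(aL(lookup As j ∈_)(a9(\ j -> fd(A.cf j ,_)(nonempty(A.H j)))j)(dF(tabulate(\ j -> fd(A.cf j ,_)(nonempty(A.H j))))As p j)))where
    go :(∃ \ J -> J ∈ nonempty(A.H j)× lookup As j ==(A.cf j , J))-> yu(lookup As j)
    go(J , la , eq)= aL yu(aI eq)(mi.hw k 𝐇(A.H j)la , dQ j)
   module _ (b : ℚ) (bb : b * ι b4 == ι cN) (g6 : ∀ (As : Vec bq r) → o8 (b9 As =< b)) (Ls : List bP) where
    xz : Vec(Fin r)(suc n)-> av N -> bP -> Fin(suc k)-> ℚ -> Fin r -> bq -> Set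
    xz c S L i σ j G = Bk.qi c S L i σ j(ba(proj₂ G))
    tj : ℕ × Fin(suc k)× Vec bq r -> av N × av N -> Set
    tj(x , i , As)S = b9 As =< b -> ¬ kl{r}B E(lookup As)-> ∀{L}-> L ∈ Ls -> ε x =< b0 L -> ∀ c -> ∃ \ j -> xz c(ai S ∪ proj₂ S)L i(ε(suc x))j(lookup As j)
    -- The failure of one two-round event: Markov, first round, second round. Writing `z` for
    -- `z ^ α` is legitimate because `α ≥ 1` outside the degenerate tuples.
    ig : ℚ
    ig = ai(f9(ι Δ)(k5 gk))+ ι(ah Ls)* ½ ^ z + ι(ah Ls)*(ι r * ½ ^ z)
    private
     nQ : 0' =< ig
     nQ = 0≤+(0≤+(bO(ai(proj₂(f9(ι Δ)(k5 gk)))))(a7(aY(ah Ls))(aQ z eX)))(a7(aY(ah Ls))(a7(aY r)(aQ z eX)))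
    qu : ∀ x i{As}-> x <' X -> As ∈ fl -> kC(gl μ μ)ig(tj(x , i , As))
    qu x i{As}zg kM = go(g6 As)(vm{r}B E(lookup As))where
     go : o8(b9 As =< b)-> o8(kl{r}B E(lookup As))-> kC(gl μ μ)ig(tj(x , i , As))
     go(no Gt)_ = fS(gl μ μ)nQ(\ _ le -> aA(Gt le))
     go _(yes si)= fS(gl μ μ)nQ(\ _ _ xA -> aA(xA si))
     go(yes le)(no xA)= dH(gl μ μ){𝒫 = \ S -> ∀{L}-> L ∈ Ls -> ε x =< b0 L -> ∀ c -> ∃ \ j -> xz c(ai S ∪ proj₂ S)L i(ε(suc x))j(lookup As j)}jp(\ S h _ _{L}-> h{L})(Bk.s3{\ j -> ai(lookup As j)}{\ j -> ba(proj₂(lookup As j))}(\ j -> fY(proj₂(lookup As j)))(\ j -> aa(ai(va j))(Data.Fin.Subset.Properties.∣p∣≤n(verts(proj₂(lookup As j)))))(\ j -> proj₂(va j))cd kg(ε x)(ρ x)(θ x)(ε(suc x))(eg x)(dt x)(h5(suc x))(lf x)(qj x)(pw x)(h5 x)(q5 x)(kP x)aN Δ ek C(af jJ(aO(ι aN)(aY aN)rZ))eQ gk yi nI jG kQ qk(af kh(aO(ι(suc n))(aY(suc n))rZ))(af q6(aO(ι z)(aY z)rZ))Ls i)where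
      va = CP kM
      rZ : ε X =< ε(suc x)
      rZ = mc(suc x)X zg
      cd = ms As eG h(\ j -> proj₂(va j))(\ j -> ai(va j))b cN b4 bb le
      α = cx.α cd
      kg : 1 <= α
      kg = nR α refl where
       nR : ∀ a -> a == α -> 1 <= a
       nR zero eq = aA(xA(jq{r}B E(lookup As)cd ic(aI eq)))
       nR(suc a)eq = bl bI
      oo : z <= z ^' α
      oo = aa(ae(aI(f6 z)))(bX z{{ℕ.>-nonZero oS}}kg)
      Kc = 8 *' κ h *' aN *' ek
      nJ : 1 <= Kc
      nJ = aC(aC(aC(bl(bI{7}))(aC(bz 2 h)(bz(suc h)h)))eQ)nI
      CQ : z <= Kc *' z ^' α
      CQ = aa oo(aL(_<= Kc *' z ^' α)(bp _)(aT(z ^' α)nJ))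
      jp : ai(f9(ι Δ)(k5 gk))+ ι(ah Ls)* ½ ^(z ^' α)+ ι(ah Ls)*(ι r * ½ ^(Kc *' z ^' α))=< ig
      jp = cQ(bA(ai(f9(ι Δ)(k5 gk)))(aO(ι(ah Ls))(aY(ah Ls))(f8 eX j1 oo)))(aO(ι(ah Ls))(aY(ah Ls))(aO(ι r)(aY r)(f8 eX j1 CQ)))
    lh : List(ℕ × Fin(suc k)× Vec bq r)
    lh = bD(upTo X)(bD(ax(suc k))fl)
    -- One pair of rounds serves all levels, parts and tuples at once; the length of `lh` does not
    -- depend on the size of the graph.
    oY : kC(gl μ μ)(ι(ah lh)* ig)(\ S -> ∀{ev}-> ev ∈ lh -> tj ev S)
    oY = mt(gl μ μ)lh{𝒫 = tj}wa where
     wa : ∀{ev}-> ev ∈ lh -> kC(gl μ μ)ig(tj ev)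
     wa{x , i , As}p = let q , pk = oG(upTo X)(bD(ax(suc k))fl)p in qu x i(HC q)(proj₂(oG(ax(suc k))fl pk))
   open vb ir
   open vc {h} {m} {aN} {r} fu fv γ h7 dI
   fm : List(s5 h m aN)
   fm = A.fm cb
   wq : dx(Vec(av N)(ah fm)× av N × av N)
   wq = gl(bN μ(ah fm))(gl μ μ)
   os : Vec(av N)(ah fm)× av N × av N -> av N
   os(Ss , gn , f7)= u8 Ss ∪(gn ∪ f7)
   Ls : List bP
   Ls = eM(bD(ax(suc k))(ax(suc n)))A.nj
   nS : A.X == X -> γ =< b0 [] -> ι(X *' h)=< ι(suc n)* ε X -> kC(bN μ(ah fm))(ι A.jL * ½ ^ m)(\ Ss -> ∃(cc(u8 Ss)0 [] fm))
   nS BY kk Az = aL(\ q -> kC(bN μ(ah fm))(ι q * ½ ^ m)(\ Ss -> ∃(cc(u8 Ss)0 [] fm)))(A.eR cb)(qr X jJ kh Az fm 0 [](aa(ae(A.eR cb))(aa(a3 A.jL _)(ae BY)))bI kk)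
   module _ (pW : ∀ x → ¬ T (aR x x)) (U : av N → a1 (suc n)) (op : ∀ S x → x ∈ₛ verts (U S)) (pY : ∀ S x y → T (aR x y) → T (adj (U S) x y))(vi : ∀ S{x y}-> x ≢ y -> T(lookup S(dN x y))-> T(adj(U S)x y))(kk : γ =< b0 [])(BY : A.X == X)(dW : β 𝐇(suc k)* ι b4 == ι cN)(g6 : ∀(As : Vec bq r)-> o8(b9 As =< β 𝐇(suc k)))(Az : ι(X *' h)=< ι(suc n)* ε X)where
    private
     b = β 𝐇(suc k)
    DN : Vec(av N)(ah fm)× av N × av N -> Set
    DN S = ∃(cc(u8(ai S))0 [] fm)×(∀{ev}-> ev ∈ lh b dW g6 Ls -> tj b dW g6 Ls ev(proj₂ S))
    rK : kC wq(ι A.jL * ½ ^ m + ι(ah(lh b dW g6 Ls))* ig b dW g6 Ls)DN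
    rK = q4 wq{𝒫 = \ S -> ∃(cc(u8(ai S))0 [] fm)}(uy(bN μ(ah fm))(gl μ μ)(nS BY kk Az))(tf(bN μ(ah fm))(gl μ μ)(oY b dW g6 Ls))
    oZ : ∀ S -> DN S -> U(os S)⟶ 𝐇
    oZ S@(Ss , gn , f7)((lG , CM), ev)= A.xw cb pW kk xB(U xB)(op xB)(pY xB)(vi xB)(g4(gD(u8 Ss)(gn ∪ f7))CM)(\ As -> b9(gs As)=< b)qv(mi.ke k 𝐇)gp yU where
     xB = os S
     qv :(∀ j -> a1(A.cf j))-> Set
     qv As = b9(gs As)=< b × ¬ kl{r}B E(lookup(gs As))
     at : ∀ As j -> lookup(gs As)j ==(A.cf j , As j)
     at As = a9(\ j -> A.cf j , As j)
     gp : ∀ As ->(∀ j -> As j ∈ nonempty(A.H j))-> b9(gs As)=< b ->(∃ \ a4 -> T ⌊ mP{r}B E(A.cf a4 , As a4)⌋ ×(∀ j -> j ≢ a4 -> ba(As j)== []))⊎ qv As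
     gp As kM le = go(vm{r}B E(lookup(gs As)))where
      CR : ∀{A : Set}(xs : List A)-> ah xs == 0 -> xs == []
      CR [] _ = refl
      go : o8(kl{r}B E(lookup(gs As)))->(∃ \ a4 -> T ⌊ mP{r}B E(A.cf a4 , As a4)⌋ ×(∀ j -> j ≢ a4 -> ba(As j)== []))⊎ qv As
      go(no xA)= aG(le , xA)
      go(yes si)= aD(AA(nP{r}B E(at As)si))where
       AA : kl{r}B E(\ j -> A.cf j , As j)-> ∃ \ a4 -> T ⌊ mP{r}B E(A.cf a4 , As a4)⌋ ×(∀ j -> j ≢ a4 -> ba(As j)== [])
       AA(a4 , ra , eZ)= a4 , bc{a? = mP{r}B E(A.cf a4 , As a4)}ra , \ j ne -> CR(ba(As j))(eZ j ne)
     pB :(∀ j -> a1(A.cf j))-> Vec(Fin r)(suc n)-> bP -> Fin(suc k)-> ℕ -> Set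
     pB As c L i x = ∃ \ j -> ∃ \(α : Vec V(A.cf j))-> ky α ×(∀ x -> lookup c(lookup α x)== j)×(∀ x -> T(e2 L i(lookup α x)))× T(fa(ba(As j))α ⊑ xB)× ε(suc x)=< b0(bj i α L)
     yU : ∀ c L x -> x <' A.X -> ah L <= A.nj -> ε x =< b0 L -> ∀ i As ->(∀ j -> As j ∈ nonempty(A.H j))-> qv As -> pB As c L i x
     yU c L x zg lq fk i As kM(le , xA)= qq nH where
      CS :(x , i , gs As)∈ lh b dW g6 Ls
      CS = ti(upTo X)(ax(suc k))fl(HD(aL(x <'_)BY zg))(∈-allFin i)(oX As kM)
      BT : L ∈ Ls
      BT = g5(bD(ax(suc k))(ax(suc n)))uG L A.nj lq
      nH : ∃ \ j -> xz b dW g6 Ls c(gn ∪ f7)L i(ε(suc x))j(lookup(gs As)j)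
      nH = ev{x , i , gs As}CS le xA{L}BT fk c
      yv : ∀ j -> xz b dW g6 Ls c(gn ∪ f7)L i(ε(suc x))j(A.cf j , As j)-> pB As c L i x
      yv j(α , uR , m2 , ft , im , dn)= j , α , uR , m2 , ft , eo(fa(ba(As j))α)(gn ∪ f7)xB im(ep(u8 Ss)(gn ∪ f7)), dn
      qq :(∃ \ j -> xz b dW g6 Ls c(gn ∪ f7)L i(ε(suc x))j(lookup(gs As)j))-> pB As c L i x
      qq(j , BQ)= yv j(aL(xz b dW g6 Ls c(gn ∪ f7)L i(ε(suc x))j)(at As j)BQ)
    o0 : 1' -(ι A.jL * ½ ^ m + ι(ah(lh b dW g6 Ls))* ig b dW g6 Ls)=< aB wq(\ S -> ao ⌊ U(os S)⟶? 𝐇 ⌋)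
    o0 = wp wq(\ S -> ⌊ U(os S)⟶? 𝐇 ⌋)(\ S bo -> bc{a? = U(os S)⟶? 𝐇}(oZ S bo))rK
    rL :(∀ S cu -> T(S ⊑ cu)-> U S ⟶ 𝐇 -> U cu ⟶ 𝐇)-> ∀ δ -> ι A.jL * ½ ^ m + ι(ah(lh b dW g6 Ls))* ig b dW g6 Ls =< δ -> ∀ gZ l u -> ι(A.jL +' 2)* p =< gZ -> 1' - δ =< aB(cI gZ l u N)(\ S -> ao ⌊ U S ⟶? 𝐇 ⌋)
    rL mono δ le gZ l u vo = af(bA 1'(c4 le))(af o0(af(ad(Ex.nO f))(jU Ex.fU Ex.gr l u(af jM vo)f(\ S cu sub -> dg{⌊ U S ⟶? 𝐇 ⌋}{⌊ U cu ⟶? 𝐇 ⌋}(\ t -> bc{a? = U cu ⟶? 𝐇}(mono S cu sub(toWitness{a? = U S ⟶? 𝐇}t)))))))where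
     f : av N -> ℚ
     f S = ao ⌊ U S ⟶? 𝐇 ⌋
     module Ex = gN (oW {N} b3 cU (ah fm))
     jM : Ex.t6 =< ι(A.jL +' 2)* p
     jM = af Ex.jM(ad(au(\ w -> ι(w +' 2)* p)(A.eR cb)))

-- Choice of the constants.

module E4 where
 open M6 using (zero;suc)
 open M11 using (∈⊤;∣p∣≤n;x∈p∪q⁺)
 open M7 using ([];_∷_)
 open M0 using (ℕ;zero;suc)
 open M1 using (∃;_×_)
 open M2 hiding (_÷_;∣_∣;floor;truncate)
 open M3
 open M8 using ([];_∷_;lookup)
 open M4 hiding (J;[_])
 open M5
 open P1
 open P2
 open P3
 open P5 using (κ)
 open P8
 open BG using (gK)
 open EG
 open Dx
 open CG
 open ET
 open EX
 open Gq
 open EY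
 kn : ∀ x δ -> 0' < δ -> ∃ \ R -> x =< ι R * δ
 kn x δ fV with <-cmp 0' x
 ... | tri≈ _ eq _ = 0 , af(ad(aI eq))(a7(aY 0)(bO fV))
 ... | tri> _ _ gt = 0 , af(bO gt)(a7(aY 0)(bO fV))
 ... | tri< G3 _ _ with f9 x G3
 ... | q , Eo , xq with archimedean(δ * q)(r6 fV Eo)
 ... | N , le = suc N ,(begin x ≡⟨ aI(ag(au(_* x)(gK 1 N))(ag(au(_* x)jZ)(aH x)))⟩(1 ÷ suc N)* ι(suc N)* x ≤⟨ aX x(bO G3)(aX(ι(suc N))(aY(suc N))le)⟩ δ * q * ι(suc N)* x ≡⟨ a0 δ q(ι(suc N))x ⟩ ι(suc N)* δ *(x * q)≡⟨ ag(au(ι(suc N)* δ *_)xq)(aF(ι(suc N)* δ))⟩ ι(suc N)* δ ∎)where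
  open RQ
  a0 : ∀ d q n x -> d * q * n * x == n * d *(x * q)
  a0 = ap ar
 eN : ∀{x δ R S}-> 0' < δ -> x =< ι R * δ -> R <= S -> x =< ι S * δ
 eN{δ = δ}fV le E5 = af le(aX δ(bO fV)(bw E5))
 rg : ∀ x δ -> 0' < δ -> ∃ \ m -> x * ½ ^ m =< δ
 rg x δ fV = m , af(aX(½ ^ m)(aQ m eX)(af DM(aX δ(bO fV)(bw(aa(bB m)(iB m))))))(ad(ag(a0(ι(2 ^' m))δ(½ ^ m))(ag(au(δ *_)yl)(aF δ))))where
  m = ai(kn x δ fV)
  DM = proj₂(kn x δ fV)
  a0 : ∀ a b c -> a * b * c == b *(a * c)
  a0 = ap ar
  yl : ι(2 ^' m)* ½ ^ m == 1'
  yl = ag(au(_* ½ ^ m)(ag(mU 2 m)(au(_^ m)l1)))(ag(aI(b5(1' + 1')½ m))(ag(au(_^ m)vR)(1^ m)))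
 module _ (C B : ℕ) (km : 1 <= C) (eH : 1 <= B) (n : ℕ) where
  private
   P? : ∀ z -> o8(C *' z ^' B <= n)
   P? z = C *' z ^' B ℕₚ.≤? n
  gP : ℕ
  gP = greatest P? n
  private
   0^ : ∀ b -> 1 <= b -> C *' 0 ^' b == 0
   0^(suc b)_ = fx C
   tk : ∀ z -> z <= C *' z ^' B
   tk zero = bI
   tk(suc z)= aa(ae(aI(ag(bp _)(f6(suc z)))))(aC km(bX(suc z)eH))
  i3 : C *' gP ^' B <= n
  i3 with Hy P? n
  ... | aD eq = aa(ae(ag(au(\ z -> C *' z ^' B)eq)(0^ B eH)))bI
  ... | aG p = p
  g7 : ∀ z -> C *' z ^' B <= n -> z <= gP
  g7 z p with vN gP z
  ... | tri< lt _ _ = aA(Hx P? n z lt(aa(tk z)p)p)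
  ... | tri≈ _ eq _ = ae(aI eq)
  ... | tri> _ _ gt = bW gt
  kT : n <' C *' suc gP ^' B
  kT = dY(\ p -> aV refl(g7(suc gP)p))
 ih :{A B : Set}(xs : List A)(ys : List B)-> ah(bD xs ys)== ah xs *' ah ys
 ih [] ys = refl
 ih(x ∷ xs)ys = ag(i7(fd(x ,_)ys))(aS _+'_(fK(x ,_)ys)(ih xs ys))
 -- The number of states is a power of `K n + 1`, which `n ≤ C (z + 1) ^ B` turns into a polynomial
 -- in `z`; `½ ^ z` beats it and leaves a factor `1 / (z + 1)`.
 rM : ∀ K C B ℓ -> ∃ \ A -> ∀ z n -> n <= C *' suc z ^' B -> 1 <= n -> ι(suc(K *' n)^' ℓ)* ½ ^ z * ι(suc z)=< ι A
 rM K C B ℓ = D *' oB , du where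
  D =(suc K *' C)^' ℓ
  pe = l0(suc(B *' ℓ))
  oB = ai pe
  du : ∀ z n -> n <= C *' suc z ^' B -> 1 <= n -> ι(suc(K *' n)^' ℓ)* ½ ^ z * ι(suc z)=< ι(D *' oB)
  du z n r3 rI = begin ι(suc(K *' n)^' ℓ)* ½ ^ z * ι(suc z)≡⟨ ag(a0(ι(suc(K *' n)^' ℓ))(½ ^ z)(ι(suc z)))(au(_* ½ ^ z)(aI(cW(suc(K *' n)^' ℓ)(suc z))))⟩ ι(suc(K *' n)^' ℓ *' suc z)* ½ ^ z ≤⟨ aX(½ ^ z)(aQ z eX)(bw t5)⟩ ι(D *' oB *' 2 ^' z)* ½ ^ z ≡⟨ ag(au(_* ½ ^ z)(cW(D *' oB)(2 ^' z)))(ag(hp(ι(D *' oB))(ι(2 ^' z))(½ ^ z))(ag(au(ι(D *' oB)*_)yl)(aF(ι(D *' oB)))))⟩ ι(D *' oB)∎ where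
   open RQ
   a0 : ∀ a b c -> a * b * c == a * c * b
   a0 = ap ar
   yl : ι(2 ^' z)* ½ ^ z == 1'
   yl = ag(au(_* ½ ^ z)(ag(mU 2 z)(au(_^ z)l1)))(ag(aI(b5(1' + 1')½ z))(ag(au(_^ z)vR)(1^ z)))
   t2 : suc(K *' n)<= suc K *' C *' suc z ^' B
   t2 = aa(aK(K *' n)rI)(aa(az(suc K)r3)(ae(aI(ew(suc K)C(suc z ^' B)))))
   t5 : suc(K *' n)^' ℓ *' suc z <= D *' oB *' 2 ^' z
   t5 = aa(aT(suc z)(b7 ℓ t2))(aa(ae(ag(au(_*' suc z)(ag(b6(suc K *' C)(suc z ^' B)ℓ)(au(D *'_)(cz(suc z)B ℓ))))(td D(suc z ^'(B *' ℓ))(suc z))))(aa(az D(proj₂(proj₂ pe)z))(ae(aI(ew D oB(2 ^' z))))))where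
    td : ∀ a b c -> a *' b *' c == a *'(c *' b)
    td = aU
 eB : ∀{q}(xs : Vec bq q)j -> ai(lookup xs j)<= Vec.sum(Vec.map ai xs)
 eB(x ∷ xs)zero = a3(ai x)_
 eB(x ∷ xs)(suc j)= aa(eB xs j)(bg _(ai x))
 sg : ∀{q}-> 2 <= q ->(xs : Vec bq q)->(∀ j -> 1 <= v(proj₂(lookup xs j)))-> 1 <= Vec.sum(Vec.map ai xs)
 sg _((n , H)∷ xs)f = aa(aa(f zero)(∣p∣≤n(verts H)))(a3 n _)
 sg()[] f
 module qw {r : ℕ} (eG : 2 <= r) (𝐇 : Vec bq r) (ej : ∀ j → 1 <= v (proj₂ (lookup 𝐇 j))) (k cN b4 : ℕ)(dW : β 𝐇(suc k)* ι b4 == ι cN)(jm : 1 <= cN)(ie : 1 <= b4)(g6 : ∀(As : Vec bq r)-> o8(b9 As =< β 𝐇(suc k)))where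
  h : ℕ
  h = Vec.sum(Vec.map ai 𝐇)
  dQ : ∀ j -> ai(lookup 𝐇 j)<= h
  dQ = eB 𝐇
  fu : 1 <= h
  fu = sg eG 𝐇 ej
  open nL k 𝐇 h using (jL; X; nj; fl)
  ¼ : ℚ -> ℚ
  ¼ δ = ½ *(½ * δ)
  dr : ℕ
  dr = ah(bD(upTo X)(bD(ax(suc k))fl))
  B E ek : ℕ
  B = cN *' h !
  E = b4 *' h !
  ek = suc(2 *'(h *' r))
  fv : 1 <= r
  fv = bW eG
  pq r2 AB :(aN m Δ : ℕ)-> ℕ
  pq aN m Δ = 16 *' κ h *' aN
  r2 aN m Δ = 272 *'(8 *' κ h *' aN *' ek)*' aN *' aN *' Δ *' κ h
  AB aN m Δ = 8 *' κ h *' m *' aN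
  -- `Y` is at least n^(1/β), and `c` is at most `D / Y`. So the statement gives success with
  -- probability `1 - δ` from an edge probability of order at most n^(-1/β) on.
  hK : ℕ -> ℚ -> ℚ -> ℕ -> ℕ -> Set
  hK D γ δ hC n = hC <= suc n ->(G : a1(suc n))-> v G == suc n -> γ =< dP.b0(adj G)(c3 G k)k [] -> ∃ \ Y -> 1 <= Y × suc n ^' b4 <= Y ^' cN × ∃ \ c -> c =< 1' × c * ι Y =< ι D ×(∀ p l u -> c =< p -> 1' - δ =< aB(cI p l u(mm(suc n)))(\ S -> ao ⌊(G ∪ᴳ cP(suc n)S)⟶? 𝐇 ⌋))
  module q7 (γ : ℚ) (h7 : 0' < γ) (dI : γ =< 1') (δ : ℚ) (fV : 0' < δ) (aN m Δ C A e0 g3 tl : ℕ) (eQ : 1 <= aN) (jJ : 1' =< ι aN * lg.ε h r fu fv γ h7 dI X) (am : ι jL * ½ ^ m =< ½ * δ) (gk : 1 <= Δ) (E6 : ι dr =< ι Δ * ¼ δ)(jG : pq aN m Δ <= C)(kQ : r2 aN m Δ <= C)(oq : AB aN m Δ <= C)(km : 1 <= C)(ws : ∀ z n -> n <= C *' suc z ^' B -> 1 <= n -> ι(suc(suc k *' n)^' nj)* ½ ^ z * ι(suc z)=< ι A)(wr : ι h * ι h =< ι e0 * lg.ε h r fu fv γ h7 dI X)(xC : ι(X *' h)=< ι g3 * lg.ε h r fu fv γ h7 dI X)(DO : ι(dr *' suc r *' A)=< ι tl * ¼ δ)where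
   module S = lg h r fu fv γ h7 dI
   private
    wv = ¼ δ
    jI : 0' < ½
    jI = da ½
    AC : 0' < wv
    AC = r6 jI(r6 jI fV)
    FS : re r h cN b4 γ
    FS = record { eG = eG;fu = fu;ie = ie;h7 = h7;dI = dI;X = X;aN = aN;m = m;Δ = Δ;ek = ek;C = C ;jJ = jJ;eQ = eQ;gk = gk ;yi = aa(aa(bB _)(bB _))(iB ek);nI = bl bI ;jG = jG;kQ = kQ;oq = oq;km = km }
    eH : 1 <= B
    eH = aC jm(oU h)
    ic : 1 <= E
    ic = aC ie(oU h)
   τ Z D : ℕ
   -- The number of rounds: one for each preliminary task and two for the main step.
   τ = jL +' 2
   Z = suc(e0 +'(g3 +'(tl +' τ)))
   D = τ *'((C *' 2 ^' B)^' b4)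
   tm : ∀ n -> hK D γ δ(C *' Z ^' B)n
   tm n ww G vG kk = At.result n ww G vG kk where
    module At (n : ℕ) (ww : C *' Z ^' B <= suc n) (G : a1 (suc n)) (vG : v G == suc n) (kk : γ =< dP.b0 (adj G) (c3 G k) k []) where
     z : ℕ
     z = gP C B km eH(suc n)
     uH : Z <= z
     uH = g7 C B km eH(suc n)Z ww
     oS : 1 <= z
     oS = aa(bl bI)uH
     qk : C *' z ^' B <= suc n
     qk = i3 C B km eH(suc n)
     n< : suc n <' C *' suc z ^' B
     n< = kT C B km eH(suc n)
     instance
      Aa : ℕ.NonZero z
      Aa = ℕ.>-nonZero oS
     tn : z <= suc n
     tn = aa(aa(ae(aI(f6 z)))(bX z eH))(aa(aa(ae(aI(bp(z ^' B))))(aT(z ^' B){1}{C}km))qk)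
     vp : e0 <= z
     vp = aa(aa(a3 _ _)(bB _))uH
     yx : g3 <= z
     yx = aa(aa(aa(a3 _ _)(bg _(e0)))(bB _))uH
     yz : tl <= z
     yz = aa(aa(aa(aa(a3 _ τ)(bg _(g3)))(bg _(e0)))(bB _))uH
     yA : τ <= z
     yA = aa(aa(aa(aa(bg τ(tl))(bg _(g3)))(bg _(e0)))(bB _))uH
     P = z ^' E
     yB : 1 <= P
     yB = bz z E
     CT : z <= P
     CT = aa(ae(aI(f6 z)))(bX z ic)
     rP = f9(ι P)(k5 yB)
     p = ai rP
     b3 : 0' =< p
     b3 = bO(ai(proj₂ rP))
     pP : p * ι P == 1'
     pP = ag(e9 p(ι P))(proj₂(proj₂ rP))
     cU : p =< 1'
     cU = af(ad(aI(aF p)))(af(aO p b3(af(ad(aI jZ))(bw yB)))(ad pP))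
     module Co = kO (suc n)
     ir : h4
     ir = record{ n = n;k = k;aR = adj G;de = c3 G k;N = mm(suc n);dN = Co.dN;br = Co.br;p = p;b3 = b3;cU = cU;P = P;pP = pP }
     q6 : ι h * ι h =< ι z * S.ε X
     q6 = eN{ι h * ι h}{S.ε X}(S.0<ε X)(wr)vp
     kh : ι h * ι h =< ι(suc n)* S.ε X
     kh = eN{ι h * ι h}{S.ε X}(S.0<ε X)(wr)(aa vp tn)
     vd : ι(X *' h)=< ι(suc n)* S.ε X
     vd = eN{ι(X *' h)}{S.ε X}(S.0<ε X)(xC)(aa yx tn)
     module F = y6 ir FS 𝐇 ej dQ z oS refl qk q6 kh
     lS : ∀ x -> x ∈ₛ verts G
     lS x = aL(x ∈ₛ_)(aI(Data.Fin.Subset.Properties.∣p∣≡n⇒p≡⊤ vG))∈⊤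
     U : av(mm(suc n))-> a1(suc n)
     U S = G ∪ᴳ cP(suc n)S
     op : ∀ S x -> x ∈ₛ verts(U S)
     op S x = x∈p∪q⁺{p = verts G}{verts(cP(suc n)S)}(aD(lS x))
     CU : ∀ S x y -> T(adj G x y)-> T(adj(U S)x y)
     CU S x y t = i2 G(cP(suc n)S){x}{y}(aD t)
     yC : ∀ S{x y}-> x ≢ y -> T(lookup S(Co.dN x y))-> T(adj(U S)x y)
     yC S{x}{y}ne t = i2 G(cP(suc n)S){x}{y}(aG(Co.xk S ne t))
     ℓ = ah F.Ls
     AD : ι ℓ * ½ ^ z * ι(suc z)=< ι A
     AD = af(aX(ι(suc z))(aY(suc z))(aX(½ ^ z)(aQ z eX)(bw(aa(gO(bD(ax(suc k))(ax(suc n)))nj)(ae(au(\ q -> suc q ^' nj)(ag(ih(ax(suc k))(ax(suc n)))(aS _*'_(cR{n = suc k}(\ x -> x))(cR{n = suc n}(\ x -> x))))))))))(ws z(suc n)(bW n<)(bl bI))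
     q = ai(f9(ι Δ)(k5 gk))
     Eo = ai(proj₂(f9(ι Δ)(k5 gk)))
     BZ : ι dr * q =< wv
     BZ = af(aX q(bO Eo)E6)(ad(ag(a0(ι Δ)wv q)(ag(au(wv *_)(proj₂(proj₂(f9(ι Δ)(k5 gk)))))(aF wv))))where
      a0 : ∀ a b c -> a * b * c == b *(a * c)
      a0 = ap ar
     E7 : ι dr *(ι ℓ * ½ ^ z + ι ℓ *(ι r * ½ ^ z))=< wv
     E7 = bZ(ι(suc z))(cO z)(begin ι(suc z)*(ι dr *(ι ℓ * ½ ^ z + ι ℓ *(ι r * ½ ^ z)))≡⟨ a0(ι(suc z))(ι dr)(ι ℓ)(½ ^ z)(ι r)⟩ ι dr *(1' + ι r)*(ι ℓ * ½ ^ z * ι(suc z))≤⟨ aO(ι dr *(1' + ι r))(a7(aY dr)(0≤+ ca(aY r)))AD ⟩ ι dr *(1' + ι r)* ι A ≡⟨ ag(au(\ w -> ι dr * w * ι A)(aI(cV r)))(ag(au(_* ι A)(aI(cW dr(suc r))))(aI(cW(dr *' suc r)A)))⟩ ι(dr *' suc r *' A)≤⟨ eN{ι(dr *' suc r *' A)}{wv}AC(DO)(aa yz(bB z))⟩ ι(suc z)* wv ∎)where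
      open RQ
      a0 : ∀ s n l h r -> s *(n *(l * h + l *(r * h)))== n *(1' + r)*(l * h * s)
      a0 = ap ar
     -- `δ` is shared out as one half for the preliminary tasks, one quarter for the Markov events,
     -- and one quarter for the events summed over all states.
     tp : ι jL * ½ ^ m + ι dr * F.ig(β 𝐇(suc k))dW g6 F.Ls =< δ
     tp = af(cQ(am)(af(ad(a0(ι dr)q(ι ℓ * ½ ^ z)(ι ℓ *(ι r * ½ ^ z))))(cQ BZ E7)))(ad(ag(aZ ½ δ)(ag(au(\ w -> w * δ)(vX ½ vR))(aH δ))))where
      a0 : ∀ n a b c -> n *(a + b + c)== n * a + n *(b + c)
      a0 = ap ar
      aZ : ∀ a d -> a * d +(a *(a * d)+ a *(a * d))==(a +(1' + 1')* a * a)* d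
      aZ = ap ar
      vX : ∀ a ->(1' + 1')* a == 1' -> a +(1' + 1')* a * a == 1'
      vX a eq = ag(au(\ w -> a + w * a)eq)(ag(d1 a)eq)where
       d1 : ∀ a -> a + 1' * a ==(1' + 1')* a
       d1 = ap ar
     -- From `n + 1 < C (z + 1) ^ B ≤ C 2^B z^B` and `z ^ (B b4) = P ^ cN`; the constant factor
     -- makes up for rounding `z`.
     Y =(C *' 2 ^' B)^' b4 *' P
     c = ι τ * p
     rB : c =< 1'
     rB = af(aX p b3(bw(aa yA CT)))(ad(proj₂(proj₂ rP)))
     CV : c * ι Y =< ι D
     CV = ad(ag(au(ι τ * p *_)(cW((C *' 2 ^' B)^' b4)P))(ag(a0(ι τ)p(ι((C *' 2 ^' B)^' b4))(ι P))(ag(au(ι τ * ι((C *' 2 ^' B)^' b4)*_)pP)(ag(aF _)(aI(cW τ _))))))where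
      a0 : ∀ t p a b -> t * p *(a * b)== t * a *(p * b)
      a0 = ap ar
     xD : 1 <= C *' 2 ^' B
     xD = aC{1}{C}km(bz 2 B)
     wx : suc n ^' b4 <= Y ^' cN
     wx = begin suc n ^' b4 ≤⟨ b7 b4(aa(bW n<)(aa(az C(b7 B(aa(aK z oS)(ae(au(z +'_)(aI(aW z)))))))(ae(ag(au(C *'_)(b6 2 z B))(aI(ew C(2 ^' B)(z ^' B)))))))⟩(C *' 2 ^' B *' z ^' B)^' b4 ≡⟨ b6(C *' 2 ^' B)(z ^' B)b4 ⟩(C *' 2 ^' B)^' b4 *'(z ^' B)^' b4 ≡⟨ au((C *' 2 ^' B)^' b4 *'_)(ag(cz z B b4)(ag(au(z ^'_)(a0 cN(h !)b4))(aI(cz z E cN))))⟩(C *' 2 ^' B)^' b4 *' P ^' cN ≤⟨ aT(P ^' cN)(aa(ae(aI(f6((C *' 2 ^' B)^' b4))))(bX((C *' 2 ^' B)^' b4){{ℕ.>-nonZero(bz(C *' 2 ^' B){{ℕ.>-nonZero xD}}b4)}}jm))⟩((C *' 2 ^' B)^' b4)^' cN *' P ^' cN ≡⟨ aI(b6((C *' 2 ^' B)^' b4)P cN)⟩ Y ^' cN ∎ where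
      open ℕₚ.≤-Reasoning
      a0 : ∀ b q c -> b *' q *' c == c *' q *' b
      a0 = aU
     B0 : ∀ gZ l u -> c =< gZ -> 1' - δ =< aB(cI gZ l u(mm(suc n)))(\ S -> ao ⌊ U S ⟶? 𝐇 ⌋)
     B0 = F.rL(\ x -> irrefl G{x})U op CU yC kk refl dW g6 vd(rJ G 𝐇)δ tp
     result : ∃ \ Y -> 1 <= Y × suc n ^' b4 <= Y ^' cN × ∃ \ c -> c =< 1' × c * ι Y =< ι D ×(∀ p l u -> c =< p -> 1' - δ =< aB(cI p l u(mm(suc n)))(\ S -> ao ⌊ U S ⟶? 𝐇 ⌋))
     result = Y , aC(bz(C *' 2 ^' B){{ℕ.>-nonZero xD}}b4)yB , wx , c , rB , CV , B0

-- The upper half of the threshold.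

module G4 where
 open M6 using (zero;suc)
 open M9 using (∣_∣)
 open M7 using ([])
 open M10 using ([])
 open M0 using (ℕ;zero;suc)
 open M1 using (∃;_×_)
 open M2 hiding (_÷_;∣_∣;floor;truncate)
 open M3
 open M8 using ([];lookup)
 open M4 hiding (J;[_])
 open M5
 open P1
 open P2
 open P3
 open P4
 open P8
 open P9
 open BG using (gK)
 open EG
 open Dx
 open CG
 open ET
 open EX
 open Gq
 open EY
 open E4
 dV : ∀ b -> 0' < b -> b * ι(↧ₙ b)== ι ℤ.∣ ↥ b ∣ × 1 <= ℤ.∣ ↥ b ∣
 dV b@(mkℚ(ℤ.+ zero)d c)(*<* lt)= aA(nr lt)where
  nr : ¬(ℤ.+ 0 ℤ.* ℤ.+ suc d ℤ.< ℤ.+ 0 ℤ.* ℤ.+ 1)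
  nr(ℤ.+<+())
 dV b@(mkℚ(ℤ.+ suc a)d c)_ = ag(au(_* ι(suc d))(aI(↥p/↧p≡p b)))(gK(suc a)d), bl bI
 dV b@(mkℚ(ℤ.-[1+ a ])d c)(*<*())
 module _ {r : ℕ} (eG : 2 <= r) (𝐇 : Vec bq r) (ej : ∀ j → 1 <= v (proj₂ (lookup 𝐇 j))) (k cN b4 : ℕ)(dW : β 𝐇(suc k)* ι b4 == ι cN)(jm : 1 <= cN)(ie : 1 <= b4)(g6 : ∀(As : Vec bq r)-> o8(b9 As =< β 𝐇(suc k)))where
  open qw eG 𝐇 ej k cN b4 dW jm ie g6
  open nL k 𝐇 h using (jL; X; nj)
  kU : ∀ γ -> 0' < γ -> γ =< 1' -> ∀ δ -> 0' < δ -> ∃ \ D -> ∃ \ hC -> ∀ n -> hK D γ δ hC n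
  kU γ h7 dI δ fV = AE(kn 1'(S.ε X)(S.0<ε X))(rg(ι jL)(½ * δ)(r6 jI fV))(kn(ι dr)(¼ δ)B1)where
   module S = lg h r fu fv γ h7 dI
   jI : 0' < ½
   jI = da ½
   B1 : 0' < ¼ δ
   B1 = r6 jI(r6 jI fV)
   vq : Set
   vq = ∃ \ D -> ∃ \ hC -> ∀ n -> hK D γ δ hC n
   module _ (oC m kV : ℕ) (Hj : 1' =< ι (suc oC) * S.ε X) (am : ι jL * ½ ^ m =< ½ * δ) (E6 : ι dr =< ι (suc kV) * ¼ δ)(C : ℕ)(jG : pq(suc oC)m(suc kV)<= C)(kQ : r2(suc oC)m(suc kV)<= C)(oq : AB(suc oC)m(suc kV)<= C)(km : 1 <= C)where
    AF :(∃ \ A -> ∀ z n -> n <= C *' suc z ^' B -> 1 <= n -> ι(suc(suc k *' n)^' nj)* ½ ^ z * ι(suc z)=< ι A)-> vq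
    AF(A , ws)= tq(kn(ι h * ι h)(S.ε X)(S.0<ε X))(kn(ι(X *' h))(S.ε X)(S.0<ε X))(kn(ι(dr *' suc r *' A))(¼ δ)B1)where
     tq :(∃ \ R -> ι h * ι h =< ι R * S.ε X)->(∃ \ R -> ι(X *' h)=< ι R * S.ε X)->(∃ \ R -> ι(dr *' suc r *' A)=< ι R * ¼ δ)-> vq
     tq(e0 , wr)(g3 , xC)(tl , DO)= Ch.D , C *' Ch.Z ^' B , Ch.tm where
      module Ch = q7 γ h7 dI δ fV (suc oC) m (suc kV) C A e0 g3 tl (bl bI) Hj am (bl bI) E6 jG kQ oq km ws wr xC DO
   vr : ∀ a b c -> a <= suc(a +'(b +' c))× b <= suc(a +'(b +' c))× c <= suc(a +'(b +' c))
   vr a b c = a6(a3 a(b +' c)), a6(aa(a3 b c)(bg(b +' c)a)), a6(aa(bg c b)(bg(b +' c)a))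
   AE :(∃ \ R -> 1' =< ι R * S.ε X)->(∃ \ m -> ι jL * ½ ^ m =< ½ * δ)->(∃ \ R -> ι dr =< ι R * ¼ δ)-> vq
   AE(oC , ac)(m , am)(kV , E6)= go(pq(suc oC)m(suc kV))(r2(suc oC)m(suc kV))(AB(suc oC)m(suc kV))refl refl refl where
    go : ∀ a b c -> a == pq(suc oC)m(suc kV)-> b == r2(suc oC)m(suc kV)-> c == AB(suc oC)m(suc kV)-> vq
    go a b c ea eb ec = AF oC m kV(eN{1'}{S.ε X}(S.0<ε X)ac(bB oC))am(eN{ι dr}{¼ δ}B1 E6(bB kV))(suc(a +'(b +' c)))(aL(_<= suc(a +'(b +' c)))ea(ai(vr a b c)))(aL(_<= suc(a +'(b +' c)))eb(ai(proj₂(vr a b c))))(aL(_<= suc(a +'(b +' c)))ec(proj₂(proj₂(vr a b c))))(bl bI)(rM(suc k)(suc(a +'(b +' c)))B nj)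
 jr :(d : ℝ)(k : ℕ)-> 1 <= k -> fL((k -' 1)÷ k)<ᴿ d -> ∃ \ γ -> 0' < γ × γ =< 1' × ∃ \ hC -> ∀ n -> hC <= suc n ->(G : a1(suc n))-> sj d G -> γ =< dP.b0(adj G)(c3 G k)k []
 jr d(suc vt)tc(tr , yD , N , CW)= go(kn(ι k)δ fV)where
  k = suc vt
  y = vt ÷ suc vt
  m = tr ⊓ 1'
  -- `tr` is the gap between `d` and `(k - 1) / k`. Half of it is lost in comparing `d` with the
  -- density at precision `tr / 2`; the other half covers `2 δ`. The cap on `m` keeps `δ ≤ 1`.
  δ = ½ *(½ * m)
  jI : 0' < ½
  jI = da ½
  FT : 0' < m
  FT with ⊓-sel tr 1'
  ... | aD eq = aL(0' <_)(aI eq)yD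
  ... | aG eq = aL(0' <_)(aI eq)gW
  fV : 0' < δ
  fV = r6 jI(r6 jI FT)
  AG : ∀ x -> 0' =< x -> ½ * x =< x
  AG x zq = af(aX x zq j1)(ad(aH x))
  AH : δ =< 1'
  AH = af(AG(½ * m)(bO(r6 jI FT)))(af(AG m(bO FT))(p⊓q≤q tr 1'))
  AI : ∀ x -> ½ * x + ½ * x == x
  AI x = ag(a0 ½ x)(ag(au(_* x)vR)(aH x))where
   a0 : ∀ a x -> a * x + a * x ==(1' + 1')* a * x
   a0 = ap ar
  yk : y * ι k == ι k - 1'
  yk = ag(gK vt vt)(ag(a0(ι vt))(au(_- 1')(aI(cV vt))))where
   a0 : ∀ x -> x == 1' + x - 1'
   a0 = ap ar
  go :(∃ \ R -> ι k =< ι R * δ)-> ∃ \ γ -> 0' < γ × γ =< 1' × ∃ \ hC -> ∀ n -> hC <= suc n ->(G : a1(suc n))-> sj d G -> γ =< dP.b0(adj G)(c3 G k)k []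
  go(R , le)= δ ^ k , rt k fV , lZ k(bO fV)AH , suc(suc R), du where
   du : ∀ n -> suc(suc R)<= suc n ->(G : a1(suc n))-> sj d G -> δ ^ k =< dP.b0(adj G)(c3 G k)k []
   du n(bl Gu)G(vG , B2)= oV G k y δ tc yk(bO fV)vG(aa(bl bI)Gu)CX(af le(af(aX δ(bO fV)(bw(fw(aa Gu(ae(aI(hQ(aa(bl bI)Gu))))))))(ad(e9(ι(n -' 1))δ))))where
    vu = ½ * tr
    ev = B2 vu(r6 jI yD)
    j = N ℕ.⊔ ai ev
    CX : y +(δ + δ)=< jS G
    CX = begin y +(δ + δ)≡⟨ au(y +_)(AI(½ * m))⟩ y + ½ * m ≤⟨ bA y(aO ½ eX(p⊓q≤p tr 1'))⟩ y + vu ≡⟨ ag(a0 y vu)(au(\ z -> y + z - vu)(AI tr))⟩ y + tr - vu ≤⟨ bC(- vu)(af(CW j(kD N(ai ev)))(proj₂ ev j(kE N(ai ev))))⟩ jS G + vu - vu ≡⟨ aZ(jS G)vu ⟩ jS G ∎ where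
     open RQ
     a0 : ∀ y e -> y + e == y +(e + e)- e
     a0 = ap ar
     aZ : ∀ y e -> y + e - e == y
     aZ = ap ar
 module _ {r : ℕ} (eG : 2 <= r) (𝐇 : Vec bq r) (ej : ∀ j → 1 <= v (proj₂ (lookup 𝐇 j))) (d : ℝ) (k : ℕ) (tc : 1 <= k) (CW : fL ((k -' 1) ÷ k) <ᴿ d) where
  o1 : 0' < β 𝐇(suc k)-> ∀ q -> q =ω(\ n -> n ^-1/ β 𝐇(suc k))->(G : ∀ n -> a1 n)->(∀ n -> sj d(G n))-> Tendsto(\ n -> ds(G n)(q n)𝐇)1'
  o1 sP q G5 G dense ε 0<ε = go(jr d k tc CW)where
   cN = ℤ.∣ ↥(β 𝐇(suc k))∣
   b4 = ↧ₙ(β 𝐇(suc k))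
   E8 = dV(β 𝐇(suc k))sP
   open qw eG 𝐇 ej k cN b4 (ai E8) (proj₂ E8) (bl bI) (λ As → b9 As ≤? β 𝐇 (suc k)) using (hK)
   vq : Set
   vq = ∃ \ N -> ∀ n -> N <= n -> fL(1' - ε)≤ᴿ ds(G n)(q n)𝐇 × ds(G n)(q n)𝐇 ≤ᴿ fL(1' + ε)
   module _ (γ : ℚ) (hC : ℕ) (cl : ∀ n → hC <= suc n → (G : a1 (suc n)) → sj d G → γ =< dP.b0 (adj G) (c3 G k) k []) where
    AJ :(∃ \ D -> ∃ \ oD -> ∀ n -> hK D γ ε oD n)-> vq
    AJ(D , oD , B0)= suc(hC +'(oD +' xE)), at where
     -- One more than `D`: the spare `y = 1 / Y` absorbs two errors of `y / 2`, from the comparison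
     -- of reals and from the approximant of the root.
     C = ι(suc D)
     xE = ai(G5 C(cO D))
     at : ∀ n -> suc(hC +'(oD +' xE))<= n -> fL(1' - ε)≤ᴿ ds(G n)(q n)𝐇 × ds(G n)(q n)𝐇 ≤ᴿ fL(1' + ε)
     at(suc n)(bl le)= ru(B0 n(a6(aa(aa(a3 oD xE)(bg(oD +' xE)hC))le))(G(suc n))(ai(dense(suc n)))(cl n(a6(aa(a3 hC(oD +' xE))le))(G(suc n))(dense(suc n)))), Bd.yd ε 0<ε where
      module Bd = zY (suc n) (q (suc n)) {P = λ R → (G (suc n) ∪ᴳ R) ⟶ 𝐇} (λ R → (G (suc n) ∪ᴳ R) ⟶? 𝐇)
      x = ai(q(suc n))
      CY = proj₂(G5 C(cO D))(suc n)(a6(aa(aa(bg xE oD)(bg(oD +' xE)hC))le))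
      ru :(∃ \ Y -> 1 <= Y × suc n ^' b4 <= Y ^' cN × ∃ \ c -> c =< 1' × c * ι Y =< ι D ×(∀ p l u -> c =< p -> 1' - ε =< aB(cI p l u(mm(suc n)))(\ S -> ao ⌊(G(suc n)∪ᴳ cP(suc n)S)⟶? 𝐇 ⌋)))-> fL(1' - ε)≤ᴿ ds(G(suc n))(q(suc n))𝐇
      ru(Y , uF , nY , c , rB , cY , B3)= Bd.uu c(1' - ε)rB(tu(f9(ι Y)(k5 uF)))B3 where
       tu :(∃ \ y -> 0' < y × ι Y * y == 1')-> ∃ \ J -> ∀ j -> J <= j -> c =< seq x j
       tu(y , Hk , Yy)= v9 ℕ.⊔ R , du where
        hy = ½ * y
        y7 : 0' < hy
        y7 = r6(da ½)Hk
        v9 = ai(CY hy y7)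
        R = ai(kn C hy y7)
        du : ∀ j -> v9 ℕ.⊔ R <= j -> c =< seq x j
        du j le = begin c ≤⟨ bZ(ι Y)(k5 uF)(af(ad(e9(ι Y)c))(af cY(ad(aI(ag(a0(ι Y)(ι D)y)(ag(au(ι D *_)Yy)(aF(ι D))))))))⟩ ι D * y ≡⟨ ag(ci(ι D)y)(au(\ w -> w * y - y)(aI(cV D)))⟩ C * y - y ≤⟨ bC(- y)(aO C(aY(suc D))E9)⟩ C *(w + u)- y ≡⟨ au(_- y)(tZ C w u)⟩ C * w + C * u - y ≤⟨ bC(- y)(cQ(proj₂(CY hy y7)j(aa(kD v9 R)le))CZ)⟩ seq x j + hy + hy - y ≡⟨ ag(aZ(seq x j)hy y)(au(\ z -> seq x j + z - y)(ag(d1 ½ y)(ag(au(_* y)vR)(aH y))))⟩ seq x j + y - y ≡⟨ m6(seq x j)y ⟩ seq x j ∎ where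
         open RQ
         t = rootNumerator cN b4(suc n)j
         w = t ÷ suc j
         u = 1 ÷ suc j
         a0 : ∀ a b c -> a *(b * c)== b *(a * c)
         a0 = ap ar
         ci : ∀ d y -> d * y ==(1' + d)* y - y
         ci = ap ar
         aZ : ∀ x h y -> x + h + h - y == x +(h + h)- y
         aZ = ap ar
         d1 : ∀ a y -> a * y + a * y ==(1' + 1')* a * y
         d1 = ap ar
         m6 : ∀ x y -> x + y - y == x
         m6 = ap ar
         wu :(w + u)* ι(suc j)== ι(suc t)
         wu = ag(Bn(ι(suc j))w u)(ag(aS _+_(gK t j)(gK 1 j))(ag(Cj(ι t)(ι 1))(aI(o9 1 t))))
         E9 : y =< w + u
         E9 = bZ(ι(suc j))(cO j)(bZ(ι Y)(k5 uF)(begin ι Y *(ι(suc j)* y)≡⟨ ag(a0(ι Y)(ι(suc j))y)(ag(au(ι(suc j)*_)Yy)(aF(ι(suc j))))⟩ ι(suc j)≤⟨ bw(te cN b4(suc n)Y(proj₂ E8)uF nY j)⟩ ι(suc t *' Y)≡⟨ ag(cW(suc t)Y)(e9(ι(suc t))(ι Y))⟩ ι Y * ι(suc t)≡⟨ au(ι Y *_)(ag(aI wu)(e9(w + u)(ι(suc j))))⟩ ι Y *(ι(suc j)*(w + u))∎))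
         CZ : C * u =< hy
         CZ = bZ(ι(suc j))(cO j)(af(ad(ag(a0(ι(suc j))C u)(ag(au(C *_)(ag(e9(ι(suc j))u)(ag(gK 1 j)jZ)))(aF C))))(eN{C}{hy}y7(proj₂(kn C hy y7))(a6(aa(kE v9 R)le))))
   go :(∃ \ γ -> 0' < γ × γ =< 1' × ∃ \ hC -> ∀ n -> hC <= suc n ->(G : a1(suc n))-> sj d G -> γ =< dP.b0(adj G)(c3 G k)k [])-> vq
   go(γ , h7 , dI , hC , cl)= AJ γ hC cl(kU eG 𝐇 ej k cN b4(ai E8)(proj₂ E8)(bl bI)(\ As -> b9 As ≤? β 𝐇(suc k))γ h7 dI ε 0<ε)

-- The case `β = 0`.

module Hl where
 open M24 using (⊥)
 open M6 using (zero;suc)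
 open M11 using (∈⊤;∣p∣≡n⇒p≡⊤;∉⊥;∣⊤∣≡n)
 open M7 using ([];_∷_;replicate)
 open M16 using (_∈_)
 open M10 using ([];_∷_)
 open M25 using (++⁺)
 open M0 using (ℕ;zero;suc)
 open M1 using (∃;_×_)
 open M2 hiding (_÷_;∣_∣;floor;truncate)
 open M3
 open M8 using ([];_∷_;lookup;tabulate)
 open M4 hiding (J;[_])
 open M15 using (toWitness)
 open M5
 open P1
 open P2
 open P3
 open P4
 open P7 using (bN)
 open P8
 open P9
 open Ge using (module mi)
 open EG
 open Dx
 open CG
 open ET
 open EX
 open Gq
 open EY
 open E4
 open G4
 tv :{A : Set}(xs : List A)-> ah xs == 0 -> xs == []
 tv [] _ = refl
 module _ {r : ℕ} (eG : 2 <= r) (𝐇 : Vec bq r) (ej : ∀ j → 1 <= v (proj₂ (lookup 𝐇 j))) (k : ℕ) (xF : β 𝐇 (suc k) == 0')(γ : ℚ)(h7 : 0' < γ)(dI : γ =< 1')where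
  private
   h = Vec.sum(Vec.map ai 𝐇)
   fu = sg eG 𝐇 ej
   dQ = eB 𝐇
   fv : 1 <= r
   fv = bW eG
   module S = lg h r fu fv γ h7 dI
   module Cn = nL k 𝐇 h
   E = 1 *' h !
   ic : 1 <= E
   ic = aC(bl(bI{0}))(oU h)
  -- The same embedding with `B = 0`. The density test then accepts only edgeless graphs, and every
  -- tuple of value at most 0 is degenerate, so all copies can be found among the preliminary ones.
  module AK (aN m e0 g3 : ℕ) (jJ : 1' =< ι aN * S.ε Cn.X) (Gv : ι Cn.jL * ½ ^ m =< ½) (wr : ι h * ι h =< ι e0 * S.ε Cn.X) (xC : ι (Cn.X *' h) =< ι g3 * S.ε Cn.X)(n : ℕ)(ww : e0 +' g3 <= suc n)(G : a1(suc n))(vG : v G == suc n)(kk : γ =< dP.b0(adj G)(c3 G k)k [])where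
   module Co = kO (suc n)
   ir : h4
   ir = record{ n = n;k = k;aR = adj G;de = c3 G k;N = mm(suc n);dN = Co.dN;br = Co.br;p = 1';b3 = ca;cU = bR;P = 1 ;pP = ag(aH(ι 1))jZ }
   fE : ∀{s}-> a1 s -> bH
   fE{s}J = ⌊ mP{r}0 E(s , J)⌋
   module A = wn ir fv 𝐇 ej h fu dQ m aN γ h7 dI (λ {s} → fE {s})
   open vb ir
   open vc {h} {m} {aN} {r} fu fv γ h7 dI
   open pr ir using (μ; bP)
   js : ∀{s}(J : a1 s)-> T(fE J)-> ba J == []
   js{s}J t = go(ba J)refl where
    ra = toWitness{a? = mP{r}0 E(s , J)}t
    go : ∀ xs -> xs == ba J -> ba J == []
    go [] eq = aI eq
    go(x ∷ xs)eq = aA(ra(⊤ₛ , aC ic(aL(1 <=_)(aI(se(ba J)))(aL(\ es -> 1 <= ah es)eq(bl bI)))))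
   cb : ∀{s}(J : a1 s)-> 1 <= s -> s <= h -> T(fE J)-> A.nM(ba J)
   cb J _ _ t = aD(js J t)
   qy : s5 h m aN -> Set
   qy t = s5.bQ t == []
   mx : ∀ t b f ->(T b -> ba(proj₂(proj₂ t))== [])-> qy(A.vg cb t b f)
   mx(i , j , J)true f g = g _
   mx(i , j , J)false f g = refl
   rN : All qy(A.fm cb)
   rN = lL(go Cn.gI)where
    go : ∀ ts -> All qy(fd(A.vh cb)ts)
    go [] = []
    go(t ∷ ts)= mx t(fE(proj₂(proj₂ t)))_(js(proj₂(proj₂ t)))∷ go ts
    B4 : ∀ q{t}-> qy t -> All qy(replicate q t)
    B4 zero p = []
    B4(suc q)p = p ∷ B4 q p
    lL : ∀{ts}-> All qy ts -> All qy(ce(replicate(r *' h))ts)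
    lL [] = []
    lL(p ∷ ps)= ++⁺(B4(r *' h)p)(lL ps)
   -- An edgeless task asks nothing of the random set, so a chain found in one outcome is also a
   -- chain for the empty set.
   vv : ∀{S x L ts b1}-> All qy ts -> cc S x L ts b1 -> cc tX x L ts b1
   vv [] [] = []
   vv(p ∷ ps)(_∷_{t = t}{α = α}τ hB)= record{ jn = fT.jn τ;DF = fT.DF τ;iz = fT.iz τ;dense = fT.dense τ ;eF = aL(\ es -> T(pr.fa ir es α ⊑ tX{mm(suc n)}))(aI p)(hW(tX{mm(suc n)}))}∷ vv ps hB
   AL : e0 <= suc n × g3 <= suc n
   AL = aa(a3 e0 g3)ww , aa(bg g3 e0)ww
   -- A failure probability below 1 means that some outcome succeeds; its random set is then
   -- discarded by `vv`.
   wy : ∃ \ lG -> cc tX 0 [](A.fm cb)lG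
   wy = C0(th(bN μ(ah(A.fm cb)))ki(qr Cn.X jJ(eN{ι h * ι h}{S.ε Cn.X}(S.0<ε Cn.X)wr(ai AL))(eN{ι(Cn.X *' h)}{S.ε Cn.X}(S.0<ε Cn.X)xC(proj₂ AL))(A.fm cb)0 [](aa(ae(A.eR cb))(a3 Cn.jL _))bI kk))where
    ki : ι(ah(A.fm cb))* ½ ^ m < 1'
    ki = D3(af(ad(au(\ q -> ι q * ½ ^ m)(A.eR cb)))Gv)Fa where
     Fa : ½ < 1'
     Fa = toWitness{a? = ½ <? 1'}_
    C0 :(∃ \ Ss -> ∃(cc(u8 Ss)0 [](A.fm cb)))-> ∃ \ lG -> cc tX 0 [](A.fm cb)lG
    C0(Ss , lG , CM)= lG , vv rN CM
   lS : ∀ x -> x ∈ₛ verts G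
   lS x = aL(x ∈ₛ_)(aI(∣p∣≡n⇒p≡⊤ vG))∈⊤
   gs :(∀ j -> a1(Cn.cf j))-> Vec bq r
   gs As = tabulate(\ j -> Cn.cf j , As j)
   gp : ∀ As ->(∀ j -> As j ∈ nonempty(Cn.H j))-> b9(gs As)=< β 𝐇(suc k)->(∃ \ a4 -> T(fE(As a4))×(∀ j -> j ≢ a4 -> ba(As j)== []))⊎ ⊥
   gp As kM le = aD(qq(nP{r}0 E at(jq{r}0 E(lookup(gs As))cd ic vn)))where
    at : ∀ j -> lookup(gs As)j ==(Cn.cf j , As j)
    at = a9(\ j -> Cn.cf j , As j)
    cd : cx(\ j -> ai(lookup(gs As)j))(\ j -> ba(proj₂(lookup(gs As)j)))0 E
    cd = ms(gs As)eG h(\ j -> aL(\ G -> ai G <= h)(aI(at j))(dQ j))(\ j -> aL(\ G -> 1 <= v(proj₂ G))(aI(at j))(mi.hw k 𝐇(Cn.H j)(kM j)))0' 0 1(ag(bY(ι 1))(aI iA))(af le(ad xF))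
    vn : cx.α cd == 0
    vn = ln(aa(a3(cx.α cd)_)(cx.Dz cd ⊤ₛ(aL(1 <=_)(aI(∣⊤∣≡n _))(aL(\ G -> 1 <= ai G)(aI(at(cx.a4 cd)))(A.kj(cx.a4 cd))))))
    qq : kl{r}0 E(\ j -> Cn.cf j , As j)-> ∃ \ a4 -> T(fE(As a4))×(∀ j -> j ≢ a4 -> ba(As j)== [])
    qq(a4 , ra , eZ)= a4 , bc{a? = mP{r}0 E(Cn.cf a4 , As a4)}ra , \ j ne -> tv(ba(As j))(eZ j ne)
   result : G ⟶ 𝐇
   result = A.xw cb(\ x -> irrefl G{x})kk tX G lS(\ x y t -> t)(\{x}{y}_ t -> aA(∉⊥(fq(Co.dN x y)tX(f1 t))))(proj₂ wy)(\ As -> b9(gs As)=< β 𝐇(suc k))(\ _ -> ⊥)(mi.ke k 𝐇)gp(\ c L x _ _ _ i As _())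
  mQ : ∃ \ hC -> ∀ n -> hC <= suc n ->(G : a1(suc n))-> v G == suc n -> γ =< dP.b0(adj G)(c3 G k)k [] -> G ⟶ 𝐇
  mQ = go(kn 1'(S.ε Cn.X)(S.0<ε Cn.X))(rg(ι Cn.jL)½(da ½))(kn(ι h * ι h)(S.ε Cn.X)(S.0<ε Cn.X))(kn(ι(Cn.X *' h))(S.ε Cn.X)(S.0<ε Cn.X))where
   go :(∃ \ R -> 1' =< ι R * S.ε Cn.X)->(∃ \ m -> ι Cn.jL * ½ ^ m =< ½)->(∃ \ R -> ι h * ι h =< ι R * S.ε Cn.X)->(∃ \ R -> ι(Cn.X *' h)=< ι R * S.ε Cn.X)-> ∃ \ hC -> ∀ n -> hC <= suc n ->(G : a1(suc n))-> v G == suc n -> γ =< dP.b0(adj G)(c3 G k)k [] -> G ⟶ 𝐇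
   go(aN , c)(m , Gv)(e0 , wr)(g3 , xC)= e0 +' g3 , \ n ww G vG kk -> AK.result aN m e0 g3 c Gv wr xC n ww G vG kk
 tw :{r : ℕ}-> 2 <= r ->(𝐇 : Vec bq r)->(∀ j -> 1 <= v(proj₂(lookup 𝐇 j)))->(d : ℝ)(k : ℕ)-> 1 <= k -> fL((k -' 1)÷ k)<ᴿ d -> β 𝐇(suc k)== 0' -> GU 𝐇 d
 tw eG 𝐇 ej d k tc CW xF = go(jr d k tc CW)where
  go :(∃ \ γ -> 0' < γ × γ =< 1' × ∃ \ hC -> ∀ n -> hC <= suc n ->(G : a1(suc n))-> sj d G -> γ =< dP.b0(adj G)(c3 G k)k [])-> GU 𝐇 d
  go(γ , h7 , dI , hC , cl)= AM(mQ eG 𝐇 ej k xF γ h7 dI)where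
   AM :(∃ \ oD -> ∀ n -> oD <= suc n ->(G : a1(suc n))-> v G == suc n -> γ =< dP.b0(adj G)(c3 G k)k [] -> G ⟶ 𝐇)-> GU 𝐇 d
   AM(oD , f)= suc(hC +' oD), at where
    at : ∀ n -> suc(hC +' oD)<= n ->(G : a1 n)-> sj d G -> G ⟶ 𝐇
    at(suc n)(bl le)G dn = f n(a6(aa(bg oD hC)le))G(ai dn)(cl n(a6(aa(a3 hC oD)le))G dn)

-- Critical families of sets that each forbid one colour.

module Z1 where
 open M6 using (zero;suc)
 open M7 using ([];_∷_)
 open M16 using (_∈_)
 open M13 using (here;there)
 open M0 using (ℕ)
 open M1 using (∃;_×_)
 open M8 using (lookup;replicate)
 open M4 hiding (J;[_])
 open M5 using (anyᵛ?)
 ji : Fin 2 -> Fin 2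
 ji zero = suc zero
 ji(suc zero)= zero
 tz : ∀ τ -> ji τ ≢ τ
 tz zero()
 tz(suc zero)()
 -- A hypergraph in which `C` is violated only when all its vertices have the one colour `o2 C`; it
 -- models copies of two kinds of graph, each kind forbidden in its own colour.
 module wz {n : ℕ} {Ed : Set} (o2 : Ed → Fin 2) (_∋_ : Ed → Fin n → Set) (_∋?_ : ∀ C u → o8 (C ∋ u)) where
  ii : Vec(Fin 2)n -> Ed -> Set
  ii c C = ∀ u -> C ∋ u -> lookup c u == o2 C
  rh : ∀ c C -> o8(ii c C)
  rh c C = D5 \ u ->(C ∋? u)→-dec(lookup c u ≟ᶠ o2 C)
  e4 : List Ed -> Set
  e4 Y = ∀ c -> ∃ \ C -> C ∈ Y × ii c C
  my : ∀ Y ->(∃ \ c -> ∀{C}-> C ∈ Y -> ¬ ii c C)⊎ e4 Y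
  my Y with anyᵛ? n(\ c -> ¬?(pG(rh c)Y))
  ... | yes(c , fA)= aD(c , \ p v -> fA(lose p v))
  ... | no uQ = aG \ c -> GS(vP(pG(rh c)Y)(\ q -> uQ(c , q)))
  ez : List Ed -> Ed -> Set
  ez Y D = ∃ \ c -> ∀{C}-> C ∈ Y -> ii c C -> C == D
  -- Greedy deletion: the members of `hA` are already known to be critical, those of `qz` are still
  -- to be tested.
  nT : ∀ hA qz -> e4(hA ++ qz)->(∀{D}-> D ∈ hA -> ez(hA ++ qz)D)-> ∃ \ Y ->(∀{C}-> C ∈ Y -> C ∈ hA ++ qz)× e4 Y ×(∀{D}-> D ∈ Y -> ez Y D)
  nT hA [] u cr = hA , dZ ,(\ c -> let C , p , v = u c in C , iJ p , v), \ p -> let c , f = cr p in c , \ q -> f(dZ q)where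
   iJ : ∀{C}-> C ∈ hA ++ [] -> C ∈ hA
   iJ p with kx hA p
   ... | aD q = q
   ... | aG()
  nT hA(C ∷ qz)u cr with my(hA ++ qz)
  ... | aG j4 = let Y , sub , uY , cY = nT hA qz j4(\ p -> let c , f = cr p in c , \ q -> f(DP q))in Y ,(\ p -> DP(sub p)), uY , cY where
   DP : ∀{D}-> D ∈ hA ++ qz -> D ∈ hA ++(C ∷ qz)
   DP p with kx hA p
   ... | aD q = dZ q
   ... | aG q = c8 hA(there q)
  ... | aD(oC , fA)= let Y , sub , uY , cY = nT(C ∷ hA)qz(\ c -> let D , p , v = u c in D , EL p , v)xf in Y ,(\ p -> Dv(sub p)), uY , cY where
   EL : ∀{D}-> D ∈ hA ++(C ∷ qz)-> D ∈ C ∷(hA ++ qz)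
   EL p with kx hA p
   ... | aD q = there(dZ q)
   ... | aG(here eq)= here eq
   ... | aG(there q)= there(c8 hA q)
   Dv : ∀{D}-> D ∈ C ∷(hA ++ qz)-> D ∈ hA ++(C ∷ qz)
   Dv(here eq)= c8 hA(here eq)
   Dv(there p)with kx hA p
   ... | aD q = dZ q
   ... | aG q = c8 hA(there q)
   xf : ∀{D}-> D ∈ C ∷ hA -> ez(C ∷(hA ++ qz))D
   xf(here refl)= oC , \{(here eq)v -> eq ;(there q)v -> aA(fA q v)}
   xf(there p)= let c , f = cr p in c , \ q -> f(Dv q)
  -- Take the colouring violated by `C` alone and flip the colour of `u`. Some set is violated now;
  -- it must contain `u`, it has the other type, and a second vertex in common with `C` would need
  -- both colours.
  AN : ∀{Y}-> e4 Y ->(∀{D}-> D ∈ Y -> ez Y D)-> ∀{C}-> C ∈ Y -> ∀ u -> C ∋ u -> ∃ \ cB -> cB ∈ Y × o2 cB ≢ o2 C × cB ∋ u ×(∀ w -> C ∋ w -> cB ∋ w -> w == u)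
  AN{Y}un cr{C}mz u Fb = go(un aN)where
   c = ai(cr mz)
   DQ : ∀{D}-> D ∈ Y -> ii c D -> D == C
   DQ = proj₂(cr mz)
   vC : ii c C
   vC = let D , AO , v = un c in aL(ii c)(DQ AO v)v
   aN = c [ u ]≔ ji(o2 C)
   kz : ∀ w -> w ≢ u -> lookup aN w == lookup c w
   kz w ne = D7 ne c(ji(o2 C))
   go :(∃ \ cB -> cB ∈ Y × ii aN cB)-> ∃ \ cB -> cB ∈ Y × o2 cB ≢ o2 C × cB ∋ u ×(∀ w -> C ∋ w -> cB ∋ w -> w == u)
   go(cB , jO , DR)with cB ∋? u
   ... | no Fc = aA(Fc(aL(_∋ u)(aI(DQ jO(\ w Fd -> ag(aI(kz w(\{ refl -> Fc Fd })))(DR w Fd))))Fb))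
   ... | yes Fe = cB , jO , xG , Fe , vw where
    xG : o2 cB ≢ o2 C
    xG eq = tz(o2 C)(ag(aI(FZ u c(ji(o2 C))))(ag(DR u Fe)eq))
    vw : ∀ w -> C ∋ w -> cB ∋ w -> w == u
    vw w p q with w ≟ᶠ u
    ... | yes eq = eq
    ... | no ne = aA(xG(ag(aI(DR w q))(ag(kz w ne)(vC w p))))
  AP : ∀{Y}-> e4 Y ->(∀{C}-> C ∈ Y -> ∃ \ u -> C ∋ u)-> ∀ τ -> ∃ \ C -> C ∈ Y × o2 C == τ
  AP un ne τ = let C , mz , v = un(replicate n τ);u , p = ne mz in C , mz , ag(aI(v u p))(lookup-replicate u τ)

-- The exploration of overlapping copies.

module Za where
 open M6 using (zero;suc)
 open M9 using (∣_∣)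
 open M7 using ([];_∷_)
 open M16 using (_∈_)
 open M10 using ([];_∷_)
 open M12 using ([];_∷_)
 open M13 using (here;there)
 open M0 using (ℕ;zero;suc)
 open M1 using (∃;_×_)
 open M8 using ([];_∷_;lookup)
 open M4 hiding (J;[_])
 open M5 using (subsets)
 open P2 using (aw; iD)
 open P3 using (_⊑_)
 open P4
 open P5 using (fr; aJ)
 private variable
  A : Set
  s : ℕ
 eS :(xs : List A)(m8 : Vec(List A)s)-> ah(fr(xs ∷ m8))== ah xs *' ah(fr m8)
 eS [] m8 = refl
 eS(x ∷ xs)m8 = ag(i7(fd(x ∷_)(fr m8)))(aS _+'_(fK(x ∷_)(fr m8))(eS xs m8))
 fF : List A -> List A -> av s -> Vec(List A)s
 fF U T [] = []
 fF U T(b ∷ O)=(if b then T else U)∷ fF U T O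
 jt : List A -> List A -> A -> Fin s -> av s -> Vec(List A)s
 jt U T x zero(_ ∷ O)=(x ∷ [])∷ fF U T O
 jt U T x(suc ay)(b ∷ O)=(if b then T else U)∷ jt U T x ay O
 i4 : av s -> Vec A s -> List A
 i4 [] [] = []
 i4(true ∷ O)(v ∷ β)= i4 O β
 i4(false ∷ O)(v ∷ β)= v ∷ i4 O β
 pO : Fin s -> av s -> Vec A s -> List A
 pO zero(_ ∷ O)(_ ∷ β)= i4 O β
 pO(suc ay)(true ∷ O)(v ∷ β)= pO ay O β
 pO(suc ay)(false ∷ O)(v ∷ β)= v ∷ pO ay O β
 mR : av s -> ℕ
 mR [] = 0
 mR(true ∷ O)= mR O
 mR(false ∷ O)= suc(mR O)
 eu : Fin s -> av s -> ℕ
 eu zero(_ ∷ O)= mR O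
 eu(suc ay)(true ∷ O)= eu ay O
 eu(suc ay)(false ∷ O)= suc(eu ay O)
 fn :(O : av s)(β : Vec A s)-> ah(i4 O β)== mR O
 fn [] [] = refl
 fn(true ∷ O)(v ∷ β)= fn O β
 fn(false ∷ O)(v ∷ β)= au suc(fn O β)
 gu :(ay : Fin s)(O : av s)(β : Vec A s)-> ah(pO ay O β)== eu ay O
 gu zero(_ ∷ O)(_ ∷ β)= fn O β
 gu(suc ay)(true ∷ O)(v ∷ β)= gu ay O β
 gu(suc ay)(false ∷ O)(v ∷ β)= au suc(gu ay O β)
 ri :(O : av s)-> mR O +' ∣ O ∣ == s
 ri [] = refl
 ri(true ∷ O)= ag(ip(mR O)∣ O ∣)(au suc(ri O))
 ri(false ∷ O)= au suc(ri O)
 rO :(ay : Fin s)(O : av s)-> lookup O ay == false -> suc(eu ay O +' ∣ O ∣)== s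
 rO zero(false ∷ O)refl = au suc(ri O)
 rO(suc ay)(true ∷ O)eq = au suc(ag(ip(eu ay O)∣ O ∣)(rO ay O eq))
 rO(suc ay)(false ∷ O)eq = au suc(rO ay O eq)
 d9 :(U T : List A)(O : av s)-> ah(fr(fF U T O))== ah T ^' ∣ O ∣ *' ah U ^' mR O
 d9 U T [] = refl
 d9 U T(true ∷ O)= ag(eS T(fF U T O))(ag(au(ah T *'_)(d9 U T O))(aI(ew(ah T)(ah T ^' ∣ O ∣)(ah U ^' mR O))))
 d9 U T(false ∷ O)= ag(eS U(fF U T O))(ag(au(ah U *'_)(d9 U T O))(a0(ah U)(ah T ^' ∣ O ∣)(ah U ^' mR O)))where
  a0 : ∀ a b c -> a *'(b *' c)== b *'(a *' c)
  a0 = aU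
 fZ :(U T : List A)(x : A)(ay : Fin s)(O : av s)-> lookup O ay == false -> ah(fr(jt U T x ay O))== ah T ^' ∣ O ∣ *' ah U ^' eu ay O
 fZ U T x zero(false ∷ O)refl = ag(eS(x ∷ [])(fF U T O))(ag(bp _)(d9 U T O))
 fZ U T x(suc ay)(true ∷ O)eq = ag(eS T(jt U T x ay O))(ag(au(ah T *'_)(fZ U T x ay O eq))(aI(ew(ah T)(ah T ^' ∣ O ∣)(ah U ^' eu ay O))))
 fZ U T x(suc ay)(false ∷ O)eq = ag(eS U(jt U T x ay O))(ag(au(ah U *'_)(fZ U T x ay O eq))(a0(ah U)(ah T ^' ∣ O ∣)(ah U ^' eu ay O)))where
  a0 : ∀ a b c -> a *'(b *' c)== b *'(a *' c)
  a0 = aU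
 gv :(U T : List A)(O : av s)(β : Vec A s)->(∀ v -> v ∈ U)->(∀ y -> lookup O y == true -> lookup β y ∈ T)-> ∀ y -> lookup β y ∈ lookup(fF U T O)y
 gv U T(true ∷ O)(v ∷ β)uv f zero = f zero refl
 gv U T(false ∷ O)(v ∷ β)uv f zero = uv v
 gv U T(b ∷ O)(v ∷ β)uv f(suc y)= gv U T O β uv(f ∘ suc)y
 hE :(U T : List A)(x : A)(ay : Fin s)(O : av s)(β : Vec A s)->(∀ v -> v ∈ U)-> lookup β ay == x ->(∀ y -> lookup O y == true -> lookup β y ∈ T)-> ∀ y -> lookup β y ∈ lookup(jt U T x ay O)y
 hE U T x zero(b ∷ O)(v ∷ β)uv eq f zero = here eq
 hE U T x zero(b ∷ O)(v ∷ β)uv eq f(suc y)= gv U T O β uv(f ∘ suc)y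
 hE U T x(suc ay)(true ∷ O)(v ∷ β)uv eq f zero = f zero refl
 hE U T x(suc ay)(false ∷ O)(v ∷ β)uv eq f zero = uv v
 hE U T x(suc ay)(b ∷ O)(v ∷ β)uv eq f(suc y)= hE U T x ay O β uv eq(f ∘ suc)y
 d4 :(O : av s)(β : Vec A s){v : A}-> v ∈ i4 O β -> ∃ \ y -> lookup O y == false × v == lookup β y
 d4 [] []()
 d4(true ∷ O)(v ∷ β)p = let y , a , b = d4 O β p in suc y , a , b
 d4(false ∷ O)(v ∷ β)(here eq)= zero , refl , eq
 d4(false ∷ O)(v ∷ β)(there p)= let y , a , b = d4 O β p in suc y , a , b
 gw :(ay : Fin s)(O : av s)(β : Vec A s){v : A}-> v ∈ pO ay O β -> ∃ \ y -> y ≢ ay × lookup O y == false × v == lookup β y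
 gw zero(_ ∷ O)(_ ∷ β)p = let y , a , b = d4 O β p in suc y ,(\()), a , b
 gw(suc ay)(true ∷ O)(v ∷ β)p = let y , n , a , b = gw ay O β p in suc y ,(\ e -> n(ze e)), a , b
 gw(suc ay)(false ∷ O)(v ∷ β)(here eq)= zero ,(\()), refl , eq
 gw(suc ay)(false ∷ O)(v ∷ β)(there p)= let y , n , a , b = gw ay O β p in suc y ,(\ e -> n(ze e)), a , b
 fo :(O : av s)(β : Vec A s)(y : Fin s)-> lookup O y == false -> lookup β y ∈ i4 O β
 fo(false ∷ O)(v ∷ β)zero eq = here refl
 fo(true ∷ O)(v ∷ β)(suc y)eq = fo O β y eq
 fo(false ∷ O)(v ∷ β)(suc y)eq = there(fo O β y eq)
 fG :(ay : Fin s)(O : av s)(β : Vec A s)(y : Fin s)-> y ≢ ay -> lookup O y == false -> lookup β y ∈ pO ay O β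
 fG zero(b ∷ O)(v ∷ β)zero ne eq = aA(ne refl)
 fG zero(b ∷ O)(v ∷ β)(suc y)ne eq = fo O β y eq
 fG(suc ay)(false ∷ O)(v ∷ β)zero ne eq = here refl
 fG(suc ay)(true ∷ O)(v ∷ β)(suc y)ne eq = fG ay O β y(ne ∘ au suc)eq
 fG(suc ay)(false ∷ O)(v ∷ β)(suc y)ne eq = there(fG ay O β y(ne ∘ au suc)eq)
 ko :{v : A}{β : Vec A s}-> ky(v ∷ β)-> ky β
 ko i x y eq with i(suc x)(suc y)eq
 ... | refl = refl
 fp :(O : av s)(β : Vec A s)-> ky β -> eD(i4 O β)
 fp [] [] i = []
 fp(true ∷ O)(v ∷ β)i = fp O β(ko i)
 fp(false ∷ O)(v ∷ β)i = All.tabulate(\ p eq -> let y , _ , e = d4 O β p in Ei(i zero(suc y)(ag eq e)))∷ fp O β(ko i)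
 hF :(ay : Fin s)(O : av s)(β : Vec A s)-> ky β -> eD(pO ay O β)
 hF zero(_ ∷ O)(_ ∷ β)i = fp O β(ko i)
 hF(suc ay)(true ∷ O)(v ∷ β)i = hF ay O β(ko i)
 hF(suc ay)(false ∷ O)(v ∷ β)i = All.tabulate(\ p eq -> let y , _ , _ , e = gw ay O β p in Ei(i zero(suc y)(ag eq e)))∷ hF ay O β(ko i)
 x8 : 2 <= s -> Fin s -> Fin s
 x8(bl(bl _))zero = suc zero
 x8(bl(bl _))(suc _)= zero
 vx :(h : 2 <= s)(y : Fin s)-> x8 h y ≢ y
 vx(bl(bl _))zero()
 vx(bl(bl _))(suc _)()
 record qA : Set where
  field
   bt : ℕ
   es : cS bt
   wA : cT es
   eT : 2 <= bt
 open qA public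
 module ot {n N : ℕ} (dN : Fin n → Fin n → Fin N)(br : ∀{x y cy cL}-> dN x y == dN cy cL ->(x == cy × y == cL)⊎(x == cL × y == cy))(b2 dO : List qA)where
  open pc dN br public
  V : Set
  V = Fin n
  -- A move of the exploration: a copy `β` of the pattern, attached at position `ay`, that meets the
  -- visited vertices otherwise exactly in the positions `O`.
  rj : Set
  rj = Σ qA \ P -> Fin(bt P)× av(bt P)× Vec V(bt P)
  g8 : ∀{s}-> Fin s -> List(av s)
  g8{s}ay = aw(\ O -> ha(lookup O ay))(subsets s)
  ij : V -> List V ->(P : qA)-> Fin(bt P)-> av(bt P)-> List rj
  ij x T P ay O = fd(\ β -> P , ay , O , β)(fr(jt(ax n)T x ay O))
  rQ : List qA -> V -> List V -> List rj
  rQ 𝒫 x T = ce(\ P -> ce(\ ay -> ce(ij x T P ay)(g8 ay))(ax(bt P)))𝒫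
  -- An edge of the copy that was seen before has to lie inside the overlap; this gives the lower
  -- bound on the number of new edges.
  lT : ∀{s}-> cS s -> av s -> Vec V s -> av N -> bH
  lT [] O β F = true
  lT(e ∷ es)O β F =(lW O e ∨ ha(lookup F(cD β e)))∧ lT es O β F
  qB : av N -> rj -> bH
  qB F(P , ay , O , β)= bn β ∧ lT(es P)O β F
  cw : rj -> av N
  cw(P , ay , O , β)= fa(es P)β
  iO : rj -> List V
  iO(P , ay , O , β)= pO ay O β
  qC : rj -> V
  qC(P , ay , O , β)= lookup β(x8(eT P)ay)
  eh : rj -> bH
  eh(P , ay , O , β)= 1 <=b ∣ O ∣
  Ff : List qA -> V -> List V -> av N ->(rj -> av N -> bH)-> av N -> bH
  Ff 𝒫 x T F k S = iD(\ mv -> qB F mv ∧(cw mv ⊑ S ∧ k mv S))(rQ 𝒫 x T)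
  -- `i5` attaches a copy from `dO` at `u`, and `ho` then attaches a copy from `b2` at each of its
  -- new vertices. The flag records whether a copy of this round met the visited set beyond its
  -- attachment. Then the exploration stops, but only once the queue is empty, because the
  -- `b2`-copies pay for the new vertices of the `dO`-copy. Otherwise the next round starts at a
  -- vertex of the last copy.
  ho : ℕ -> List V -> bH -> List V -> av N -> V -> av N -> bH
  i5 : ℕ -> List V -> av N -> V -> av N -> bH
  ho t [] true T F u S = true
  ho t [] false T F u S = i5 t T F u S
  ho t(x ∷ hB)b T F u S = Ff b2 x T F(\ mv -> ho t hB(b ∨ eh mv)(iO mv ++ T)(F ∪ cw mv)(qC mv))S
  i5 zero T F u S = false
  i5(suc t)T F u S = Ff dO u T F(\ mv -> ho t(iO mv)(eh mv)(iO mv ++ T)(F ∪ cw mv)u)S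
  root :(P : qA)-> Fin(bt P)
  root P = x8(eT P)(x8(eT P)(AQ(eT P)))where
   AQ : ∀{s}-> 2 <= s -> Fin s
   AQ(bl _)= zero
  rk : List(Σ qA \ P -> Vec V(bt P))
  rk = ce(\ P -> fd(P ,_)(aJ n(bt P)))b2
  gU : av N -> bH
  gU S = iD(\(P , β)-> bn β ∧(fa(es P)β ⊑ S ∧ i5 n(e5 β)(fa(es P)β)(lookup β(root P))S))rk

-- The probability that the exploration closes up.

module Zb where
 open M6 using (zero;suc)
 open M9 using (∣_∣)
 open M11 using (x∈p∪q⁺;x∈p∪q⁻;∣p∣≤n)
 open M7 using ([];_∷_)
 open M16 using (_∈_)
 open M13 using (here;there)
 open M0 using (ℕ;zero;suc)
 open M1 using (_×_)
 open M2 hiding (_÷_;∣_∣;floor;truncate)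
 open M3
 open M8 using ([];_∷_;lookup)
 open M4 hiding (J;[_])
 open M15 using (toWitness)
 open M5 using (subsets)
 open P1
 open P2
 open P3
 open P4
 open P5 using (fr; aJ)
 open CG using (gm)
 open Za
 eU :{A : Set}(xs : List A){f g : A -> ℚ}->(∀{a}-> a ∈ xs -> f a =< g a)-> aM xs f =< aM xs g
 eU [] h = bR
 eU(x ∷ xs)h = cQ(h(here refl))(eU xs(h ∘ there))
 module Fg {n N : ℕ} (dN : Fin n → Fin n → Fin N)(br : ∀{x y cy cL}-> dN x y == dN cy cL ->(x == cy × y == cL)⊎(x == cL × y == cy))(b2 dO : List qA){p : ℚ}(b3 : 0' =< p)(cU : p =< 1')where
  open ot dN br b2 dO
  μ : dx(av N)
  μ = cI p b3 cU N
  w : av N ->(av N -> bH)-> ℚ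
  w F f = aB μ(\ S -> ao(F ⊑ S)* ao(f S))
  kp : ∀ e -> 0' =< p ^ e
  kp e = aQ e b3
  Fh : ∀ F f -> w F f =< p ^ ∣ F ∣
  Fh F f = af(bm μ(\ S -> af(aO(ao(F ⊑ S))(a8(F ⊑ S))(hU(f S)))(ad(aF(ao(F ⊑ S))))))(ad(iV b3 cU F))
  vy : ∀ F -> w F(\ _ -> false)=< 0'
  vy F = af(bm μ(\ S -> ad(fJ(ao(F ⊑ S)))))(ad(bk μ 0'))
  C1 :{A : Set}(F : av N)(xs : List A)(g : A -> av N -> bH)-> w F(\ S -> iD(\ a -> g a S)xs)=< aM xs(\ a -> w F(g a))
  C1 F xs g = af(bm μ(\ S -> af(aO(ao(F ⊑ S))(a8(F ⊑ S))(hG(\ a -> g a S)xs))(ad(aI(fy xs(ao(F ⊑ S))(\ a -> ao(g a S)))))))(ad(gC xs μ(\ a S -> ao(F ⊑ S)* ao(g a S))))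
  yE : ∀(F G S : av N)-> T(F ⊑ S)-> T(G ⊑ S)-> T((F ∪ G)⊑ S)
  yE F G S a b = hH(F ∪ G)S sub where
   sub : ∀{x}-> x Data.Fin.Subset.∈(F ∪ G)-> x Data.Fin.Subset.∈ S
   sub q with x∈p∪q⁻ F G q
   ... | aD r = gE F S a r
   ... | aG r = gE G S b r
  C2 : ∀ F G k -> w F(\ S -> G ⊑ S ∧ k S)=< w(F ∪ G)k
  C2 F G k = bm μ pt where
   pt : ∀ S -> ao(F ⊑ S)* ao(G ⊑ S ∧ k S)=< ao((F ∪ G)⊑ S)* ao(k S)
   pt S = af(ad(aI(cX(F ⊑ S)(G ⊑ S ∧ k S))))(af(dg{F ⊑ S ∧(G ⊑ S ∧ k S)}{((F ∪ G)⊑ S)∧ k S}(\ t -> let a , r = bh{F ⊑ S}t;b , c = bh{G ⊑ S}r in cA{(F ∪ G)⊑ S}(yE F G S a b)c))(ad(cX((F ∪ G)⊑ S)(k S))))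
  qD : ∀{s}(es : cS s)O β F -> T(lT es O β F)-> ∀{e}-> e ∈ es -> T(lW O e ∨ ha(lookup F(cD β e)))
  qD(e ∷ es)O β F t(here refl)= ai(bh{lW O e ∨ ha(lookup F(cD β e))}t)
  qD(e ∷ es)O β F t(there q)= qD es O β F(proj₂(bh{lW O e ∨ ha(lookup F(cD β e))}t))q
  uI : ∀ F mv -> T(qB F mv)->(let P , ay , O , β = mv in(ah(es P)-' ch(es P)O)+' ∣ F ∣ <= ∣ F ∪ cw mv ∣)
  uI F mv@(P , ay , O , β)t = aa(ae(au(_+' ∣ F ∣)zh))(jA(es P)β(ha ∘ lW O)F(F ∪ cw mv)(wA P)(toWitness{a? = ly β}(ai(bh{bn β}t)))(\ q -> x∈p∪q⁺(aD q))(\ q -> x∈p∪q⁺(aG q))iz)where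
   zh : ah(es P)-' ch(es P)O == gX(es P)O
   zh = ag(au(_-' ch(es P)O)(aI(lz(es P)O)))(ℕₚ.m+n∸m≡n(ch(es P)O)(gX(es P)O))
   iz : ∀ e -> e ∈ es P -> T(ha(lW O e))-> cD β e Data.Fin.Subset.∉ F
   iz e xH nt q with lw{lW O e}(qD(es P)O β F(proj₂(bh{bn β}t))xH)
   ... | aD a = gc{lW O e}nt a
   ... | aG b = gc{lookup F(cD β e)}b(ei(gz q))
  weight : List V ->(P : qA)-> Fin(bt P)-> av(bt P)-> ℚ
  weight T P ay O = ι(ah T ^' ∣ O ∣ *' n ^' eu ay O)* p ^(ah(es P)-' ch(es P)O)
  -- Union bound over the moves of one step: `weight` multiplies the number of moves of a given
  -- shape by `p` to the number of their new edges, and `c` bounds the continuation.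
  ou : ∀ 𝒫 x T F k(c :(P : qA)-> Fin(bt P)-> av(bt P)-> ℚ)->(∀ P ay O -> 0' =< c P ay O)->(∀ P ay O β -> P ∈ 𝒫 -> lookup O ay == false -> w(F ∪ cw(P , ay , O , β))(k(P , ay , O , β))=< p ^ ∣ F ∪ cw(P , ay , O , β)∣ * c P ay O)-> ∀ D ->(∀ P ay O -> P ∈ 𝒫 -> lookup O ay == false -> weight T P ay O * c P ay O =< D)-> w F(Ff 𝒫 x T F k)=< p ^ ∣ F ∣ *(aM 𝒫(\ P -> aM(ax(bt P))(\ ay -> ι(ah(g8 ay))))* D)
  ou 𝒫 x T F k c iu hk D hD = begin w F(Ff 𝒫 x T F k)≤⟨ C1 F(rQ 𝒫 x T)g ⟩ aM(rQ 𝒫 x T)(\ mv -> w F(g mv))≡⟨ ag(dB(\ P -> ce(\ ay -> ce(ij x T P ay)(g8 ay))(ax(bt P)))𝒫 me)(bF 𝒫(\ P -> ag(dB(\ ay -> ce(ij x T P ay)(g8 ay))(ax(bt P))me)(bF(ax(bt P))(\ ay -> dB(ij x T P ay)(g8 ay)me))))⟩ aM 𝒫(\ P -> aM(ax(bt P))(\ ay -> aM(g8 ay)(\ O -> aM(ij x T P ay O)(\ mv -> w F(g mv)))))≤⟨ eU 𝒫(\{P}c6 -> cj(ax(bt P))(\ ay -> af(eU(g8 ay)(\{O}DS -> AR P ay O c6(kz ay O DS)))(ad(bL(g8 ay)(p ^ ∣ F ∣ * D)))))⟩ aM 𝒫(\ P -> aM(ax(bt P))(\ ay -> ι(ah(g8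 ay))*(p ^ ∣ F ∣ * D)))≡⟨ ag(bF 𝒫(\ P -> ag(bF(ax(bt P))(\ ay -> e9(ι(ah(g8 ay)))(p ^ ∣ F ∣ * D)))(fy(ax(bt P))(p ^ ∣ F ∣ * D)(\ ay -> ι(ah(g8 ay))))))(fy 𝒫(p ^ ∣ F ∣ * D)(\ P -> aM(ax(bt P))(\ ay -> ι(ah(g8 ay)))))⟩ p ^ ∣ F ∣ * D * aM 𝒫(\ P -> aM(ax(bt P))(\ ay -> ι(ah(g8 ay))))≡⟨ a0(p ^ ∣ F ∣)D(aM 𝒫(\ P -> aM(ax(bt P))(\ ay -> ι(ah(g8 ay)))))⟩ p ^ ∣ F ∣ *(aM 𝒫(\ P -> aM(ax(bt P))(\ ay -> ι(ah(g8 ay))))* D)∎ where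
   open RQ
   a0 : ∀ a b c -> a * b * c == a *(c * b)
   a0 = ap ar
   g : rj -> av N -> bH
   g mv S = qB F mv ∧(cw mv ⊑ S ∧ k mv S)
   me : rj -> ℚ
   me mv = w F(g mv)
   kz : ∀{s}(ay : Fin s)O -> O ∈ g8 ay -> lookup O ay == false
   kz{s}ay O DS with lookup O ay | proj₂(aP(\ O -> ha(lookup O ay))(subsets s)DS)
   ... | false | _ = refl
   wa : ∀ P ay O β -> P ∈ 𝒫 -> lookup O ay == false -> w F(g(P , ay , O , β))=< p ^ ∣ F ∣ *(p ^(ah(es P)-' ch(es P)O)* c P ay O)
   wa P ay O β c6 tA = go(qB F mv)refl where
    mv = P , ay , O , β
    e = ah(es P)-' ch(es P)O
    go : ∀ b -> b == qB F mv -> w F(\ S -> b ∧(cw mv ⊑ S ∧ k mv S))=< p ^ ∣ F ∣ *(p ^ e * c P ay O)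
    go false eq = af(vy F)(a7(kp ∣ F ∣)(a7(kp e)(iu P ay O)))
    go true eq = af(C2 F(cw mv)(k mv))(af(hk P ay O β c6 tA)(af(aX(c P ay O)(iu P ay O)(af(f8 b3 cU(uI F mv(ei(aI eq))))(ad(ag(zl p e ∣ F ∣)(e9(p ^ e)(p ^ ∣ F ∣))))))(ad(hp(p ^ ∣ F ∣)(p ^ e)(c P ay O)))))
   AR : ∀ P ay O -> P ∈ 𝒫 -> lookup O ay == false -> aM(ij x T P ay O)(\ mv -> w F(g mv))=< p ^ ∣ F ∣ * D
   AR P ay O c6 tA = begin aM(ij x T P ay O)(\ mv -> w F(g mv))≡⟨ fM(\ β -> P , ay , O , β)(fr(jt(ax n)T x ay O))me ⟩ aM Fi(\ β -> w F(g(P , ay , O , β)))≤⟨ cj Fi(\ β -> wa P ay O β c6 tA)⟩ aM Fi(\ _ -> p ^ ∣ F ∣ *(p ^ e * c P ay O))≡⟨ bL Fi(p ^ ∣ F ∣ *(p ^ e * c P ay O))⟩ ι(ah Fi)*(p ^ ∣ F ∣ *(p ^ e * c P ay O))≡⟨ au(\ q -> ι q *(p ^ ∣ F ∣ *(p ^ e * c P ay O)))(ag(fZ(ax n)T x ay O tA)(au(\ q -> ah T ^' ∣ O ∣ *' q ^' eu ay O)(cR{n = n}(\ x -> x))))⟩ ι q *(p ^ ∣ F ∣ *(p ^ e * c P ay O))≡⟨ aZ(ι q)(p ^ ∣ F ∣)(p ^ e)(c P ay O)⟩ p ^ ∣ F ∣ *(weight T P ay O * c P ay O)≤⟨ aO(p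 ^ ∣ F ∣)(kp ∣ F ∣)(hD P ay O c6 tA)⟩ p ^ ∣ F ∣ * D ∎ where
    Fi = fr(jt(ax n)T x ay O)
    e = ah(es P)-' ch(es P)O
    q = ah T ^' ∣ O ∣ *' n ^' eu ay O
    aZ : ∀ q f e c -> q *(f *(e * c))== f *(q * e * c)
    aZ = ap ar
  en : List qA -> ℚ
  en 𝒫 = aM 𝒫(\ P -> aM(ax(bt P))(\ ay -> ι(ah(g8 ay))))
  rl : ∀ 𝒫 -> 0' =< en 𝒫
  rl 𝒫 = cZ 𝒫(\ P -> cZ(ax(bt P))(\ ay -> aY(ah(g8 ay))))
  -- `G` is the cost of one `b2`-copy. The `dO`-copy before it offsets one factor `G` per new
  -- vertex, so a round without overlap costs a constant times `θ`, while an overlap contributes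
  -- `ξ`. The start has expected number at most `θ / ξ`, and a single overlap pays for it.
  module Fj (G ξ θ Λ : ℚ) (h : ℕ) (kW : 0' =< G) (ju : 0' =< ξ) (DT : ξ =< 1') (eg : 0' =< θ) (dt : θ =< 1') (nU : 0' =< Λ)(kq : ∀{P}-> P ∈ b2 -> bt P <= h)(kr : ∀{P}-> P ∈ dO -> bt P <= h)(tB : ∀ P ay O -> P ∈ b2 -> lookup O ay == false -> ∣ O ∣ == 0 -> ι(n ^' eu ay O)* p ^(ah(es P)-' ch(es P)O)=< G * θ)(wB : ∀ P ay O -> P ∈ b2 -> lookup O ay == false -> 1 <= ∣ O ∣ -> ι(n ^' eu ay O)* p ^(ah(es P)-' ch(es P)O)=< G * ξ)(vz : ∀ P ay O -> P ∈ dO -> lookup O ay == false -> ∣ O ∣ == 0 -> ι(n ^' eu ay O)* p ^(ah(es P)-' ch(es P)O)* G ^ eu ay O =< θ)(yF : ∀ P ay O -> P ∈ dO -> lookup O ay == false -> 1 <= ∣ O ∣ -> ι(n ^' eu ay O)* p ^(ah(es P)-' ch(es P)O)* G ^ eu ay O =< ξ)(AS : ∀ P -> P ∈ b2 -> ι(n ^' bt P)* p ^ ah(es P)* ξ =< θ)(Ee : en b2 * θ =< 1')(Ef : en dO * θ =< 1')(k2 : en dO * θ * ι(2 ^'(h +' h *' h))=< ½)(wC : ∀ m -> ι h *(en b2 *(1' + ι(suc(m +'(h +' h *' h))^' h))+ 1')^ h + en dO *(ι(suc(m +'(h +' h *' h))^' h)*(en b2 *(1' + ι(suc(m +'(h +'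 h *' h))^' h))+ 1')^ h)=< ½ *(Λ * ι(2 ^' m)))where
   private
    Q A : ℕ -> ℚ
    Q m = ι(suc m ^' h)
    A m = en b2 *(1' + Q m)+ 1'
    wE : ∀ m -> 0' =< Q m
    wE m = aY(suc m ^' h)
    o3 : ∀ m -> 1' =< A m
    o3 m = bK(en b2 *(1' + Q m))(a7(rl b2)(0≤+ ca(wE m)))(Cj(en b2 *(1' + Q m))1')
    mS : ∀ m -> 0' =< A m
    mS m = af ca(o3 m)
    yG : ∀{s}(T : List V)(O : av s)m -> ah T <= m -> s <= h -> ι(ah T ^' ∣ O ∣)=< Q m
    yG T O m le Gw = bw(aa(b7 ∣ O ∣(a6 le))(bX(suc m)(aa(∣p∣≤n O)Gw)))
    tC : ∀ P ay(O : av(bt P))-> lookup O ay == false -> bt P <= h -> eu ay O <= h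
    tC P ay O kz le = aa(aa(a3(eu ay O)∣ O ∣)(bB _))(aa(ae(rO ay O kz))le)
    kX : ∀ P ay O β T -> lookup O ay == false -> bt P <= h -> ah(iO(P , ay , O , β)++ T)<= h +' ah T
    kX P ay O β T kz le = aa(ae(ag(i7(pO ay O β))(au(_+' ah T)(gu ay O β))))(aK(ah T)(tC P ay O kz le))
    jv : ∀ T P ay O -> weight T P ay O == ι(ah T ^' ∣ O ∣)*(ι(n ^' eu ay O)* p ^(ah(es P)-' ch(es P)O))
    jv T P ay O = ag(au(_* p ^(ah(es P)-' ch(es P)O))(cW(ah T ^' ∣ O ∣)(n ^' eu ay O)))(hp(ι(ah T ^' ∣ O ∣))(ι(n ^' eu ay O))(p ^(ah(es P)-' ch(es P)O)))
    yH : ∀{s}(O : av s)->(∣ O ∣ == 0 ×(1 <=b ∣ O ∣)== false)⊎(1 <= ∣ O ∣ ×(1 <=b ∣ O ∣)== true)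
    yH O with ∣ O ∣
    ... | zero = aD(refl , refl)
    ... | suc _ = aG(bl bI , refl)
    ow : ∀ P ay(O : av(bt P))-> 0' =< ι(n ^' eu ay O)* p ^(ah(es P)-' ch(es P)O)
    ow P ay O = a7(aY(n ^' eu ay O))(kp(ah(es P)-' ch(es P)O))
    FU : ∀(T : List V)q -> q == 0 -> ι(ah T ^' q)== 1'
    FU T .0 refl = jZ
   module _ (M t : ℕ) where
    vA : ∀ hB T F u -> ah T +' h *' ah hB <= M -> w F(ho t hB true T F u)=< p ^ ∣ F ∣ *(G * A M)^ ah hB
    vA [] T F u le = af(Fh F(\ _ -> true))(ad(aI(aF(p ^ ∣ F ∣))))
    vA(x ∷ hB)T F u le = af(ou b2 x T F(\ mv -> ho t hB true(iO mv ++ T)(F ∪ cw mv)(qC mv))(\ _ _ _ -> R)(\ _ _ _ -> nd)(\ P ay O β c6 kz -> vA hB(pO ay O β ++ T)(F ∪ fa(es P)β)_(aa(aK(h *' ah hB)(kX P ay O β T kz(kq c6)))(aa(ae(a0 h(ah T)(ah hB)))le)))(G *(1' + Q M)* R)du)(aO(p ^ ∣ F ∣)(kp ∣ F ∣)(af(bK(G * R)(a7 kW nd)(aZ(en b2)G(Q M)R))(ad refl)))where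
     R =(G * A M)^ ah hB
     nd : 0' =< R
     nd = aQ(ah hB)(a7 kW(mS M))
     a0 : ∀ h t r -> h +' t +' h *' r == t +' h *' suc r
     a0 = aU
     aZ : ∀ c g q r -> g *(c *(1' + q)+ 1')* r == c *(g *(1' + q)* r)+ g * r
     aZ = ap ar
     du : ∀ P ay O -> P ∈ b2 -> lookup O ay == false -> weight T P ay O * R =< G *(1' + Q M)* R
     du P ay O c6 kz = aX R nd(af(ad(jv T P ay O))(gp(yH O)))where
      raw = ι(n ^' eu ay O)* p ^(ah(es P)-' ch(es P)O)
      gp :(∣ O ∣ == 0 ×(1 <=b ∣ O ∣)== false)⊎(1 <= ∣ O ∣ ×(1 <=b ∣ O ∣)== true)-> ι(ah T ^' ∣ O ∣)* raw =< G *(1' + Q M)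
      gp(aD(o , _))= af(ad(ag(au(_* raw)(FU T ∣ O ∣ o))(aH raw)))(af(tB P ay O c6 kz o)(aO G kW(af dt(bK(Q M)(wE M)refl))))
      gp(aG(o , _))= af(dS(aY(ah T ^' ∣ O ∣))(yG T O M(aa(a3(ah T)_)le)(kq c6))(ow P ay O)(af(wB P ay O c6 kz o)(aO G kW DT)))(bK G kW(d1 G(Q M)))where
       d1 : ∀ g q -> g *(1' + q)== q *(g * 1')+ g
       d1 = ap ar
    module _ (L : ℚ) (qE : 0' =< L) (kY : ∀ T F u → ah T <= M → w F (i5 t T F u) =< p ^ ∣ F ∣ * (ξ * L)) where
     dR : ℕ -> bH -> ℚ
     dR q true =(G * A M)^ q
     -- Either none of the `q` pending copies overlaps and `ξ * L` is left for later rounds, or a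
     -- first overlap occurs at one of `q` places, contributes `ξ`, and the copies after it are
     -- bounded crudely through `A M`.
     dR q false = G ^ q *(ξ *(L + ι q * A M ^ q))
     hL : ∀ q b -> 0' =< dR q b
     hL q true = aQ q(a7 kW(mS M))
     hL q false = a7(aQ q kW)(a7 ju(0≤+ qE(a7(aY q)(aQ q(mS M)))))
     wF : ∀ hB b T F u -> ah T +' h *' ah hB <= M -> w F(ho t hB b T F u)=< p ^ ∣ F ∣ * dR(ah hB)b
     wF hB true T F u le = vA hB T F u le
     wF [] false T F u le = af(kY T F u(aa(a3(ah T)_)le))(aO(p ^ ∣ F ∣)(kp ∣ F ∣)(ad(aI(ag(aH(ξ *(L + ι 0 * 1')))(au(ξ *_)(ag(au(L +_)(ag(aF(ι 0))iA))(dL L)))))))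
     wF(x ∷ hB)false T F u le = af(ou b2 x T F(\ mv -> ho t hB(eh mv)(iO mv ++ T)(F ∪ cw mv)(qC mv))(\ P ay O -> dR q(1 <=b ∣ O ∣))(\ P ay O -> hL q(1 <=b ∣ O ∣))(\ P ay O β c6 kz -> wF hB(1 <=b ∣ O ∣)(pO ay O β ++ T)(F ∪ fa(es P)β)_(aa(aK(h *' q)(kX P ay O β T kz(kq c6)))(aa(ae(a0 h(ah T)q))le)))(G *(θ * dR q false + Q M *(ξ * dR q true)))du)(aO(p ^ ∣ F ∣)(kp ∣ F ∣)total)where
      q = ah hB
      a = A M
      a0 : ∀ h t r -> h +' t +' h *' r == t +' h *' suc r
      a0 = aU
      du : ∀ P ay O -> P ∈ b2 -> lookup O ay == false -> weight T P ay O * dR q(1 <=b ∣ O ∣)=< G *(θ * dR q false + Q M *(ξ * dR q true))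
      du P ay O c6 kz = gp(yH O)where
       raw = ι(n ^' eu ay O)* p ^(ah(es P)-' ch(es P)O)
       gp :(∣ O ∣ == 0 ×(1 <=b ∣ O ∣)== false)⊎(1 <= ∣ O ∣ ×(1 <=b ∣ O ∣)== true)-> weight T P ay O * dR q(1 <=b ∣ O ∣)=< G *(θ * dR q false + Q M *(ξ * dR q true))
       gp(aD(o , b))= af(ad(aS(\ x b -> x * dR q b)(ag(jv T P ay O)(ag(au(_* raw)(FU T ∣ O ∣ o))(aH raw)))b))(af(aX(dR q false)(hL q false)(tB P ay O c6 kz o))(bK(G *(Q M *(ξ * dR q true)))(a7 kW(a7(wE M)(a7 ju(hL q true))))(ci G θ(dR q false)(Q M *(ξ * dR q true)))))where
        ci : ∀ g t f r -> g *(t * f + r)== g * t * f + g * r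
        ci = ap ar
       gp(aG(o , b))= af(ad(aS(\ x b -> x * dR q b)(jv T P ay O)b))(af(aX(dR q true)(hL q true)(dS(aY(ah T ^' ∣ O ∣))(yG T O M(aa(a3(ah T)_)le)(kq c6))(ow P ay O)(wB P ay O c6 kz o)))(bK(G *(θ * dR q false))(a7 kW(a7 eg(hL q false)))(ci G ξ(θ * dR q false)(Q M)(dR q true))))where
        ci : ∀ g x f q v -> g *(f + q *(x * v))== q *(g * x)* v + g * f
        ci = ap ar
      total : en b2 *(G *(θ * dR q false + Q M *(ξ * dR q true)))=< dR(suc q)false
      total = begin en b2 *(G *(θ * dR q false + Q M *(ξ * dR q true)))≡⟨ au(\ z -> en b2 *(G *(θ * dR q false + Q M *(ξ * z))))(b5 G a q)⟩ en b2 *(G *(θ *(G ^ q *(ξ *(L + ι q * a ^ q)))+ Q M *(ξ *(G ^ q * a ^ q))))≡⟨ iM(en b2)G θ(G ^ q)ξ(L + ι q * a ^ q)(Q M)(a ^ q)⟩ G * G ^ q *(ξ *(en b2 * θ *(L + ι q * a ^ q)+ en b2 * Q M * a ^ q))≤⟨ aO(G * G ^ q)(aQ(suc q)kW)(aO ξ ju(cQ(aX(L + ι q * a ^ q)(0≤+ qE(a7(aY q)li))Ee)(aX(a ^ q)li C3)))⟩ G * G ^ q *(ξ *(1' *(L + ι q * a ^ q)+ a * a ^ q))≤⟨ aO(G * G ^ q)(aQ(suc q)kW)(aO ξ ju(af(bC(a * a ^ q)(af(ad(aH(L + ι q * a ^ q)))(bA L(aO(ι q)(aY q)(af(ad(aI(aH(a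 ^ q))))(aX(a ^ q)li(o3 M)))))))(ad(ag(mX L(ι q)(a * a ^ q))(au(\ z -> L + z *(a * a ^ q))(aI(cV q)))))))⟩ G * G ^ q *(ξ *(L + ι(suc q)*(a * a ^ q)))∎ where
       open RQ
       li : 0' =< a ^ q
       li = aQ q(mS M)
       C3 : en b2 * Q M =< a
       C3 = bK(en b2 + 1')(0≤+(rl b2)ca)(wG(en b2)(Q M))where
        wG : ∀ c q -> c *(1' + q)+ 1' == c * q +(c + 1')
        wG = ap ar
       iM : ∀ c g t gq x l q aq -> c *(g *(t *(gq *(x * l))+ q *(x *(gq * aq))))== g * gq *(x *(c * t * l + c * q * aq))
       iM = ap ar
       mX : ∀ l i x -> l + i * x + x == l +(1' + i)* x
       mX = ap ar
   -- The bound does not depend on the number `t` of rounds left. A round adds at most `h + h * h`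
   -- visited vertices, so the bound grows by `2 ^ (h + h * h)`, which the factor `θ` beats through
   -- `k2`; the polynomial contribution of overlaps is absorbed by `Λ` through `wC`.
   kY : ∀ t m T F u -> ah T <= m -> w F(i5 t T F u)=< p ^ ∣ F ∣ *(ξ *(Λ * ι(2 ^' m)))
   kY zero m T F u le = af(vy F)(a7(kp ∣ F ∣)(a7 ju(a7 nU(aY(2 ^' m)))))
   kY(suc t)m T F u le = af(ou dO u T F(\ mv -> ho t(iO mv)(eh mv)(iO mv ++ T)(F ∪ cw mv)u)(\ P ay O -> me(eu ay O)(1 <=b ∣ O ∣))(\ P ay O -> B5(eu ay O)(1 <=b ∣ O ∣))(\ P ay O β c6 kz -> af(wF M t L qE(\ T F u -> kY t M T F u)(pO ay O β)(1 <=b ∣ O ∣)(pO ay O β ++ T)(F ∪ fa(es P)β)u(aa(fI(aa(kX P ay O β T kz(kr c6))(bJ h le))(az h(aa(ae(gu ay O β))(tC P ay O kz(kr c6)))))(ae(a0 h m))))(ad(au(\ z -> p ^ ∣ F ∪ fa(es P)β ∣ * me z(1 <=b ∣ O ∣))(gu ay O β))))(ξ *(θ *(L + ι h * a ^ h)+ Q M * a ^ h))du)(aO(p ^ ∣ F ∣)(kp ∣ F ∣)total)where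
    M = m +'(h +' h *' h)
    a = A M
    L = Λ * ι(2 ^' M)
    qE : 0' =< L
    qE = a7 nU(aY(2 ^' M))
    me = dR M t L qE(\ T F u -> kY t M T F u)
    B5 = hL M t L qE(\ T F u -> kY t M T F u)
    a0 : ∀ h m -> h +' m +' h *' h == m +'(h +' h *' h)
    a0 = aU
    du : ∀ P ay O -> P ∈ dO -> lookup O ay == false -> weight T P ay O * me(eu ay O)(1 <=b ∣ O ∣)=< ξ *(θ *(L + ι h * a ^ h)+ Q M * a ^ h)
    du P ay O c6 kz = gp(yH O)where
     q = eu ay O
     raw = ι(n ^' eu ay O)* p ^(ah(es P)-' ch(es P)O)
     AT : a ^ q =< a ^ h
     AT = m3(o3 M)(tC P ay O kz(kr c6))
     li : 0' =< a ^ q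
     li = aQ q(mS M)
     xI : 0' =< a ^ h
     xI = aQ h(mS M)
     gp :(∣ O ∣ == 0 ×(1 <=b ∣ O ∣)== false)⊎(1 <= ∣ O ∣ ×(1 <=b ∣ O ∣)== true)-> weight T P ay O * me q(1 <=b ∣ O ∣)=< ξ *(θ *(L + ι h * a ^ h)+ Q M * a ^ h)
     gp(aD(o , b))= begin weight T P ay O * me q(1 <=b ∣ O ∣)≡⟨ aS(\ x b -> x * me q b)(ag(jv T P ay O)(ag(au(_* raw)(FU T ∣ O ∣ o))(aH raw)))b ⟩ raw *(G ^ q *(ξ *(L + ι q * a ^ q)))≡⟨ iM raw(G ^ q)(ξ *(L + ι q * a ^ q))⟩ raw * G ^ q *(ξ *(L + ι q * a ^ q))≤⟨ dS(a7(ow P ay O)(aQ q kW))(vz P ay O c6 kz o)(a7 ju(0≤+ qE(a7(aY q)li)))(aO ξ ju(bA L(dS(aY q)(bw(tC P ay O kz(kr c6)))li AT)))⟩ θ *(ξ *(L + ι h * a ^ h))≤⟨ bK(ξ *(Q M * a ^ h))(a7 ju(a7(wE M)xI))(mX ξ θ(L + ι h * a ^ h)(Q M * a ^ h))⟩ ξ *(θ *(L + ι h * a ^ h)+ Q M * a ^ h)∎ where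
      open RQ
      iM : ∀ r g x -> r *(g * x)== r * g * x
      iM = ap ar
      mX : ∀ x t l r -> x *(t * l + r)== t *(x * l)+ x * r
      mX = ap ar
     gp(aG(o , b))= begin weight T P ay O * me q(1 <=b ∣ O ∣)≡⟨ aS(\ x b -> x * me q b)(jv T P ay O)b ⟩ ι(ah T ^' ∣ O ∣)* raw *(G * a)^ q ≡⟨ ag(au(ι(ah T ^' ∣ O ∣)* raw *_)(b5 G a q))(iM(ι(ah T ^' ∣ O ∣))raw(G ^ q)(a ^ q))⟩ ι(ah T ^' ∣ O ∣)*(raw * G ^ q * a ^ q)≤⟨ dS(aY(ah T ^' ∣ O ∣))(yG T O M(aa le(a3 m _))(kr c6))(a7(a7(ow P ay O)(aQ q kW))li)(dS(a7(ow P ay O)(aQ q kW))(yF P ay O c6 kz o)li AT)⟩ Q M *(ξ * a ^ h)≤⟨ bK(ξ *(θ *(L + ι h * a ^ h)))(a7 ju(a7 eg(0≤+ qE(a7(aY h)xI))))(mX ξ(θ *(L + ι h * a ^ h))(Q M)(a ^ h))⟩ ξ *(θ *(L + ι h * a ^ h)+ Q M * a ^ h)∎ where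
      open RQ
      iM : ∀ t r g x -> t * r *(g * x)== t *(r * g * x)
      iM = ap ar
      mX : ∀ x l q r -> x *(l + q * r)== q *(x * r)+ x * l
      mX = ap ar
    total : en dO *(ξ *(θ *(L + ι h * a ^ h)+ Q M * a ^ h))=< ξ *(Λ * ι(2 ^' m))
    total = begin en dO *(ξ *(θ *(L + ι h * a ^ h)+ Q M * a ^ h))≡⟨ iM(en dO)ξ θ L(ι h * a ^ h)(Q M * a ^ h)⟩ ξ *(en dO * θ * L +(en dO * θ *(ι h * a ^ h)+ en dO *(Q M * a ^ h)))≤⟨ aO ξ ju(cQ oN(af(bC(en dO *(Q M * a ^ h))(af(aX(ι h * a ^ h)(a7(aY h)(aQ h(mS M)))Ef)(ad(aH(ι h * a ^ h)))))(wC m)))⟩ ξ *(½ *(Λ * ι(2 ^' m))+ ½ *(Λ * ι(2 ^' m)))≡⟨ au(ξ *_)(ag(mX ½(Λ * ι(2 ^' m)))(ag(au(_*(Λ * ι(2 ^' m)))vR)(aH(Λ * ι(2 ^' m)))))⟩ ξ *(Λ * ι(2 ^' m))∎ where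
     open RQ
     iM : ∀ c x t l a b -> c *(x *(t *(l + a)+ b))== x *(c * t * l +(c * t * a + c * b))
     iM = ap ar
     mX : ∀ a x -> a * x + a * x ==(1' + 1')* a * x
     mX = ap ar
     oN : en dO * θ * L =< ½ *(Λ * ι(2 ^' m))
     oN = af(ad(ag(au(\ z -> en dO * θ *(Λ * z))(ag(au ι(gR 2 m(h +' h *' h)))(cW(2 ^' m)(2 ^'(h +' h *' h)))))(wG(en dO * θ)Λ(ι(2 ^' m))(ι(2 ^'(h +' h *' h))))))(aX(Λ * ι(2 ^' m))(a7 nU(aY(2 ^' m)))k2)where
      wG : ∀ c l m h -> c *(l *(m * h))== c * h *(l * m)
      wG = ap ar
   qF : aB μ(ao ∘ gU)=< ι(ah b2)*(θ *(Λ * ι(2 ^' h)))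
   qF = begin aB μ(ao ∘ gU)≤⟨ bm μ(\ S -> hG(\ a -> g a S)rk)⟩ aB μ(\ S -> aM rk(\ a -> ao(g a S)))≡⟨ gC rk μ(\ a S -> ao(g a S))⟩ aM rk(\ a -> aB μ(\ S -> ao(g a S)))≡⟨ dB(\ P -> fd(lU P)(aJ n(bt P)))b2 me ⟩ aM b2(\ P -> aM(fd(lU P)(aJ n(bt P)))me)≤⟨ eU b2 AR ⟩ aM b2(\ _ -> D)≡⟨ bL b2 D ⟩ ι(ah b2)* D ∎ where
    open RQ
    D = θ *(Λ * ι(2 ^' h))
    R = Λ * ι(2 ^' h)
    nd : 0' =< R
    nd = a7 nU(aY(2 ^' h))
    g :(Σ qA \ P -> Vec V(bt P))-> av N -> bH
    g(P , β)S = bn β ∧(fa(es P)β ⊑ S ∧ i5 n(e5 β)(fa(es P)β)(lookup β(root P))S)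
    lU :(P : qA)-> Vec V(bt P)-> Σ qA(\ P -> Vec V(bt P))
    lU P β = P , β
    me :(Σ qA \ P -> Vec V(bt P))-> ℚ
    me a = aB μ(\ S -> ao(g a S))
    wa : ∀ P -> P ∈ b2 -> ∀ β -> aB μ(\ S -> ao(g(P , β)S))=< p ^ ah(es P)*(ξ * R)
    wa P c6 β = go(bn β)refl where
     k : av N -> bH
     k = i5 n(e5 β)(fa(es P)β)(lookup β(root P))
     go : ∀ b -> b == bn β -> aB μ(\ S -> ao(b ∧(fa(es P)β ⊑ S ∧ k S)))=< p ^ ah(es P)*(ξ * R)
     go false eq = af(ad(bk μ 0'))(a7(kp(ah(es P)))(a7 ju nd))
     go true eq = af(ad(bf μ(\ S -> cX(fa(es P)β ⊑ S)(k S))))(af(kY n h(e5 β)(fa(es P)β)(lookup β(root P))(aa(ae(n9 β))(kq c6)))(aX(ξ * R)(a7 ju nd)(f8 b3 cU(jB(es P)β(wA P)(toWitness{a? = ly β}(ei(aI eq)))))))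
    AR : ∀{P}-> P ∈ b2 -> aM(fd(lU P)(aJ n(bt P)))me =< D
    AR{P}c6 = begin aM(fd(lU P)(aJ n(bt P)))me ≡⟨ fM(lU P)(aJ n(bt P))me ⟩ aM(aJ n(bt P))(\ β -> aB μ(\ S -> ao(g(P , β)S)))≤⟨ cj(aJ n(bt P))(wa P c6)⟩ aM(aJ n(bt P))(\ _ -> p ^ ah(es P)*(ξ * R))≡⟨ bL(aJ n(bt P))(p ^ ah(es P)*(ξ * R))⟩ ι(ah(aJ n(bt P)))*(p ^ ah(es P)*(ξ * R))≡⟨ ag(au(_*(p ^ ah(es P)*(ξ * R)))(ag(gm n(bt P))(aI(mU n(bt P)))))(iM(ι(n ^' bt P))(p ^ ah(es P))ξ R)⟩ ι(n ^' bt P)* p ^ ah(es P)* ξ * R ≤⟨ aX R nd(AS P c6)⟩ θ * R ∎ where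
     iM : ∀ a b c d -> a *(b *(c * d))== a * b * c * d
     iM = ap ar

-- Extremal sub-patterns.

module Zd where
 open M6 using (zero;suc)
 open M9 using (∣_∣)
 open M7 using ([];_∷_)
 open M16 using (_∈_)
 open M10 using ([];_∷_)
 open M12 using ([];_∷_)
 open M13 using (here;there)
 open M0 using (ℕ;zero;suc)
 open M1 using (∃;_×_)
 open M2 using (ℚ)
 open M8 using ([];_∷_;lookup)
 open M4 hiding (J;[_])
 open M15 using (toWitness)
 open M5 using (subsets;_∈ˡ?_)
 open P1
 open P2 using (aw)
 open P4
 open P9 using (hI)
 open BG using (qY)
 private variable
  s : ℕ
 dX :{A : Set}{xs : List A}(zs : List A)-> eD xs ->(∀{x}-> x ∈ xs -> x ∈ zs)-> ah xs <= ah zs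
 dX{xs = []}zs u f = bI
 dX{xs = x ∷ xs}zs(px ∷ u)f with ∈-∃++(f(here refl))
 ... | as , bs , refl = aa(bl(dX(as ++ bs)u sub))(ae(ag(au suc(i7 as))(ag(aI(ip(ah as)(ah bs)))(aI(i7 as)))))where
  sub : ∀{y}-> y ∈ xs -> y ∈ as ++ bs
  sub p with kx as(f(there p))
  ... | aD q = dZ q
  ... | aG(here refl)= aA(All.lookup px p refl)
  ... | aG(there q)= c8 as q
 -- Enumerated in increasing order, so that edges keep their smaller end first.
 jP :(U : av s)-> Vec(Fin s)∣ U ∣
 jP [] = []
 jP(true ∷ U)= zero ∷ Vec.map suc(jP U)
 jP(false ∷ U)= Vec.map suc(jP U)
 hN :(U : av s)(a b : Fin ∣ U ∣)-> a Fin.< b -> lookup(jP U)a Fin.< lookup(jP U)b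
 hN(true ∷ U)zero(suc b)lt = aL(\ z -> 1 <= Fin.toℕ z)(aI(bv b suc(jP U)))(bl bI)
 hN(true ∷ U)(suc a)(suc b)(bl lt)= lp Fin._<_(aI(bv a suc(jP U)))(aI(bv b suc(jP U)))(bl(hN U a b lt))
 hN(false ∷ U)a b lt = lp Fin._<_(aI(bv a suc(jP U)))(aI(bv b suc(jP U)))(bl(hN U a b lt))
 o4 :(U : av s)(a b : Fin ∣ U ∣)-> lookup(jP U)a Fin.< lookup(jP U)b -> a Fin.< b
 o4 U a b lt with vN(Fin.toℕ a)(Fin.toℕ b)
 ... | tri< p _ _ = p
 ... | tri≈ _ q _ = aA(aV(au(\ z -> Fin.toℕ(lookup(jP U)z))(Data.Fin.Properties.toℕ-injective q))lt)where
     import Data.Fin.Properties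
 ... | tri> _ _ g = aA(oE lt(hN U b a g))
 qG :(U : av s)-> ky(jP U)
 qG U a b eq with vN(Fin.toℕ a)(Fin.toℕ b)
 ... | tri< p _ _ = aA(aV(au Fin.toℕ eq)(hN U a b p))
 ... | tri≈ _ q _ = Data.Fin.Properties.toℕ-injective q where
     import Data.Fin.Properties
 ... | tri> _ _ g = aA(aV(au Fin.toℕ(aI eq))(hN U b a g))
 iP :(U : av s)(x : Fin s)-> T(lookup U x)-> ∃ \ a -> lookup(jP U)a == x
 iP(true ∷ U)zero t = zero , refl
 iP(true ∷ U)(suc x)t = let a , eq = iP U x t in suc a , ag(bv a suc(jP U))(au suc eq)
 iP(false ∷ U)(suc x)t = let a , eq = iP U x t in a , ag(bv a suc(jP U))(au suc eq)
 cw :(U : av s)-> av ∣ U ∣ -> av s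
 cw [] [] = []
 cw(true ∷ U)(b ∷ W)= b ∷ cw U W
 cw(false ∷ U)W = false ∷ cw U W
 eV :(U : av s)(W : av ∣ U ∣)-> ∣ cw U W ∣ == ∣ W ∣
 eV [] [] = refl
 eV(true ∷ U)(true ∷ W)= au suc(eV U W)
 eV(true ∷ U)(false ∷ W)= eV U W
 eV(false ∷ U)W = eV U W
 fH :(U : av s)(W : av ∣ U ∣)(a : Fin ∣ U ∣)-> lookup(cw U W)(lookup(jP U)a)== lookup W a
 fH(true ∷ U)(b ∷ W)zero = refl
 fH(true ∷ U)(b ∷ W)(suc a)= ag(au(lookup(b ∷ cw U W))(bv a suc(jP U)))(fH U W a)
 fH(false ∷ U)W a = ag(au(lookup(false ∷ cw U W))(bv a suc(jP U)))(fH U W a)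
 module _ {s : ℕ} (es : cS s) (kJ : cT es) (U : av s) where
  private
   w = jP U
   nV : Fin ∣ U ∣ × Fin ∣ U ∣ -> Fin s × Fin s
   nV(a , b)= lookup w a , lookup w b
   wH : Fin ∣ U ∣ × Fin ∣ U ∣ -> bH
   wH ab = ⌊ nV ab ∈ˡ? es ⌋
   rm = bD(ax ∣ U ∣)(ax ∣ U ∣)
  dJ : cS ∣ U ∣
  dJ = aw wH rm
  kZ : ∀{ab}-> ab ∈ dJ -> nV ab ∈ es
  kZ{ab}p = toWitness{a? = nV ab ∈ˡ? es}(proj₂(aP wH rm p))
  rR : ∀ ab -> nV ab ∈ es -> ab ∈ dJ
  rR(a , b)p = cE wH rm(dM(∈-allFin a)(∈-allFin b))(bc{a? = nV(a , b)∈ˡ? es}p)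
  iQ : cT dJ
  iQ = cF wH(lr(allFin⁺ ∣ U ∣)(allFin⁺ ∣ U ∣)), All.tabulate(\{ab}p -> o4 U(ai ab)(proj₂ ab)(All.lookup(proj₂ kJ)(kZ p)))
  private
   wI : ∀{ab cd}-> nV ab == nV cd -> ab == cd
   wI{a , b}{c , d}eq = aS _,_(qG U a c(au ai eq))(qG U b d(au proj₂ eq))
  mT : ch es U <= ah dJ
  mT = aa(dX(fd nV dJ)(cF(lW U)(ai kJ))sub)(ae(fK nV dJ))where
   sub : ∀{e}-> e ∈ aw(lW U)es -> e ∈ fd nV dJ
   sub{x , y}p = let q , t = aP(lW U)es p;tx , ty = bh{lookup U x}t;a , ea = iP U x tx;b , eb = iP U y ty;eq = aS _,_ ea eb in aL(_∈ fd nV dJ)eq(∈-map⁺ nV dJ(rR(a , b)(aL(_∈ es)(aI eq)q)))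
  qH : ∀ W -> ch dJ W <= ch es(cw U W)
  qH W = aa(ae(aI(fK nV(aw(lW W)dJ))))(dX(aw(lW(cw U W))es)(iE nV(\ _ _ -> wI)(cF(lW W)(ai iQ)))sub)where
   sub : ∀{e}-> e ∈ fd nV(aw(lW W)dJ)-> e ∈ aw(lW(cw U W))es
   sub p = let(a , b), q , eq = ∈-map⁻ nV(aw(lW W)dJ)p;m , t = aP(lW W)dJ q;ta , tb = bh{lookup W a}t in aL(_∈ aw(lW(cw U W))es)(aI eq)(cE(lW(cw U W))es(kZ m)(cA{lookup(cw U W)(lookup w a)}(aL T(aI(fH U W a))ta)(aL T(aI(fH U W b))tb)))
 record qI {s : ℕ} (es : cS s) (A c E : ℕ) : Set where
  field
   ed : ℕ
   d5 : cS ed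
   bQ : cT d5
   k0 : 2 <= ed
   tD : ed <= s
   rS : A *' ed <= c +' E *' ah d5
   ox : ∀ O -> 1 <= ∣ O ∣ -> A *' ed +' E *' ch d5 O <= A *' ∣ O ∣ +' E *' ah d5
   inside : Vec(Fin s)ed
   ks : ky inside
   gx : ∀{a b}->(a , b)∈ d5 ->(lookup inside a , lookup inside b)∈ es
 -- Minimise `A |U| - E e(U)` over the sets with at least two vertices. Minimality is the inequality
 -- `ox` for subsets of that size; single vertices carry no edge, and `c ≤ A` covers them.
 yI :{s : ℕ}(es : cS s)-> cT es ->(∀ U -> ∣ U ∣ <= 1 -> ch es U == 0)->(A c E : ℕ)-> c <= A ->(∃ \ U -> 2 <= ∣ U ∣ × A *' ∣ U ∣ <= c +' E *' ch es U)-> qI es A c E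
 yI{s}es kJ ki A c E wJ(xJ , AU , Fk)= rT(qY f xJ mA)where
  Ec : av s -> bH
  Ec U = ⌊ 2 ℕₚ.≤? ∣ U ∣ ⌋
  mA = aw Ec(subsets s)
  f : av s -> ℚ
  f U = ι(A *' ∣ U ∣)ℚ.- ι(E *' ch es U)
  DU : ∀{U W}-> f U ≤ℚ f W -> A *' ∣ U ∣ +' E *' ch es W <= A *' ∣ W ∣ +' E *' ch es U
  DU{U}{W}le = bS(ℚₚ.≤-trans(ℚₚ.≤-reflexive(ag(o9 _ _)(a0(ι(A *' ∣ U ∣))(ι(E *' ch es U))(ι(E *' ch es W)))))(ℚₚ.≤-trans(ℚₚ.+-monoˡ-≤(ι(E *' ch es U)ℚ.+ ι(E *' ch es W))le)(ℚₚ.≤-reflexive(ag(aZ(ι(A *' ∣ W ∣))(ι(E *' ch es U))(ι(E *' ch es W)))(aI(o9 _ _))))))where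
   a0 : ∀ a b c -> a ℚ.+ c ==(a ℚ.- b)ℚ.+(b ℚ.+ c)
   a0 = ap ar
   aZ : ∀ a b c ->(a ℚ.- c)ℚ.+(b ℚ.+ c)== a ℚ.+ b
   aZ = ap ar
  rT :(∃ \ gy -> gy ∈(xJ ∷ mA)×(∀{W}-> W ∈(xJ ∷ mA)-> f gy ≤ℚ f W))-> qI es A c E
  rT(gy , B6 , uj)= record { ed = ∣ gy ∣;d5 = dJ es kJ gy;bQ = iQ es kJ gy;k0 = tE B6;tD = Data.Fin.Subset.Properties.∣p∣≤n gy ;rS = aa tF(bJ c lq);ox = Fl;inside = jP gy;ks = qG gy;gx = kZ es kJ gy } where
   import Data.Fin.Subset.Properties
   tE : gy ∈(xJ ∷ mA)-> 2 <= ∣ gy ∣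
   tE(here eq)= aL(\ U -> 2 <= ∣ U ∣)(aI eq)AU
   tE(there p)= toWitness{a? = 2 ℕₚ.≤? ∣ gy ∣}(proj₂(aP Ec(subsets s)p))
   lq : E *' ch es gy <= E *' ah(dJ es kJ gy)
   lq = az E(mT es kJ gy)
   tF : A *' ∣ gy ∣ <= c +' E *' ch es gy
   tF = kA(E *' ch es xJ)_ _(aa(DU{gy}{xJ}(uj(here refl)))(aa(aK(E *' ch es gy)Fk)(ae(a0 c(E *' ch es xJ)(E *' ch es gy)))))where
    a0 : ∀ a b c -> a +' b +' c == a +' c +' b
    a0 = aU
   uJ : ∀ W -> 1 <= ∣ W ∣ -> A *' ∣ gy ∣ +' E *' ch es W <= A *' ∣ W ∣ +' E *' ch es gy
   uJ W Fm with 2 ℕₚ.≤? ∣ W ∣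
   ... | yes Fn = DU{gy}{W}(uj(there(cE Ec(subsets s)(hI W)(bc{a? = 2 ℕₚ.≤? ∣ W ∣}Fn))))
   ... | no B7 = aa(ae(ag(au(\ z -> A *' ∣ gy ∣ +' E *' z)(ki W(fw(dY B7))))(ag(au(A *' ∣ gy ∣ +'_)(fx E))(aW _))))(aa tF(aK(E *' ch es gy)(aa wJ(aa(ae(aI(f4 A)))(az A Fm)))))
   Fl : ∀ O -> 1 <= ∣ O ∣ -> A *' ∣ gy ∣ +' E *' ch(dJ es kJ gy)O <= A *' ∣ O ∣ +' E *' ah(dJ es kJ gy)
   Fl O AV = aa(bJ(A *' ∣ gy ∣)(az E(qH es kJ gy O)))(aa(uJ(cw gy O)(aL(1 <=_)(aI(eV gy O))AV))(fI(ae(au(A *'_)(eV gy O)))lq))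

-- A critical family drives the exploration to success.

module Zc where
 open M6 using (zero;suc)
 open M11 using (x∈p∪q⁻)
 open M7 using ([];_∷_)
 open M16 using (_∈_)
 open M10 using ([];_∷_)
 open M12 using ([];_∷_)
 open M13 using (here;there)
 open M22 using (++⁺)
 open M0 using (ℕ;zero;suc)
 open M1 using (∃;_×_)
 open M8 using ([];_∷_;lookup;tabulate)
 open M4 hiding (J;[_])
 open M15 using (toWitness)
 open P2 using (iD)
 open P3 using (_⊑_)
 open P4
 open P5 using (fr; aJ; lB; ey; ∈-concatMap⁺)
 open P9 using (hI)
 open FQ using (ef)
 open Z1
 open Za
 open Zd using (dX)
 mB :{A : Set}(b : A -> bH){xs : List A}{x : A}-> x ∈ xs -> T(b x)-> T(iD b xs)
 mB b{y ∷ xs}(here refl)t = gb t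
 mB b{y ∷ xs}(there p)t = hq{b y}(mB b p t)
 iR :{A : Set}{s : ℕ}(β : Vec A s)(y : Fin s)-> lookup β y ∈ e5 β
 iR(v ∷ β)zero = here refl
 iR(v ∷ β)(suc y)= there(iR β y)
 dA :{A : Set}{s : ℕ}(β : Vec A s){v : A}-> v ∈ e5 β -> ∃ \ y -> lookup β y == v
 dA(v ∷ β)(here eq)= zero , aI eq
 dA(v ∷ β)(there p)= let y , eq = dA β p in suc y , eq
 i6 :{A : Set}{s : ℕ}(β : Vec A s)-> ky β -> eD(e5 β)
 i6 [] i = []
 i6(v ∷ β)i = All.tabulate(\ p eq -> let y , e = dA β p in Ei(i zero(suc y)(ag eq(aI e))))∷ i6 β(ko i)
 module AW {n N : ℕ} (dN : Fin n → Fin n → Fin N)(br : ∀{x y cy cL}-> dN x y == dN cy cL ->(x == cy × y == cL)⊎(x == cL × y == cy))(b2 dO : List qA)(S : av N)where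
  open ot dN br b2 dO
  eC : Fin 2 -> List qA
  eC zero = b2
  eC(suc zero)= dO
  record pB : Set where
   field
    o2 : Fin 2
    kJ : qA
    vB : kJ ∈ eC o2
    at : Vec V(bt kJ)
    hs : ky at
    eF : T(fa(es kJ)at ⊑ S)
  open pB public
  _∋_ : pB -> V -> Set
  C ∋ u = ∃ \ y -> lookup(at C)y == u
  _∋?_ : ∀ C u -> o8(C ∋ u)
  C ∋? u = FI \ y -> lookup(at C)y ≟ᶠ u
  iS : List V -> av N -> Set
  iS W F = ∀ a b -> T(lookup F(dN a b))-> a ∈ W × b ∈ W
  -- All explored edges at `x` stay within `C`, so a copy that meets `C` only in `x` contains no
  -- explored edge at `x`.
  o5 : V -> pB -> av N -> Set
  o5 x C F = ∀ b ->(T(lookup F(dN x b))⊎ T(lookup F(dN b x)))-> C ∋ b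
  kt : ∀ C a b -> T(lookup(fa(es(kJ C))(at C))(dN a b))-> C ∋ a × C ∋ b
  kt C a b t = let p , q = iX(es(kJ C))(at C)a b(fq(dN a b)_(f1 t))in ef(at C)p , ef(at C)q
  hO : ∀(F G : av N)l -> T(lookup(F ∪ G)l)-> T(lookup F l)⊎ T(lookup G l)
  hO F G l t with x∈p∪q⁻ F G(fq l(F ∪ G)(f1 t))
  ... | aD p = aD(ei(gz p))
  ... | aG q = aG(ei(gz q))
  qJ : ∀{s}(es : cS s)O β F ->(∀{e}-> e ∈ es -> T(lW O e ∨ ha(lookup F(cD β e))))-> T(lT es O β F)
  qJ [] O β F f = tt
  qJ(e ∷ es)O β F f = cA{lW O e ∨ ha(lookup F(cD β e))}(f(here refl))(qJ es O β F(f ∘ there))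
  record tG (𝒫 : List qA) (cB : pB) (x : V) (W : List V) (F : av N) : Set where
   field
    mv : rj
    AX : mv ∈ rQ 𝒫 x W
    ok : T(qB F mv)
    xK : T(cw mv ⊑ S)
    tH : cw mv == fa(es(kJ cB))(at cB)
    jX : iS(iO mv ++ W)(F ∪ cw mv)
    xL : eD(iO mv ++ W)
    rU : eD(iO mv)
    mC : ∀{v}-> v ∈ iO mv -> cB ∋ v × ¬(v ∈ W)
    mD : ∀{v}-> cB ∋ v -> v ∈ iO mv ++ W
    vD : cB ∋ qC mv
    nW : eh mv == false -> ¬(qC mv ∈ W)
    tI : eh mv == false -> suc(ah W)<= ah(iO mv ++ W)
  -- The overlap `O` consists of the visited positions other than the attachment. An explored edge
  -- of the copy has both ends visited, hence lies inside `O`, unless it is at `x`; there its other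
  -- end lies in `C`, which the copy meets only in `x`.
  xM : ∀ C cB x W F -> cB ∋ x ->(∀ w -> C ∋ w -> cB ∋ w -> w == x)-> x ∈ W -> iS W F -> eD W -> o5 x C F -> tG(eC(o2 cB))cB x W F
  xM C cB x W F(ay , wK)vw oz mY uW w0 = record { mv = mv;AX = iw;ok = cA{bn β}(bc{a? = ly β}(hs cB))(qJ(es P)O β F iz);xK = eF cB;tH = refl ;jX = jX;xL = ++⁺(hF ay O β(hs cB))uW(\(p , q)-> proj₂(mC p)q);rU = hF ay O β(hs cB);mC = mC;mD = mD;vD = x8(eT P)ay , refl;nW = nW;tI = tI } where
   P = kJ cB
   β = at cB
   vE : Fin(bt P)-> bH
   vE y = ha ⌊ y ≟ᶠ ay ⌋ ∧ ⌊ pG(lookup β y ≟ᶠ_)W ⌋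
   O : av(bt P)
   O = tabulate vE
   mv : rj
   mv = P , ay , O , β
   AY : ∀ y -> lookup O y == vE y
   AY = a9 vE
   AZ : lookup O ay == false
   AZ = ag(AY ay)(go(ay ≟ᶠ ay)refl)where
    go :(d : o8(ay == ay))-> d ==(ay ≟ᶠ ay)-> ha ⌊ ay ≟ᶠ ay ⌋ ∧ ⌊ pG(lookup β ay ≟ᶠ_)W ⌋ == false
    go(yes _)e = au(\ d -> ha ⌊ d ⌋ ∧ ⌊ pG(lookup β ay ≟ᶠ_)W ⌋)(aI e)
    go(no ne)e = aA(ne refl)
   xN : ∀ y -> lookup O y == true -> lookup β y ∈ W
   xN y e = toWitness{a? = pG(lookup β y ≟ᶠ_)W}(proj₂(bh{ha ⌊ y ≟ᶠ ay ⌋}(ei(ag(aI(AY y))e))))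
   vF : ∀ y -> y ≢ ay -> lookup O y == false -> ¬(lookup β y ∈ W)
   vF y ne e q = nr(ag(aI e)(ag(AY y)(f1(cA{ha ⌊ y ≟ᶠ ay ⌋}(lx(\ t -> ne(toWitness{a? = y ≟ᶠ ay}t)))(bc{a? = pG(lookup β y ≟ᶠ_)W}q)))))where
    nr : ¬(false == true)
    nr()
   A0 : ∀ y -> y ≢ ay -> lookup β y ∈ W -> T(lookup O y)
   A0 y ne q = aL T(aI(AY y))(cA{ha ⌊ y ≟ᶠ ay ⌋}(lx(\ t -> ne(toWitness{a? = y ≟ᶠ ay}t)))(bc{a? = pG(lookup β y ≟ᶠ_)W}q))
   iw : mv ∈ rQ(eC(o2 cB))x W
   iw = ∈-concatMap⁺(\ P -> ce(\ ay -> ce(ij x W P ay)(g8 ay))(ax(bt P)))(vB cB)(∈-concatMap⁺(\ ay -> ce(ij x W P ay)(g8 ay))(∈-allFin ay)(∈-concatMap⁺(ij x W P ay)(cE(\ O -> ha(lookup O ay))_(hI O)(aL(T ∘ ha)(aI AZ)tt))(∈-map⁺(\ β -> P , ay , O , β)(fr(jt(ax n)W x ay O))(lB(jt(ax n)W x ay O)β(hE(ax n)W x ay O β ∈-allFin wK xN)))))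
   iz : ∀{e}-> e ∈ es P -> T(lW O e ∨ ha(lookup F(cD β e)))
   iz{a , b}xH with lW O(a , b)in Hm
   ... | true = tt
   ... | false = lx o6 where
    Hn = All.lookup(proj₂(wA P))xH
    C4 : a ≢ b
    C4 eq = aV(au Fin.toℕ eq)Hn
    pC : ∀ y -> y ≢ ay -> C ∋ lookup β y -> y == ay
    pC y ne q = hs cB y ay(ag(vw(lookup β y)q(y , refl))(aI wK))
    o6 : ¬ T(lookup F(cD β(a , b)))
    o6 t with a ≟ᶠ ay | b ≟ᶠ ay
    ... | yes refl | yes refl = C4 refl
    ... | yes refl | no B8 = B8(pC b B8(w0(lookup β b)(aD(aL(\ z -> T(lookup F(dN z(lookup β b))))wK t))))
    ... | no B9 | yes refl = B9(pC a B9(w0(lookup β a)(aG(aL(\ z -> T(lookup F(dN(lookup β a)z)))wK t))))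
    ... | no B9 | no B8 = aL T Hm(cA{lookup O a}(A0 a B9(ai(mY _ _ t)))(A0 b B8(proj₂(mY _ _ t))))
   mC : ∀{v}-> v ∈ pO ay O β -> cB ∋ v × ¬(v ∈ W)
   mC p = let y , ne , e , eq = gw ay O β p in(y , aI eq), \ q -> vF y ne e(aL(_∈ W)eq q)
   mD : ∀{v}-> cB ∋ v -> v ∈ pO ay O β ++ W
   mD(y , refl)with y ≟ᶠ ay
   ... | yes refl = c8(pO ay O β)(aL(_∈ W)(aI wK)oz)
   ... | no ne with lookup O y in e
   ... | true = c8(pO ay O β)(xN y e)
   ... | false = dZ(fG ay O β y ne e)
   jX : iS(pO ay O β ++ W)(F ∪ fa(es P)β)
   jX a b t with hO F(fa(es P)β)(dN a b)t
   ... | aD p = let q , r = mY a b p in c8(pO ay O β)q , c8(pO ay O β)r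
   ... | aG p = let q , r = kt cB a b p in mD q , mD r
   fA : eh mv == false -> ∀ y -> lookup O y == false
   fA ov y with lookup O y in e
   ... | false = refl
   ... | true = aA(aL T ov(f5(gf O y(ei e))))
   nW : eh mv == false -> ¬(qC mv ∈ W)
   nW ov = vF(x8(eT P)ay)(vx(eT P)ay)(fA ov(x8(eT P)ay))
   tI : eh mv == false -> suc(ah W)<= ah(pO ay O β ++ W)
   tI ov = aa(aK(ah W)(nonempty(fG ay O β(x8(eT P)ay)(vx(eT P)ay)(fA ov(x8(eT P)ay)))))(ae(aI(i7(pO ay O β))))where
    nonempty : ∀{A : Set}{v : A}{xs}-> v ∈ xs -> 1 <= ah xs
    nonempty(here _)= bl bI
    nonempty(there _)= bl bI
  module _ (Y : List pB) (Fo : ∀ {C} → C ∈ Y → ∀ u → C ∋ u → ∃ λ cB → cB ∈ Y × o2 cB ≢ o2 C × cB ∋ u × (∀ w → C ∋ w → cB ∋ w → w == u)) where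
   tJ : ∀{τ wL : Fin 2}-> wL ≢ τ -> τ == zero -> wL == suc zero
   tJ{τ}{zero}ne eq = aA(ne(aI eq))
   tJ{τ}{suc zero}ne eq = refl
   nX : ∀{τ wL : Fin 2}-> wL ≢ τ -> τ == suc zero -> wL == zero
   nX{τ}{zero}ne eq = refl
   nX{τ}{suc zero}ne eq = aA(ne(aI eq))
   wM : V -> List V -> av N -> Set
   wM u W F = ∃ \ C -> C ∈ Y × o2 C == zero × C ∋ u × u ∈ W × o5 u C F
   -- As long as nothing overlaps, the visited list gains vertices with each copy while staying free
   -- of repetitions, so `n < ah W + t` persists. When the rounds are used up, `W` would have more
   -- than `n` distinct vertices.
   qK : ∀ t hB b W F u cB -> cB ∈ Y -> o2 cB == suc zero ->(∀{x}-> x ∈ hB -> cB ∋ x × x ∈ W × o5 x cB F)-> eD hB -> iS W F -> eD W ->(b == false -> n <' ah W +' t)->(b == false -> hB == [] -> wM u W F)-> T(ho t hB b W F u S)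
   sh : ∀ t W F u -> wM u W F -> iS W F -> eD W -> n <' ah W +' t -> T(i5 t W F u S)
   qK t [] true W F u cB jO tg vH Gx mY uW wN yJ = tt
   qK t [] false W F u cB jO tg vH Gx mY uW wN yJ = sh t W F u(yJ refl refl)mY uW(wN refl)
   qK t(x ∷ hB)b W F u cB jO tg vH(Gy ∷ Gx)mY uW wN yJ = step(Fo jO x(ai(vH(here refl))))where
    step :(∃ \ ro -> ro ∈ Y × o2 ro ≢ o2 cB × ro ∋ x ×(∀ w -> cB ∋ w -> ro ∋ w -> w == x))-> T(ho t(x ∷ hB)b W F u S)
    step(ro , Ca , A1 , A2 , vw)= mB _(aL(\ τ -> A.mv ∈ rQ(eC τ)x W)A3 A.AX)(cA{qB F A.mv}A.ok(cA{cw A.mv ⊑ S}A.xK(qK t hB(b ∨ eh A.mv)(iO A.mv ++ W)(F ∪ cw A.mv)(qC A.mv)cB jO tg yK Gx A.jX A.xL qL nZ)))where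
     A3 : o2 ro == zero
     A3 = nX A1 tg
     module A = tG (xM cB ro x W F A2 vw (ai (proj₂ (vH (here refl)))) mY uW (proj₂ (proj₂ (vH (here refl)))))
     ik : ∀ a c -> T(lookup(cw A.mv)(dN a c))-> ro ∋ a × ro ∋ c
     ik a c q = kt ro a c(aL(\ I -> T(lookup I(dN a c)))A.tH q)
     yK : ∀{cy}-> cy ∈ hB -> cB ∋ cy × cy ∈ iO A.mv ++ W × o5 cy cB(F ∪ cw A.mv)
     yK{cy}p = ai Fp , c8(iO A.mv)(ai(proj₂ Fp)), w0 where
      Fp = vH(there p)
      o6 : ro ∋ cy -> ∀{b}-> cB ∋ b
      o6 q = aA(All.lookup Gy p(aI(vw cy(ai Fp)q)))
      w0 : o5 cy cB(F ∪ cw A.mv)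
      w0 c(aD q)with hO F(cw A.mv)(dN cy c)q
      ... | aD r = proj₂(proj₂ Fp)c(aD r)
      ... | aG r = o6(ai(ik cy c r))
      w0 c(aG q)with hO F(cw A.mv)(dN c cy)q
      ... | aD r = proj₂(proj₂ Fp)c(aG r)
      ... | aG r = o6(proj₂(ik c cy r))
     yL : ∀{a c}-> a ∨ c == false -> a == false × c == false
     yL{false}eq = refl , eq
     qL : b ∨ eh A.mv == false -> n <' ah(iO A.mv ++ W)+' t
     qL eq = aa(wN(ai(yL{b}eq)))(aK t(aa(bB(ah W))(A.tI(proj₂(yL{b}eq)))))
     nZ : b ∨ eh A.mv == false -> hB == [] -> wM(qC A.mv)(iO A.mv ++ W)(F ∪ cw A.mv)
     nZ eq _ = ro , Ca , A3 , A.vD , A.mD A.vD , w0 where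
      iz = A.nW(proj₂(yL{b}eq))
      w0 : o5(qC A.mv)ro(F ∪ cw A.mv)
      w0 c(aD q)with hO F(cw A.mv)(dN(qC A.mv)c)q
      ... | aD r = aA(iz(ai(mY _ _ r)))
      ... | aG r = proj₂(ik(qC A.mv)c r)
      w0 c(aG q)with hO F(cw A.mv)(dN c(qC A.mv))q
      ... | aD r = aA(iz(proj₂(mY _ _ r)))
      ... | aG r = ai(ik c(qC A.mv)r)
   sh zero W F u yJ mY uW wN = aA(aV refl(gQ wN(aa(ae(aW(ah W)))(aa(dX(ax n)uW(\{x}_ -> ∈-allFin x))(ae(cR{n = n}(\ x -> x)))))))
   sh(suc t)W F u(C , mz , tg , Fq , Fr , w0)mY uW wN = step(Fo mz u Fq)where
    step :(∃ \ cB -> cB ∈ Y × o2 cB ≢ o2 C × cB ∋ u ×(∀ w -> C ∋ w -> cB ∋ w -> w == u))-> T(i5(suc t)W F u S)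
    step(cB , jO , A1 , A4 , vw)= mB _(aL(\ τ -> A.mv ∈ rQ(eC τ)u W)A5 A.AX)(cA{qB F A.mv}A.ok(cA{cw A.mv ⊑ S}A.xK(qK t(iO A.mv)(eh A.mv)(iO A.mv ++ W)(F ∪ cw A.mv)u cB jO A5 vH A.rU A.jX A.xL qL nZ)))where
     A5 : o2 cB == suc zero
     A5 = tJ A1 tg
     module A = tG (xM C cB u W F A4 vw Fr mY uW w0)
     ik : ∀ a c -> T(lookup(cw A.mv)(dN a c))-> cB ∋ a × cB ∋ c
     ik a c q = kt cB a c(aL(\ I -> T(lookup I(dN a c)))A.tH q)
     vH : ∀{x}-> x ∈ iO A.mv -> cB ∋ x × x ∈ iO A.mv ++ W × o5 x cB(F ∪ cw A.mv)
     vH{x}p = ai(A.mC p), dZ p , xO where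
      iz = proj₂(A.mC p)
      xO : o5 x cB(F ∪ cw A.mv)
      xO c(aD q)with hO F(cw A.mv)(dN x c)q
      ... | aD r = aA(iz(ai(mY _ _ r)))
      ... | aG r = proj₂(ik x c r)
      xO c(aG q)with hO F(cw A.mv)(dN c x)q
      ... | aD r = aA(iz(proj₂(mY _ _ r)))
      ... | aG r = ai(ik c x r)
     qL : eh A.mv == false -> n <' ah(iO A.mv ++ W)+' t
     qL eq = aa wN(aa(ae(ip(ah W)t))(aK t(A.tI eq)))
     nZ : eh A.mv == false -> iO A.mv == [] -> wM u(iO A.mv ++ W)(F ∪ cw A.mv)
     nZ eq Ho = aA(aV refl(aa(A.tI eq)(ae(au(\ xs -> ah(xs ++ W))Ho))))
   wO : ∀ C -> C ∈ Y -> o2 C == zero -> T(gU S)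
   wO C mz tg = mB _(∈-concatMap⁺(\ P -> fd(P ,_)(aJ n(bt P)))(aL(\ τ -> P ∈ eC τ)tg(vB C))(∈-map⁺(P ,_)(aJ n(bt P))(ey β)))(cA{bn β}(bc{a? = ly β}(hs C))(cA{fa(es P)β ⊑ S}(eF C)(sh n(e5 β)(fa(es P)β)(lookup β(root P))(C , mz , tg ,(root P , refl), iR β(root P), w0)mY(i6 β(hs C))(aa(aK n(aa(bl bI)(eT P)))(ae(au(_+' n)(aI(n9 β))))))))where
    P = kJ C
    β = at C
    w0 : o5(lookup β(root P))C(fa(es P)β)
    w0 b(aD q)= proj₂(kt C _ b q)
    w0 b(aG q)= ai(kt C b _ q)
    mY : iS(e5 β)(fa(es P)β)
    mY a b q = let(y , e),(cL , lA)= kt C a b q in aL(_∈ e5 β)e(iR β y), aL(_∈ e5 β)lA(iR β cL)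

-- A two-colouring when the exploration fails.

module Ze where
 open M6 using (zero;suc)
 open M7 using ([];_∷_)
 open M16 using (_∈_)
 open M13 using (here;there)
 open M0 using (ℕ;zero;suc)
 open M1 using (∃;_×_)
 open M8 using ([];_∷_;lookup)
 open M4 hiding (J;[_])
 open P3 using (_⊑_)
 open P4
 open P5 using (aJ; ey; ∈-concatMap⁺)
 open Z1
 open Za
 open Zc
 module xP {n N : ℕ} (dN : Fin n → Fin n → Fin N)(br : ∀{x y cy cL}-> dN x y == dN cy cL ->(x == cy × y == cL)⊎(x == cL × y == cy))(b2 dO : List qA)(S : av N)where
  open ot dN br b2 dO
  open AW dN br b2 dO S
  open wz o2 _∋_ _∋?_
  nx : ∀ τ P -> P ∈ eC τ ->(β : Vec V(bt P))-> o8(ky β)-> o8(T(fa(es P)β ⊑ S))-> List pB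
  nx τ P c6 β(yes i)(yes p)= record{ o2 = τ;kJ = P;vB = c6;at = β;hs = i;eF = p }∷ []
  nx τ P c6 β _ _ = []
  ku : ∀ τ 𝒫 ->(∀ P -> P ∈ 𝒫 -> P ∈ eC τ)-> List pB
  ku τ [] f = []
  ku τ(P ∷ 𝒫)f = ce(\ β -> nx τ P(f P(here refl))β(ly β)(T?(fa(es P)β ⊑ S)))(aJ n(bt P))++ ku τ 𝒫(\ Q q -> f Q(there q))
  mE : pB -> Fin 2 -> ∀{s}-> Vec V s -> Set
  mE C τ β = o2 C == τ ×(∀ u -> C ∋ u -> ∃ \ y -> lookup β y == u)
  il : ∀ τ 𝒫 f{P}-> P ∈ 𝒫 ->(β : Vec V(bt P))-> ky β -> T(fa(es P)β ⊑ S)-> ∃ \ C -> C ∈ ku τ 𝒫 f × mE C τ β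
  il τ(P ∷ 𝒫)f(here refl)β i p = go(ly β)(T?(fa(es P)β ⊑ S))refl refl where
   mk = \ β -> nx τ P(f P(here refl))β(ly β)(T?(fa(es P)β ⊑ S))
   go :(d : o8(ky β))(hP : o8(T(fa(es P)β ⊑ S)))-> d == ly β -> hP == T?(fa(es P)β ⊑ S)-> ∃ \ C -> C ∈ ku τ(P ∷ 𝒫)f × mE C τ β
   go(no Hp)_ _ _ = aA(Hp i)
   go(yes _)(no uQ)_ _ = aA(uQ p)
   go(yes mV)(yes gZ)Gz BZ = C , dZ(∈-concatMap⁺ mk(ey β)(lp(\ d hP -> C ∈ nx τ P(f P(here refl))β d hP)Gz BZ(here refl))), refl , \ u q -> q where
    C : pB
    C = record{ o2 = τ;kJ = P;vB = f P(here refl);at = β;hs = mV;eF = gZ }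
  il τ(P ∷ 𝒫)f(there q)β i p = let C , mz , lL = il τ 𝒫(\ Q q -> f Q(there q))q β i p in C , c8 _ mz , lL
  tK : List pB
  tK = ku zero b2(\ _ p -> p)++ ku(suc zero)dO(\ _ p -> p)
  pD : ∀ τ{P}-> P ∈ eC τ ->(β : Vec V(bt P))-> ky β -> T(fa(es P)β ⊑ S)-> ∃ \ C -> C ∈ tK × mE C τ β
  pD zero c6 β i p = let C , mz , lL = il zero b2(\ _ p -> p)c6 β i p in C , dZ mz , lL
  pD(suc zero)c6 β i p = let C , mz , lL = il(suc zero)dO(\ _ p -> p)c6 β i p in C , c8 _ mz , lL
  -- Applied to the family of all present copies of both kinds: if no colouring avoided them, a
  -- critical subfamily would exist, and the exploration along it would succeed.
  uK : ¬ T(gU S)-> ∃ \(c : Vec(Fin 2)n)-> ∀ τ{P}-> P ∈ eC τ ->(β : Vec V(bt P))-> ky β -> T(fa(es P)β ⊑ S)-> ¬(∀ y -> lookup c(lookup β y)== τ)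
  uK wQ with my tK
  ... | aD(c , fA)= c , \ τ c6 β i p mono -> let C , mz , tg , Hq = pD τ c6 β i p in fA mz(\ u q -> let y , eq = Hq u q in ag(au(lookup c)(aI eq))(ag(mono y)(aI tg)))
  ... | aG Hr = aA(go(nT [] tK Hr(\())))where
   go : ¬(∃ \ Y ->(∀{C}-> C ∈ Y -> C ∈ tK)× e4 Y ×(∀{D}-> D ∈ Y -> ez Y D))
   go(Y , _ , uY , cY)= let C , mz , tg = AP uY(\{C}_ -> lookup(at C)(root(kJ C)), root(kJ C), refl)zero in wQ(wO Y(AN uY cY)C mz tg)

-- Exponent inequalities and constants for the exploration.

module Zf where
 open M6 using (zero;suc)
 open M9 using (∣_∣)
 open M7 using ([];_∷_)
 open M16 using (_∈_)
 open M0 using (ℕ;zero;suc)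
 open M1 using (∃;_×_)
 open M2 hiding (_÷_;∣_∣;floor;truncate)
 open M3
 open M8 using ([];_∷_;lookup)
 open M4 hiding (J;[_])
 open M5 using (subsets)
 open P1
 open P2
 open P3
 open P4
 open E4 using (kn; eN)
 open Za
 open Zb
 jY : ∀{s}(es : cS s)O -> ∣ O ∣ == 0 -> ch es O == 0
 jY [] O eq = refl
 jY((x , y)∷ es)O eq with lookup O x in ex
 ... | false = jY es O eq
 ... | true = aA(aV(aI eq)(gf O x(ei ex)))
 module C5 (z B E : ℕ) (ζ θ p : ℚ) (n : ℕ) (iT : 0' =< ζ) (kv : ζ =< 1') (zi : ι z * ζ == 1') (eg : 0' =< θ) (dt : θ =< 1') (b3 : 0' =< p)(r3 : n <= z ^' B)(vo : p =< θ * ζ ^ E)where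
  -- `n` is at most `z ^ B` and `p` at most `θ ζ ^ E` with `ζ = 1 / z`, so a count `n ^ ν p ^ e`
  -- turns into a power of `ζ` and only a comparison of exponents remains.
  scale : ∀ ν e a b -> B *' ν +' b <= E *' e +' a -> ι(n ^' ν)* p ^ e * ζ ^ a =< θ ^ e * ζ ^ b
  scale ν e a b le = begin ι(n ^' ν)* p ^ e * ζ ^ a ≤⟨ aX(ζ ^ a)(aQ a iT)(dS(aY(n ^' ν))wx(aQ e b3)C6)⟩ ι z ^ x *(θ ^ e * ζ ^(E *' e))* ζ ^ a ≡⟨ ag(iM(ι z ^ x)(θ ^ e)(ζ ^(E *' e))(ζ ^ a))(au(\ q -> θ ^ e *(ι z ^ x * q))(aI(zl ζ(E *' e)a)))⟩ θ ^ e *(ι z ^ x * ζ ^(E *' e +' a))≤⟨ aO(θ ^ e)(aQ e eg)(aO(ι z ^ x)(aQ x(aY z))(f8 iT kv le))⟩ θ ^ e *(ι z ^ x * ζ ^(x +' b))≡⟨ au(\ q -> θ ^ e * q)(ag(au(ι z ^ x *_)(zl ζ x b))(ag(aI(hp(ι z ^ x)(ζ ^ x)(ζ ^ b)))(ag(au(_* ζ ^ b)(ag(aI(b5(ι z)ζ x))(ag(au(_^ x)zi)(1^ x))))(aH(ζ ^ b)))))⟩ θ ^ e * ζ ^ b ∎ where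
   open RQ
   x = B *' ν
   iM : ∀ a t e c -> a *(t * e)* c == t *(a *(e * c))
   iM = ap ar
   wx : ι(n ^' ν)=< ι z ^ x
   wx = af(bw(aa(b7 ν r3)(ae(cz z B ν))))(ad(mU z x))
   C6 : p ^ e =< θ ^ e * ζ ^(E *' e)
   C6 = af(j0 e b3 vo)(ad(ag(b5 θ(ζ ^ E)e)(au(θ ^ e *_)(ag(aI(Cp ζ e E))(au(ζ ^_)(ck e E))))))
  -- With at least one new edge a factor `θ` survives; `vI` is the version without it.
  n1 : ∀ ν e a b -> B *' ν +' b <= E *' e +' a -> 1 <= e -> ι(n ^' ν)* p ^ e * ζ ^ a =< θ * ζ ^ b
  n1 ν e a b le tL = af(scale ν e a b le)(aX(ζ ^ b)(aQ b iT)(af(f8 eg dt tL)(ad(aF θ))))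
  vI : ∀ ν e a b -> B *' ν +' b <= E *' e +' a -> ι(n ^' ν)* p ^ e * ζ ^ a =< ζ ^ b
  vI ν e a b le = af(scale ν e a b le)(af(aX(ζ ^ b)(aQ b iT)(lZ e eg dt))(ad(aH(ζ ^ b))))
 record dK (A c E : ℕ) (P : qA) : Set where
  field
   rS : A *' bt P <= c +' E *' ah(es P)
   ox : ∀ O -> 1 <= ∣ O ∣ -> A *' bt P +' E *' ch(es P)O <= A *' ∣ O ∣ +' E *' ah(es P)
  lV : c <= A -> 1 <= A -> 1 <= ah(es P)
  lV wJ o3 with ah(es P)in eq
  ... | suc _ = bl bI
  ... | zero = aA(aV refl(aa(aa(ae(el 1 A))(bJ A o3))chain))where
   a0 : ∀ A -> A +' A == A *' 2
   a0 = aU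
   chain : A +' A <= A
   chain = aa(ae(a0 A))(aa(az A(eT P))(aa rS(aa(ae(ag(au(\ q -> c +' E *' q)eq)(ag(au(c +'_)(fx E))(aW c))))wJ)))
  tM : ∀ ay O -> lookup O ay == false -> 1 <= ∣ O ∣ -> A *' suc(eu ay O)<= E *'(ah(es P)-' ch(es P)O)
  tM ay O kz AV = aa(ℕₚ.m+n≤o⇒m≤o∸n(A *' suc ν)(rq(A *' ∣ O ∣)_ _(aa(ae(a0 A ∣ O ∣ ν(E *' ch(es P)O)))(aa(ae(au(\ s -> A *' s +' E *' ch(es P)O)(rO ay O kz)))(ox O AV)))))(ae(aI(ℕₚ.*-distribˡ-∸ E(ah(es P))(ch(es P)O))))where
   ν = eu ay O
   a0 : ∀ a o v e -> a *' o +'(a *' suc v +' e)== a *' suc(v +' o)+' e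
   a0 = aU
  tN : ∀ ay O -> lookup O ay == false -> ∣ O ∣ == 0 -> A *' suc(eu ay O)<= c +' E *'(ah(es P)-' ch(es P)O)
  tN ay O kz o = aa(ae(au(A *'_)(ag(au suc(aI(ag(au(eu ay O +'_)o)(aW _))))(rO ay O kz))))(aa rS(ae(au(\ q -> c +' E *'(ah(es P)-' q))(aI(jY(es P)O o)))))
 cC : List qA -> ℚ
 cC 𝒫 = aM 𝒫(\ P -> aM(ax(bt P))(\ ay -> ι(ah(aw(\ O -> ha(lookup O ay))(subsets(bt P))))))
 mF : ∀ 𝒫 -> 0' =< cC 𝒫
 mF 𝒫 = cZ 𝒫(\ P -> cZ(ax(bt P))(\ ay -> aY(ah(aw(\ O -> ha(lookup O ay))(subsets(bt P))))))
 -- The left side is polynomial in `m`, since `A` and `Q` are bounded by powers of `M + 1`; by `l0`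
 -- a multiple of `2 ^ m` dominates it.
 uL : ∀(cJ cK : ℚ)(h : ℕ)-> 0' =< cJ -> 0' =< cK -> ∃ \ Λ -> 0' =< Λ ×(∀ m -> let M = m +'(h +' h *' h);Q = ι(suc M ^' h);A = cJ *(1' + Q)+ 1' in ι h * A ^ h + cK *(Q * A ^ h)=< ½ *(Λ * ι(2 ^' m)))
 uL cJ cK h DV DW = ι(2 *' X), aY(2 *' X), du where
  c = h +' h *' h
  aj = kn cJ 1' gW
  ak = kn cK 1' gW
  j = ai aj
  k = ai ak
  C7 : cJ =< ι j
  C7 = af(proj₂ aj)(ad(aF(ι j)))
  C8 : cK =< ι k
  C8 = af(proj₂ ak)(ad(aF(ι k)))
  pe = l0(h *' suc h)
  oB = ai pe
  D = suc(2 *' j)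
  X =(h +' k)*'(D ^' h *'(oB *' 2 ^' c))
  du : ∀ m -> let M = m +' c;Q = ι(suc M ^' h);A = cJ *(1' + Q)+ 1' in ι h * A ^ h + cK *(Q * A ^ h)=< ½ *(ι(2 *' X)* ι(2 ^' m))
  du m = begin ι h * A ^ h + cK *(Q * A ^ h)≤⟨ cQ(aO(ι h)(aY h)A6)(dS DW C8(a7(aY q)(aQ h mS))(aO Q(aY q)A6))⟩ ι h * ι a + ι k *(ι q * ι a)≡⟨ ag(aS _+_(aI(cW h a))(ag(au(ι k *_)(aI(cW q a)))(aI(cW k(q *' a)))))(aI(o9(h *' a)(k *'(q *' a))))⟩ ι(h *' a +' k *'(q *' a))≤⟨ bw t5 ⟩ ι(X *' 2 ^' m)≡⟨ ag(cW X(2 ^' m))(aI(ag(au(\ w -> ½ *(w * ι(2 ^' m)))(ag(cW 2 X)(au(_* ι X)l1)))(ag(iM ½(ι X)(ι(2 ^' m)))(ag(au(_*(ι X * ι(2 ^' m)))vR)(aH _)))))⟩ ½ *(ι(2 *' X)* ι(2 ^' m))∎ where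
   open RQ
   M = m +' c
   q = suc M ^' h
   Q = ι q
   A = cJ *(1' + Q)+ 1'
   a =(D *' q)^' h
   sk : 1 <= q
   sk = bz(suc M)h
   mS : 0' =< A
   mS = 0≤+(a7 DV(0≤+ ca(aY q)))ca
   iM : ∀ h x y -> h *((1' + 1')* x * y)==(1' + 1')* h *(x * y)
   iM = ap ar
   Fs : A =< ι(D *' q)
   Fs = af(bC 1'(aX(1' + Q)(0≤+ ca(aY q))C7))(af(ad(ag(aS _+_(ag(au(ι j *_)(aI(cV q)))(aI(cW j(suc q))))(aI jZ))(aI(o9(j *' suc q)1))))(bw Ft))where
    Ft : j *' suc q +' 1 <= D *' q
    Ft = aa(fI(az j(aK q sk))sk)(ae(a0 j q))where
     a0 : ∀ j q -> j *'(q +' q)+' q == suc(2 *' j)*' q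
     a0 = aU
   A6 : A ^ h =< ι a
   A6 = af(j0 h mS Fs)(ad(aI(mU(D *' q)h)))
   t5 : h *' a +' k *'(q *' a)<= X *' 2 ^' m
   t5 = wR where
    qh : q *' q ^' h <= oB *' 2 ^' c *' 2 ^' m
    qh = aa(ae(ag(cz(suc M)h(suc h))refl))(aa(proj₂(proj₂ pe)M)(ae(ag(au(oB *'_)(ag(gR 2 m c)(ck(2 ^' m)(2 ^' c))))(aI(ew oB(2 ^' c)(2 ^' m))))))
    mX : ∀ h k q D x -> h *'(q *'(D *' x))+' k *'(q *'(D *' x))==(h +' k)*'(D *'(q *' x))
    mX = aU
    wG : ∀ a b c d -> a *'(b *'(c *' d))== a *'(b *' c)*' d
    wG = aU
    wR : h *' a +' k *'(q *' a)<= X *' 2 ^' m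
    wR = aa(aK(k *'(q *' a))(az h(aL(_<= q *' a)(bp a)(aT a sk))))(aa(ae(ag(au(\ w -> h *'(q *' w)+' k *'(q *' w))(b6 D q h))(mX h k q(D ^' h)(q ^' h))))(aa(az(h +' k)(az(D ^' h)qh))(ae(wG(h +' k)(D ^' h)(oB *' 2 ^' c)(2 ^' m)))))
 mG : ∀(R : ℕ)-> ∃ \ θ -> 0' < θ × θ =< 1' ×(∀{x δ S}-> 0' < δ -> x =< ι S * δ -> S <= R -> x * θ =< δ)
 mG R = θ , n2 , dt , du where
  rc = f9(ι(suc R))(cO R)
  θ = ai rc
  n2 = ai(proj₂ rc)
  dt : θ =< 1'
  dt = af(ad(aI(aH θ)))(af(aX θ(bO n2)(af(ad(aI jZ))(bw(bl(bI{R})))))(ad(proj₂(proj₂ rc))))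
  du : ∀{x δ S}-> 0' < δ -> x =< ι S * δ -> S <= R -> x * θ =< δ
  du{x}{δ}{S}fV le Fu = af(aX θ(bO n2)(eN{x}{δ}fV le(a6 Fu)))(ad(ag(iM(ι(suc R))δ θ)(ag(au(δ *_)(proj₂(proj₂ rc)))(aF δ))))where
   iM : ∀ a b c -> a * b * c == b *(a * c)
   iM = ap ar
 module Fv {n N : ℕ} (dN : Fin n → Fin n → Fin N)(br : ∀{x y cy cL}-> dN x y == dN cy cL ->(x == cy × y == cL)⊎(x == cL × y == cy))(b2 dO : List qA)(h B E α z : ℕ)(ζ θ Λ p : ℚ)(eH : 1 <= B)(ic : 1 <= E)(kg : 1 <= α)(n3 : α <= B)(mH : ∀{P}-> P ∈ b2 -> dK B α E P)(qM : ∀{P}-> P ∈ dO -> dK α α E P)(kq : ∀{P}-> P ∈ b2 -> bt P <= h)(kr : ∀{P}-> P ∈ dO -> bt P <= h)(iT : 0' =< ζ)(kv : ζ =< 1')(zi : ι z * ζ == 1')(eg : 0' =< θ)(dt : θ =< 1')(b3 : 0' =< p)(cU : p =< 1')(r3 : n <= z ^' B)(vo : p =< θ * ζ ^ E)(nU : 0' =< Λ)(Ee : cC b2 * θ =< 1')(Ef : cC dO * θ =< 1')(k2 : cC dO * θ * ι(2 ^'(h +' h *' h))=< ½)(wC : ∀ m -> ι h *(cC b2 *(1' + ι(suc(m +'(h +' h *' h))^' h))+ 1')^ h + cC dO *(ι(suc(m +'(h +' h *' h))^' h)*(cC b2 *(1' + ι(suc(m +'(h +' h *' h))^' h))+ 1')^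 h)=< ½ *(Λ * ι(2 ^' m)))where
  open C5 z B E ζ θ p n iT kv zi eg dt b3 r3 vo
  private
   G ξ : ℚ
   -- By `tN` a `b2`-copy without overlap has exponent at least `B - α`, and by `tM` an overlap
   -- raises this to `B`. For a `dO`-copy, after paying `G` per new vertex, the exponents are 0 and
   -- `α`. Hence an overlap gains `ξ = ζ ^ α` in both cases.
   G = ζ ^(B -' α)
   ξ = ζ ^ α
   DX : ∀ x -> x * ζ ^ 0 == x
   DX = aF
   Cb : B -' α +' α == B
   Cb = m0 n3
   vJ : ∀(x : ℕ)-> B *' x ==(B -' α)*' x +' α *' x
   vJ x = ag(au(_*' x)(aI Cb))(lm x(B -' α)α)
   G^ : ∀ ν -> G ^ ν == ζ ^((B -' α)*' ν)
   G^ ν = ag(aI(Cp ζ ν(B -' α)))(au(ζ ^_)(ck ν(B -' α)))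
  tB : ∀ P ay O -> P ∈ b2 -> lookup O ay == false -> ∣ O ∣ == 0 -> ι(n ^' eu ay O)* p ^(ah(es P)-' ch(es P)O)=< G * θ
  tB P ay O c6 kz o = af(ad(aI(DX _)))(af(n1 ν e 0(B -' α)(aa t5(ae(aI(aW _))))tL)(ad(e9 θ G)))where
   open dK (mH c6)
   ν = eu ay O
   e = ah(es P)-' ch(es P)O
   tL : 1 <= e
   tL = aa(lV n3 eH)(ae(au(ah(es P)-'_)(aI(jY(es P)O o))))
   t5 : B *' ν +'(B -' α)<= E *' e
   t5 = kA α _ _(aa(ae(ag(r4(B *' ν)(B -' α)α)(ag(au(B *' ν +'_)Cb)(a0 B ν))))(aa(tN ay O kz o)(ae(el α _))))where
    a0 : ∀ b v -> b *' v +' b == b *' suc v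
    a0 = aU
  wB : ∀ P ay O -> P ∈ b2 -> lookup O ay == false -> 1 <= ∣ O ∣ -> ι(n ^' eu ay O)* p ^(ah(es P)-' ch(es P)O)=< G * ξ
  wB P ay O c6 kz o = af(ad(aI(DX _)))(af(vI ν e 0(B -' α +' α)(aa t5(ae(aI(aW _)))))(ad(zl ζ(B -' α)α)))where
   open dK (mH c6)
   ν = eu ay O
   e = ah(es P)-' ch(es P)O
   t5 : B *' ν +'(B -' α +' α)<= E *' e
   t5 = aa(ae(ag(au(B *' ν +'_)Cb)(a0 B ν)))(tM ay O kz o)where
    a0 : ∀ b v -> b *' v +' b == b *' suc v
    a0 = aU
  vz : ∀ P ay O -> P ∈ dO -> lookup O ay == false -> ∣ O ∣ == 0 -> ι(n ^' eu ay O)* p ^(ah(es P)-' ch(es P)O)* G ^ eu ay O =< θ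
  vz P ay O c6 kz o = af(ad(au(ι(n ^' ν)* p ^ e *_)(G^ ν)))(af(n1 ν e((B -' α)*' ν)0 t5 tL)(ad(aF θ)))where
   open dK (qM c6)
   ν = eu ay O
   e = ah(es P)-' ch(es P)O
   tL : 1 <= e
   tL = aa(lV bT kg)(ae(au(ah(es P)-'_)(aI(jY(es P)O o))))
   Fw : α *' ν <= E *' e
   Fw = rq α _ _(aa(ae(aI(Ci α ν)))(tN ay O kz o))
   t5 : B *' ν +' 0 <= E *' e +'(B -' α)*' ν
   t5 = aa(ae(ag(aW _)(ag(vJ ν)(el _(α *' ν)))))(aK((B -' α)*' ν)Fw)
  yF : ∀ P ay O -> P ∈ dO -> lookup O ay == false -> 1 <= ∣ O ∣ -> ι(n ^' eu ay O)* p ^(ah(es P)-' ch(es P)O)* G ^ eu ay O =< ξ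
  yF P ay O c6 kz o = af(ad(au(ι(n ^' ν)* p ^ e *_)(G^ ν)))(vI ν e((B -' α)*' ν)α t5)where
   open dK (qM c6)
   ν = eu ay O
   e = ah(es P)-' ch(es P)O
   t5 : B *' ν +' α <= E *' e +'(B -' α)*' ν
   t5 = aa(ae(ag(au(_+' α)(vJ ν))(a0((B -' α)*' ν)α ν)))(aK((B -' α)*' ν)(tM ay O kz o))where
    a0 : ∀ x a v -> x +' a *' v +' a == a *' suc v +' x
    a0 = aU
  start : ∀ P -> P ∈ b2 -> ι(n ^' bt P)* p ^ ah(es P)* ξ =< θ
  start P c6 = af(n1(bt P)(ah(es P))α 0(aa(ae(aW _))(aa rS(ae(el α _))))(lV n3 eH))(ad(aF θ))where
      open dK (mH c6)
  module Ct = Fg dN br b2 dO b3 cU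
  uM : aB(cI p b3 cU N)(ao ∘ ot.gU dN br b2 dO)=< ι(ah b2)*(θ *(Λ * ι(2 ^' h)))
  uM = Ct.Fj.qF G ξ θ Λ h(aQ(B -' α)iT)(aQ α iT)(lZ α iT kv)eg dt nU kq kr tB wB vz yF start Ee Ef k2 wC

-- The complete multipartite graph.

module Zg where
 open M24 using (⊥)
 open M6 using (zero;suc;combine)
 open M11 using (∈⊤;∣⊤∣≡n;x∈p∩q⁻;_∈?_)
 open M7 using ([];_∷_)
 open M16 using (_∈_)
 open M0 using (ℕ;zero;suc)
 open M20 using (_C_)
 open M1 using (∃;_×_)
 open M2 hiding (_÷_;∣_∣;floor;truncate)
 open M3
 open M8 using ([];_∷_;lookup;tabulate)
 open M4 hiding (J;[_])
 open M15 using (toWitness)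
 open M5
 open P1
 open P2
 open P4
 open EY using (lP; s9; i1)
 open Zd using (dX)
 rV : ∀{n}(G : a1 n)k -> k *'(v G C 2)<= e G *' suc k -> k ÷ suc k =< jS G
 rV G k le with v G C 2
 ... | zero = /-mono k k 1 0(aa(ae(f4 k))(aa(bB k)(ae(aI(bp(suc k))))))
 ... | suc w = /-mono k k(e G)w le
 module lj (k m : ℕ) where
  K M : ℕ
  K = suc k
  M = suc m
  n : ℕ
  n = K *' M
  dp : Fin n -> Fin K
  dp = quotient{K}M
  eW : Fin n -> Fin n -> bH
  eW x y = ⌊ dp x ≟ᶠ dp y ⌋
  rW : ∀ x y -> T(eW x y)-> T(eW y x)
  rW x y t = bc{a? = dp y ≟ᶠ dp x}(aI(toWitness{a? = dp x ≟ᶠ dp y}t))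
  cg : a1 n
  cg = record { verts = ⊤ₛ;adj = \ x y -> ha(eW x y);sym-adj = \{x}{y}t -> lx(\ s -> gc{eW x y}t(rW y x s));irrefl = \{x}t -> gc{eW x x}t(bc{a? = dp x ≟ᶠ dp x}refl);support = \ _ -> ∈⊤ }
  tO : ∀ x -> ah(aw(eW x)(ax n))<= M
  tO x = aa(dX(fd(combine(dp x))(ax M))(cF(eW x)(allFin⁺ n))sub)(ae(ag(fK(combine(dp x))(ax M))(cR{n = M}(\ x -> x))))where
   sub : ∀{y}-> y ∈ aw(eW x)(ax n)-> y ∈ fd(combine(dp x))(ax M)
   sub{y}p = aL(_∈ fd(combine(dp x))(ax M))(ag(au(\ i -> combine i(proj₂(Hw{K}M y)))(toWitness{a? = dp x ≟ᶠ dp y}(proj₂(aP(eW x)(ax n)p))))(F0{K}M y))(∈-map⁺(combine(dp x))(ax M)(∈-allFin(proj₂(Hw{K}M y))))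
  fW :{A : Set}(b : A -> bH)(xs : List A)-> aM xs(\ a -> ao(ha(b a)))+ ι(ah(aw b xs))== ι(ah xs)
  fW b [] = bu(ι 0)
  fW b(x ∷ xs)with b x
  ... | true = ag(au(_+ ι(suc(ah(aw b xs))))(bu(aM xs(\ a -> ao(ha(b a))))))(ag(au(aM xs(\ a -> ao(ha(b a)))+_)(cV(ah(aw b xs))))(ag(a0(aM xs(\ a -> ao(ha(b a))))(ι(ah(aw b xs))))(ag(au(1' +_)(fW b xs))(aI(cV(ah xs))))))where
   a0 : ∀ a b -> a +(1' + b)== 1' +(a + b)
   a0 = ap ar
  ... | false = ag(+-assoc 1'(aM xs(\ a -> ao(ha(b a))))(ι(ah(aw b xs))))(ag(au(1' +_)(fW b xs))(aI(cV(ah xs))))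
  A7 : ∀ x -> ι(k *' M)=< aM(ax n)(\ y -> ao(adj cg x y))
  A7 x = begin ι(k *' M)≡⟨ ag(a0(ι(k *' M))(ι M))(au(_- ι M)(ag(aI(o9 M(k *' M)))(au ι(aI(cR{n = n}(\ x -> x))))))⟩ ι(ah(ax n))- ι M ≤⟨ bA(ι(ah(ax n)))(c4(bw(tO x)))⟩ ι(ah(ax n))- ι(ah(aw(eW x)(ax n)))≡⟨ au(_- ι(ah(aw(eW x)(ax n))))(aI(fW(eW x)(ax n)))⟩ D + ι(ah(aw(eW x)(ax n)))- ι(ah(aw(eW x)(ax n)))≡⟨ aZ D(ι(ah(aw(eW x)(ax n))))⟩ D ∎ where
   open RQ
   D = aM(ax n)(\ y -> ao(adj cg x y))
   a0 : ∀ a b -> a == b + a - b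
   a0 = ap ar
   aZ : ∀ a b -> a + b - b == a
   aZ = ap ar
  C9 : n *'(k *' M)<= e cg +' e cg
  C9 = bS(begin ι(n *'(k *' M))≡⟨ ag(cW n(k *' M))(ag(au(\ q -> ι q * ι(k *' M))(aI(cR{n = n}(\ x -> x))))(aI(bL(ax n)(ι(k *' M)))))⟩ aM(ax n)(\ _ -> ι(k *' M))≤⟨ cj(ax n)A7 ⟩ aM(ax n)(\ x -> aM(ax n)(\ y -> ao(adj cg x y)))≤⟨ cj(ax n)(\ x -> cj(ax n)(pt x))⟩ aM(ax n)(\ x -> aM(ax n)(\ y -> F x y + F y x))≡⟨ ag(bF(ax n)(\ x -> l2(ax n)(F x)(\ y -> F y x)))(l2(ax n)(\ x -> aM(ax n)(F x))(\ x -> aM(ax n)(\ y -> F y x)))⟩ G6 + aM(ax n)(\ x -> aM(ax n)(\ y -> F y x))≡⟨ aS _+_(aI es)(ag(iC(ax n)(ax n)(\ x y -> F y x))(aI es))⟩ ι(e cg)+ ι(e cg)≡⟨ aI(o9(e cg)(e cg))⟩ ι(e cg +' e cg)∎)where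
   open RQ
   F : Fin n -> Fin n -> ℚ
   F x y = ao(⌊ x <?ᶠ y ⌋ ∧ adj cg x y)
   G6 = aM(ax n)(\ x -> aM(ax n)(F x))
   es : ι(e cg)== G6
   es = lP cg 0
   pt : ∀ x y -> ao(adj cg x y)=< F x y + F y x
   pt x y = go(<ᶠ-cmp x y)where
    go : _ -> ao(adj cg x y)=< F x y + F y x
    go(tri< lt _ _)= af(dg{adj cg x y}{⌊ x <?ᶠ y ⌋ ∧ adj cg x y}(\ t -> cA{⌊ x <?ᶠ y ⌋}(bc{a? = x <?ᶠ y}lt)t))(bK(F y x)(a8(⌊ y <?ᶠ x ⌋ ∧ adj cg y x))refl)
    go(tri≈ _ refl _)= af(dg{adj cg x y}{false}(\ t -> irrefl cg{x}t))(0≤+(a8(⌊ x <?ᶠ y ⌋ ∧ adj cg x y))(a8(⌊ y <?ᶠ x ⌋ ∧ adj cg y x)))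
    go(tri> _ _ gt)= af(dg{adj cg x y}{⌊ y <?ᶠ x ⌋ ∧ adj cg y x}(\ t -> cA{⌊ y <?ᶠ x ⌋}(bc{a? = y <?ᶠ x}gt)(sym-adj cg{x}{y}t)))(bK(F x y)(a8(⌊ x <?ᶠ y ⌋ ∧ adj cg x y))(Cj(F x y)(F y x)))
  tP : v cg == n
  tP = ∣⊤∣≡n n
  n4 : k ÷ suc k =< jS cg
  n4 = rV cg k(kB 2(aa(ae(ag(au(\ q -> 2 *'(k *'(q C 2)))tP)(ag(ci k(n C 2))(au(k *'_)(s9 r1)))))(aa(az k(az n(bB r1)))(aa(ae(aZ k M))(aa(aT(suc k)C9)(ae(d1(e cg)(suc k))))))))where
   r1 = m +' k *' M
   ci : ∀ a b -> 2 *'(a *' b)== a *'(2 *' b)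
   ci = aU
   aZ : ∀ k M -> k *'(suc k *' M *'(suc k *' M))== suc k *' M *'(k *' M)*' suc k
   aZ = aU
   d1 : ∀ e k ->(e +' e)*' k == 2 *'(e *' k)
   d1 = aU
  module _ {r : ℕ} (𝐇 : Vec bq r) (df : ∀ j → Vec (List (a1 (ai (lookup 𝐇 j)))) K) (oA : ∀ j → cm (proj₂ (lookup 𝐇 j)) K (df j))(R : a1 n)(m2 : Fin K -> Vec(Fin r)n)(tQ : ∀ i j{A}-> A ∈ lookup(df j)i ->(f : Vec(Fin n)(ai(lookup 𝐇 j)))->(∀ x -> x ∈ₛ verts A -> lookup(m2 i)(lookup f x)== j)->(∀ x y -> x ∈ₛ verts A -> y ∈ₛ verts A -> lookup f x == lookup f y -> x == y)->(∀ x y -> T(adj A x y)-> T(adj R(lookup f x)(lookup f y)))-> ⊥)where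
   -- Vertices of part `i` are coloured by `m2 i`. The parts split a copy of `H j` into a partition,
   -- and the certificate puts one of the pieces into a family. That piece has all its edges in `R`,
   -- since `cg` has none inside a part, and so contradicts `tQ`.
   kw : ¬((cg ∪ᴳ R)⟶ 𝐇)
   kw Gp = go(Gp c)where
    c : Vec(Fin r)n
    c = tabulate(\ x -> lookup(m2(dp x))x)
    go : ¬(∃ \ j -> ∃ \ f -> zf(cg ∪ᴳ R)c j(proj₂(lookup 𝐇 j))f)
    go(j , f , u1 , jn , nl)= jv(oA j aN)where
     H = proj₂(lookup 𝐇 j)
     aN : Vec(Fin K)(ai(lookup 𝐇 j))
     aN = tabulate(\ x -> dp(lookup f x))
     qN : ∀{i x}-> x ∈ₛ jQ aN i -> dp(lookup f x)== i
     qN{i}{x}p = ag(aI(a9(\ x -> dp(lookup f x))x))(toWitness{a? = lookup aN x ≟ᶠ i}(aL T(bv x(\ j -> ⌊ j ≟ᶠ i ⌋)aN)(ei(gz p))))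
     jv : ¬(∃ \ i -> Any((H [ jQ aN i ])≈_)(lookup(df j)i))
     jv(i , Gf)= Da(GS Gf)where
      Da : ¬(∃ \ A -> A ∈ lookup(df j)i ×(H [ jQ aN i ])≈ A)
      Da(A , d2 ,(GA , GB))= tQ i j d2 f gY Fx Db where
       iJ : ∀{x}-> x ∈ₛ verts A -> x ∈ₛ verts H × x ∈ₛ jQ aN i
       iJ{x}p = x∈p∩q⁻(verts H)(jQ aN i)(aL(x ∈ₛ_)(aI GA)p)
       gY : ∀ x -> x ∈ₛ verts A -> lookup(m2 i)(lookup f x)== j
       gY x p = ag(aI(ag(a9(\ x -> lookup(m2(dp x))x)(lookup f x))(au(\ i -> lookup(m2 i)(lookup f x))(qN(proj₂(iJ p))))))(proj₂(u1 x(ai(iJ p))))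
       Fx : ∀ x y -> x ∈ₛ verts A -> y ∈ₛ verts A -> lookup f x == lookup f y -> x == y
       Fx x y p q = jn x y(ai(iJ p))(ai(iJ q))
       Db : ∀ x y -> T(adj A x y)-> T(adj R(lookup f x)(lookup f y))
       Db x y t = GC(i1 cg R{lookup f x}{lookup f y}(nl x y(proj₂(proj₂ w))))where
        w = toWitness{a? = x ∈? jQ aN i ×-dec(y ∈? jQ aN i ×-dec T?(adj H x y))}(aL T(aI(GB x y))t)
        GC : T(adj cg(lookup f x)(lookup f y))⊎ T(adj R(lookup f x)(lookup f y))-> T(adj R(lookup f x)(lookup f y))
        GC(aG q)= q
        GC(aD q)= aA(gc{eW(lookup f x)(lookup f y)}q(bc{a? = dp(lookup f x)≟ᶠ dp(lookup f y)}(ag(qN(ai w))(aI(qN(ai(proj₂ w)))))))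

-- Colourings of one part that avoid the families.

module Zh where
 open M24 using (⊥)
 open M6 using (zero;suc)
 open M9 using (∣_∣)
 open M11 using (∣∁p∣≡n∸∣p∣;∣⁅x⁆∣≡1;x∈⁅y⁆⇒x≡y;x∉p⇒x∈∁p)
 open M7 using ([];_∷_)
 open M16 using (_∈_)
 open M10 using ([];_∷_)
 open M13 using (here;there)
 open M0 using (ℕ;zero;suc)
 open M1 using (∃;_×_)
 open M2 hiding (_÷_;∣_∣;floor;truncate)
 open M3
 open M8 using ([];_∷_;lookup;replicate)
 open M4 hiding (J;[_])
 open M15 using (toWitness)
 open M5
 open P1
 open P2
 open P3
 open P4
 open P5 using (aJ; ey; ∈-concatMap⁺)
 open P9
 open BG
 open CG using (gm)
 open E4 using (kn)
 open Z1
 open Za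
 open Zb using (eU)
 open Zc
 open Zd
 open Ze
 open Zf
 record io {s : ℕ} (A : a1 s) (P : qA) : Set where
  field
   inside : Vec(Fin s)(bt P)
   ks : ky inside
   k1 : ∀ y -> lookup inside y ∈ₛ verts A
   gx : ∀{a b}->(a , b)∈ es P -> T(adj A(lookup inside a)(lookup inside b))
 o7 : ∀{s}(G : a1 s){A c E h : ℕ}-> 1 <= A -> s <= h -> qI(ba G)A c E -> ∃ \ P -> io G P × dK A c E P × bt P <= h
 o7{s}G{A}{c}{E}o3 jy b = P , A8 , record{ rS = rS;ox = ox }, aa tD jy where
  open qI b
  P : qA
  P = record{ bt = ed;es = d5;wA = bQ;eT = k0 }
  -- An extremal pattern has no isolated vertex: deleting one would lower `A |U| - E e(U)` by
  -- `A ≥ 1`. So each vertex of the pattern ends an edge and therefore belongs to the graph.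
  yM : ∀ y -> ∃ \ e -> e ∈ d5 ×(ai e == y ⊎ proj₂ e == y)
  yM y = go(lc d5)where
   O = ∁ ⁅ y ⁆
   O# : ∣ O ∣ == ed -' 1
   O# = ag(∣∁p∣≡n∸∣p∣ ⁅ y ⁆)(au(ed -'_)(∣⁅x⁆∣≡1 y))
   DY : ∀{x}-> x ≢ y -> T(lookup O x)
   DY{x}ne = ei(gz(x∉p⇒x∈∁p(\ q -> ne(x∈⁅y⁆⇒x≡y y q))))
   pu : ∀ xs ->(∀ e -> e ∈ xs -> ai e ≢ y × proj₂ e ≢ y)-> ch xs O == ah xs
   pu [] f = refl
   pu((a , b)∷ xs)f rewrite f1(DY(ai(f(a , b)(here refl))))| f1(DY(proj₂(f(a , b)(here refl))))= au suc(pu xs(\ e q -> f e(there q)))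
   lc : ∀ xs ->(∃ \ e -> e ∈ xs ×(ai e == y ⊎ proj₂ e == y))⊎(∀ e -> e ∈ xs -> ai e ≢ y × proj₂ e ≢ y)
   lc [] = aG(\ e())
   lc((a , b)∷ xs)with a ≟ᶠ y | b ≟ᶠ y | lc xs
   ... | yes p | _ | _ = aD((a , b), here refl , aD p)
   ... | no _ | yes p | _ = aD((a , b), here refl , aG p)
   ... | no _ | no _ | aD(e , xH , q)= aD(e , there xH , q)
   ... | no na | no nb | aG f = aG \{ e(here refl)-> na , nb;e(there q)-> f e q }
   go :(∃ \ e -> e ∈ d5 ×(ai e == y ⊎ proj₂ e == y))⊎(∀ e -> e ∈ d5 -> ai e ≢ y × proj₂ e ≢ y)-> ∃ \ e -> e ∈ d5 ×(ai e == y ⊎ proj₂ e == y)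
   go(aD r)= r
   go(aG f)= aA(aV refl(aa(ae(el 1(A *'(ed -' 1))))(aa(bJ(A *'(ed -' 1))o3)(aa(ae Dc)(kA(E *' ah d5)_ _ Fl)))))where
    jx : 1 <= ed
    jx = aa(bl bI)k0
    Dc : A *'(ed -' 1)+' A == A *' ed
    Dc = ag(el(A *'(ed -' 1))A)(ag(aI(Ci A(ed -' 1)))(au(A *'_)(hQ jx)))
    Fl : A *' ed +' E *' ah d5 <= A *'(ed -' 1)+' E *' ah d5
    Fl = lp(\ x o -> A *' ed +' E *' x <= A *' o +' E *' ah d5)(pu d5 f)O#(ox O(aa(rs 1 k0)(ae(aI O#))))
  A8 : io G P
  A8 = record{ inside = inside;ks = ks;k1 = u1;gx = \ q -> iG G(aD(gx q))} where
   u1 : ∀ y -> lookup inside y ∈ₛ verts G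
   u1 y with yM y
   ... |(a , b), q , aD refl = support G(iG G(aD(gx q)))
   ... |(a , b), q , aG refl = support G(sym-adj G(iG G(aD(gx q))))
 oy :{X Y : Set}{Q : X -> Y -> Set}(xs : List X)->(∀{x}-> x ∈ xs -> ∃(Q x))-> ∃ \ ys ->(∀{x}-> x ∈ xs -> ∃ \ y -> y ∈ ys × Q x y)×(∀{y}-> y ∈ ys -> ∃ \ x -> Q x y)
 oy [] f = [] ,(\()), \()
 oy(x ∷ xs)f = let ys , g , k = oy xs(f ∘ there);y , q = f(here refl)in y ∷ ys ,(\{(here refl)-> y , here refl , q ;(there p)-> let z , GD , r = g p in z , there GD , r }), \{(here refl)-> x , q ;(there p)-> k p }
 module t7 {r : ℕ} (cf : Fin r → ℕ) (Gs : ∀ j → List (a1 (cf j))) (tR : ∀ j {A} → A ∈ Gs j → ∃ λ x → x ∈ₛ verts A) where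
  lk :{n N : ℕ}->(Fin n -> Fin n -> Fin N)-> av N -> Vec(Fin r)n -> Set
  lk{n}dN S c = ∀ j{A}-> A ∈ Gs j ->(f : Vec(Fin n)(cf j))->(∀ x -> x ∈ₛ verts A -> lookup c(lookup f x)== j)->(∀ x y -> x ∈ₛ verts A -> y ∈ₛ verts A -> lookup f x == lookup f y -> x == y)->(∀ x y -> T(adj A x y)-> T(lookup S(dN(lookup f x)(lookup f y))))-> ⊥
  -- The constant `θ` comes before the number of vertices, and the exceptional event before `z` and
  -- `p`; the bound on its probability is uniform in them.
  record fc (B E : ℕ) (δ : ℚ) : Set where
   field
    θ : ℚ
    n2 : 0' < θ
    dt : θ =< 1'
    vK : ∀{n N}(dN : Fin n -> Fin n -> Fin N)(br : ∀{x y cy cL}-> dN x y == dN cy cL ->(x == cy × y == cL)⊎(x == cL × y == cy))-> ∃ \(gU : av N -> bH)->(∀ z ζ p(b3 : 0' =< p)(cU : p =< 1')-> 0' =< ζ -> ζ =< 1' -> ι z * ζ == 1' -> n <= z ^' B -> p =< θ * ζ ^ E -> aB(cI p b3 cU N)(ao ∘ gU)=< δ)×(∀ S -> ¬ T(gU S)-> ∃(lk dN S))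
  module wS {n N : ℕ} (dN : Fin n → Fin n → Fin N)(br : ∀{x y cy cL}-> dN x y == dN cy cL ->(x == cy × y == cL)⊎(x == cL × y == cy))(S : av N){s : ℕ}{A : a1 s}{P : qA}(w : io A P)(f : Vec(Fin n)s)(jn : ∀ x y -> x ∈ₛ verts A -> y ∈ₛ verts A -> lookup f x == lookup f y -> x == y)(nl : ∀ x y -> T(adj A x y)-> T(lookup S(dN(lookup f x)(lookup f y))))where
   open io w
   open pc dN br
   γ : Vec(Fin n)(bt P)
   γ = Vec.map(lookup f)inside
   uN : ∀ y -> lookup γ y == lookup f(lookup inside y)
   uN y = bv y(lookup f)inside
   xQ : ky γ
   xQ x y eq = ks x y(jn _ _(k1 x)(k1 y)(ag(aI(uN x))(ag eq(uN y))))
   pE : T(fa(es P)γ ⊑ S)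
   pE = hH(fa(es P)γ)S sub where
    sub : ∀{l}-> l ∈ₛ fa(es P)γ -> l ∈ₛ S
    sub q = let(a , b), xH , eq = l5(es P)γ q in aL(_∈ₛ S)(aI eq)(fq _ S(f1(lp(\ u v -> T(lookup S(dN u v)))(aI(uN a))(aI(uN b))(nl _ _(gx xH)))))
  module _ (B E h : ℕ) (eH : 1 <= B) (ic : 1 <= E) (δ : ℚ) (fV : 0' < δ) (a4 d6 : Fin r) (fs : d6 ≢ a4) where
   private
    vL : ∀ j{A}-> A ∈ Gs j -> ∀{n}(c : Vec(Fin r)n)(f : Vec(Fin n)(cf j))->(∀ v -> lookup c v ≢ j)-> ¬(∀ x -> x ∈ₛ verts A -> lookup c(lookup f x)== j)
    vL j d2 c f kz mono = let x , p = tR j d2 in kz _(mono x p)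
   -- When the second density is 0, the expected number of copies of the leading patterns is already
   -- small; outside that event the constant colouring `a4` works.
   tS :(∀{A}-> A ∈ Gs a4 -> ∃ \ P -> io A P × dK B 0 E P × bt P <= h)-> fc B E δ
   tS GE = rT(oy(Gs a4)GE)where
    rT :(∃ \ b2 ->(∀{A}-> A ∈ Gs a4 -> ∃ \ P -> P ∈ b2 ×(io A P × dK B 0 E P × bt P <= h))×(∀{P}-> P ∈ b2 -> ∃ \ A -> io A P × dK B 0 E P × bt P <= h))-> fc B E δ
    rT(b2 , lL , wt)= from(kn(ι(ah b2))δ fV)where
     from :(∃ \ R -> ι(ah b2)=< ι R * δ)-> fc B E δ
     from(R , GF)= record{ θ = θ;n2 = ai(proj₂ sf);dt = ai(proj₂(proj₂ sf));vK = zh } where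
      sf = mG R
      θ = ai sf
      zh : ∀{n N}(dN : Fin n -> Fin n -> Fin N)(br : ∀{x y cy cL}-> dN x y == dN cy cL ->(x == cy × y == cL)⊎(x == cL × y == cy))-> ∃ \(gU : av N -> bH)->(∀ z ζ p(b3 : 0' =< p)(cU : p =< 1')-> 0' =< ζ -> ζ =< 1' -> ι z * ζ == 1' -> n <= z ^' B -> p =< θ * ζ ^ E -> aB(cI p b3 cU N)(ao ∘ gU)=< δ)×(∀ S -> ¬ T(gU S)-> ∃(lk dN S))
      zh{n}{N}dN br = gU , wT , kR where
       open pc dN br
       A9 : Set
       A9 = Σ qA \ P -> Vec(Fin n)(bt P)
       vM :(P : qA)-> Vec(Fin n)(bt P)-> A9
       vM P β = P , β
       yN : List A9
       yN = ce(\ P -> fd(vM P)(aJ n(bt P)))b2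
       g : A9 -> av N -> bH
       g(P , β)S = bn β ∧(fa(es P)β ⊑ S)
       gU : av N -> bH
       gU S = iD(\ a -> g a S)yN
       wT : ∀ z ζ p(b3 : 0' =< p)(cU : p =< 1')-> 0' =< ζ -> ζ =< 1' -> ι z * ζ == 1' -> n <= z ^' B -> p =< θ * ζ ^ E -> aB(cI p b3 cU N)(ao ∘ gU)=< δ
       wT z ζ p b3 cU iT kv zi r3 vo = begin aB wU(ao ∘ gU)≤⟨ m4 wU yN g ⟩ aM yN me ≡⟨ dB(\ P -> fd(vM P)(aJ n(bt P)))b2 me ⟩ aM b2(\ P -> aM(fd(vM P)(aJ n(bt P)))me)≤⟨ eU b2 AR ⟩ aM b2(\ _ -> θ)≡⟨ bL b2 θ ⟩ ι(ah b2)* θ ≤⟨ proj₂(proj₂(proj₂ sf)){ι(ah b2)}{δ}{R}fV GF bT ⟩ δ ∎ where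
        open RQ
        open C5 z B E ζ θ p n iT kv zi (bO (ai (proj₂ sf))) (ai (proj₂ (proj₂ sf))) b3 r3 vo
        wU = cI p b3 cU N
        me : A9 -> ℚ
        me a = aB wU(\ S -> ao(g a S))
        wa : ∀ P β -> me(P , β)=< p ^ ah(es P)
        wa P β = go(bn β)refl where
         go : ∀ b -> b == bn β -> aB wU(\ S -> ao(b ∧(fa(es P)β ⊑ S)))=< p ^ ah(es P)
         go false eq = af(ad(bk wU 0'))(aQ(ah(es P))b3)
         go true eq = af(ad(iV b3 cU(fa(es P)β)))(f8 b3 cU(jB(es P)β(wA P)(toWitness{a? = ly β}(ei(aI eq)))))
        AR : ∀{P}-> P ∈ b2 -> aM(fd(vM P)(aJ n(bt P)))me =< θ
        AR{P}c6 = begin aM(fd(vM P)(aJ n(bt P)))me ≡⟨ fM(vM P)(aJ n(bt P))me ⟩ aM(aJ n(bt P))(\ β -> me(P , β))≤⟨ cj(aJ n(bt P))(wa P)⟩ aM(aJ n(bt P))(\ _ -> p ^ ah(es P))≡⟨ ag(bL(aJ n(bt P))(p ^ ah(es P)))(au(_* p ^ ah(es P))(ag(gm n(bt P))(aI(mU n(bt P)))))⟩ ι(n ^' bt P)* p ^ ah(es P)≡⟨ aI(aF(ι(n ^' bt P)* p ^ ah(es P)))⟩ ι(n ^' bt P)* p ^ ah(es P)* 1' ≤⟨ n1(bt P)(ah(es P))0 0(aa(ae(aW _))(aa(dK.rS wP)(ae(aI(aW _)))))(dK.lV wP bI eH)⟩ θ * 1' ≡⟨ aF θ ⟩ θ ∎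 where
         wP : dK B 0 E P
         wP = ai(proj₂(proj₂(wt c6)))
       kR : ∀ S -> ¬ T(gU S)-> ∃(lk dN S)
       kR S wQ = replicate n a4 , tQ where
        tQ : lk dN S(replicate n a4)
        tQ j{A}d2 f mono jn nl with j ≟ᶠ a4
        ... | no ne = vL j d2(replicate n a4)f(\ v eq -> ne(ag(aI eq)(lookup-replicate v a4)))mono
        ... | yes refl with lL d2
        ... | P , c6 , w , _ , _ = wQ(mB(\ a -> g a S)(∈-concatMap⁺(\ P -> fd(vM P)(aJ n(bt P)))c6(∈-map⁺(vM P)(aJ n(bt P))(ey Rs.γ)))(cA{bn Rs.γ}(bc{a? = ly Rs.γ}Rs.xQ)Rs.pE))where
            module Rs = wS dN br S w f jn nl
   -- Two colours suffice: patterns inside the graphs of family `a4` play the part of `b2` and those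
   -- of family `d6` the part of `dO`; no vertex receives any other colour.
   n5 :(α : ℕ)-> 1 <= α -> α <= B ->(∀{A}-> A ∈ Gs a4 -> ∃ \ P -> io A P × dK B α E P × bt P <= h)->(∀{A}-> A ∈ Gs d6 -> ∃ \ P -> io A P × dK α α E P × bt P <= h)-> fc B E δ
   n5 α kg n3 Cc Cd = rT(oy(Gs a4)Cc)(oy(Gs d6)Cd)where
    DZ : Fin r -> ℕ -> ℕ -> Set
    DZ j a c = ∃ \ 𝒫 ->(∀{A}-> A ∈ Gs j -> ∃ \ P -> P ∈ 𝒫 ×(io A P × dK a c E P × bt P <= h))×(∀{P}-> P ∈ 𝒫 -> ∃ \ A -> io A P × dK a c E P × bt P <= h)
    rT : DZ a4 B α -> DZ d6 α α -> fc B E δ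
    rT(b2 , D0 , Dd)(dO , D1 , De)= yO(uL(cC b2)(cC dO)h(mF b2)(mF dO))where
     c = h +' h *' h
     yO :(∃ \ Λ -> 0' =< Λ ×(∀ m -> let M = m +'(h +' h *' h);Q = ι(suc M ^' h);A = cC b2 *(1' + Q)+ 1' in ι h * A ^ h + cC dO *(Q * A ^ h)=< ½ *(Λ * ι(2 ^' m))))-> fc B E δ
     yO(Λ , nU , wC)= tq(kn(cC b2)1' gW)(kn(cC dO)1' gW)(kn(cC dO * ι(2 ^' c))½(da ½))(kn(ι(ah b2)*(Λ * ι(2 ^' h)))δ fV)where
      tq :(∃ \ R -> cC b2 =< ι R * 1')->(∃ \ R -> cC dO =< ι R * 1')->(∃ \ R -> cC dO * ι(2 ^' c)=< ι R * ½)->(∃ \ R -> ι(ah b2)*(Λ * ι(2 ^' h))=< ι R * δ)-> fc B E δ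
      tq(e0 , GG)(g3 , GH)(tl , GI)(Cf , GJ)= record{ θ = θ;n2 = n2;dt = dt;vK = zh } where
       R = e0 +'(g3 +'(tl +' Cf))
       sf = mG R
       θ = ai sf
       n2 = ai(proj₂ sf)
       dt = ai(proj₂(proj₂ sf))
       ki = proj₂(proj₂(proj₂ sf))
       Ee : cC b2 * θ =< 1'
       Ee = ki{cC b2}{1'}{e0}gW GG(a3 e0 _)
       Ef : cC dO * θ =< 1'
       Ef = ki{cC dO}{1'}{g3}gW GH(aa(a3 g3 _)(bg _ e0))
       k2 : cC dO * θ * ι(2 ^' c)=< ½
       k2 = af(ad(a0(cC dO)θ(ι(2 ^' c))))(ki{cC dO * ι(2 ^' c)}{½}{tl}(da ½)GI(aa(a3 tl Cf)(aa(bg _ g3)(bg _ e0))))where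
        a0 : ∀ a b c -> a * b * c == a * c * b
        a0 = ap ar
       final : ι(ah b2)*(θ *(Λ * ι(2 ^' h)))=< δ
       final = af(ad(a0(ι(ah b2))θ(Λ * ι(2 ^' h))))(ki{ι(ah b2)*(Λ * ι(2 ^' h))}{δ}{Cf}fV GJ(aa(bg Cf tl)(aa(bg _ g3)(bg _ e0))))where
        a0 : ∀ a b c -> a *(b * c)== a * c * b
        a0 = ap ar
       zh : ∀{n N}(dN : Fin n -> Fin n -> Fin N)(br : ∀{x y cy cL}-> dN x y == dN cy cL ->(x == cy × y == cL)⊎(x == cL × y == cy))-> ∃ \(gU : av N -> bH)->(∀ z ζ p(b3 : 0' =< p)(cU : p =< 1')-> 0' =< ζ -> ζ =< 1' -> ι z * ζ == 1' -> n <= z ^' B -> p =< θ * ζ ^ E -> aB(cI p b3 cU N)(ao ∘ gU)=< δ)×(∀ S -> ¬ T(gU S)-> ∃(lk dN S))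
       zh{n}{N}dN br = ot.gU dN br b2 dO ,(\ z ζ p b3 cU iT kv zi r3 vo -> af(Fv.uM dN br b2 dO h B E α z ζ θ Λ p eH ic kg n3(\ c6 -> ai(proj₂(proj₂(Dd c6))))(\ c6 -> ai(proj₂(proj₂(De c6))))(\ c6 -> proj₂(proj₂(proj₂(Dd c6))))(\ c6 -> proj₂(proj₂(proj₂(De c6))))iT kv zi(bO n2)dt b3 cU r3 vo nU Ee Ef k2 wC)final), kR where
        kR : ∀ S -> ¬ T(ot.gU dN br b2 dO S)-> ∃(lk dN S)
        kR S wQ = go(xP.uK dN br b2 dO S wQ)where
         open AW dN br b2 dO S using (eC)
         mZ : Fin 2 -> Fin r
         mZ zero = a4
         mZ(suc zero)= d6
         n6 : ∀{a b}-> mZ a == mZ b -> a == b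
         n6{zero}{zero}eq = refl
         n6{zero}{suc zero}eq = aA(fs(aI eq))
         n6{suc zero}{zero}eq = aA(fs eq)
         n6{suc zero}{suc zero}eq = refl
         pF : ∀ a -> mZ a == a4 ⊎ mZ a == d6
         pF zero = aD refl
         pF(suc zero)= aG refl
         go :(∃ \(c : Vec(Fin 2)n)-> ∀ τ{P}-> P ∈ eC τ ->(β : Vec(Fin n)(bt P))-> ky β -> T(pc.fa dN br(es P)β ⊑ S)-> ¬(∀ y -> lookup c(lookup β y)== τ))-> ∃(lk dN S)
         go(c , fA)= Vec.map mZ c , tQ where
          at : ∀ v -> lookup(Vec.map mZ c)v == mZ(lookup c v)
          at v = bv v mZ c
          o6 : ∀ τ{s}{A : a1 s}{P}-> P ∈ eC τ -> io A P ->(f : Vec(Fin n)s)->(∀ x -> x ∈ₛ verts A -> lookup(Vec.map mZ c)(lookup f x)== mZ τ)->(∀ x y -> x ∈ₛ verts A -> y ∈ₛ verts A -> lookup f x == lookup f y -> x == y)->(∀ x y -> T(adj A x y)-> T(lookup S(dN(lookup f x)(lookup f y))))-> ⊥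
          o6 τ c6 w f mono jn nl = fA τ c6 Rs.γ Rs.xQ Rs.pE(\ y -> n6(ag(aI(at(lookup Rs.γ y)))(ag(au(lookup(Vec.map mZ c))(Rs.uN y))(mono _(io.k1 w y)))))where
              module Rs = wS dN br S w f jn nl
          tQ : lk dN S(Vec.map mZ c)
          tQ j{A}d2 f mono jn nl with j ≟ᶠ a4 | j ≟ᶠ d6
          ... | yes refl | _ = let P , c6 , w , _ = D0 d2 in o6 zero c6 w f mono jn nl
          ... | no _ | yes refl = let P , c6 , w , _ = D1 d2 in o6(suc zero)c6 w f mono jn nl
          ... | no GK | no GL = vL j d2(Vec.map mZ c)f(\ v eq -> kz v eq(pF(lookup c v)))mono where
           kz : ∀ v -> lookup(Vec.map mZ c)v == j -> mZ(lookup c v)== a4 ⊎ mZ(lookup c v)== d6 -> ⊥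
           kz v eq(aD q)= GK(ag(aI eq)(ag(at v)q))
           kz v eq(aG q)= GL(ag(aI eq)(ag(at v)q))

-- The lower half of the threshold.

module Zi where
 open M24 using (⊥)
 open M6 using (zero;suc)
 open M9 using (∣_∣)
 open M11 using (nonempty?;Empty-unique;∣⊥∣≡0)
 open M16 using (_∈_)
 open M0 using (ℕ;zero;suc)
 open M1 using (∃;_×_)
 open M2 hiding (_÷_;∣_∣;floor;truncate)
 open M3
 open M8 using (lookup;tabulate)
 open M4 hiding (J;[_])
 open M15 using (toWitness)
 open M5
 open P1
 open P2
 open P3
 open P4
 open P9
 open BG
 open Ge
 open EG
 open EX using (_!; oU; ia)
 open E4 using (gP; i3; g7; kT; eB)
 open Z1
 open Zc using (mB)
 open Za
 open Zd
 open Zf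
 open Zg
 open Zh
 rX : ∀{m}(W : av m)-> 1 <= ∣ W ∣ -> ∃ \ y -> y ∈ₛ W
 rX{m}W le with nonempty? W
 ... | yes q = q
 ... | no nq = aA(aV refl(aa le(ae(ag(au ∣_∣(Empty-unique nq))(∣⊥∣≡0 m)))))
 tT : ∀ a b n j -> 1 <= a -> rootNumerator a b n j ^' a *' n ^' b <= suc j ^' a
 tT(suc a)b n j _ = go(Hy{P = \ m -> m ^' suc a *' n ^' b <= suc j ^' suc a}(\ m -> m ^' suc a *' n ^' b ℕₚ.≤? suc j ^' suc a)(suc j))where
  x = rootNumerator(suc a)b n j
  go : x == 0 ⊎ x ^' suc a *' n ^' b <= suc j ^' suc a -> x ^' suc a *' n ^' b <= suc j ^' suc a
  go(aG p)= p
  go(aD eq)= aa(ae(au(\ x -> x ^' suc a *' n ^' b)eq))bI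
 qO : ∀ a{x y}-> 1 <= a -> x ^' a <= y ^' a -> x <= y
 qO(suc a){x}{y}_ le = GQ(\ lt -> aV refl(gQ(ℕₚ.^-monoˡ-<(suc a)lt)le))
 k3 : ∀{K}(zj : Fin K -> ℚ)->(∀ i -> 0' < zj i)-> ∃ \ θ -> 0' < θ × θ =< 1' ×(∀ i -> θ =< zj i)
 k3{zero}zj pos = 1' , gW , bR , \()
 k3{suc K}zj pos = let θ , n2 , dt , le = k3(zj ∘ suc)(pos ∘ suc)in zj zero ⊓ θ , yP(pos zero)n2 , af(p⊓q≤q(zj zero)θ)dt , \{ zero -> p⊓q≤p(zj zero)θ ;(suc i)-> af(p⊓q≤q(zj zero)θ)(le i)} where
  yP : ∀{a b}-> 0' < a -> 0' < b -> 0' < a ⊓ b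
  yP{a}{b}p q with ⊓-sel a b
  ... | aD eq = aL(0' <_)(aI eq)p
  ... | aG eq = aL(0' <_)(aI eq)q
 module Fy {r : ℕ} (eG : 2 <= r) (𝐇 : Vec bq r) (ej : ∀ j → 1 <= v (proj₂ (lookup 𝐇 j))) (k cN b4 : ℕ)(dW : β 𝐇(suc k)* ι b4 == ι cN)(jm : 1 <= cN)(ie : 1 <= b4)(sP : 0' < β 𝐇(suc k))where
  open mi k 𝐇 using (cf; H; hv; hw; gj)
  b : ℚ
  b = β 𝐇(suc k)
  h B E : ℕ
  h = Vec.sum(Vec.map ai 𝐇)
  B = cN *' h !
  E = b4 *' h !
  eH : 1 <= B
  eH = aC jm(oU h)
  ic : 1 <= E
  ic = aC ie(oU h)
  bE : b * ι E == ι B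
  bE = ag(au(b *_)(cW b4(h !)))(ag(aI(hp b(ι b4)(ι(h !))))(ag(au(_* ι(h !))dW)(aI(cW cN(h !)))))
  module y8 (df : ∀ j → Vec (List (a1 (cf j))) (suc k)) (oA : ∀ j → cm (H j) (suc k) (df j))(iw : ∀ j i{J}-> J ∈ lookup(df j)i -> J ∈ nonempty(H j))(du : ∀ i As ->(∀ j -> lookup As j ∈ fd(hv j)(lookup(df j)i))-> b =< b9 As)where
   module xR (i : Fin (suc k)) where
    Gs : ∀ j -> List(a1(cf j))
    Gs j = lookup(df j)i
    Ba : ∀ j{A}-> A ∈ Gs j -> ∃ \ x -> x ∈ₛ verts A
    Ba j{A}d2 = rX(verts A)(hw(H j)(iw j i d2))
    open t7 cf Gs Ba public
    fj : Vec(List bq)r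
    fj = tabulate(\ j -> fd(hv j)(Gs j))
    at : ∀ j -> lookup fj j == fd(hv j)(Gs j)
    at j = a9(\ j -> fd(hv j)(Gs j))j
    tU : ∀ j{A}-> A ∈ Gs j -> hv j A ∈ lookup fj j
    tU j{A}d2 = aL(hv j A ∈_)(aI(at j))(∈-map⁺(hv j)(Gs j)d2)
    uO : ∀ j -> ∃ \ A -> A ∈ lookup fj j
    uO j = let A , d2 = ld(H j)(df j)(oA j)(\ i la -> hw(H j)(iw j i la))i in hv j A , tU j d2
    module GM (δ : ℚ) (fV : 0' < δ) (a4 d6 : Fin r) (fs : d6 ≢ a4) (D : bq) (AO : D ∈ lookup fj d6)(Bb : ∀{A}-> A ∈ lookup fj d6 -> μ D =< μ A)(wV : ∀{A}-> A ∈ lookup fj a4 -> μ D =< μ A ×(b =< μ D ⊎(∃ \ U -> 1 <= ∣ U ∣ × b * ι ∣ U ∣ =< μ D + ι(ch(ba(proj₂ A))U))))where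
     Bc : ai D <= h
     Bc = go(∈-map⁻(hv d6)(Gs d6)(aL(D ∈_)(at d6)AO))where
      go :(∃ \ A -> A ∈ Gs d6 × D == hv d6 A)-> ai D <= h
      go(A , _ , eq)= aa(ae(au ai eq))(eB 𝐇 d6)
     w dw : ℕ
     w = ai(ia(proj₂ D)h Bc)
     dw = b4 *' w
     Fz : μ D * ι E == ι dw
     Fz = ag(au(μ D *_)(cW b4(h !)))(ag(a0(μ D)(ι b4)(ι(h !)))(ag(au(ι b4 *_)(proj₂(ia(proj₂ D)h Bc)))(aI(cW b4 w))))where
      a0 : ∀ a b c -> a *(b * c)== b *(a * c)
      a0 = ap ar
     qS : ∀{A}-> A ∈ Gs a4 -> B <= dw ⊎(∃ \ U -> 1 <= ∣ U ∣ × B *' ∣ U ∣ <= dw +' E *' ch(ba A)U)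
     qS{A}d2 = go(proj₂(wV(tU a4 d2)))where
      go : b =< μ D ⊎(∃ \ U -> 1 <= ∣ U ∣ × b * ι ∣ U ∣ =< μ D + ι(ch(ba A)U))-> B <= dw ⊎(∃ \ U -> 1 <= ∣ U ∣ × B *' ∣ U ∣ <= dw +' E *' ch(ba A)U)
      go(aD y0)= aD(bS(af(ad(aI bE))(af(aX(ι E)(aY E)y0)(ad Fz))))
      go(aG(U , h0 , le))= aG(U , h0 , bS(begin ι(B *' ∣ U ∣)≡⟨ ag(cW B ∣ U ∣)(ag(au(_* ι ∣ U ∣)(aI bE))(a0 b(ι E)(ι ∣ U ∣)))⟩ ι E *(b * ι ∣ U ∣)≤⟨ aO(ι E)(aY E)le ⟩ ι E *(μ D + ι(ch(ba A)U))≡⟨ ag(aZ(ι E)(μ D)(ι(ch(ba A)U)))(aS _+_ Fz(aI(cW E(ch(ba A)U))))⟩ ι dw + ι(E *' ch(ba A)U)≡⟨ aI(o9 dw(E *' ch(ba A)U))⟩ ι(dw +' E *' ch(ba A)U)∎))where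
       open RQ
       a0 : ∀ a b c -> a * b * c == b *(a * c)
       a0 = ap ar
       aZ : ∀ a b c -> a *(b + c)== b * a + a * c
       aZ = ap ar
     -- The density of `A` is at least `dw / E`, so a set attaining it satisfies
     -- `dw (|U| - 1) ≤ E e(U)`; any smaller `α` may take the place of `dw`.
     tV : 1 <= dw -> ∀{n}(A : a1 n)-> μ D =< gT A -> ∀ α -> α <= dw -> ∃ \ U -> 2 <= ∣ U ∣ × α *' ∣ U ∣ <= α +' E *' ch(ba A)U
     tV iU A Df α Be = go(oM A(gA FA Df))where
      FA : 0' < μ D
      FA = vO(\ le -> aV refl(aa iU(bS{dw}{0}(af(ad(aI Fz))(af(aX(ι E)(aY E)le)(ad(ag(bY(ι E))(aI iA))))))))
      go :(∃ \ U -> 2 <= ∣ U ∣ × gT A * ι(∣ U ∣ -' 1)=< ι(ch(ba A)U))-> ∃ \ U -> 2 <= ∣ U ∣ × α *' ∣ U ∣ <= α +' E *' ch(ba A)U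
      go(U , mO , le)= U , mO , aa(ae(ag(au(α *'_)(aI(hQ(bW mO))))(Ci α u)))(bJ α(aa(aT u Be)uP))where
       open RQ
       u = ∣ U ∣ -' 1
       a0 : ∀ a b c -> a * b * c == b *(a * c)
       a0 = ap ar
       uP : dw *' u <= E *' ch(ba A)U
       uP = bS(begin ι(dw *' u)≡⟨ ag(cW dw u)(ag(au(_* ι u)(aI Fz))(a0(μ D)(ι E)(ι u)))⟩ ι E *(μ D * ι u)≤⟨ aO(ι E)(aY E)(af(aX(ι u)(aY u)Df)le)⟩ ι E * ι(ch(ba A)U)≡⟨ aI(cW E(ch(ba A)U))⟩ ι(E *' ch(ba A)U)∎)
     GN : ℕ -> ℕ -> ∀{n}-> a1 n -> Set
     GN A c G = ∃ \ P -> io G P × dK A c E P × bt P <= h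
     lL : ∀{n}(G : a1 n)A c -> 1 <= A -> c <= A -> n <= h ->(∃ \ U -> 2 <= ∣ U ∣ × A *' ∣ U ∣ <= c +' E *' ch(ba G)U)-> GN A c G
     lL G A c o3 wJ Aw x = o7 G o3 Aw(yI(ba G)(fY G)(jW G)A c E wJ x)
     Bf : ∀{A}-> A ∈ Gs a4 -> B <= dw ⊎(∃ \ U -> 2 <= ∣ U ∣ × B *' ∣ U ∣ <= dw +' E *' ch(ba A)U)
     Bf{A}d2 = go(qS d2)where
      go : B <= dw ⊎(∃ \ U -> 1 <= ∣ U ∣ × B *' ∣ U ∣ <= dw +' E *' ch(ba A)U)-> B <= dw ⊎(∃ \ U -> 2 <= ∣ U ∣ × B *' ∣ U ∣ <= dw +' E *' ch(ba A)U)
      go(aD le)= aD le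
      go(aG(U , h0 , le))with 2 ℕₚ.≤? ∣ U ∣
      ... | yes mO = aG(U , mO , le)
      -- A single vertex carries no edge, so the inequality for it already reads `B ≤ dw`.
      ... | no FB = aD(aa(ae(aI(f4 B)))(aa(az B h0)(aa le(ae(ag(au(\ q -> dw +' E *' q)(jW A U(fw(dY FB))))(ag(au(dw +'_)(fx E))(aW dw)))))))
     result : fc B E δ
     result = go dw refl where
      go : ∀ x -> x == dw -> fc B E δ
      go zero eq = tS B E h eH ic δ fV a4 d6 fs(\{A}d2 -> lL A B 0 eH bI(eB 𝐇 a4)(p3 d2(Bf d2)))where
       p3 : ∀{A}-> A ∈ Gs a4 -> B <= dw ⊎(∃ \ U -> 2 <= ∣ U ∣ × B *' ∣ U ∣ <= dw +' E *' ch(ba A)U)-> ∃ \ U -> 2 <= ∣ U ∣ × B *' ∣ U ∣ <= 0 +' E *' ch(ba A)U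
       p3 d2(aD le)= aA(aV refl(aa eH(aa le(ae(aI eq)))))
       p3{A}d2(aG(U , mO , le))= U , mO , aL(\ a -> B *' ∣ U ∣ <= a +' E *' ch(ba A)U)(aI eq)le
      go(suc x)eq = compare(ℕₚ.≤-total dw B)where
       iU : 1 <= dw
       iU = aa(bl bI)(ae eq)
       xS : ∀ α -> 1 <= α -> α <= dw -> ∀{A}-> A ∈ Gs d6 -> GN α α A
       xS α kg Be{A}d2 = lL A α α kg bT(eB 𝐇 d6)(tV iU A(Bb(tU d6 d2))α Be)
       Bg : ∀{A}-> A ∈ Gs a4 -> B <= dw -> ∃ \ U -> 2 <= ∣ U ∣ × B *' ∣ U ∣ <= B +' E *' ch(ba A)U
       Bg{A}d2 Cg = tV iU A(ai(wV(tU a4 d2)))B Cg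
       p3 : ∀{A}-> A ∈ Gs a4 -> B <= dw ⊎(∃ \ U -> 2 <= ∣ U ∣ × B *' ∣ U ∣ <= dw +' E *' ch(ba A)U)-> ∃ \ U -> 2 <= ∣ U ∣ × B *' ∣ U ∣ <= dw +' E *' ch(ba A)U
       p3 d2(aG p)= p
       p3{A}d2(aD Cg)= let U , mO , le = Bg d2 Cg in U , mO , aa le(aK(E *' ch(ba A)U)Cg)
       -- The exponent `B - α` must not be negative. If the second density exceeds `b`, both
       -- families are treated with `α = B`.
       compare : dw <= B ⊎ B <= dw -> fc B E δ
       compare(aD n3)= n5 B E h eH ic δ fV a4 d6 fs dw iU n3(\{A}d2 -> lL A B dw eH n3(eB 𝐇 a4)(p3 d2(Bf d2)))(xS dw iU bT)
       compare(aG Bh)= n5 B E h eH ic δ fV a4 d6 fs B eH bT(\{A}d2 -> lL A B B eH bT(eB 𝐇 a4)(Bg d2 Bh))(xS B eH Bh)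
    n7 : ∀ δ -> 0' < δ -> fc B E δ
    n7 δ fV = let a4 , d6 , ne , D , AO , mX , iM = sL fj eG uO b sP(\ As kM -> du i As(\ j -> aL(lookup As j ∈_)(at j)(kM j)))in GM.result δ fV a4 d6 ne D AO(\{A}-> mX{A})(\{A}-> iM{A})
   module _ (Bi : ∀ i δ → 0' < δ → xR.fc i B E δ) where
    Dg :(q : ℕ -> [0,1])->(∀ ε -> 0' < ε -> ∃ \ N -> ∀ n -> N <= n -> ai(q n)≤ᴿ fL ε *ᴿ root cN b4 n)-> Tendsto(\ m -> ds(lj.cg k m)(q(suc k *' suc m))𝐇)0'
    Dg q GO ε 0<ε = ai ev , \ m FC -> At.ru(suc k *' suc m)(bl bI)(lj.cg k m)(lj.kw k m 𝐇 df oA), At.Dh(suc k *' suc m)(bl bI)(lj.cg k m)(lj.kw k m 𝐇 df oA)(proj₂ ev(suc k *' suc m)(aa FC(aa(bB m)(a3(suc m)(k *' suc m)))))where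
     rc = f9(ι(suc k))(cO k)
     δ : ℚ
     δ = ai rc * ε
     fV : 0' < δ
     fV = r6(ai(proj₂ rc))0<ε
     G7 : ι(suc k)* δ == ε
     G7 = ag(aI(hp(ι(suc k))(ai rc)ε))(ag(au(_* ε)(proj₂(proj₂ rc)))(aH ε))
     o : ∀ i -> xR.fc i B E δ
     o i = Bi i δ fV
     zj : Fin(suc k)-> ℚ
     zj i = xR.fc.θ(o i)
     lb = k3 zj(\ i -> xR.fc.n2(o i))
     θ = ai lb
     n2 : 0' < θ
     n2 = ai(proj₂ lb)
     jI : 0' < ½
     jI = da ½
     kf : ℚ
     -- `½ ^ E` compensates for rounding n^(1/B) up to `z`, which at most doubles the lower integer;
     -- the remaining one half leaves room for comparing Cauchy sequences.
     kf = ½ * θ * ½ ^ E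
     ev = GO kf(r6(r6 jI n2)(rt E jI))
     module At (n : ℕ) (rI : 1 <= n) (G : a1 n)(kw : ∀(R : a1 n)(m2 : Fin(suc k)-> Vec(Fin r)n)->(∀ i j{A}-> A ∈ lookup(df j)i ->(f : Vec(Fin n)(cf j))->(∀ x -> x ∈ₛ verts A -> lookup(m2 i)(lookup f x)== j)->(∀ x y -> x ∈ₛ verts A -> y ∈ₛ verts A -> lookup f x == lookup f y -> x == y)->(∀ x y -> T(adj A x y)-> T(adj R(lookup f x)(lookup f y)))-> ⊥)-> ¬((G ∪ᴳ R)⟶ 𝐇))where
      module Co = kO n
      module Bd = zY n (q n) {P = λ R → (G ∪ᴳ R) ⟶ 𝐇} (λ R → (G ∪ᴳ R) ⟶? 𝐇)
      ru : fL(0' - ε)≤ᴿ ds G(q n)𝐇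
      ru = Bd.yc ε 0<ε
      rf z : ℕ
      rf = gP 1 B bT eH n
      z = suc rf
      Bj : 1 <= rf
      Bj = g7 1 B bT eH n 1(aa(ae(ag(bp(1 ^' B))(ℕₚ.^-zeroˡ B)))rI)
      G8 : rf ^' B <= n
      G8 = aa(ae(aI(bp(rf ^' B))))(i3 1 B bT eH n)
      r3 : n <= z ^' B
      r3 = aa(bW(kT 1 B bT eH n))(ae(bp(z ^' B)))
      rz = f9(ι z)(cO rf)
      ζ = ai rz
      y9 : 0' < ζ
      y9 = ai(proj₂ rz)
      zi : ι z * ζ == 1'
      zi = proj₂(proj₂ rz)
      kv : ζ =< 1'
      kv = af(ad(aI(aH ζ)))(af(aX ζ(bO y9)(af(ad(aI jZ))(bw(bl(bI{rf})))))(ad zi))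
      c : ℚ
      c = θ * ζ ^ E
      En : 0' < c
      En = r6 n2(rt E y9)
      Bl : ∀ j -> rootNumerator cN b4 n j *' z ^' E <= 2 ^' E *' suc j
      Bl j = begin x *' z ^' E ≤⟨ az x(b7 E(aa(aK rf Bj)(ae(au(rf +'_)(aI(aW rf))))))⟩ x *'(2 *' rf)^' E ≡⟨ ag(au(x *'_)(b6 2 rf E))(a0 x(2 ^' E)(rf ^' E))⟩ 2 ^' E *'(x *' rf ^' E)≤⟨ az(2 ^' E)(qO cN jm Bm)⟩ 2 ^' E *' suc j ∎ where
       open ℕₚ.≤-Reasoning
       x = rootNumerator cN b4 n j
       a0 : ∀ a b c -> a *'(b *' c)== b *'(a *' c)
       a0 = aU
       aZ : ∀ a b c -> a *' b *' c == c *' b *' a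
       aZ = aU
       Bm :(x *' rf ^' E)^' cN <= suc j ^' cN
       Bm = begin(x *' rf ^' E)^' cN ≡⟨ ag(b6 x(rf ^' E)cN)(au(x ^' cN *'_)(ag(cz rf E cN)(ag(au(rf ^'_)(aZ b4(h !)cN))(aI(cz rf B b4)))))⟩ x ^' cN *'(rf ^' B)^' b4 ≤⟨ az(x ^' cN)(b7 b4 G8)⟩ x ^' cN *' n ^' b4 ≤⟨ tT cN b4 n j jm ⟩ suc j ^' cN ∎
      yQ : ∀ j -> seq(root cN b4 n)j =< ι(2 ^' E)* ζ ^ E
      yQ j = begin s ≡⟨ ag(aI(aF s))(ag(au(s *_)(aI(ag(aI(b5(ι z)ζ E))(ag(au(_^ E)zi)(1^ E)))))(aI(hp s(ι z ^ E)(ζ ^ E))))⟩ s * ι z ^ E * ζ ^ E ≤⟨ aX(ζ ^ E)(aQ E(bO y9))(bZ(ι(suc j))(cO j)Di)⟩ ι(2 ^' E)* ζ ^ E ∎ where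
       open RQ
       x = rootNumerator cN b4 n j
       s = seq(root cN b4 n)j
       a0 : ∀ j s z -> j *(s * z)== s * j * z
       a0 = ap ar
       Di : ι(suc j)*(s * ι z ^ E)=< ι(suc j)* ι(2 ^' E)
       Di = begin ι(suc j)*(s * ι z ^ E)≡⟨ ag(a0(ι(suc j))s(ι z ^ E))(ag(aS _*_(gK x j)(aI(mU z E)))(aI(cW x(z ^' E))))⟩ ι(x *' z ^' E)≤⟨ bw(Bl j)⟩ ι(2 ^' E *' suc j)≡⟨ ag(cW(2 ^' E)(suc j))(e9(ι(2 ^' E))(ι(suc j)))⟩ ι(suc j)* ι(2 ^' E)∎
      ki : ai(q n)≤ᴿ fL kf *ᴿ root cN b4 n -> ∃ \ J -> ∀ j -> J <= j -> seq(ai(q n))j =< c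
      ki le = ai sl , \ j GP -> begin seq(ai(q n))j ≤⟨ proj₂ sl j GP ⟩ kf * seq(root cN b4 n)j + ½ * c ≤⟨ bC(½ * c)(aO kf(a7(a7(bO jI)(bO n2))(aQ E(bO jI)))(yQ j))⟩ kf *(ι(2 ^' E)* ζ ^ E)+ ½ * c ≡⟨ au(_+ ½ * c)(ag(a0 ½ θ(½ ^ E)(ι(2 ^' E))(ζ ^ E))(ag(au(½ * c *_)yl)(aF(½ * c))))⟩ ½ * c + ½ * c ≡⟨ ag(aZ ½ c)(ag(au(_* c)vR)(aH c))⟩ c ∎ where
       open RQ
       sl = le(½ * c)(r6 jI En)
       a0 : ∀ a t p w s -> a * t * p *(w * s)== a *(t * s)*(w * p)
       a0 = ap ar
       aZ : ∀ a x -> a * x + a * x ==(1' + 1')* a * x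
       aZ = ap ar
       yl : ι(2 ^' E)* ½ ^ E == 1'
       yl = ag(au(_* ½ ^ E)(ag(mU 2 E)(au(_^ E)l1)))(ag(aI(b5(1' + 1')½ E))(ag(au(_^ E)vR)(1^ E)))
      zh = \ i -> xR.fc.vK(o i)Co.dN Co.br
      rp : Fin(suc k)-> av(mm n)-> bH
      rp i = ai(zh i)
      gU : av(mm n)-> bH
      gU S = iD(\ i -> rp i S)(ax(suc k))
      rY : ∀ S -> T ⌊(G ∪ᴳ cP n S)⟶? 𝐇 ⌋ -> T(gU S)
      rY S t = go(T?(gU S))where
       go : o8(T(gU S))-> T(gU S)
       go(yes p)= p
       go(no uQ)= aA(kw(cP n S)(\ i -> ai(cl i))(\ i j d2 f mono jn nl -> proj₂(cl i)j d2 f mono jn(\ x y t -> Co.xl S(nl x y t)))(toWitness{a? =(G ∪ᴳ cP n S)⟶? 𝐇}t))where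
        cl : ∀ i -> ∃(xR.lk i Co.dN S)
        cl i = proj₂(proj₂(zh i))S(\ t -> uQ(mB(\ i -> rp i S)(∈-allFin i)t))
      vk : ∀ p l u -> p =< c -> aB(cI p l u(mm n))(\ S -> ao ⌊(G ∪ᴳ cP n S)⟶? 𝐇 ⌋)=< 0' + ε
      vk p l u FD = begin aB ν(\ S -> ao ⌊(G ∪ᴳ cP n S)⟶? 𝐇 ⌋)≤⟨ bm ν(\ S -> dg{⌊(G ∪ᴳ cP n S)⟶? 𝐇 ⌋}{gU S}(rY S))⟩ aB ν(ao ∘ gU)≤⟨ m4 ν(ax(suc k))rp ⟩ aM(ax(suc k))(\ i -> aB ν(ao ∘ rp i))≤⟨ cj(ax(suc k))AR ⟩ aM(ax(suc k))(\ _ -> δ)≡⟨ ag(bL(ax(suc k))δ)(ag(au(\ w -> ι w * δ)(cR{n = suc k}(\ x -> x)))(ag G7(aI(bu ε))))⟩ 0' + ε ∎ where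
       open RQ
       ν = cI p l u(mm n)
       AR : ∀ i -> aB ν(ao ∘ rp i)=< δ
       AR i = ai(proj₂(zh i))z ζ p l u(bO y9)kv zi r3(af FD(aX(ζ ^ E)(aQ E(bO y9))(proj₂(proj₂(proj₂ lb))i)))
      Dh : ai(q n)≤ᴿ fL kf *ᴿ root cN b4 n -> ds G(q n)𝐇 ≤ᴿ fL(0' + ε)
      Dh le = Bd.ur c(0' + ε)(bO En)(ki le)vk
  ll : Set
  ll =(q : ℕ -> [0,1])->(∀ ε -> 0' < ε -> ∃ \ N -> ∀ n -> N <= n -> ai(q n)≤ᴿ fL ε *ᴿ root cN b4 n)-> Tendsto(\ m -> ds(lj.cg k m)(q(suc k *' suc m))𝐇)0'
  n8 : ll
  n8 = go(gj sP)where
   go :(∃ \(df : ∀ j -> Vec(List(a1(cf j)))(suc k))->(∀ j -> cm(H j)(suc k)(df j))×(∀ j i{J}-> J ∈ lookup(df j)i -> J ∈ nonempty(H j))×(∀ i As ->(∀ j -> lookup As j ∈ fd(hv j)(lookup(df j)i))-> b =< b9 As))-> ll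
   go(df , oA , iw , du)= Ce.Dg Ce.xR.n7 where
       module Ce = y8 df oA (λ j i {J} → iw j i {J}) du

-- Assembly of the theorem.

open import Defs
open import Data.Nat.Base using (ℕ; zero; suc; _≤_; _*_)
open import Data.Product using (_×_)
open import Data.Rational using (0ℚ; 1ℚ)
open import Data.Vec.Base using (lookup)
open G4
open Hl
open Zg
open Zi
tW : ∀ b → 1 ≤ ↧ₙ b
tW (Data.Rational.mkℚ _ _ _) = bl bI
theorem1p18 :
  (r : ℕ) → 2 ≤ r →
  (𝐇 : Vec FinGraph r) → (∀ j → 1 ≤ v (proj₂ (lookup 𝐇 j))) →
  (d : ℝ) → fromℚ 0ℚ <ᴿ d → d <ᴿ fromℚ 1ℚ →
  (k : ℕ) → 2 ≤ k →
  fromℚ ((k ∸ 2) ÷ (k ∸ 1)) <ᴿ d → d ≤ᴿ fromℚ ((k ∸ 1) ÷ k) →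
  (0ℚ <ℚ β 𝐇 k → IsThreshold 𝐇 d (λ n → n ^-1/ β 𝐇 k)) ×
  (β 𝐇 k ≡ 0ℚ → AllRamsey 𝐇 d)
theorem1p18 r eG 𝐇 ej d _ _ (suc (suc vt)) _ CW B2 =
 (λ sP → ((λ m → suc k * suc m) , bl bI , (λ m → FV (suc k) (ℕₚ.n<1+n (suc m))) , (λ m → lj.cg k m) , dense ,
   λ q GO → Fy.n8 eG 𝐇 ej k ℤ.∣ ↥ β 𝐇 (suc k) ∣ (↧ₙ β 𝐇 (suc k)) (ai (dV (β 𝐇 (suc k)) sP)) (proj₂ (dV (β 𝐇 (suc k)) sP)) (tW (β 𝐇 (suc k))) sP q GO) ,
  o1 eG 𝐇 ej d k (bl bI) CW sP) ,
 tw eG 𝐇 ej d k (bl bI) CW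
 where
 -- One less than the `k` of the statement: from here on the number of parts is `suc k`.
 k = suc vt
 dense : ∀ m → IsDense d (lj.cg k m)
 dense m = lj.tP k m , λ ε 0<ε → ai (B2 ε 0<ε) , λ n le → ℚₚ.≤-trans (proj₂ (B2 ε 0<ε) n le) (ℚₚ.+-monoˡ-≤ ε (lj.n4 k m))
theorem1p18 _ _ _ _ _ _ _ zero () _ _
theorem1p18 _ _ _ _ _ _ _ (suc zero) (bl ()) _ _
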